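{- Let $A$ and $B$ be unit-free MALL formulas with $A\cong B$. Then there exist cut-free proof-nets $\theta$ with conclusions $A^\perp,B$ and $\psi$ with conclusions $B^\perp,A$ such that the composition of $\theta$ and $\psi$ over $B$ reduces by proof-net cut-elimination to the identity proof-net of $A$, and the composition of $\psi$ and $\theta$ over $A$ reduces by proof-net cut-elimination to the identity proof-net of $B$.
   Context: Unit-free MALL formulas: $A::=X\mid X^\perp\mid A\otimes A\mid A⅋A\mid A\&A\mid A\oplus A$, negation by $(A\otimes B)^\perp=B^\perp⅋A^\perp$, $(A\&B)^\perp=B^\perp\oplus A^\perp$. $A\cong B$: there are MALL sequent calculus proofs $\pi$ of $\vdash A^\perp,B$ and $\pi'$ of $\vdash B^\perp,A$ whose cut on $B$ (resp. on $A$) equals the axiom proof of $\vdash A^\perp,A$ (resp. $\vdash B^\perp,B$) up to the equivalence generated by cut-elimination and axiom-expansion. Proof-nets (Hughes–van Glabbeek): a sequent is identified with its forest of syntactic trees (internal vertices = connectives, leaves = atom occurrences). A cut pair is $A*A^\perp$ (unordered); a cut sequent $[\Sigma]\,\Gamma$ is a list $\Sigma$ of cut pairs and a sequent $\Gamma$. An additive resolution of $[\Sigma]\,\Gamma$ is the result of deleting zero or more cut pairs and one argument subtree of every $\&$ and $\oplus$ vertex; a $\&$-resolution deletes one argument subtree of each $\&$ vertex only. A link is an unordered pair of leaves labelled $X$ and $X^\perp$. A linking $\lambda$ is a set of disjoint links whose leaves are exactly the leaves of some additive resolution, denoted $[\Sigma]\Gamma\upharpoonright\lambda$. A set $\Lambda$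 of linkings toggles a $\&$-vertex $W$ if both premises of $W$ occur in $\bigcup_{\lambda\in\Lambda}[\Sigma]\Gamma\upharpoonright\lambda$; a link $a$ depends on $W$ in $\Lambda$ if there are $\lambda,\lambda'\in\Lambda$ with $a\in\lambda\setminus\lambda'$ and $W$ the only $\&$ toggled by $\{\lambda,\lambda'\}$. $\mathcal{G}_\Lambda$ is the graph $\bigcup_\lambda[\Sigma]\Gamma\upharpoonright\lambda$ plus the links of $\bigcup\Lambda$ plus jump edges $l\to W$ for each leaf $l$ of a link in $\bigcup\Lambda$ depending on $W$ in $\Lambda$. Switch edges of a $⅋$ or $\&$ vertex are its in-edges (premise edges and jumps to it); a switching cycle uses at most one switch edge per such vertex; a $⅋$-switching of $\lambda$ deletes one switch edge of each $⅋$ in $\mathcal{G}_{\{\lambda\}}$. A proof-net on $[\Sigma]\Gamma$ is a set $\theta$ of linkings with: (P0) every cut pair has a leaf in some linking; (P1) exactly one linking of $\theta$ is on any given $\&$-resolution; (P2) every $⅋$-switching of every $\lambda\in\theta$ is a tree; (P3) every $\Lambda\subseteq\theta$ with $|\Lambda|\ge2$ toggles a $\&$-vertex lying in no switching cycle of $\mathcal{G}_\Lambda$. It is cut-free if $\Sigma$ is empty; its conclusions are then $\Gamma$. Composition of $\theta$ on $[\Sigma]\Gamma,A$ and $\psi$ on $[\Xi]\Delta,A^\perp$ over $A$: $\{\lambda\cup\mu\mid\lambda\in\theta,\mu\in\psi\}$ on $[\Sigma,\Xi,A*A^\perp]\,\Gamma,\Delta$. Cut-elimination of a cut pair $A*A^\perp$: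 (a) if $A$ is atomic, delete the pair and replace each pair of links $(l,A),(A^\perp,m)$ by $(l,m)$; (b) if $A=A_1\otimes A_2$, $A^\perp=A_2^\perp⅋A_1^\perp$, replace by $A_1*A_1^\perp$ and $A_2*A_2^\perp$ keeping all linkings; (c) if $A=A_1\&A_2$, $A^\perp=A_2^\perp\oplus A_1^\perp$, replace by $A_1*A_1^\perp$, $A_2*A_2^\perp$, delete linkings in which the $\&$ and $\oplus$ do not keep dual premises, then delete cut pairs no leaf of which occurs in a remaining linking. This is confluent and terminating. Identity proof-net of $A$: the translation of the fully axiom-expanded axiom proof of $\vdash A^\perp,A$, where translation maps an atomic axiom to $\{\{(X,X^\perp)\}\}$, $⅋$ and $\oplus_i$ keep the set of linkings, $\otimes$ takes all pairwise unions $\lambda\cup\mu$, and $\&$ takes the union of the two sets of linkings. -}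

module Defs where

open import Data.Bool using (Bool; true; false; not; if_then_else_; _∧_; _∨_)
open import Data.Nat using (ℕ; zero; suc; _≡ᵇ_; _<ᵇ_; _∸_; _+_)
open import Data.List using (List; []; _∷_; _++_; map; concatMap; filterᵇ; length)
open import Data.Bool.ListAction using (any)
open import Data.List.Membership.Propositional using (_∈_; _∉_)
open import Data.List.Relation.Unary.All using (All)
open import Data.List.Relation.Unary.Unique.Propositional using (Unique)
open import Data.List.Relation.Binary.Permutation.Propositional using (_↭_)
open import Data.Maybe using (Maybe; just; nothing; _>>=_)
open import Data.Product using (Σ; ∃; ∃-syntax; _×_; _,_; proj₁; proj₂)
open import Data.Sum using (_⊎_)
open import Data.Unit using (⊤)
open import Data.Empty using (⊥)
open import Relation.Nullary using (¬_)
open import Relation.Binary.PropositionalEquality using (_≡_; _≢_)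
open import Relation.Binary.Construct.Closure.ReflexiveTransitive using (Star)
open import Function.Bundles using (_⇔_)

infixr 6 _⊗_ _⅋_ _&_ _⊕_

data Fm : Set where
  var  : ℕ → Fm
  nvar : ℕ → Fm
  _⊗_ _⅋_ _&_ _⊕_ : Fm → Fm → Fm

dual : Fm → Fm
dual (var n)  = nvar n
dual (nvar n) = var n
dual (A ⊗ B)  = dual B ⅋ dual A
dual (A ⅋ B)  = dual B ⊗ dual A
dual (A & B)  = dual B ⊕ dual A
dual (A ⊕ B)  = dual B & dual A

-- 2. MALL sequent calculus (one-sided, with axioms on arbitrary formulas).
--
-- Formula occurrences of a sequent carry names (natural numbers), so that
-- sequents are lists of named formulas taken up to permutation (exchange
-- is implicit).  A proof is a proof term P together with a typing
-- derivation  P ⊢ Γ .  Premise names of a rule are bound in the premise.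

Name : Set
Name = ℕ

data Tm : Set where
  ax   : Name → Name → Fm → Tm                 -- ax x y A     : x : A^⊥ , y : A
  cut  : Fm → Name → Tm → Name → Tm → Tm       -- cut A x P y Q : cut of x : A in P against y : A^⊥ in Q
  tens : Name → Name → Tm → Name → Tm → Tm     -- tens z x P y Q : z : A ⊗ B from x : A in P, y : B in Q
  par  : Name → Name → Name → Tm → Tm          -- par z x y P   : z : A ⅋ B from x : A, y : B in P
  wth  : Name → Name → Tm → Name → Tm → Tm     -- wth z x P y Q : z : A & B from x : A in P, y : B in Q
  inl  : Name → Fm → Name → Tm → Tm            -- inl z B x P   : z : A ⊕ B from x : A in P
  inr  : Name → Fm → Name → Tm → Tm            -- inr z A x P   : z : A ⊕ B from x : B in P

Ctx : Set
Ctx = List (Name × Fm)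

dom : Ctx → List Name
dom = map proj₁

Disj : Ctx → Ctx → Set
Disj Γ Δ = All (λ p → proj₁ p ∉ dom Δ) Γ

infix 3 _⊢_

data _⊢_ : Tm → Ctx → Set where
  ⊢ax   : ∀ {x y} (A : Fm) → x ≢ y →
          ax x y A ⊢ (x , dual A) ∷ (y , A) ∷ []
  ⊢ex   : ∀ {P Γ Δ} → P ⊢ Γ → Γ ↭ Δ → P ⊢ Δ
  ⊢cut  : ∀ {P Q x y A Γ Δ} → P ⊢ (x , A) ∷ Γ → Q ⊢ (y , dual A) ∷ Δ → Disj Γ Δ →
          cut A x P y Q ⊢ Γ ++ Δ
  ⊢tens : ∀ {P Q x y z A B Γ Δ} → P ⊢ (x , A) ∷ Γ → Q ⊢ (y , B) ∷ Δ → Disj Γ Δ →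
          z ∉ dom (Γ ++ Δ) → tens z x P y Q ⊢ (z , A ⊗ B) ∷ Γ ++ Δ
  ⊢par  : ∀ {P x y z A B Γ} → P ⊢ (x , A) ∷ (y , B) ∷ Γ → z ∉ dom Γ →
          par z x y P ⊢ (z , A ⅋ B) ∷ Γ
  ⊢wth  : ∀ {P Q x y z A B Γ} → P ⊢ (x , A) ∷ Γ → Q ⊢ (y , B) ∷ Γ → z ∉ dom Γ →
          wth z x P y Q ⊢ (z , A & B) ∷ Γ
  ⊢inl  : ∀ {P x z A B Γ} → P ⊢ (x , A) ∷ Γ → z ∉ dom Γ →
          inl z B x P ⊢ (z , A ⊕ B) ∷ Γ
  ⊢inr  : ∀ {P x z A B Γ} → P ⊢ (x , B) ∷ Γ → z ∉ dom Γ →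
          inr z A x P ⊢ (z , A ⊕ B) ∷ Γ

names : Tm → List Name
names (ax x y _)       = x ∷ y ∷ []
names (cut _ x P y Q)  = x ∷ y ∷ names P ++ names Q
names (tens z x P y Q) = z ∷ x ∷ y ∷ names P ++ names Q
names (par z x y P)    = z ∷ x ∷ y ∷ names P
names (wth z x P y Q)  = z ∷ x ∷ y ∷ names P ++ names Q
names (inl z _ x P)    = z ∷ x ∷ names P
names (inr z _ x P)    = z ∷ x ∷ names P

ren : Name → Name → Tm → Tm
ren a b (ax x y A)       = ax (if x ≡ᵇ a then b else x) (if y ≡ᵇ a then b else y) A
ren a b (cut C x P y Q)  = cut C x (if x ≡ᵇ a then P else ren a b P)
                                 y (if y ≡ᵇ a then Q else ren a b Q)
ren a b (tens z x P y Q) = tens (if z ≡ᵇ a then b else z)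
                                x (if x ≡ᵇ a then P else ren a b P)
                                y (if y ≡ᵇ a then Q else ren a b Q)
ren a b (par z x y P)    = par (if z ≡ᵇ a then b else z) x y
                               (if (x ≡ᵇ a) ∨ (y ≡ᵇ a) then P else ren a b P)
ren a b (wth z x P y Q)  = wth (if z ≡ᵇ a then b else z)
                               x (if x ≡ᵇ a then P else ren a b P)
                               y (if y ≡ᵇ a then Q else ren a b Q)
ren a b (inl z B x P)    = inl (if z ≡ᵇ a then b else z) B x (if x ≡ᵇ a then P else ren a b P)
ren a b (inr z A x P)    = inr (if z ≡ᵇ a then b else z) A x (if x ≡ᵇ a then P else ren a b P)

data Step : Tm → Tm → Set where
  ax-l  : ∀ {C A x z y Q} → x ∉ names Q → Step (cut C z (ax x z A) y Q) (ren y x Q)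
  ax-l' : ∀ {C A x z y Q} → z ∉ names Q → Step (cut C x (ax x z A) y Q) (ren y z Q)
  ax-r  : ∀ {C A x z y Q} → x ∉ names Q → Step (cut C y Q z (ax x z A)) (ren y x Q)
  ax-r' : ∀ {C A x z y Q} → z ∉ names Q → Step (cut C y Q x (ax x z A)) (ren y z Q)
  ⊗⅋₁ : ∀ {A B z x P y Q w u v R} →
        Step (cut (A ⊗ B) z (tens z x P y Q) w (par w u v R)) (cut A x P v (cut B y Q u R))
  ⊗⅋₂ : ∀ {A B z x P y Q w u v R} →
        Step (cut (A ⊗ B) z (tens z x P y Q) w (par w u v R)) (cut B y Q u (cut A x P v R))
  ⅋⊗₁ : ∀ {D E w u v R z x P y Q} →
        Step (cut (D ⅋ E) w (par w u v R) z (tens z x P y Q)) (cut E v (cut D u R y Q) x P)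
  ⅋⊗₂ : ∀ {D E w u v R z x P y Q} →
        Step (cut (D ⅋ E) w (par w u v R) z (tens z x P y Q)) (cut D u (cut E v R x P) y Q)
  &inl : ∀ {A B z x P y Q w D u R} →
         Step (cut (A & B) z (wth z x P y Q) w (inl w D u R)) (cut B y Q u R)
  &inr : ∀ {A B z x P y Q w D u R} →
         Step (cut (A & B) z (wth z x P y Q) w (inr w D u R)) (cut A x P u R)
  inl& : ∀ {A B w D u R z x P y Q} →
         Step (cut (A ⊕ B) w (inl w D u R) z (wth z x P y Q)) (cut A u R y Q)
  inr& : ∀ {A B w D u R z x P y Q} →
         Step (cut (A ⊕ B) w (inr w D u R) z (wth z x P y Q)) (cut B u R x P)
  parL  : ∀ {C x z a b P y Q} → z ≢ x → a ∉ names Q → b ∉ names Q →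
          Step (cut C x (par z a b P) y Q) (par z a b (cut C x P y Q))
  tensL₁ : ∀ {C x z a P b P' y Q} → z ≢ x → x ∉ names P' → a ∉ names Q →
          Step (cut C x (tens z a P b P') y Q) (tens z a (cut C x P y Q) b P')
  tensL₂ : ∀ {C x z a P b P' y Q} → z ≢ x → x ∉ names P → b ∉ names Q →
          Step (cut C x (tens z a P b P') y Q) (tens z a P b (cut C x P' y Q))
  wthL  : ∀ {C x z a P b P' y Q} → z ≢ x → a ∉ names Q → b ∉ names Q →
          Step (cut C x (wth z a P b P') y Q) (wth z a (cut C x P y Q) b (cut C x P' y Q))
  inlL  : ∀ {C x z D a P y Q} → z ≢ x → a ∉ names Q →
          Step (cut C x (inl z D a P) y Q) (inl z D a (cut C x P y Q))
  inrL  : ∀ {C x z D a P y Q} → z ≢ x → a ∉ names Q →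
          Step (cut C x (inr z D a P) y Q) (inr z D a (cut C x P y Q))
  parR  : ∀ {C x P y z a b Q} → z ≢ y → a ∉ names P → b ∉ names P →
          Step (cut C x P y (par z a b Q)) (par z a b (cut C x P y Q))
  tensR₁ : ∀ {C x P y z a Q b Q'} → z ≢ y → y ∉ names Q' → a ∉ names P →
          Step (cut C x P y (tens z a Q b Q')) (tens z a (cut C x P y Q) b Q')
  tensR₂ : ∀ {C x P y z a Q b Q'} → z ≢ y → y ∉ names Q → b ∉ names P →
          Step (cut C x P y (tens z a Q b Q')) (tens z a Q b (cut C x P y Q'))
  wthR  : ∀ {C x P y z a Q b Q'} → z ≢ y → a ∉ names P → b ∉ names P →
          Step (cut C x P y (wth z a Q b Q')) (wth z a (cut C x P y Q) b (cut C x P y Q'))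
  inlR  : ∀ {C x P y z D a Q} → z ≢ y → a ∉ names P →
          Step (cut C x P y (inl z D a Q)) (inl z D a (cut C x P y Q))
  inrR  : ∀ {C x P y z D a Q} → z ≢ y → a ∉ names P →
          Step (cut C x P y (inr z D a Q)) (inr z D a (cut C x P y Q))
  η⊗ : ∀ {x y A B} u v a b →
       Step (ax x y (A ⊗ B)) (par x u v (tens y a (ax v a A) b (ax u b B)))
  η⅋ : ∀ {x y A B} u v a b →
       Step (ax x y (A ⅋ B)) (par y a b (tens x u (ax u b B) v (ax v a A)))
  η& : ∀ {x y A B} u v a b →
       Step (ax x y (A & B)) (wth y a (inr x (dual B) u (ax u a A)) b (inl x (dual A) v (ax v b B)))
  η⊕ : ∀ {x y A B} u v a b →
       Step (ax x y (A ⊕ B)) (wth x u (inr y A a (ax u a B)) v (inl y B b (ax v b A)))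
  -- the axiom on A, named (x,y), and the axiom on A^⊥, named (y,x), are the same rule instance
  axsym : ∀ {x y A} → Step (ax x y A) (ax y x (dual A))
  αcut₁ : ∀ {C x P y Q x'} → x' ∉ names P → Step (cut C x P y Q) (cut C x' (ren x x' P) y Q)
  αcut₂ : ∀ {C x P y Q y'} → y' ∉ names Q → Step (cut C x P y Q) (cut C x P y' (ren y y' Q))
  αtens₁ : ∀ {z x P y Q x'} → x' ∉ names P → Step (tens z x P y Q) (tens z x' (ren x x' P) y Q)
  αtens₂ : ∀ {z x P y Q y'} → y' ∉ names Q → Step (tens z x P y Q) (tens z x P y' (ren y y' Q))
  αpar₁ : ∀ {z x y P x'} → x' ∉ names P → Step (par z x y P) (par z x' y (ren x x' P))
  αpar₂ : ∀ {z x y P y'} → y' ∉ names P → Step (par z x y P) (par z x y' (ren y y' P))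
  αwth₁ : ∀ {z x P y Q x'} → x' ∉ names P → Step (wth z x P y Q) (wth z x' (ren x x' P) y Q)
  αwth₂ : ∀ {z x P y Q y'} → y' ∉ names Q → Step (wth z x P y Q) (wth z x P y' (ren y y' Q))
  αinl  : ∀ {z B x P x'} → x' ∉ names P → Step (inl z B x P) (inl z B x' (ren x x' P))
  αinr  : ∀ {z A x P x'} → x' ∉ names P → Step (inr z A x P) (inr z A x' (ren x x' P))
  c-cut₁  : ∀ {C x P P' y Q} → Step P P' → Step (cut C x P y Q) (cut C x P' y Q)
  c-cut₂  : ∀ {C x P y Q Q'} → Step Q Q' → Step (cut C x P y Q) (cut C x P y Q')
  c-tens₁ : ∀ {z x P P' y Q} → Step P P' → Step (tens z x P y Q) (tens z x P' y Q)
  c-tens₂ : ∀ {z x P y Q Q'} → Step Q Q' → Step (tens z x P y Q) (tens z x P y Q')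
  c-par   : ∀ {z x y P P'} → Step P P' → Step (par z x y P) (par z x y P')
  c-wth₁  : ∀ {z x P P' y Q} → Step P P' → Step (wth z x P y Q) (wth z x P' y Q)
  c-wth₂  : ∀ {z x P y Q Q'} → Step Q Q' → Step (wth z x P y Q) (wth z x P y Q')
  c-inl   : ∀ {z B x P P'} → Step P P' → Step (inl z B x P) (inl z B x P')
  c-inr   : ∀ {z A x P P'} → Step P P' → Step (inr z A x P) (inr z A x P')

data Conv (Γ : Ctx) : Tm → Tm → Set where
  conv-refl  : ∀ {P} → P ⊢ Γ → Conv Γ P P
  conv-step  : ∀ {P Q} → P ⊢ Γ → Q ⊢ Γ → Step P Q → Conv Γ P Q
  conv-sym   : ∀ {P Q} → Conv Γ P Q → Conv Γ Q P
  conv-trans : ∀ {P Q R} → Conv Γ P Q → Conv Γ Q R → Conv Γ P R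

_≅_ : Fm → Fm → Set
A ≅ B = Σ Tm λ π → Σ Tm λ π' →
          (π  ⊢ (0 , dual A) ∷ (1 , B) ∷ []) ×
          (π' ⊢ (0 , dual B) ∷ (1 , A) ∷ []) ×
          Conv ((0 , dual A) ∷ (1 , A) ∷ []) (cut B 1 π 0 π') (ax 0 1 A) ×
          Conv ((0 , dual B) ∷ (1 , B) ∷ []) (cut A 1 π' 0 π) (ax 0 1 B)

-- 3. Cut sequents, vertices, linkings (Hughes–van Glabbeek)

-- A cut pair is named by a list of booleans; the pair (c , A) is A * A^⊥,
-- with side false = A and side true = A^⊥.
CutName : Set
CutName = List Bool

data Root : Set where
  concl   : ℕ → Root                -- i-th formula of Γ
  cutside : CutName → Bool → Root

-- a vertex of the forest: a root together with a path (false = left premise)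
Vertex : Set
Vertex = Root × List Bool

record CutSeq : Set where
  constructor cs
  field
    cuts   : List (CutName × Fm)
    concls : List Fm
open CutSeq public

sub : Fm → List Bool → Maybe Fm
sub A [] = just A
sub (var _)  (_ ∷ _) = nothing
sub (nvar _) (_ ∷ _) = nothing
sub (A ⊗ B) (d ∷ p) = sub (if d then B else A) p
sub (A ⅋ B) (d ∷ p) = sub (if d then B else A) p
sub (A & B) (d ∷ p) = sub (if d then B else A) p
sub (A ⊕ B) (d ∷ p) = sub (if d then B else A) p

nth : List Fm → ℕ → Maybe Fm
nth [] _ = nothing
nth (A ∷ _) zero = just A
nth (_ ∷ Γ) (suc i) = nth Γ i

eqCN : CutName → CutName → Bool
eqCN [] [] = true
eqCN (true ∷ c) (true ∷ d) = eqCN c d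
eqCN (false ∷ c) (false ∷ d) = eqCN c d
eqCN _ _ = false

eqB : Bool → Bool → Bool
eqB true true = true
eqB false false = true
eqB _ _ = false

eqRoot : Root → Root → Bool
eqRoot (concl i) (concl j) = i ≡ᵇ j
eqRoot (cutside c s) (cutside d t) = eqCN c d ∧ eqB s t
eqRoot _ _ = false

findCut : List (CutName × Fm) → CutName → Maybe Fm
findCut [] _ = nothing
findCut ((d , A) ∷ Σ') c = if eqCN c d then just A else findCut Σ' c

sideFm : Bool → Fm → Fm
sideFm s A = if s then dual A else A

rootFm : CutSeq → Root → Maybe Fm
rootFm S (concl i) = nth (concls S) i
rootFm S (cutside c s) = findCut (cuts S) c >>= λ A → just (sideFm s A)

vfm : CutSeq → Vertex → Maybe Fm
vfm S (r , p) = rootFm S r >>= λ A → sub A p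

_▹_ : Vertex → Bool → Vertex
(r , p) ▹ d = (r , p ++ (d ∷ []))

IsLeaf : CutSeq → Vertex → Set
IsLeaf S v = ∃[ n ] (vfm S v ≡ just (var n) ⊎ vfm S v ≡ just (nvar n))

IsWith : CutSeq → Vertex → Set
IsWith S v = ∃[ A ] ∃[ B ] (vfm S v ≡ just (A & B))

IsPar : CutSeq → Vertex → Set
IsPar S v = ∃[ A ] ∃[ B ] (vfm S v ≡ just (A ⅋ B))

-- a link: unordered pair of leaves labelled X and X^⊥ ; we orient it as
-- (leaf labelled X , leaf labelled X^⊥)
record Link : Set where
  constructor lk
  field
    pos neg : Vertex
open Link public

ends : Link → List Vertex
ends a = pos a ∷ neg a ∷ []

Linking : Set
Linking = List Link      -- read as a set of links

Net : Set
Net = List Linking       -- read as a set of linkings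

leaves : Linking → List Vertex
leaves = concatMap ends

SameLinking : Linking → Linking → Set
SameLinking λ₁ λ₂ = ∀ a → (a ∈ λ₁) ⇔ (a ∈ λ₂)

SameNet : Net → Net → Set
SameNet θ θ' = (∀ λ₁ → λ₁ ∈ θ → ∃[ λ₂ ] (λ₂ ∈ θ' × SameLinking λ₁ λ₂)) ×
               (∀ λ₂ → λ₂ ∈ θ' → ∃[ λ₁ ] (λ₁ ∈ θ × SameLinking λ₁ λ₂))

-- additive resolutions: which cut pairs are kept, and which argument of
-- each & / ⊕ vertex is kept.
record AddRes : Set where
  field
    keepCut : CutName → Bool
    pick    : Vertex → Bool
open AddRes public

-- the path p from root r (current prefix acc, current subformula A) stays
-- inside the resolution
PathOK : (Vertex → Bool) → Root → List Bool → Fm → List Bool → Set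
PathOK pk r acc A [] = ⊤
PathOK pk r acc (var _)  (_ ∷ _) = ⊥
PathOK pk r acc (nvar _) (_ ∷ _) = ⊥
PathOK pk r acc (A ⊗ B) (d ∷ p) = PathOK pk r (acc ++ (d ∷ [])) (if d then B else A) p
PathOK pk r acc (A ⅋ B) (d ∷ p) = PathOK pk r (acc ++ (d ∷ [])) (if d then B else A) p
PathOK pk r acc (A & B) (d ∷ p) =
  d ≡ pk (r , acc) × PathOK pk r (acc ++ (d ∷ [])) (if d then B else A) p
PathOK pk r acc (A ⊕ B) (d ∷ p) =
  d ≡ pk (r , acc) × PathOK pk r (acc ++ (d ∷ [])) (if d then B else A) p

RootKept : AddRes → Root → Set
RootKept R (concl _) = ⊤
RootKept R (cutside c _) = keepCut R c ≡ true

InAddRes : CutSeq → AddRes → Vertex → Set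
InAddRes S R (r , p) = RootKept R r × ∃[ A ] (rootFm S r ≡ just A × PathOK (pick R) r [] A p)

WfLink : CutSeq → Link → Set
WfLink S a = ∃[ n ] (vfm S (pos a) ≡ just (var n) × vfm S (neg a) ≡ just (nvar n))

IsLinking : CutSeq → Linking → Set
IsLinking S λ₀ =
  All (WfLink S) λ₀ ×
  (∀ a b v → a ∈ λ₀ → b ∈ λ₀ → v ∈ ends a → v ∈ ends b → a ≡ b) ×
  ∃[ R ] (∀ v → ((IsLeaf S v × InAddRes S R v) ⇔ (v ∈ leaves λ₀)))

-- the vertices of [Σ]Γ ↾ λ : those vertices having a leaf of λ above them
-- (the resolution whose leaves are those of λ is unique)
InRes : Linking → Vertex → Set
InRes λ₀ (r , p) = ∃[ q ] ((r , p ++ q) ∈ leaves λ₀)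

OnAmp : CutSeq → (Vertex → Bool) → Linking → Set
OnAmp S ρ λ₀ = ∀ W d → IsWith S W → InRes λ₀ (W ▹ d) → d ≡ ρ W

Vert : List Linking → Vertex → Set
Vert Λ v = ∃[ λ₀ ] (λ₀ ∈ Λ × InRes λ₀ v)

InU : List Linking → Link → Set
InU Λ a = ∃[ λ₀ ] (λ₀ ∈ Λ × a ∈ λ₀)

Toggles : CutSeq → List Linking → Vertex → Set
Toggles S Λ W = IsWith S W × Vert Λ (W ▹ false) × Vert Λ (W ▹ true)

DependsOn : CutSeq → List Linking → Link → Vertex → Set
DependsOn S Λ a W = ∃[ λ₁ ] ∃[ λ₂ ] (λ₁ ∈ Λ × λ₂ ∈ Λ × a ∈ λ₁ × a ∉ λ₂ ×
                       Toggles S (λ₁ ∷ λ₂ ∷ []) W ×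
                       (∀ W' → Toggles S (λ₁ ∷ λ₂ ∷ []) W' → W' ≡ W))

data Edge : Set where
  tree : Vertex → Bool → Edge       -- between v ▹ d and v (an in-edge of v)
  link : Link → Edge
  jump : Vertex → Vertex → Edge     -- jump l → W (an in-edge of W)
  cutE : CutName → Edge             -- the cut vertex of pair c, joining A and A^⊥

endpoints : Edge → Vertex × Vertex
endpoints (tree v d) = (v ▹ d , v)
endpoints (link a) = (pos a , neg a)
endpoints (jump l W) = (l , W)
endpoints (cutE c) = ((cutside c false , []) , (cutside c true , []))

Joins : Edge → Vertex → Vertex → Set
Joins e u v = (u ≡ proj₁ (endpoints e) × v ≡ proj₂ (endpoints e)) ⊎
              (u ≡ proj₂ (endpoints e) × v ≡ proj₁ (endpoints e))

EdgeIn : CutSeq → List Linking → Edge → Set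
EdgeIn S Λ (tree v d) = Vert Λ (v ▹ d)
EdgeIn S Λ (link a) = InU Λ a
EdgeIn S Λ (jump l W) = ∃[ a ] (InU Λ a × l ∈ ends a × DependsOn S Λ a W)
EdgeIn S Λ (cutE c) = Vert Λ (cutside c false , [])

SwitchOf : CutSeq → Edge → Vertex → Set
SwitchOf S e w = (IsPar S w ⊎ IsWith S w) × InEdge e
  where
  InEdge : Edge → Set
  InEdge (tree v _) = v ≡ w
  InEdge (link _) = ⊥
  InEdge (jump _ W) = W ≡ w
  InEdge (cutE _) = ⊥

Walk : (Edge → Set) → Vertex → List (Edge × Vertex) → Vertex → Set
Walk E u [] w = u ≡ w
Walk E u ((e , v) ∷ rest) w = E e × Joins e u v × Walk E v rest w

record Cycle (E : Edge → Set) : Set where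
  field
    start    : Vertex
    steps    : List (Edge × Vertex)
    nonempty : steps ≢ []
    closed   : Walk E start steps start
    distE    : Unique (map proj₁ steps)
    distV    : Unique (map proj₂ steps)
open Cycle public

IsSwitchingCycle : CutSeq → (E : Edge → Set) → Cycle E → Set
IsSwitchingCycle S E c = ∀ w e e' → e ∈ map proj₁ (steps c) → e' ∈ map proj₁ (steps c) →
                         SwitchOf S e w → SwitchOf S e' w → e ≡ e'

Adj : (Edge → Set) → Vertex → Vertex → Set
Adj E u v = ∃[ e ] (E e × Joins e u v)

IsTree : (Vertex → Set) → (Edge → Set) → Set
IsTree V E = (∀ u v → V u → V v → Star (Adj E) u v) × (Cycle E → ⊥)

SwEdges : CutSeq → Linking → (Vertex → Bool) → Edge → Set
SwEdges S λ₀ sw e = EdgeIn S (λ₀ ∷ []) e × ¬ Deleted e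
  where
  Deleted : Edge → Set
  Deleted (tree v d) = IsPar S v × d ≡ sw v
  Deleted (link _) = ⊥
  Deleted (jump _ _) = ⊥
  Deleted (cutE _) = ⊥

P0 : CutSeq → Net → Set
P0 S θ = ∀ c A → (c , A) ∈ cuts S →
         ∃[ λ₀ ] ∃[ l ] (λ₀ ∈ θ × l ∈ leaves λ₀ ×
            (proj₁ l ≡ cutside c false ⊎ proj₁ l ≡ cutside c true))

P1 : CutSeq → Net → Set
P1 S θ = ∀ (ρ : Vertex → Bool) →
         ∃[ λ₀ ] (λ₀ ∈ θ × OnAmp S ρ λ₀ ×
                  (∀ λ₁ → λ₁ ∈ θ → OnAmp S ρ λ₁ → SameLinking λ₁ λ₀))

P2 : CutSeq → Net → Set
P2 S θ = ∀ λ₀ → λ₀ ∈ θ → ∀ (sw : Vertex → Bool) →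
         IsTree (Vert (λ₀ ∷ [])) (SwEdges S λ₀ sw)

P3 : CutSeq → Net → Set
P3 S θ = ∀ (Λ : List Linking) → (∀ λ₀ → λ₀ ∈ Λ → λ₀ ∈ θ) →
         (∃[ λ₁ ] ∃[ λ₂ ] (λ₁ ∈ Λ × λ₂ ∈ Λ × ¬ SameLinking λ₁ λ₂)) →
         ∃[ W ] (Toggles S Λ W ×
                 ((c : Cycle (EdgeIn S Λ)) → IsSwitchingCycle S (EdgeIn S Λ) c →
                  W ∉ map proj₂ (steps c)))

IsProofNet : CutSeq → Net → Set
IsProofNet S θ = All (IsLinking S) θ × P0 S θ × P1 S θ × P2 S θ × P3 S θ

mapLink : (Vertex → Vertex) → Link → Link
mapLink f a = lk (f (pos a)) (f (neg a))

onRoot : (Root → Root) → Vertex → Vertex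
onRoot f (r , p) = (f r , p)

dropIx : List Fm → ℕ → List Fm
dropIx [] _ = []
dropIx (_ ∷ Γ) zero = Γ
dropIx (A ∷ Γ) (suc i) = A ∷ dropIx Γ i

-- composition of cut-free θ on Γ (cut formula A = i-th of Γ) and ψ on Δ
-- (A^⊥ = j-th of Δ): a net on [A * A^⊥] Γ∖i , Δ∖j   (cut pair named [])
NetState : Set
NetState = CutSeq × Net

compose : (Γ Δ : List Fm) (i j : ℕ) (A : Fm) → Net → Net → NetState
compose Γ Δ i j A θ ψ =
  cs (([] , A) ∷ []) (dropIx Γ i ++ dropIx Δ j) ,
  concatMap (λ λ₀ → map (λ μ → map (mapLink (onRoot f)) λ₀ ++ map (mapLink (onRoot g)) μ) ψ) θ
  where
  f : Root → Root
  f (concl k) = if k ≡ᵇ i then cutside [] false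
                else (if k <ᵇ i then concl k else concl (k ∸ 1))
  f r = r
  g : Root → Root
  g (concl k) = if k ≡ᵇ j then cutside [] true
                else concl ((length Γ ∸ 1) + (if k <ᵇ j then k else k ∸ 1))
  g r = r

onCut : CutName → Root → Bool
onCut c (cutside d _) = eqCN c d
onCut c (concl _) = false

dropCut : CutName → List (CutName × Fm) → List (CutName × Fm)
dropCut c = filterᵇ (λ p → not (eqCN c (proj₁ p)))

mergeAt : CutName → Linking → Linking
mergeAt c λ₀ =
  filterᵇ (λ a → not (onCut c (proj₁ (pos a)) ∨ onCut c (proj₁ (neg a)))) λ₀ ++
  concatMap (λ a → if onCut c (proj₁ (pos a))
                   then concatMap (λ b → if onCut c (proj₁ (neg b))
                                         then lk (pos b) (neg a) ∷ [] else []) λ₀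
                   else []) λ₀

-- (b),(c) : the pair c, whose side s is A₁ ⊗ A₂ (resp. A₁ & A₂), is replaced
-- by the pairs (false ∷ c) = A₁ * A₁^⊥ and (true ∷ c) = A₂ * A₂^⊥
remap : CutName → Bool → Vertex → Vertex
remap c s (cutside d t , (e ∷ p)) =
  if eqCN c d
  then (if eqB s t then (cutside (e ∷ c) false , p) else (cutside (not e ∷ c) true , p))
  else (cutside d t , (e ∷ p))
remap c s v = v

splitCuts : CutName → Fm → Fm → List (CutName × Fm) → List (CutName × Fm)
splitCuts c A₁ A₂ Σ' = (false ∷ c , A₁) ∷ (true ∷ c , A₂) ∷ dropCut c Σ'

under : Root → Bool → Vertex → Bool
under r d (r' , (e ∷ _)) = eqRoot r r' ∧ eqB d e
under r d (_ , []) = false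

-- the & (side s) and the ⊕ (other side) of pair c keep non-dual premises
mismatch : CutName → Bool → Linking → Bool
mismatch c s λ₀ =
  (any (under (cutside c s) false) (leaves λ₀) ∧ any (under (cutside c (not s)) false) (leaves λ₀)) ∨
  (any (under (cutside c s) true)  (leaves λ₀) ∧ any (under (cutside c (not s)) true)  (leaves λ₀))

prune : List (CutName × Fm) → Net → List (CutName × Fm)
prune Σ' θ = filterᵇ (λ p → any (λ λ₀ → any (λ v → onCut (proj₁ p) (proj₁ v)) (leaves λ₀)) θ) Σ'

data NStep : NetState → NetState → Set where
  atomic : ∀ {Σ' Γ θ c A} → (c , A) ∈ Σ' → (∃[ n ] (A ≡ var n ⊎ A ≡ nvar n)) →
           NStep (cs Σ' Γ , θ) (cs (dropCut c Σ') Γ , map (mergeAt c) θ)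
  mult   : ∀ {Σ' Γ θ c A A₁ A₂} (s : Bool) → (c , A) ∈ Σ' → sideFm s A ≡ A₁ ⊗ A₂ →
           NStep (cs Σ' Γ , θ) (cs (splitCuts c A₁ A₂ Σ') Γ , map (map (mapLink (remap c s))) θ)
  add    : ∀ {Σ' Γ θ c A A₁ A₂} (s : Bool) → (c , A) ∈ Σ' → sideFm s A ≡ A₁ & A₂ →
           let θ' = map (map (mapLink (remap c s))) (filterᵇ (λ λ₀ → not (mismatch c s λ₀)) θ)
           in NStep (cs Σ' Γ , θ) (cs (prune (splitCuts c A₁ A₂ Σ') θ') Γ , θ')

-- identity proof-net of A, on the conclusions A^⊥ (index 0) , A (index 1)
shift : Bool → Bool → Link → Link
shift b₀ b₁ = mapLink f
  where
  f : Vertex → Vertex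
  f (concl zero , p) = (concl zero , b₀ ∷ p)
  f (concl (suc zero) , p) = (concl (suc zero) , b₁ ∷ p)
  f v = v

idNet : Fm → Net
idNet (var n)  = (lk (concl 1 , []) (concl 0 , []) ∷ []) ∷ []
idNet (nvar n) = (lk (concl 0 , []) (concl 1 , []) ∷ []) ∷ []
idNet (B ⊗ C) = concatMap (λ λ₀ → map (λ μ → map (shift true false) λ₀ ++ map (shift false true) μ) (idNet C)) (idNet B)
idNet (B ⅋ C) = concatMap (λ λ₀ → map (λ μ → map (shift true false) λ₀ ++ map (shift false true) μ) (idNet C)) (idNet B)
idNet (B & C) = map (map (shift true false)) (idNet B) ++ map (map (shift false true)) (idNet C)
idNet (B ⊕ C) = map (map (shift true false)) (idNet B) ++ map (map (shift false true)) (idNet C)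

ReducesToId : NetState → Fm → Set
ReducesToId N A = ∃[ θ ] (Star NStep N (cs [] (dual A ∷ A ∷ []) , θ) × SameNet θ (idNet A))

{-# OPTIONS --safe #-}
-- A linking is viewed as a relation from its leaves labelled X to its leaves labelled X^⊥, and
-- a net as the set of such slices. A cut executes paths: it joins the dual leaves of the cut
-- formulas, keeps the pairs of slices in which every joined leaf meets a leaf (this condition
-- matches the additive choices), and relates the endpoints of the resulting paths. Every proof
-- then denotes a net of slices over its conclusions, invariantly under cut-elimination and
-- axiom-expansion, and eliminating its cuts yields a cut-free derivation with the same
-- denotation. The linkings read off cut-free derivations are proof-nets, by induction on the
-- derivation. Each step of proof-net cut-elimination preserves the execution of all remaining
-- cuts. The composition of the two nets therefore executes to the denotation of the axiom, and
-- so reduces to the identity net. Closed paths are recorded as a component of a slice: as the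
-- axiom has none, no atomic cut encountered on the way has both ends on one link.
module Submission where

open import Defs
open import Data.Bool using (Bool; true; false; not; if_then_else_; _∧_; _∨_)
open import Data.Bool.Properties using (not-involutive)
open import Data.Bool.ListAction using (any)
open import Data.Nat using (ℕ; zero; suc; _+_; _≡ᵇ_; _≤_; _<_; z≤n; s≤s)
open import Data.Nat.Properties using (_≟_; suc-injective; +-suc; ≡ᵇ⇒≡; ≡⇒≡ᵇ)
open import Data.List using (List; []; _∷_; _++_; map; concatMap; filterᵇ; length)
open import Data.List.Properties using (map-++; map-∘; map-cong; ++-assoc; ++-identityʳ; ∷-injectiveˡ; ∷-injectiveʳ; ++-cancelˡ)
open import Data.List.Membership.Propositional using (_∈_; _∉_)
open import Data.List.Membership.Propositional.Properties
  using (∈-map⁺; ∈-map⁻; ∈-++⁺ˡ; ∈-++⁺ʳ; ∈-++⁻; ∈-concatMap⁺; ∈-concatMap⁻)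
open import Data.List.Relation.Unary.Any using (here; there)
open import Data.List.Relation.Unary.All using (All; []; _∷_)
open import Data.List.Relation.Unary.Unique.Propositional using (Unique)
open import Data.List.Relation.Unary.AllPairs using ([]; _∷_)
open import Data.List.Relation.Binary.Permutation.Propositional
  using (_↭_; ↭-refl; ↭-sym; ↭-trans; ↭-reflexive; prep; swap)
open import Data.Maybe using (Maybe; just)
open import Data.Maybe.Properties using (just-injective)
open import Data.Product using (Σ; ∃-syntax; _×_; _,_; proj₁; proj₂)
open import Data.Sum using (_⊎_; inj₁; inj₂)
open import Data.Unit using (⊤; tt)
open import Data.Empty using (⊥; ⊥-elim)
open import Relation.Nullary using (¬_; Dec; yes; no)
open import Relation.Binary.PropositionalEquality
  using (_≡_; _≢_; refl; sym; trans; cong; cong₂; subst)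
open import Relation.Binary.Construct.Closure.ReflexiveTransitive using (Star; ε; _◅_; _◅◅_)
open import Function.Bundles using (mk⇔; Equivalence)
open import Data.Bool.Properties using () renaming (_≟_ to _≟ᵇ_)
open import Data.List.Relation.Binary.Permutation.Propositional.Properties using (∈-resp-↭)
open import Data.List.Relation.Binary.Permutation.Propositional.Properties
  using (drop-∷; ↭-map-inv; map⁺; ++⁺ˡ; ++⁺ʳ; ++⁺; ++-comm)
open import Data.List.Properties using (map-id)
import Data.List.Relation.Binary.Permutation.Propositional.Properties as Perm
open import Data.Bool using () renaming (T to IsTrue)
open import Data.List.Membership.Propositional using (lose; find)
open import Data.List.Relation.Binary.Permutation.Propositional.Properties using (All-resp-↭)
import Data.List.Properties as ListP
import Data.Product.Properties as ProdP
import Data.List.Relation.Unary.All as AllM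
import Data.List.Relation.Unary.AllPairs.Properties as AllPairsP
import Data.List.Relation.Unary.AllPairs as AllPairsM
import Data.List.Membership.DecPropositional as DecMem
open import Data.List.Properties using (concatMap-cong)
open import Data.List.Properties using (length-++)
open import Data.List.Membership.Propositional.Properties using (∈-filter⁺; ∈-filter⁻)
open import Data.Bool using (T?)
open import Data.Nat using (s≤s⁻¹)
open import Data.Nat.Properties using (≤-trans; ≤-refl; +-monoʳ-≤; m≤n+m; +-assoc; +-comm; ≤-reflexive)
open import Data.List.Properties using (length-filter)

-- Slices and path execution

infix 2 _↔_
_↔_ : Set → Set → Set
A ↔ B = (A → B) × (B → A)

record Slice (W : Set) : Set₁ where
  field
    Leaf : W → Set
    Rel  : W → W → Set
    Loop : Set
    src  : ∀ {u v} → Rel u v → Leaf u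
    tgt  : ∀ {u v} → Rel u v → Leaf v
open Slice

record Wiring (W V : Set) : Set₁ where
  field
    out        : W → V → Set
    joins      : W → W → Set
    functional : ∀ {w v v'} → out w v → out w v' → v ≡ v'
    exclusive  : ∀ {w w' v} → out w v → joins w w' → ⊥
open Wiring

data Run {W V : Set} (D : Wiring W V) (S : Slice W) : W → W → Set where
  hop  : ∀ {u v} → Rel S u v → Run D S u v
  step : ∀ {u v v' w} → Rel S u v → joins D v v' → Run D S v' w → Run D S u w

run-src : ∀ {W V} {D : Wiring W V} {S u v} → Run D S u v → Leaf S u
run-src {S = S} (hop r) = src S r
run-src {S = S} (step r _ _) = src S r

run-tgt : ∀ {W V} {D : Wiring W V} {S u v} → Run D S u v → Leaf S v
run-tgt {S = S} (hop r) = tgt S r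
run-tgt (step _ _ p) = run-tgt p

run-append : ∀ {W V} {D : Wiring W V} {S u v v' w} →
             Run D S u v → joins D v v' → Run D S v' w → Run D S u w
run-append (hop r) k q = step r k q
run-append (step r k' p) k q = step r k' (run-append p k q)

wire : ∀ {W V} → Wiring W V → Slice W → Slice V
wire D S = record
  { Leaf = λ v → ∃[ w ] (out D w v × Leaf S w)
  ; Rel  = λ v v' → ∃[ w ] ∃[ w' ] (out D w v × out D w' v' × Run D S w w')
  ; Loop = Loop S ⊎ ∃[ u ] ∃[ v ] (Run D S u v × joins D v u)
  ; src  = λ (w , w' , o , o' , p) → w , o , run-src p
  ; tgt  = λ (w , w' , o , o' , p) → w' , o' , run-tgt p }

-- The matching condition on additive choices: every leaf is either exported or wired to a leaf.
Routed : ∀ {W V} → Wiring W V → Slice W → Set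
Routed {W} {V} D S = ∀ w → Leaf S w → (∃[ v ] out D w v) ⊎ (∃[ w' ] (joins D w w' × Leaf S w'))

record Sim {W W' : Set} (φ : W → W') (S : Slice W) (S' : Slice W') : Set where
  field
    leaf~ : ∀ w → Leaf S w ↔ Leaf S' (φ w)
    rel~  : ∀ u v → Rel S u v ↔ Rel S' (φ u) (φ v)
    loop~ : Loop S ↔ Loop S'
open Sim

_≃_ : ∀ {W} → Slice W → Slice W → Set
_≃_ = Sim (λ w → w)

≃-refl : ∀ {W} {S : Slice W} → S ≃ S
≃-refl = record { leaf~ = λ _ → (λ x → x) , (λ x → x)
                ; rel~ = λ _ _ → (λ x → x) , (λ x → x) ; loop~ = (λ x → x) , (λ x → x) }

≃-sym : ∀ {W} {S T : Slice W} → S ≃ T → T ≃ S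
≃-sym e = record { leaf~ = λ w → proj₂ (leaf~ e w) , proj₁ (leaf~ e w)
                 ; rel~ = λ u v → proj₂ (rel~ e u v) , proj₁ (rel~ e u v)
                 ; loop~ = proj₂ (loop~ e) , proj₁ (loop~ e) }

≃-trans : ∀ {W} {S T U : Slice W} → S ≃ T → T ≃ U → S ≃ U
≃-trans e f = record
  { leaf~ = λ w → (λ x → proj₁ (leaf~ f w) (proj₁ (leaf~ e w) x)) ,
                  (λ x → proj₂ (leaf~ e w) (proj₂ (leaf~ f w) x))
  ; rel~ = λ u v → (λ x → proj₁ (rel~ f u v) (proj₁ (rel~ e u v) x)) ,
                   (λ x → proj₂ (rel~ e u v) (proj₂ (rel~ f u v) x))
  ; loop~ = (λ x → proj₁ (loop~ f) (proj₁ (loop~ e) x)) ,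
            (λ x → proj₂ (loop~ e) (proj₂ (loop~ f) x)) }

record Agree {W W' V : Set} (φ : W → W') (D : Wiring W V) (D' : Wiring W' V) (S : Slice W) : Set where
  field
    out~   : ∀ w → Leaf S w → ∀ v → out D w v ↔ out D' (φ w) v
    joins~ : ∀ w w' → Leaf S w → Leaf S w' → joins D w w' ↔ joins D' (φ w) (φ w')
open Agree

≃⇒agree : ∀ {W V} {D : Wiring W V} {S : Slice W} → Agree (λ w → w) D D S
≃⇒agree = record { out~ = λ _ _ _ → (λ x → x) , (λ x → x) ; joins~ = λ _ _ _ _ → (λ x → x) , (λ x → x) }

record Halfway {W W' V : Set} (φ : W → W') (D : Wiring W V) (D' : Wiring W' V)
               (S : Slice W) (S' : Slice W') : Set where
  field
    leaf→  : ∀ {w} → Leaf S w → Leaf S' (φ w)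
    rel→   : ∀ {u v} → Rel S u v → Rel S' (φ u) (φ v)
    loop→  : Loop S → Loop S'
    out→   : ∀ {w v} → Leaf S w → out D w v → out D' (φ w) v
    joins→ : ∀ {w w'} → Leaf S w → Leaf S w' → joins D w w' → joins D' (φ w) (φ w')

module _ {W W' V : Set} {φ : W → W'} {D : Wiring W V} {D' : Wiring W' V}
         {S : Slice W} {S' : Slice W'} (h : Halfway φ D D' S S') where
  open Halfway h

  run→ : ∀ {u v} → Run D S u v → Run D' S' (φ u) (φ v)
  run→ (hop r) = hop (rel→ r)
  run→ (step r k p) = step (rel→ r) (joins→ (tgt S r) (run-src p) k) (run→ p)

  wire-leaf→ : ∀ {v} → Leaf (wire D S) v → Leaf (wire D' S') v
  wire-leaf→ (w , o , l) = φ w , out→ l o , leaf→ l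

  wire-rel→ : ∀ {u v} → Rel (wire D S) u v → Rel (wire D' S') u v
  wire-rel→ (w , w' , o , o' , p) = φ w , φ w' , out→ (run-src p) o , out→ (run-tgt p) o' , run→ p

  wire-loop→ : Loop (wire D S) → Loop (wire D' S')
  wire-loop→ (inj₁ l) = inj₁ (loop→ l)
  wire-loop→ (inj₂ (u , v , p , k)) = inj₂ (φ u , φ v , run→ p , joins→ (run-tgt p) (run-src p) k)

  routed→ : (∀ w' → Leaf S' w' → ∃[ w ] (w' ≡ φ w × Leaf S w)) → Routed D S → Routed D' S'
  routed→ back M w' l' with back w' l'
  ... | w , refl , l with M w l
  ...   | inj₁ (v , o) = inj₁ (v , out→ l o)
  ...   | inj₂ (w₂ , k , l₂) = inj₂ (φ w₂ , joins→ l l₂ k , leaf→ l₂)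

module _ {W W' V : Set} {φ : W → W'} (ψ : W' → W) (ψφ : ∀ w → ψ (φ w) ≡ w) (φψ : ∀ w → φ (ψ w) ≡ w)
         {D : Wiring W V} {D' : Wiring W' V} {S : Slice W} {S' : Slice W'}
         (s : Sim φ S S') (a : Agree φ D D' S) where
  private
    there→ : Halfway φ D D' S S'
    there→ = record
      { leaf→ = proj₁ (leaf~ s _) ; rel→ = proj₁ (rel~ s _ _) ; loop→ = proj₁ (loop~ s)
      ; out→ = λ l → proj₁ (out~ a _ l _) ; joins→ = λ l l' → proj₁ (joins~ a _ _ l l') }

    leaf← : ∀ {w} → Leaf S' w → Leaf S (ψ w)
    leaf← {w} l = proj₂ (leaf~ s (ψ w)) (subst (Leaf S') (sym (φψ w)) l)

    subst₂' : ∀ (R : W' → W' → Set) {u v} → R u v → R (φ (ψ u)) (φ (ψ v))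
    subst₂' R {u} {v} r rewrite φψ u | φψ v = r

    back→ : Halfway ψ D' D S' S
    back→ = record
      { leaf→ = leaf←
      ; rel→ = λ {u} {v} r → proj₂ (rel~ s (ψ u) (ψ v)) (subst₂' (Rel S') r)
      ; loop→ = proj₂ (loop~ s)
      ; out→ = λ {w} {v} l o → proj₂ (out~ a (ψ w) (leaf← l) v) (subst (λ x → out D' x v) (sym (φψ w)) o)
      ; joins→ = λ {w} {w'} l l' k →
          proj₂ (joins~ a (ψ w) (ψ w') (leaf← l) (leaf← l')) (subst₂' (joins D') k) }

  rewire : wire D S ≃ wire D' S'
  rewire = record
    { leaf~ = λ _ → wire-leaf→ there→ , wire-leaf→ back→
    ; rel~ = λ _ _ → wire-rel→ there→ , wire-rel→ back→
    ; loop~ = wire-loop→ there→ , wire-loop→ back→ }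

  rewire-routed : Routed D S ↔ Routed D' S'
  rewire-routed =
    routed→ there→ (λ w' l → ψ w' , sym (φψ w') , leaf← l) ,
    routed→ back→ (λ w l → φ w , sym (ψφ w) , proj₁ (leaf~ s w) l)

infixl 5 _⨾_
_⨾_ : ∀ {W V U} → Wiring W V → Wiring V U → Wiring W U
D ⨾ E = record
  { out = λ w u → ∃[ v ] (out D w v × out E v u)
  ; joins = λ w w' → joins D w w' ⊎ ∃[ v ] ∃[ v' ] (out D w v × joins E v v' × out D w' v')
  ; functional = λ where
      (v , o , e) (v' , o' , e') → functional E (subst (λ x → out E x _) (functional D o o') e) e'
  ; exclusive = λ where
      (v , o , e) (inj₁ k) → exclusive D o k
      (v , o , e) (inj₂ (v₁ , v₂ , o₁ , k , o₂)) →
        exclusive E e (subst (λ x → joins E x v₂) (functional D o₁ o) k) }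

module _ {W V U : Set} (D : Wiring W V) (E : Wiring V U) (S : Slice W) where
  private
    inner→ : ∀ {u v} → Run D S u v → Run (D ⨾ E) S u v
    inner→ (hop r) = hop r
    inner→ (step r k p) = step r (inj₁ k) (inner→ p)

    flat→ : ∀ {v v'} → Run E (wire D S) v v' →
            ∃[ w ] ∃[ w' ] (out D w v × out D w' v' × Run (D ⨾ E) S w w')
    flat→ (hop (w , w' , o , o' , p)) = w , w' , o , o' , inner→ p
    flat→ (step (w , w' , o , o' , p) k q) with flat→ q
    ... | a , b , oa , ob , q' =
      w , b , o , ob , run-append (inner→ p) (inj₂ (_ , _ , o' , k , oa)) q'

    nest : ∀ {w w' v'} → Run (D ⨾ E) S w w' → out D w' v' →
           Run D S w w' ⊎ ∃[ a ] ∃[ v₁ ] ∃[ v₂ ]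
             (Run D S w a × out D a v₁ × joins E v₁ v₂ × Run E (wire D S) v₂ v')
    nest (hop r) o' = inj₁ (hop r)
    nest (step r (inj₁ k) p) o' with nest p o'
    ... | inj₁ q = inj₁ (step r k q)
    ... | inj₂ (a , v₁ , v₂ , q , rest) = inj₂ (a , v₁ , v₂ , step r k q , rest)
    nest (step r (inj₂ (v₁ , v₂ , o , k , o₂)) p) o' with nest p o'
    ... | inj₁ q = inj₂ (_ , v₁ , v₂ , hop r , o , k , hop (_ , _ , o₂ , o' , q))
    ... | inj₂ (a , u₁ , u₂ , q , oa , ka , R) =
      inj₂ (_ , v₁ , v₂ , hop r , o , k , step (_ , _ , o₂ , oa , q) ka R)

    flat← : ∀ {w w' v v'} → out D w v → out D w' v' → Run (D ⨾ E) S w w' → Run E (wire D S) v v'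
    flat← o o' p with nest p o'
    ... | inj₁ q = hop (_ , _ , o , o' , q)
    ... | inj₂ (a , v₁ , v₂ , q , oa , k , R) = step (_ , _ , o , oa , q) k R

    first-crossing : ∀ {w w'} → Run (D ⨾ E) S w w' →
      Run D S w w' ⊎ ∃[ a ] ∃[ v₁ ] ∃[ v₂ ] ∃[ b ]
        (Run D S w a × out D a v₁ × joins E v₁ v₂ × out D b v₂ × Run (D ⨾ E) S b w')
    first-crossing (hop r) = inj₁ (hop r)
    first-crossing (step r (inj₁ k) p) with first-crossing p
    ... | inj₁ q = inj₁ (step r k q)
    ... | inj₂ (a , v₁ , v₂ , b , q , rest) = inj₂ (a , v₁ , v₂ , b , step r k q , rest)
    first-crossing (step r (inj₂ (v₁ , v₂ , o , k , o₂)) p) =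
      inj₂ (_ , v₁ , v₂ , _ , hop r , o , k , o₂ , p)

    loop→ : Loop (wire E (wire D S)) → Loop (wire (D ⨾ E) S)
    loop→ (inj₁ (inj₁ l)) = inj₁ l
    loop→ (inj₁ (inj₂ (u , v , p , k))) = inj₂ (u , v , inner→ p , inj₁ k)
    loop→ (inj₂ (u , v , p , k)) with flat→ p
    ... | w , w' , o , o' , q = inj₂ (w , w' , q , inj₂ (v , u , o' , k , o))

    loop← : Loop (wire (D ⨾ E) S) → Loop (wire E (wire D S))
    loop← (inj₁ l) = inj₁ (inj₁ l)
    loop← (inj₂ (u , v , p , inj₂ (v₁ , v₂ , o , k , o₂))) = inj₂ (v₂ , v₁ , flat← o₂ o p , k)
    loop← (inj₂ (u , v , p , inj₁ k)) with first-crossing p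
    ... | inj₁ q = inj₁ (inj₂ (u , v , q , k))
    ... | inj₂ (a , v₁ , v₂ , b , q , oa , ke , ob , p') =
      inj₂ (v₂ , v₁ , flat← ob oa (run-append p' (inj₁ k) (inner→ q)) , ke)

  flatten : wire E (wire D S) ≃ wire (D ⨾ E) S
  flatten = record
    { leaf~ = λ u → (λ (v , e , w , o , l) → w , (v , o , e) , l) ,
                    (λ (w , (v , o , e) , l) → v , e , w , o , l)
    ; rel~ = λ u u' →
        (λ (v , v' , e , e' , p) → let (w , w' , o , o' , q) = flat→ p in
           w , w' , (v , o , e) , (v' , o' , e') , q) ,
        (λ (w , w' , (v , o , e) , (v' , o' , e') , q) → v , v' , e , e' , flat← o o' q)
    ; loop~ = loop→ , loop← }

  flatten-routed : (Routed D S × Routed E (wire D S)) ↔ Routed (D ⨾ E) S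
  flatten-routed = fwd , (λ M → bwd₁ M , bwd₂ M)
    where
    fwd : Routed D S × Routed E (wire D S) → Routed (D ⨾ E) S
    fwd (M , N) w l with M w l
    ... | inj₂ (w' , k , l') = inj₂ (w' , inj₁ k , l')
    ... | inj₁ (v , o) with N v (w , o , l)
    ...   | inj₁ (u , e) = inj₁ (u , v , o , e)
    ...   | inj₂ (v' , k , w' , o' , l') = inj₂ (w' , inj₂ (v , v' , o , k , o') , l')
    bwd₁ : Routed (D ⨾ E) S → Routed D S
    bwd₁ M w l with M w l
    ... | inj₁ (u , v , o , e) = inj₁ (v , o)
    ... | inj₂ (w' , inj₁ k , l') = inj₂ (w' , k , l')
    ... | inj₂ (w' , inj₂ (v , v' , o , k , o') , l') = inj₁ (v , o)
    bwd₂ : Routed (D ⨾ E) S → Routed E (wire D S)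
    bwd₂ M v (w , o , l) with M w l
    ... | inj₁ (u , v' , o' , e) = inj₁ (u , subst (λ x → out E x u) (functional D o' o) e)
    ... | inj₂ (w' , inj₁ k , l') = ⊥-elim (exclusive D o k)
    ... | inj₂ (w' , inj₂ (v₁ , v' , o₁ , k , o') , l') =
      inj₂ (v' , subst (λ x → joins E x v') (functional D o₁ o) k , w' , o' , l')

_⊎ₛ_ : ∀ {W W'} → Slice W → Slice W' → Slice (W ⊎ W')
S ⊎ₛ T = record
  { Leaf = λ where (inj₁ w) → Leaf S w
                   (inj₂ w) → Leaf T w
  ; Rel = rel
  ; Loop = Loop S ⊎ Loop T
  ; src = λ { {inj₁ _} {inj₁ _} r → src S r ; {inj₂ _} {inj₂ _} r → src T r }
  ; tgt = λ { {inj₁ _} {inj₁ _} r → tgt S r ; {inj₂ _} {inj₂ _} r → tgt T r } }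
  where
  rel : _ → _ → Set
  rel (inj₁ u) (inj₁ v) = Rel S u v
  rel (inj₂ u) (inj₂ v) = Rel T u v
  rel _ _ = ⊥

_⊕ʷ_ : ∀ {W W' V V'} → Wiring W V → Wiring W' V' → Wiring (W ⊎ W') (V ⊎ V')
D ⊕ʷ E = record { out = o ; joins = k ; functional = λ {w} {v} {v'} → f w v v' ; exclusive = λ {w} {w'} {v} → x w w' v }
  where
  o : _ → _ → Set
  o (inj₁ w) (inj₁ v) = out D w v
  o (inj₂ w) (inj₂ v) = out E w v
  o _ _ = ⊥
  k : _ → _ → Set
  k (inj₁ w) (inj₁ v) = joins D w v
  k (inj₂ w) (inj₂ v) = joins E w v
  k _ _ = ⊥
  f : ∀ w v v' → o w v → o w v' → v ≡ v'
  f (inj₁ _) (inj₁ _) (inj₁ _) p q = cong inj₁ (functional D p q)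
  f (inj₂ _) (inj₂ _) (inj₂ _) p q = cong inj₂ (functional E p q)
  f (inj₁ _) (inj₁ _) (inj₂ _) _ ()
  f (inj₁ _) (inj₂ _) _ ()
  f (inj₂ _) (inj₁ _) _ ()
  f (inj₂ _) (inj₂ _) (inj₁ _) _ ()
  x : ∀ w w' v → o w v → k w w' → ⊥
  x (inj₁ _) (inj₁ _) (inj₁ _) p q = exclusive D p q
  x (inj₂ _) (inj₂ _) (inj₂ _) p q = exclusive E p q
  x (inj₁ _) (inj₁ _) (inj₂ _) ()
  x (inj₁ _) (inj₂ _) _ _ ()
  x (inj₂ _) (inj₁ _) _ _ ()
  x (inj₂ _) (inj₂ _) (inj₁ _) ()

module _ {W W' V V' : Set} (D : Wiring W V) (E : Wiring W' V') (S : Slice W) (T : Slice W') where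
  private
    left→ : ∀ {u v} → Run D S u v → Run (D ⊕ʷ E) (S ⊎ₛ T) (inj₁ u) (inj₁ v)
    left→ (hop r) = hop r
    left→ (step {v = v} {v' = v'} r k p) = step {v = inj₁ v} {v' = inj₁ v'} r k (left→ p)

    right→ : ∀ {u v} → Run E T u v → Run (D ⊕ʷ E) (S ⊎ₛ T) (inj₂ u) (inj₂ v)
    right→ (hop r) = hop r
    right→ (step {v = v} {v' = v'} r k p) = step {v = inj₂ v} {v' = inj₂ v'} r k (right→ p)

    left← : ∀ {u w} → Run (D ⊕ʷ E) (S ⊎ₛ T) (inj₁ u) w → ∃[ v ] (w ≡ inj₁ v × Run D S u v)
    left← {w = inj₁ v} (hop r) = v , refl , hop r
    left← (step {v = inj₁ _} {v' = inj₁ _} r k p) with left← p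
    ... | v , refl , q = v , refl , step r k q

    right← : ∀ {u w} → Run (D ⊕ʷ E) (S ⊎ₛ T) (inj₂ u) w → ∃[ v ] (w ≡ inj₂ v × Run E T u v)
    right← {w = inj₂ v} (hop r) = v , refl , hop r
    right← (step {v = inj₂ _} {v' = inj₂ _} r k p) with right← p
    ... | v , refl , q = v , refl , step r k q

    rel→ : ∀ u v → Rel (wire D S ⊎ₛ wire E T) u v → Rel (wire (D ⊕ʷ E) (S ⊎ₛ T)) u v
    rel→ (inj₁ _) (inj₁ _) (w , w' , o , o' , p) = inj₁ w , inj₁ w' , o , o' , left→ p
    rel→ (inj₂ _) (inj₂ _) (w , w' , o , o' , p) = inj₂ w , inj₂ w' , o , o' , right→ p

    rel← : ∀ u v → Rel (wire (D ⊕ʷ E) (S ⊎ₛ T)) u v → Rel (wire D S ⊎ₛ wire E T) u v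
    rel← (inj₁ _) v (inj₁ w , w' , o , o' , p) with left← p
    rel← (inj₁ _) (inj₁ _) (inj₁ w , _ , o , o' , p) | w' , refl , q = w , w' , o , o' , q
    rel← (inj₂ _) v (inj₂ w , w' , o , o' , p) with right← p
    rel← (inj₂ _) (inj₂ _) (inj₂ w , _ , o , o' , p) | w' , refl , q = w , w' , o , o' , q

    leaf→ : ∀ v → Leaf (wire D S ⊎ₛ wire E T) v → Leaf (wire (D ⊕ʷ E) (S ⊎ₛ T)) v
    leaf→ (inj₁ _) (w , o , l) = inj₁ w , o , l
    leaf→ (inj₂ _) (w , o , l) = inj₂ w , o , l

    leaf← : ∀ v → Leaf (wire (D ⊕ʷ E) (S ⊎ₛ T)) v → Leaf (wire D S ⊎ₛ wire E T) v
    leaf← (inj₁ _) (inj₁ w , o , l) = w , o , l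
    leaf← (inj₂ _) (inj₂ w , o , l) = w , o , l

    loop→ : Loop (wire D S ⊎ₛ wire E T) → Loop (wire (D ⊕ʷ E) (S ⊎ₛ T))
    loop→ (inj₁ (inj₁ l)) = inj₁ (inj₁ l)
    loop→ (inj₁ (inj₂ (u , v , p , k))) = inj₂ (inj₁ u , inj₁ v , left→ p , k)
    loop→ (inj₂ (inj₁ l)) = inj₁ (inj₂ l)
    loop→ (inj₂ (inj₂ (u , v , p , k))) = inj₂ (inj₂ u , inj₂ v , right→ p , k)

    loop← : Loop (wire (D ⊕ʷ E) (S ⊎ₛ T)) → Loop (wire D S ⊎ₛ wire E T)
    loop← (inj₁ (inj₁ l)) = inj₁ (inj₁ l)
    loop← (inj₁ (inj₂ l)) = inj₂ (inj₁ l)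
    loop← (inj₂ (inj₁ u , _ , p , k)) with left← p
    ... | v , refl , q = inj₁ (inj₂ (u , v , q , k))
    loop← (inj₂ (inj₂ u , _ , p , k)) with right← p
    ... | v , refl , q = inj₂ (inj₂ (u , v , q , k))

  bifunctor : (wire D S ⊎ₛ wire E T) ≃ wire (D ⊕ʷ E) (S ⊎ₛ T)
  bifunctor = record { leaf~ = λ v → leaf→ v , leaf← v ; rel~ = λ u v → rel→ u v , rel← u v
                     ; loop~ = loop→ , loop← }

  bifunctor-routed : (Routed D S × Routed E T) ↔ Routed (D ⊕ʷ E) (S ⊎ₛ T)
  bifunctor-routed = fwd , (λ M → bwd₁ M , bwd₂ M)
    where
    fwd : Routed D S × Routed E T → Routed (D ⊕ʷ E) (S ⊎ₛ T)
    fwd (M , N) (inj₁ w) l with M w l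
    ... | inj₁ (v , o) = inj₁ (inj₁ v , o)
    ... | inj₂ (v , k) = inj₂ (inj₁ v , k)
    fwd (M , N) (inj₂ w) l with N w l
    ... | inj₁ (v , o) = inj₁ (inj₂ v , o)
    ... | inj₂ (v , k) = inj₂ (inj₂ v , k)
    bwd₁ : Routed (D ⊕ʷ E) (S ⊎ₛ T) → Routed D S
    bwd₁ M w l with M (inj₁ w) l
    ... | inj₁ (inj₁ v , o) = inj₁ (v , o)
    ... | inj₂ (inj₁ v , k) = inj₂ (v , k)
    bwd₂ : Routed (D ⊕ʷ E) (S ⊎ₛ T) → Routed E T
    bwd₂ M w l with M (inj₂ w) l
    ... | inj₁ (inj₂ v , o) = inj₁ (v , o)
    ... | inj₂ (inj₂ v , k) = inj₂ (v , k)

relabel : ∀ {W V} → (W → V) → Wiring W V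
relabel h = record { out = λ w v → v ≡ h w ; joins = λ _ _ → ⊥
                   ; functional = λ p q → trans p (sym q) ; exclusive = λ _ () }

record SNet (W : Set) : Set₁ where
  field
    Ix : Set
    at : Ix → Slice W
open SNet

infix 3 _≈_
record _≈_ {W : Set} (N M : SNet W) : Set where
  constructor _,_
  field
    forth : ∀ i → ∃[ j ] (at N i ≃ at M j)
    back  : ∀ j → ∃[ i ] (at N i ≃ at M j)

≈-refl : ∀ {W} {N : SNet W} → N ≈ N
≈-refl = (λ i → i , ≃-refl) , (λ i → i , ≃-refl)

≈-sym : ∀ {W} {N M : SNet W} → N ≈ M → M ≈ N
≈-sym (f , g) = (λ j → proj₁ (g j) , ≃-sym (proj₂ (g j))) , (λ i → proj₁ (f i) , ≃-sym (proj₂ (f i)))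

≈-trans : ∀ {W} {N M L : SNet W} → N ≈ M → M ≈ L → N ≈ L
≈-trans (f , g) (f' , g') =
  (λ i → let (j , e) = f i ; (k , e') = f' j in k , ≃-trans e e') ,
  (λ k → let (j , e') = g' k ; (i , e) = g j in i , ≃-trans e e')

wireN : ∀ {W V} → Wiring W V → SNet W → SNet V
wireN D N = record { Ix = ∃[ i ] Routed D (at N i) ; at = λ (i , _) → wire D (at N i) }

infixr 6 _⊎ₙ_
_⊎ₙ_ : ∀ {W W'} → SNet W → SNet W' → SNet (W ⊎ W')
N ⊎ₙ M = record { Ix = Ix N × Ix M ; at = λ (i , j) → at N i ⊎ₛ at M j }

infixr 5 _∪ₙ_
_∪ₙ_ : ∀ {W} → SNet W → SNet W → SNet W
N ∪ₙ M = record { Ix = Ix N ⊎ Ix M ; at = λ where (inj₁ i) → at N i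
                                                  (inj₂ j) → at M j }

relN : ∀ {W V} → (W → V) → SNet W → SNet V
relN h = wireN (relabel h)

rewireN : ∀ {W W' V} {N : SNet W} {N' : SNet W'} {D : Wiring W V} {D' : Wiring W' V}
          (φ : W → W') (ψ : W' → W) → (∀ w → ψ (φ w) ≡ w) → (∀ w → φ (ψ w) ≡ w) →
          (∀ i → ∃[ j ] Sim φ (at N i) (at N' j)) → (∀ j → ∃[ i ] Sim φ (at N i) (at N' j)) →
          (∀ i → Agree φ D D' (at N i)) → wireN D N ≈ wireN D' N'
rewireN φ ψ ψφ φψ f g a =
  (λ (i , M) → let (j , s) = f i in
     (j , proj₁ (rewire-routed ψ ψφ φψ s (a i)) M) , rewire ψ ψφ φψ s (a i)) ,
  (λ (j , M) → let (i , s) = g j in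
     (i , proj₂ (rewire-routed ψ ψφ φψ s (a i)) M) , rewire ψ ψφ φψ s (a i))

agreeN : ∀ {W V} {N : SNet W} {D D' : Wiring W V} →
         (∀ i → Agree (λ w → w) D D' (at N i)) → wireN D N ≈ wireN D' N
agreeN = rewireN (λ w → w) (λ w → w) (λ _ → refl) (λ _ → refl) (λ i → i , ≃-refl) (λ i → i , ≃-refl)

wireN-cong : ∀ {W V} {N N' : SNet W} (D : Wiring W V) → N ≈ N' → wireN D N ≈ wireN D N'
wireN-cong D (f , g) =
  rewireN {D = D} (λ w → w) (λ w → w) (λ _ → refl) (λ _ → refl) f g (λ _ → ≃⇒agree {D = D})

⊎ₛ-cong : ∀ {W W'} {S S' : Slice W} {T T' : Slice W'} → S ≃ S' → T ≃ T' → (S ⊎ₛ T) ≃ (S' ⊎ₛ T')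
⊎ₛ-cong {S = S} {S'} {T} {T'} e f = record { leaf~ = l ; rel~ = r ; loop~ = lp→ , lp← }
  where
  l : ∀ w → Leaf (S ⊎ₛ T) w ↔ Leaf (S' ⊎ₛ T') w
  l (inj₁ w) = leaf~ e w
  l (inj₂ w) = leaf~ f w
  r : ∀ u v → Rel (S ⊎ₛ T) u v ↔ Rel (S' ⊎ₛ T') u v
  r (inj₁ u) (inj₁ v) = rel~ e u v
  r (inj₂ u) (inj₂ v) = rel~ f u v
  r (inj₁ _) (inj₂ _) = (λ x → x) , (λ x → x)
  r (inj₂ _) (inj₁ _) = (λ x → x) , (λ x → x)
  lp→ : Loop S ⊎ Loop T → Loop S' ⊎ Loop T'
  lp→ (inj₁ x) = inj₁ (proj₁ (loop~ e) x)
  lp→ (inj₂ x) = inj₂ (proj₁ (loop~ f) x)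
  lp← : Loop S' ⊎ Loop T' → Loop S ⊎ Loop T
  lp← (inj₁ x) = inj₁ (proj₂ (loop~ e) x)
  lp← (inj₂ x) = inj₂ (proj₂ (loop~ f) x)

⊎ₙ-cong : ∀ {W W'} {N N' : SNet W} {M M' : SNet W'} → N ≈ N' → M ≈ M' → N ⊎ₙ M ≈ N' ⊎ₙ M'
⊎ₙ-cong (f , g) (f' , g') =
  (λ (i , j) → (proj₁ (f i) , proj₁ (f' j)) , ⊎ₛ-cong (proj₂ (f i)) (proj₂ (f' j))) ,
  (λ (i , j) → (proj₁ (g i) , proj₁ (g' j)) , ⊎ₛ-cong (proj₂ (g i)) (proj₂ (g' j)))

∪ₙ-cong : ∀ {W} {N N' M M' : SNet W} → N ≈ N' → M ≈ M' → N ∪ₙ M ≈ N' ∪ₙ M'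
∪ₙ-cong (f , g) (f' , g') =
  (λ where (inj₁ i) → inj₁ (proj₁ (f i)) , proj₂ (f i)
           (inj₂ i) → inj₂ (proj₁ (f' i)) , proj₂ (f' i)) ,
  (λ where (inj₁ i) → inj₁ (proj₁ (g i)) , proj₂ (g i)
           (inj₂ i) → inj₂ (proj₁ (g' i)) , proj₂ (g' i))

flattenN : ∀ {W V U} {N : SNet W} (D : Wiring W V) (E : Wiring V U) →
           wireN E (wireN D N) ≈ wireN (D ⨾ E) N
flattenN {N = N} D E =
  (λ ((i , M) , M') → (i , proj₁ (flatten-routed D E (at N i)) (M , M')) , flatten D E (at N i)) ,
  (λ (i , M) → let (M₁ , M₂) = proj₂ (flatten-routed D E (at N i)) M in
     ((i , M₁) , M₂) , flatten D E (at N i))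

bifunctorN : ∀ {W W' V V'} {N : SNet W} {M : SNet W'} (D : Wiring W V) (E : Wiring W' V') →
             wireN D N ⊎ₙ wireN E M ≈ wireN (D ⊕ʷ E) (N ⊎ₙ M)
bifunctorN {N = N} {M} D E =
  (λ ((i , m) , (j , m')) →
     ((i , j) , proj₁ (bifunctor-routed D E (at N i) (at M j)) (m , m')) , bifunctor D E (at N i) (at M j)) ,
  (λ ((i , j) , m) → let (m₁ , m₂) = proj₂ (bifunctor-routed D E (at N i) (at M j)) m in
     ((i , m₁) , (j , m₂)) , bifunctor D E (at N i) (at M j))

relN-id : ∀ {W} {N : SNet W} {h : W → W} → (∀ i w → Leaf (at N i) w → h w ≡ w) → relN h N ≈ N
relN-id {N = N} {h} hyp =
  (λ (i , _) → i , e i) , (λ i → (i , λ w _ → inj₁ (h w , refl)) , e i)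
  where
  run : ∀ {i u v} → Run (relabel h) (at N i) u v → Rel (at N i) u v
  run (hop r) = r
  e : ∀ i → wire (relabel h) (at N i) ≃ at N i
  e i = record
    { leaf~ = λ v → (λ (w , o , l) → subst (Leaf (at N i)) (sym (trans o (hyp i w l))) l) ,
                    (λ l → v , sym (hyp i v l) , l)
    ; rel~ = λ u v →
        (λ { (w , w' , refl , refl , hop r) →
             subst (λ x → Rel (at N i) x (h w')) (sym (hyp i w (src (at N i) r)))
               (subst (Rel (at N i) w) (sym (hyp i w' (tgt (at N i) r))) r) }) ,
        (λ r → u , v , sym (hyp i u (src (at N i) r)) , sym (hyp i v (tgt (at N i) r)) , hop r)
    ; loop~ = (λ { (inj₁ l) → l ; (inj₂ (_ , _ , _ , ())) }) , inj₁ }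

infixr 6 _∘ʷ_ _ʷ∘_
_∘ʷ_ : ∀ {W V U} → Wiring V U → (W → V) → Wiring W U
D ∘ʷ h = record { out = λ w → out D (h w) ; joins = λ w w' → joins D (h w) (h w')
                ; functional = functional D ; exclusive = exclusive D }

_ʷ∘_ : ∀ {W V U} → (V → U) → Wiring W V → Wiring W U
h ʷ∘ D = record { out = λ w u → ∃[ v ] (out D w v × u ≡ h v) ; joins = joins D
                ; functional = λ { (v , o , refl) (v' , o' , refl) → cong h (functional D o o') }
                ; exclusive = λ (_ , o , _) → exclusive D o }

pre : ∀ {W V U} {N : SNet W} (D : Wiring V U) (h : W → V) → wireN D (relN h N) ≈ wireN (D ∘ʷ h) N
pre D h = ≈-trans (flattenN (relabel h) D) (agreeN λ i → record
  { out~ = λ w _ v → (λ { (_ , refl , o) → o }) , (λ o → h w , refl , o)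
  ; joins~ = λ w w' _ _ → (λ { (inj₂ (_ , _ , refl , k , refl)) → k }) ,
                          (λ k → inj₂ (h w , h w' , refl , k , refl)) })

post : ∀ {W V U} {N : SNet W} (D : Wiring W V) (h : V → U) → relN h (wireN D N) ≈ wireN (h ʷ∘ D) N
post D h = ≈-trans (flattenN D (relabel h)) (agreeN λ i → record
  { out~ = λ w _ v → (λ x → x) , (λ x → x)
  ; joins~ = λ w w' _ _ → (λ { (inj₁ k) → k ; (inj₂ (_ , _ , _ , () , _)) }) , inj₁ })

wireN-∪ : ∀ {W V} {N M : SNet W} (D : Wiring W V) → wireN D (N ∪ₙ M) ≈ wireN D N ∪ₙ wireN D M
wireN-∪ D = (λ where (inj₁ i , m) → inj₁ (i , m) , ≃-refl
                     (inj₂ i , m) → inj₂ (i , m) , ≃-refl) ,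
            (λ where (inj₁ (i , m)) → (inj₁ i , m) , ≃-refl
                     (inj₂ (i , m)) → (inj₂ i , m) , ≃-refl)

⊎ₙ-distrib-∪ : ∀ {W W'} {N M : SNet W} {L : SNet W'} → (N ∪ₙ M) ⊎ₙ L ≈ (N ⊎ₙ L) ∪ₙ (M ⊎ₙ L)
⊎ₙ-distrib-∪ = (λ where (inj₁ i , l) → inj₁ (i , l) , ≃-refl
                        (inj₂ i , l) → inj₂ (i , l) , ≃-refl) ,
               (λ where (inj₁ (i , l)) → (inj₁ i , l) , ≃-refl
                        (inj₂ (i , l)) → (inj₂ i , l) , ≃-refl)

∪ₙ-emptyʳ : ∀ {W} {N M : SNet W} → ¬ Ix M → N ∪ₙ M ≈ N
∪ₙ-emptyʳ no-M = (λ { (inj₁ i) → i , ≃-refl ; (inj₂ j) → ⊥-elim (no-M j) }) , (λ i → inj₁ i , ≃-refl)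

-- Cuts and rules on slices

Occ : Set
Occ = ℕ × List Bool

flip : List Bool → List Bool
flip = map not

flip-flip : ∀ p → flip (flip p) ≡ p
flip-flip [] = refl
flip-flip (d ∷ p) = cong₂ _∷_ (not-involutive d) (flip-flip p)

flip-swap : ∀ {p q} → q ≡ flip p → p ≡ flip q
flip-swap {p} refl = sym (flip-flip p)

not-≢ : ∀ d → d ≢ not d
not-≢ true ()
not-≢ false ()

rename : (ℕ → ℕ) → Occ → Occ
rename f (n , p) = f n , p

abstract
  lab : ℕ → ℕ → Bool → Occ → Occ
  lab x z d (n , p) with n ≟ x
  ... | yes _ = z , d ∷ p
  ... | no _  = n , p

  lab₂ : ℕ → ℕ → ℕ → Occ → Occ
  lab₂ x y z (n , p) with n ≟ x
  ... | yes _ = z , false ∷ p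
  ... | no _ with n ≟ y
  ...   | yes _ = z , true ∷ p
  ...   | no _  = n , p

  lab-hit : ∀ {x z d p} → lab x z d (x , p) ≡ (z , d ∷ p)
  lab-hit {x} with x ≟ x
  ... | yes _ = refl
  ... | no x≢x = ⊥-elim (x≢x refl)

  lab-miss : ∀ {x z d n p} → n ≢ x → lab x z d (n , p) ≡ (n , p)
  lab-miss {x} {n = n} n≢x with n ≟ x
  ... | yes e = ⊥-elim (n≢x e)
  ... | no _ = refl

  lab₂-left : ∀ {x y z p} → lab₂ x y z (x , p) ≡ (z , false ∷ p)
  lab₂-left {x} with x ≟ x
  ... | yes _ = refl
  ... | no x≢x = ⊥-elim (x≢x refl)

  lab₂-right : ∀ {x y z p} → y ≢ x → lab₂ x y z (y , p) ≡ (z , true ∷ p)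
  lab₂-right {x} {y} y≢x with y ≟ x
  ... | yes e = ⊥-elim (y≢x e)
  ... | no _ with y ≟ y
  ...   | yes _ = refl
  ...   | no y≢y = ⊥-elim (y≢y refl)

  lab₂-miss : ∀ {x y z n p} → n ≢ x → n ≢ y → lab₂ x y z (n , p) ≡ (n , p)
  lab₂-miss {x} {y} {n = n} n≢x n≢y with n ≟ x
  ... | yes e = ⊥-elim (n≢x e)
  ... | no _ with n ≟ y
  ...   | yes e = ⊥-elim (n≢y e)
  ...   | no _ = refl

tensL : ℕ → ℕ → ℕ → Occ ⊎ Occ → Occ
tensL z x y (inj₁ v) = lab x z false v
tensL z x y (inj₂ v) = lab y z true v

cutW : (ℕ → ℕ) → (ℕ → ℕ) → ℕ → ℕ → Wiring (Occ ⊎ Occ) Occ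
cutW f g x y = record
  { out = o ; joins = k ; functional = λ {w} → fun {w} ; exclusive = λ {w} {w'} {v} → exc w w' v }
  where
  o : Occ ⊎ Occ → Occ → Set
  o (inj₁ v) u = proj₁ v ≢ x × u ≡ rename f v
  o (inj₂ v) u = proj₁ v ≢ y × u ≡ rename g v
  k : Occ ⊎ Occ → Occ ⊎ Occ → Set
  k (inj₁ (n , p)) (inj₂ (m , q)) = n ≡ x × m ≡ y × q ≡ flip p
  k (inj₂ (m , q)) (inj₁ (n , p)) = n ≡ x × m ≡ y × q ≡ flip p
  k (inj₁ _) (inj₁ _) = ⊥
  k (inj₂ _) (inj₂ _) = ⊥
  fun : ∀ {w v v'} → o w v → o w v' → v ≡ v'
  fun {inj₁ _} (_ , refl) (_ , refl) = refl
  fun {inj₂ _} (_ , refl) (_ , refl) = refl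
  exc : ∀ w w' v → o w v → k w w' → ⊥
  exc (inj₁ _) (inj₂ _) _ (n≢x , _) (n≡x , _) = n≢x n≡x
  exc (inj₂ _) (inj₁ _) _ (n≢y , _) (_ , n≡y , _) = n≢y n≡y

cutN : (ℕ → ℕ) → (ℕ → ℕ) → ℕ → ℕ → SNet Occ → SNet Occ → SNet Occ
cutN f g x y N M = wireN (cutW f g x y) (N ⊎ₙ M)

tensN : ℕ → ℕ → ℕ → SNet Occ → SNet Occ → SNet Occ
tensN z x y N M = relN (tensL z x y) (N ⊎ₙ M)

parN : ℕ → ℕ → ℕ → SNet Occ → SNet Occ
parN z x y N = relN (lab₂ x y z) N

plusN : ℕ → ℕ → Bool → SNet Occ → SNet Occ
plusN z x d N = relN (lab x z d) N

withN : ℕ → ℕ → ℕ → SNet Occ → SNet Occ → SNet Occ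
withN z x y N M = plusN z x false N ∪ₙ plusN z y true M

cutN-cong : ∀ {f g x y N N' M M'} → N ≈ N' → M ≈ M' → cutN f g x y N M ≈ cutN f g x y N' M'
cutN-cong {f} {g} {x} {y} e e' = wireN-cong (cutW f g x y) (⊎ₙ-cong e e')

tensN-cong : ∀ {z x y N N' M M'} → N ≈ N' → M ≈ M' → tensN z x y N M ≈ tensN z x y N' M'
tensN-cong e e' = wireN-cong _ (⊎ₙ-cong e e')

withN-cong : ∀ {z x y N N' M M'} → N ≈ N' → M ≈ M' → withN z x y N M ≈ withN z x y N' M'
withN-cong e e' = ∪ₙ-cong (wireN-cong _ e) (wireN-cong _ e')

sum-map : ∀ {A B C D : Set} → (A → C) → (B → D) → A ⊎ B → C ⊎ D
sum-map f g (inj₁ a) = inj₁ (f a)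
sum-map f g (inj₂ b) = inj₂ (g b)

relN-⊎ : ∀ {A B C D} {N : SNet A} {M : SNet B} (h : A → C) (k : B → D) →
         relN h N ⊎ₙ relN k M ≈ relN (sum-map h k) (N ⊎ₙ M)
relN-⊎ h k = ≈-trans (bifunctorN (relabel h) (relabel k)) (agreeN λ i → record
  { out~ = λ where
      (inj₁ _) _ (inj₁ _) → (λ { refl → refl }) , (λ { refl → refl })
      (inj₁ _) _ (inj₂ _) → (λ ()) , (λ ())
      (inj₂ _) _ (inj₁ _) → (λ ()) , (λ ())
      (inj₂ _) _ (inj₂ _) → (λ { refl → refl }) , (λ { refl → refl })
  ; joins~ = λ where
      (inj₁ _) (inj₁ _) _ _ → (λ ()) , (λ ())
      (inj₁ _) (inj₂ _) _ _ → (λ ()) , (λ ())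
      (inj₂ _) (inj₁ _) _ _ → (λ ()) , (λ ())
      (inj₂ _) (inj₂ _) _ _ → (λ ()) , (λ ()) })

relN-as-id : ∀ {W} {N : SNet W} → N ≈ relN (λ w → w) N
relN-as-id = ≈-sym (relN-id (λ _ _ _ → refl))

relN-∘ : ∀ {W V U} {N : SNet W} (h : W → V) (k : V → U) → relN k (relN h N) ≈ relN (λ w → k (h w)) N
relN-∘ h k = pre (relabel k) h

relN-agree : ∀ {W V} {N : SNet W} {h k : W → V} → (∀ i w → Leaf (at N i) w → h w ≡ k w) → relN h N ≈ relN k N
relN-agree e = agreeN λ i → record
  { out~ = λ w l v → (λ o → trans o (e i w l)) , (λ o → trans o (sym (e i w l)))
  ; joins~ = λ _ _ _ _ → (λ ()) , (λ ()) }

cutN-flat : ∀ {A B f g x y} {N : SNet A} {M : SNet B} (h : A → Occ) (k : B → Occ) →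
            cutN f g x y (relN h N) (relN k M) ≈ wireN (cutW f g x y ∘ʷ sum-map h k) (N ⊎ₙ M)
cutN-flat {f = f} {g} {x} {y} h k =
  ≈-trans (wireN-cong (cutW f g x y) (relN-⊎ h k)) (pre (cutW f g x y) (sum-map h k))

⊎-swap : ∀ {A B : Set} → A ⊎ B → B ⊎ A
⊎-swap (inj₁ a) = inj₂ a
⊎-swap (inj₂ b) = inj₁ b

⊎-swap-swap : ∀ {A B : Set} (w : A ⊎ B) → ⊎-swap (⊎-swap w) ≡ w
⊎-swap-swap (inj₁ _) = refl
⊎-swap-swap (inj₂ _) = refl

swap-sim : ∀ {A B} (S : Slice A) (T : Slice B) → Sim ⊎-swap (S ⊎ₛ T) (T ⊎ₛ S)
swap-sim S T = record
  { leaf~ = λ where (inj₁ _) → (λ l → l) , (λ l → l)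
                    (inj₂ _) → (λ l → l) , (λ l → l)
  ; rel~ = λ where (inj₁ _) (inj₁ _) → (λ l → l) , (λ l → l)
                   (inj₁ _) (inj₂ _) → (λ l → l) , (λ l → l)
                   (inj₂ _) (inj₁ _) → (λ l → l) , (λ l → l)
                   (inj₂ _) (inj₂ _) → (λ l → l) , (λ l → l)
  ; loop~ = ⊎-swap , ⊎-swap }

relN-swap : ∀ {A B V} {N : SNet A} {M : SNet B} (h : A ⊎ B → V) →
            relN h (N ⊎ₙ M) ≈ relN (λ w → h (⊎-swap w)) (M ⊎ₙ N)
relN-swap {N = N} {M} h = rewireN ⊎-swap ⊎-swap ⊎-swap-swap ⊎-swap-swap
  (λ (i , j) → (j , i) , swap-sim (at N i) (at M j)) (λ (j , i) → (i , j) , swap-sim (at N i) (at M j))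
  (λ i → record { out~ = λ w _ v → subst (λ w' → v ≡ h w ↔ v ≡ h w') (sym (⊎-swap-swap w)) ((λ x → x) , (λ x → x))
                ; joins~ = λ _ _ _ _ → (λ ()) , (λ ()) })

cut-sym : ∀ {f g x y N M} → cutN f g x y N M ≈ cutN g f y x M N
cut-sym {N = N} {M} = rewireN ⊎-swap ⊎-swap ⊎-swap-swap ⊎-swap-swap
  (λ (i , j) → (j , i) , swap-sim (at N i) (at M j)) (λ (j , i) → (i , j) , swap-sim (at N i) (at M j))
  (λ _ → record
    { out~ = λ where (inj₁ _) _ _ → (λ o → o) , (λ o → o)
                     (inj₂ _) _ _ → (λ o → o) , (λ o → o)
    ; joins~ = λ where
        (inj₁ _) (inj₁ _) _ _ → (λ ()) , (λ ())
        (inj₂ _) (inj₂ _) _ _ → (λ ()) , (λ ())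
        (inj₁ _) (inj₂ _) _ _ → (λ (a , b , c) → b , a , flip-swap c) , (λ (a , b , c) → b , a , flip-swap c)
        (inj₂ _) (inj₁ _) _ _ → (λ (a , b , c) → b , a , flip-swap c) , (λ (a , b , c) → b , a , flip-swap c) })

cut-post : ∀ {f g x y N M} (r : ℕ → ℕ) →
           relN (rename r) (cutN f g x y N M) ≈ cutN (λ n → r (f n)) (λ n → r (g n)) x y N M
cut-post {f} {g} {x} {y} r = ≈-trans (post (cutW f g x y) (rename r)) (agreeN λ _ → record
  { out~ = λ where
      (inj₁ v) _ u → (λ { (_ , (a , refl) , refl) → a , refl }) , (λ { (a , refl) → _ , (a , refl) , refl })
      (inj₂ v) _ u → (λ { (_ , (a , refl) , refl) → a , refl }) , (λ { (a , refl) → _ , (a , refl) , refl })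
  ; joins~ = λ _ _ _ _ → (λ k → k) , (λ k → k) })

LeafHyp : SNet Occ → (Occ → Set) → Set
LeafHyp N P = ∀ i v → Leaf (at N i) v → P v

cut-agree : ∀ {f f' g g' x y N M} →
            LeafHyp N (λ v → proj₁ v ≢ x → f (proj₁ v) ≡ f' (proj₁ v)) →
            LeafHyp M (λ v → proj₁ v ≢ y → g (proj₁ v) ≡ g' (proj₁ v)) →
            cutN f g x y N M ≈ cutN f' g' x y N M
cut-agree hN hM = agreeN λ (i , j) → record
  { out~ = λ where
      (inj₁ v) l u → (λ (a , e) → a , trans e (cong (_, proj₂ v) (hN i v l a))) ,
                     (λ (a , e) → a , trans e (cong (_, proj₂ v) (sym (hN i v l a))))
      (inj₂ v) l u → (λ (a , e) → a , trans e (cong (_, proj₂ v) (hM j v l a))) ,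
                     (λ (a , e) → a , trans e (cong (_, proj₂ v) (sym (hM j v l a))))
  ; joins~ = λ where
      (inj₁ _) (inj₁ _) _ _ → (λ ()) , (λ ())
      (inj₂ _) (inj₂ _) _ _ → (λ ()) , (λ ())
      (inj₁ _) (inj₂ _) _ _ → (λ k → k) , (λ k → k)
      (inj₂ _) (inj₁ _) _ _ → (λ k → k) , (λ k → k) }

cut-rel : ∀ {f g x y N M} (h h' : Occ → Occ) →
  LeafHyp N (λ v → (proj₁ v ≡ x × h v ≡ v) ⊎
                   (proj₁ v ≢ x × proj₁ (h v) ≢ x × h' (rename f v) ≡ rename f (h v))) →
  LeafHyp M (λ v → proj₁ v ≢ y → h' (rename g v) ≡ rename g v) →
  cutN f g x y (relN h N) M ≈ relN h' (cutN f g x y N M)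
cut-rel {f} {g} {x} {y} {N} {M} h h' hN hM =
  ≈-trans (cutN-cong ≈-refl relN-as-id)
  (≈-trans (cutN-flat h (λ v → v))
  (≈-trans (agreeN λ (i , j) → record { out~ = o i j ; joins~ = k i j })
           (≈-sym (post (cutW f g x y) h'))))
  where
  D = cutW f g x y ∘ʷ sum-map h (λ v → v)
  D' = h' ʷ∘ cutW f g x y
  o : ∀ i j w → Leaf (at N i ⊎ₛ at M j) w → ∀ u → out D w u ↔ out D' w u
  o i j (inj₁ v) l u with hN i v l
  ... | inj₁ (refl , e) =
    (λ (a , _) → ⊥-elim (a (cong proj₁ e))) , (λ (_ , (a , _) , _) → ⊥-elim (a refl))
  ... | inj₂ (a , b , e) =
    (λ { (_ , refl) → _ , (a , refl) , sym e }) , (λ { (_ , (_ , refl) , refl) → b , e })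
  o i j (inj₂ v) l u =
    (λ { (a , refl) → _ , (a , refl) , sym (hM j v l a) }) ,
    (λ { (_ , (a , refl) , refl) → a , hM j v l a })
  kk : ∀ i v m q → Leaf (at N i) v →
       (proj₁ (h v) ≡ x × m ≡ y × q ≡ flip (proj₂ (h v))) ↔ (proj₁ v ≡ x × m ≡ y × q ≡ flip (proj₂ v))
  kk i v m q l with hN i v l
  ... | inj₁ (refl , e) rewrite e = (λ k → k) , (λ k → k)
  ... | inj₂ (a , b , _) = (λ (c , _) → ⊥-elim (b c)) , (λ (c , _) → ⊥-elim (a c))
  k : ∀ i j w w' → Leaf (at N i ⊎ₛ at M j) w → Leaf (at N i ⊎ₛ at M j) w' → joins D w w' ↔ joins D' w w'
  k i j (inj₁ v) (inj₂ (m , q)) l _ = kk i v m q l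
  k i j (inj₂ (m , q)) (inj₁ v) _ l = kk i v m q l
  k i j (inj₁ _) (inj₁ _) _ _ = (λ ()) , (λ ())
  k i j (inj₂ _) (inj₂ _) _ _ = (λ ()) , (λ ())

exch₂₃ : ∀ {A B C : Set} → (A ⊎ B) ⊎ C → (A ⊎ C) ⊎ B
exch₂₃ (inj₁ (inj₁ a)) = inj₁ (inj₁ a)
exch₂₃ (inj₁ (inj₂ b)) = inj₂ b
exch₂₃ (inj₂ c) = inj₁ (inj₂ c)

exch₂₃-inv : ∀ {A B C : Set} (w : (A ⊎ B) ⊎ C) → exch₂₃ (exch₂₃ w) ≡ w
exch₂₃-inv (inj₁ (inj₁ _)) = refl
exch₂₃-inv (inj₁ (inj₂ _)) = refl
exch₂₃-inv (inj₂ _) = refl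

assoc→ : ∀ {A B C : Set} → (A ⊎ B) ⊎ C → A ⊎ (B ⊎ C)
assoc→ (inj₁ (inj₁ a)) = inj₁ a
assoc→ (inj₁ (inj₂ b)) = inj₂ (inj₁ b)
assoc→ (inj₂ c) = inj₂ (inj₂ c)

assoc← : ∀ {A B C : Set} → A ⊎ (B ⊎ C) → (A ⊎ B) ⊎ C
assoc← (inj₁ a) = inj₁ (inj₁ a)
assoc← (inj₂ (inj₁ b)) = inj₁ (inj₂ b)
assoc← (inj₂ (inj₂ c)) = inj₂ c

assoc←→ : ∀ {A B C : Set} (w : (A ⊎ B) ⊎ C) → assoc← (assoc→ w) ≡ w
assoc←→ (inj₁ (inj₁ _)) = refl
assoc←→ (inj₁ (inj₂ _)) = refl
assoc←→ (inj₂ _) = refl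

assoc→← : ∀ {A B C : Set} (w : A ⊎ (B ⊎ C)) → assoc→ (assoc← w) ≡ w
assoc→← (inj₁ _) = refl
assoc→← (inj₂ (inj₁ _)) = refl
assoc→← (inj₂ (inj₂ _)) = refl

module _ {A B C : Set} (S : Slice A) (T : Slice B) (U : Slice C) where
  private
    i : ∀ {X : Set} → X ↔ X
    i = (λ x → x) , (λ x → x)

  exch₂₃-sim : Sim exch₂₃ ((S ⊎ₛ T) ⊎ₛ U) ((S ⊎ₛ U) ⊎ₛ T)
  exch₂₃-sim = record
    { leaf~ = λ where (inj₁ (inj₁ _)) → i
                      (inj₁ (inj₂ _)) → i
                      (inj₂ _) → i
    ; rel~ = λ where
        (inj₁ (inj₁ _)) (inj₁ (inj₁ _)) → i
        (inj₁ (inj₁ _)) (inj₁ (inj₂ _)) → i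
        (inj₁ (inj₁ _)) (inj₂ _) → i
        (inj₁ (inj₂ _)) (inj₁ (inj₁ _)) → i
        (inj₁ (inj₂ _)) (inj₁ (inj₂ _)) → i
        (inj₁ (inj₂ _)) (inj₂ _) → i
        (inj₂ _) (inj₁ (inj₁ _)) → i
        (inj₂ _) (inj₁ (inj₂ _)) → i
        (inj₂ _) (inj₂ _) → i
    ; loop~ = exch₂₃ , exch₂₃ }

  assoc-sim : Sim assoc→ ((S ⊎ₛ T) ⊎ₛ U) (S ⊎ₛ (T ⊎ₛ U))
  assoc-sim = record
    { leaf~ = λ where (inj₁ (inj₁ _)) → i
                      (inj₁ (inj₂ _)) → i
                      (inj₂ _) → i
    ; rel~ = λ where
        (inj₁ (inj₁ _)) (inj₁ (inj₁ _)) → i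
        (inj₁ (inj₁ _)) (inj₁ (inj₂ _)) → i
        (inj₁ (inj₁ _)) (inj₂ _) → i
        (inj₁ (inj₂ _)) (inj₁ (inj₁ _)) → i
        (inj₁ (inj₂ _)) (inj₁ (inj₂ _)) → i
        (inj₁ (inj₂ _)) (inj₂ _) → i
        (inj₂ _) (inj₁ (inj₁ _)) → i
        (inj₂ _) (inj₁ (inj₂ _)) → i
        (inj₂ _) (inj₂ _) → i
    ; loop~ = assoc→ , assoc← }

cut-tens : ∀ {f g x y N P M} (t t' : Occ ⊎ Occ → Occ) →
  LeafHyp N (λ v → (proj₁ v ≡ x × t (inj₁ v) ≡ v) ⊎
                   (proj₁ v ≢ x × proj₁ (t (inj₁ v)) ≢ x × t' (inj₁ (rename f v)) ≡ rename f (t (inj₁ v)))) →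
  LeafHyp P (λ v → proj₁ (t (inj₂ v)) ≢ x × t' (inj₂ (rename f v)) ≡ rename f (t (inj₂ v))) →
  LeafHyp M (λ v → proj₁ v ≢ y → t' (inj₁ (rename g v)) ≡ rename g v) →
  cutN f g x y (relN t (N ⊎ₙ P)) M ≈ relN t' (cutN f g x y N M ⊎ₙ relN (rename f) P)
cut-tens {f} {g} {x} {y} {N} {P} {M} t t' hN hP hM =
  ≈-trans (cutN-cong ≈-refl relN-as-id)
  (≈-trans (cutN-flat t (λ v → v))
  (≈-trans (rewireN exch₂₃ exch₂₃ exch₂₃-inv exch₂₃-inv
              (λ ((a , b) , c) → ((a , c) , b) , exch₂₃-sim (at N a) (at P b) (at M c))
              (λ ((a , c) , b) → ((a , b) , c) , exch₂₃-sim (at N a) (at P b) (at M c))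
              (λ ((a , b) , c) → record { out~ = o a b c ; joins~ = k a b c }))
  (≈-trans (≈-sym (post (cutW f g x y ⊕ʷ relabel (rename f)) t'))
           (wireN-cong _ (≈-sym (bifunctorN (cutW f g x y) (relabel (rename f))))))))
  where
  D = cutW f g x y ∘ʷ sum-map t (λ v → v)
  D' = t' ʷ∘ (cutW f g x y ⊕ʷ relabel (rename f))
  o : ∀ a b c w → Leaf ((at N a ⊎ₛ at P b) ⊎ₛ at M c) w → ∀ u → out D w u ↔ out D' (exch₂₃ w) u
  o a b c (inj₁ (inj₁ v)) l u with hN a v l
  ... | inj₁ (refl , e) =
    (λ (q , _) → ⊥-elim (q (cong proj₁ e))) , (λ { (inj₁ _ , (q , _) , _) → ⊥-elim (q refl) })
  ... | inj₂ (q , r , e) =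
    (λ { (_ , refl) → inj₁ _ , (q , refl) , sym e }) , (λ { (inj₁ _ , (_ , refl) , refl) → r , e })
  o a b c (inj₁ (inj₂ v)) l u with hP b v l
  ... | q , e = (λ { (_ , refl) → inj₂ _ , refl , sym e }) , (λ { (inj₂ _ , refl , refl) → q , e })
  o a b c (inj₂ v) l u =
    (λ { (q , refl) → inj₁ _ , (q , refl) , sym (hM c v l q) }) ,
    (λ { (inj₁ _ , (q , refl) , refl) → q , hM c v l q })
  kN : ∀ i v m q → Leaf (at N i) v →
       (proj₁ (t (inj₁ v)) ≡ x × m ≡ y × q ≡ flip (proj₂ (t (inj₁ v)))) ↔
       (proj₁ v ≡ x × m ≡ y × q ≡ flip (proj₂ v))
  kN i v m q l with hN i v l
  ... | inj₁ (refl , e) rewrite e = (λ k → k) , (λ k → k)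
  ... | inj₂ (a , b , _) = (λ (c , _) → ⊥-elim (b c)) , (λ (c , _) → ⊥-elim (a c))
  k : ∀ a b c w w' → Leaf ((at N a ⊎ₛ at P b) ⊎ₛ at M c) w → Leaf ((at N a ⊎ₛ at P b) ⊎ₛ at M c) w' →
      joins D w w' ↔ joins D' (exch₂₃ w) (exch₂₃ w')
  k a b c (inj₁ (inj₁ v)) (inj₂ (m , q)) l _ = kN a v m q l
  k a b c (inj₂ (m , q)) (inj₁ (inj₁ v)) _ l = kN a v m q l
  k a b c (inj₁ (inj₂ v)) (inj₂ (m , q)) l _ = (λ (e , _) → ⊥-elim (proj₁ (hP b v l) e)) , (λ ())
  k a b c (inj₂ (m , q)) (inj₁ (inj₂ v)) _ l = (λ (e , _) → ⊥-elim (proj₁ (hP b v l) e)) , (λ ())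
  k a b c (inj₁ (inj₁ _)) (inj₁ (inj₁ _)) _ _ = (λ ()) , (λ ())
  k a b c (inj₁ (inj₁ _)) (inj₁ (inj₂ _)) _ _ = (λ ()) , (λ ())
  k a b c (inj₁ (inj₂ _)) (inj₁ (inj₁ _)) _ _ = (λ ()) , (λ ())
  k a b c (inj₁ (inj₂ _)) (inj₁ (inj₂ _)) _ _ = (λ ()) , (λ ())
  k a b c (inj₂ _) (inj₂ _) _ _ = (λ ()) , (λ ())

cut-assoc : ∀ {f g z w f₁ g₁ x v f₂ g₂ y u P Q R} (d : Bool) (t : Occ ⊎ Occ → Occ) (h : Occ → Occ) →
  LeafHyp P (λ a → (proj₁ a ≡ x × t (inj₁ a) ≡ (z , d ∷ proj₂ a)) ⊎
    (proj₁ a ≢ x × proj₁ (t (inj₁ a)) ≢ z × rename f (t (inj₁ a)) ≡ rename f₁ a)) →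
  LeafHyp Q (λ a → (proj₁ a ≡ y × t (inj₂ a) ≡ (z , not d ∷ proj₂ a)) ⊎
    (proj₁ a ≢ y × f₂ (proj₁ a) ≢ v × proj₁ (t (inj₂ a)) ≢ z ×
     rename f (t (inj₂ a)) ≡ rename g₁ (rename f₂ a))) →
  LeafHyp R (λ a → (proj₁ a ≢ u × g₂ (proj₁ a) ≡ v × h a ≡ (w , not d ∷ proj₂ a)) ⊎
    ((proj₁ a ≡ u × h a ≡ (w , d ∷ proj₂ a)) ⊎
     (proj₁ a ≢ u × g₂ (proj₁ a) ≢ v × proj₁ (h a) ≢ w ×
      rename g (h a) ≡ rename g₁ (rename g₂ a)))) →
  cutN f g z w (relN t (P ⊎ₙ Q)) (relN h R) ≈ cutN f₁ g₁ x v P (cutN f₂ g₂ y u Q R)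
cut-assoc {f} {g} {z} {w} {f₁} {g₁} {x} {v} {f₂} {g₂} {y} {u} {P} {Q} {R} d t h hP hQ hR =
  ≈-trans (cutN-flat t h)
  (≈-trans (rewireN assoc→ assoc← assoc←→ assoc→←
              (λ ((a , b) , c) → (a , b , c) , assoc-sim (at P a) (at Q b) (at R c))
              (λ (a , b , c) → ((a , b) , c) , assoc-sim (at P a) (at Q b) (at R c))
              (λ ((a , b) , c) → record { out~ = o a b c ; joins~ = k a b c }))
  (≈-sym (≈-trans (wireN-cong (cutW f₁ g₁ x v)
                     (≈-trans (⊎ₙ-cong relN-as-id ≈-refl) (bifunctorN (relabel (λ a → a)) (cutW f₂ g₂ y u))))
                  (flattenN (relabel (λ a → a) ⊕ʷ cutW f₂ g₂ y u) (cutW f₁ g₁ x v)))))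
  where
  D = cutW f g z w ∘ʷ sum-map t h
  D' = (relabel (λ a → a) ⊕ʷ cutW f₂ g₂ y u) ⨾ cutW f₁ g₁ x v
  X : _ → _ → _ → Slice _
  X a b c = (at P a ⊎ₛ at Q b) ⊎ₛ at R c
  o : ∀ a b c s → Leaf (X a b c) s → ∀ r → out D s r ↔ out D' (assoc→ s) r
  o a b c (inj₁ (inj₁ s)) l r with hP a s l
  ... | inj₁ (refl , e) = (λ (q , _) → ⊥-elim (q (cong proj₁ e))) ,
                          (λ { (inj₁ _ , refl , (q , _)) → ⊥-elim (q refl) })
  ... | inj₂ (p , q , e) = (λ { (_ , refl) → inj₁ s , refl , p , e }) ,
                           (λ { (inj₁ _ , refl , (_ , refl)) → q , sym e })
  o a b c (inj₁ (inj₂ s)) l r with hQ b s l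
  ... | inj₁ (refl , e) = (λ (q , _) → ⊥-elim (q (cong proj₁ e))) ,
                          (λ { (inj₂ _ , (q , _) , _) → ⊥-elim (q refl) })
  ... | inj₂ (p , p' , q , e) = (λ { (_ , refl) → inj₂ _ , (p , refl) , p' , e }) ,
                                (λ { (inj₂ _ , (_ , refl) , (_ , refl)) → q , sym e })
  o a b c (inj₂ s) l r with hR c s l
  ... | inj₁ (n , refl , e) = (λ (q , _) → ⊥-elim (q (cong proj₁ e))) ,
                              (λ { (inj₂ _ , (_ , refl) , (q , _)) → ⊥-elim (q refl) })
  ... | inj₂ (inj₁ (refl , e)) = (λ (q , _) → ⊥-elim (q (cong proj₁ e))) ,
                                 (λ { (inj₂ _ , (q , _) , _) → ⊥-elim (q refl) })
  ... | inj₂ (inj₂ (p , p' , q , e)) = (λ { (_ , refl) → inj₂ _ , (p , refl) , p' , e }) ,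
                                       (λ { (inj₂ _ , (_ , refl) , (_ , refl)) → q , sym e })
  flips : ∀ {e e' : Bool} {p q} → e ∷ q ≡ flip (e' ∷ p) → q ≡ flip p
  flips refl = refl
  Dn : Occ → Occ → Set
  Dn a b = proj₁ a ≡ z × proj₁ b ≡ w × proj₂ b ≡ flip (proj₂ a)
  PR : ∀ {a c} s r → Leaf (at P a) s → Leaf (at R c) r →
       Dn (t (inj₁ s)) (h r) ↔ (proj₁ s ≡ x × (proj₁ r ≢ u × g₂ (proj₁ r) ≡ v) × proj₂ r ≡ flip (proj₂ s))
  PR {a} {c} s r ls lr with hP a s ls | hR c r lr
  ... | inj₂ (p , q , _) | _ = (λ (e , _) → ⊥-elim (q e)) , (λ (e , _) → ⊥-elim (p e))
  ... | inj₁ (refl , e) | inj₁ (p , refl , e') rewrite e | e' =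
    (λ (_ , _ , k) → refl , (p , refl) , flips k) , (λ (_ , _ , k) → refl , refl , cong (not d ∷_) k)
  ... | inj₁ (refl , e) | inj₂ (inj₁ (refl , e')) rewrite e | e' =
    (λ (_ , _ , k) → ⊥-elim (not-≢ d (∷-injectiveˡ k))) , (λ (_ , (p , _) , _) → ⊥-elim (p refl))
  ... | inj₁ (refl , e) | inj₂ (inj₂ (p , p' , q , _)) =
    (λ (_ , k , _) → ⊥-elim (q k)) , (λ (_ , (_ , k) , _) → ⊥-elim (p' k))
  QR : ∀ {b c} s r → Leaf (at Q b) s → Leaf (at R c) r →
       Dn (t (inj₂ s)) (h r) ↔ (proj₁ s ≡ y × proj₁ r ≡ u × proj₂ r ≡ flip (proj₂ s))
  QR {b} {c} s r ls lr with hQ b s ls | hR c r lr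
  ... | inj₂ (p , _ , q , _) | _ = (λ (e , _) → ⊥-elim (q e)) , (λ (e , _) → ⊥-elim (p e))
  ... | inj₁ (refl , e) | inj₁ (p , _ , e') rewrite e | e' =
    (λ (_ , _ , k) → ⊥-elim (not-≢ (not d) (∷-injectiveˡ k))) , (λ (_ , k , _) → ⊥-elim (p k))
  ... | inj₁ (refl , e) | inj₂ (inj₁ (refl , e')) rewrite e | e' =
    (λ (_ , _ , k) → refl , refl , flips k) ,
    (λ (_ , _ , k) → refl , refl , cong₂ _∷_ (sym (not-involutive d)) k)
  ... | inj₁ (refl , e) | inj₂ (inj₂ (p , p' , q , _)) =
    (λ (_ , k , _) → ⊥-elim (q k)) , (λ (_ , k , _) → ⊥-elim (p k))
  PQ : ∀ {b} r → Leaf (at Q b) r → f₂ (proj₁ r) ≡ v → proj₁ r ≢ y → ⊥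
  PQ {b} r lr e e' with hQ b r lr
  ... | inj₁ (e'' , _) = e' e''
  ... | inj₂ (_ , e'' , _) = e'' e
  k : ∀ a b c s s' → Leaf (X a b c) s → Leaf (X a b c) s' → joins D s s' ↔ joins D' (assoc→ s) (assoc→ s')
  k a b c (inj₁ (inj₁ s)) (inj₂ r) ls lr = let (f⇒ , f⇐) = PR {a} {c} s r ls lr in
    (λ e → let (e₁ , (e₂ , e₃) , e₄) = f⇒ e in
       inj₂ (inj₁ s , inj₂ (rename g₂ r) , refl , (e₁ , e₃ , e₄) , (e₂ , refl))) ,
    (λ { (inj₂ (inj₁ _ , inj₂ _ , refl , (e₁ , e₃ , e₄) , (e₂ , refl))) → f⇐ (e₁ , (e₂ , e₃) , e₄)
       ; (inj₁ ()) ; (inj₂ (inj₁ _ , inj₁ _ , _ , () , _)) })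
  k a b c (inj₂ r) (inj₁ (inj₁ s)) lr ls = let (f⇒ , f⇐) = PR {a} {c} s r ls lr in
    (λ e → let (e₁ , (e₂ , e₃) , e₄) = f⇒ e in
       inj₂ (inj₂ (rename g₂ r) , inj₁ s , (e₂ , refl) , (e₁ , e₃ , e₄) , refl)) ,
    (λ { (inj₂ (inj₂ _ , inj₁ _ , (e₂ , refl) , (e₁ , e₃ , e₄) , refl)) → f⇐ (e₁ , (e₂ , e₃) , e₄)
       ; (inj₁ ()) ; (inj₂ (inj₂ _ , inj₂ _ , _ , () , _)) })
  k a b c (inj₁ (inj₂ s)) (inj₂ r) ls lr = let (f⇒ , f⇐) = QR {b} {c} s r ls lr in
    (λ e → inj₁ (f⇒ e)) ,
    (λ { (inj₁ e) → f⇐ e ; (inj₂ (inj₂ _ , inj₂ _ , _ , () , _)) })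
  k a b c (inj₂ r) (inj₁ (inj₂ s)) lr ls = let (f⇒ , f⇐) = QR {b} {c} s r ls lr in
    (λ e → inj₁ (f⇒ e)) ,
    (λ { (inj₁ e) → f⇐ e ; (inj₂ (inj₂ _ , inj₂ _ , _ , () , _)) })
  k a b c (inj₁ (inj₁ s)) (inj₁ (inj₁ r)) _ _ = (λ ()) , λ { (inj₁ ()) ; (inj₂ (inj₁ _ , inj₁ _ , _ , () , _)) }
  k a b c (inj₁ (inj₁ s)) (inj₁ (inj₂ r)) ls lr = (λ ()) , λ where
    (inj₂ (inj₁ _ , inj₂ _ , refl , (_ , e , _) , (e' , refl))) → PQ r lr e e'
  k a b c (inj₁ (inj₂ r)) (inj₁ (inj₁ s)) lr ls = (λ ()) , λ where
    (inj₂ (inj₂ _ , inj₁ _ , (e' , refl) , (_ , e , _) , refl)) → PQ r lr e e'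
  k a b c (inj₁ (inj₂ s)) (inj₁ (inj₂ r)) _ _ = (λ ()) , λ { (inj₁ ()) ; (inj₂ (inj₂ _ , inj₂ _ , _ , () , _)) }
  k a b c (inj₂ s) (inj₂ r) _ _ = (λ ()) , λ { (inj₁ ()) ; (inj₂ (inj₂ _ , inj₂ _ , _ , () , _)) }

cut-choice : ∀ {f g z w x u N M} (h h' : Occ → Occ) (d : Bool) →
  LeafHyp N (λ v → (proj₁ v ≡ x × h v ≡ (z , d ∷ proj₂ v)) ⊎ (proj₁ v ≢ x × proj₁ v ≢ z × h v ≡ v)) →
  LeafHyp M (λ v → (proj₁ v ≡ u × h' v ≡ (w , not d ∷ proj₂ v)) ⊎ (proj₁ v ≢ u × proj₁ v ≢ w × h' v ≡ v)) →
  cutN f g z w (relN h N) (relN h' M) ≈ cutN f g x u N M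
cut-choice {f} {g} {z} {w} {x} {u} {N} {M} h h' d hN hM =
  ≈-trans (cutN-flat h h') (agreeN λ (i , j) → record { out~ = o i j ; joins~ = k i j })
  where
  D = cutW f g z w ∘ʷ sum-map h h'
  D' = cutW f g x u
  o : ∀ i j s → Leaf (at N i ⊎ₛ at M j) s → ∀ r → out D s r ↔ out D' s r
  o i j (inj₁ v) l r with hN i v l
  ... | inj₁ (refl , e) = (λ (q , _) → ⊥-elim (q (cong proj₁ e))) , (λ (q , _) → ⊥-elim (q refl))
  ... | inj₂ (a , b , e) rewrite e = (λ (_ , q) → a , q) , (λ (_ , q) → b , q)
  o i j (inj₂ v) l r with hM j v l
  ... | inj₁ (refl , e) = (λ (q , _) → ⊥-elim (q (cong proj₁ e))) , (λ (q , _) → ⊥-elim (q refl))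
  ... | inj₂ (a , b , e) rewrite e = (λ (_ , q) → a , q) , (λ (_ , q) → b , q)
  kk : ∀ i j v r → Leaf (at N i) v → Leaf (at M j) r →
       (proj₁ (h v) ≡ z × proj₁ (h' r) ≡ w × proj₂ (h' r) ≡ flip (proj₂ (h v))) ↔
       (proj₁ v ≡ x × proj₁ r ≡ u × proj₂ r ≡ flip (proj₂ v))
  kk i j v r l l' with hN i v l | hM j r l'
  ... | inj₂ (a , b , e) | _ rewrite e = (λ (q , _) → ⊥-elim (b q)) , (λ (q , _) → ⊥-elim (a q))
  ... | inj₁ _ | inj₂ (a , b , e) rewrite e = (λ (_ , q , _) → ⊥-elim (b q)) , (λ (_ , q , _) → ⊥-elim (a q))
  ... | inj₁ (refl , e) | inj₁ (refl , e') rewrite e | e' =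
    (λ (_ , _ , q) → refl , refl , ∷-injectiveʳ q) , (λ (_ , _ , q) → refl , refl , cong (not d ∷_) q)
  k : ∀ i j s s' → Leaf (at N i ⊎ₛ at M j) s → Leaf (at N i ⊎ₛ at M j) s' → joins D s s' ↔ joins D' s s'
  k i j (inj₁ v) (inj₂ r) l l' = kk i j v r l l'
  k i j (inj₂ r) (inj₁ v) l' l = kk i j v r l l'
  k i j (inj₁ _) (inj₁ _) _ _ = (λ ()) , (λ ())
  k i j (inj₂ _) (inj₂ _) _ _ = (λ ()) , (λ ())

cut-clash : ∀ {f g z w x N M} (h h' : Occ → Occ) (d : Bool) →
  (∀ i → ∃[ p ] Leaf (at N i) (x , p)) → (∀ p → h (x , p) ≡ (z , d ∷ p)) →
  LeafHyp M (λ v → h' v ≡ (w , d ∷ proj₂ v) ⊎ proj₁ (h' v) ≢ w) →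
  ¬ Ix (cutN f g z w (relN h N) (relN h' M))
cut-clash {z = z} {w} {x} {N} {M} h h' d hN hx hM (((i , _) , (j , _)) , M₀) with hN i
... | p , l with M₀ (inj₁ (z , d ∷ p)) ((x , p) , sym (hx p) , l)
...   | inj₁ (_ , q , _) = q refl
...   | inj₂ (inj₂ _ , (_ , e , e') , (v , refl , l')) with hM j v l'
...     | inj₂ q = q e
...     | inj₁ q rewrite q = not-≢ d (∷-injectiveˡ e')

-- Additive resolutions and axioms

dual-dual : ∀ A → dual (dual A) ≡ A
dual-dual (var _) = refl
dual-dual (nvar _) = refl
dual-dual (A ⊗ B) = cong₂ _⊗_ (dual-dual A) (dual-dual B)
dual-dual (A ⅋ B) = cong₂ _⅋_ (dual-dual A) (dual-dual B)
dual-dual (A & B) = cong₂ _&_ (dual-dual A) (dual-dual B)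
dual-dual (A ⊕ B) = cong₂ _⊕_ (dual-dual A) (dual-dual B)

sub-dual : ∀ A p {B} → sub A p ≡ just B → sub (dual A) (flip p) ≡ just (dual B)
sub-dual A [] refl = refl
sub-dual (A ⊗ B) (false ∷ p) e = sub-dual A p e
sub-dual (A ⊗ B) (true ∷ p) e = sub-dual B p e
sub-dual (A ⅋ B) (false ∷ p) e = sub-dual A p e
sub-dual (A ⅋ B) (true ∷ p) e = sub-dual B p e
sub-dual (A & B) (false ∷ p) e = sub-dual A p e
sub-dual (A & B) (true ∷ p) e = sub-dual B p e
sub-dual (A ⊕ B) (false ∷ p) e = sub-dual A p e
sub-dual (A ⊕ B) (true ∷ p) e = sub-dual B p e

data Res : Fm → Set where
  at⁺ : ∀ {n} → Res (var n)
  at⁻ : ∀ {n} → Res (nvar n)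
  r⊗  : ∀ {A B} → Res A → Res B → Res (A ⊗ B)
  r⅋  : ∀ {A B} → Res A → Res B → Res (A ⅋ B)
  r&₁ : ∀ {A B} → Res A → Res (A & B)
  r&₂ : ∀ {A B} → Res B → Res (A & B)
  r⊕₁ : ∀ {A B} → Res A → Res (A ⊕ B)
  r⊕₂ : ∀ {A B} → Res B → Res (A ⊕ B)

rleaf : ∀ {A} → Res A → List Bool → Set
rleaf at⁺ [] = ⊤
rleaf at⁺ (_ ∷ _) = ⊥
rleaf at⁻ [] = ⊤
rleaf at⁻ (_ ∷ _) = ⊥
rleaf (r⊗ r s) [] = ⊥
rleaf (r⊗ r s) (false ∷ p) = rleaf r p
rleaf (r⊗ r s) (true ∷ p) = rleaf s p
rleaf (r⅋ r s) [] = ⊥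
rleaf (r⅋ r s) (false ∷ p) = rleaf r p
rleaf (r⅋ r s) (true ∷ p) = rleaf s p
rleaf (r&₁ r) [] = ⊥
rleaf (r&₁ r) (false ∷ p) = rleaf r p
rleaf (r&₁ r) (true ∷ p) = ⊥
rleaf (r&₂ r) [] = ⊥
rleaf (r&₂ r) (false ∷ p) = ⊥
rleaf (r&₂ r) (true ∷ p) = rleaf r p
rleaf (r⊕₁ r) [] = ⊥
rleaf (r⊕₁ r) (false ∷ p) = rleaf r p
rleaf (r⊕₁ r) (true ∷ p) = ⊥
rleaf (r⊕₂ r) [] = ⊥
rleaf (r⊕₂ r) (false ∷ p) = ⊥
rleaf (r⊕₂ r) (true ∷ p) = rleaf r p

rleaf-nonempty : ∀ {A} (r : Res A) → ∃[ p ] rleaf r p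
rleaf-nonempty at⁺ = [] , tt
rleaf-nonempty at⁻ = [] , tt
rleaf-nonempty (r⊗ r _) = let (p , l) = rleaf-nonempty r in false ∷ p , l
rleaf-nonempty (r⅋ r _) = let (p , l) = rleaf-nonempty r in false ∷ p , l
rleaf-nonempty (r&₁ r) = let (p , l) = rleaf-nonempty r in false ∷ p , l
rleaf-nonempty (r&₂ r) = let (p , l) = rleaf-nonempty r in true ∷ p , l
rleaf-nonempty (r⊕₁ r) = let (p , l) = rleaf-nonempty r in false ∷ p , l
rleaf-nonempty (r⊕₂ r) = let (p , l) = rleaf-nonempty r in true ∷ p , l

Pos Neg : Fm → List Bool → Set
Pos A p = ∃[ k ] (sub A p ≡ just (var k))
Neg A p = ∃[ k ] (sub A p ≡ just (nvar k))

rleaf-atom : ∀ {A} (r : Res A) p → rleaf r p → Pos A p ⊎ Neg A p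
rleaf-atom at⁺ [] l = inj₁ (_ , refl)
rleaf-atom at⁻ [] l = inj₂ (_ , refl)
rleaf-atom (r⊗ r s) (false ∷ p) l = rleaf-atom r p l
rleaf-atom (r⊗ r s) (true ∷ p) l = rleaf-atom s p l
rleaf-atom (r⅋ r s) (false ∷ p) l = rleaf-atom r p l
rleaf-atom (r⅋ r s) (true ∷ p) l = rleaf-atom s p l
rleaf-atom (r&₁ r) (false ∷ p) l = rleaf-atom r p l
rleaf-atom (r&₂ r) (true ∷ p) l = rleaf-atom r p l
rleaf-atom (r⊕₁ r) (false ∷ p) l = rleaf-atom r p l
rleaf-atom (r⊕₂ r) (true ∷ p) l = rleaf-atom r p l

pos-dual : ∀ A p → Pos A p → Neg (dual A) (flip p)
pos-dual A p (k , e) = k , sub-dual A p e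

neg-dual : ∀ A p → Neg A p → Pos (dual A) (flip p)
neg-dual A p (k , e) = k , sub-dual A p e

pos-undual : ∀ A p → Pos (dual A) p → Neg A (flip p)
pos-undual A p (k , e) = k , subst (λ F → sub F (flip p) ≡ just (nvar k)) (dual-dual A) (sub-dual (dual A) p e)

neg-undual : ∀ A p → Neg (dual A) p → Pos A (flip p)
neg-undual A p (k , e) = k , subst (λ F → sub F (flip p) ≡ just (var k)) (dual-dual A) (sub-dual (dual A) p e)

dualR : ∀ {A} → Res A → Res (dual A)
dualR at⁺ = at⁻
dualR at⁻ = at⁺
dualR (r⊗ r s) = r⅋ (dualR s) (dualR r)
dualR (r⅋ r s) = r⊗ (dualR s) (dualR r)
dualR (r&₁ r) = r⊕₂ (dualR r)
dualR (r&₂ r) = r⊕₁ (dualR r)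
dualR (r⊕₁ r) = r&₂ (dualR r)
dualR (r⊕₂ r) = r&₁ (dualR r)

rleaf-dual : ∀ {A} (r : Res A) p → rleaf (dualR r) (flip p) ≡ rleaf r p
rleaf-dual at⁺ [] = refl
rleaf-dual at⁺ (_ ∷ _) = refl
rleaf-dual at⁻ [] = refl
rleaf-dual at⁻ (_ ∷ _) = refl
rleaf-dual (r⊗ r s) [] = refl
rleaf-dual (r⊗ r s) (false ∷ p) = rleaf-dual r p
rleaf-dual (r⊗ r s) (true ∷ p) = rleaf-dual s p
rleaf-dual (r⅋ r s) [] = refl
rleaf-dual (r⅋ r s) (false ∷ p) = rleaf-dual r p
rleaf-dual (r⅋ r s) (true ∷ p) = rleaf-dual s p
rleaf-dual (r&₁ r) [] = refl
rleaf-dual (r&₁ r) (false ∷ p) = rleaf-dual r p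
rleaf-dual (r&₁ r) (true ∷ p) = refl
rleaf-dual (r&₂ r) [] = refl
rleaf-dual (r&₂ r) (false ∷ p) = refl
rleaf-dual (r&₂ r) (true ∷ p) = rleaf-dual r p
rleaf-dual (r⊕₁ r) [] = refl
rleaf-dual (r⊕₁ r) (false ∷ p) = rleaf-dual r p
rleaf-dual (r⊕₁ r) (true ∷ p) = refl
rleaf-dual (r⊕₂ r) [] = refl
rleaf-dual (r⊕₂ r) (false ∷ p) = refl
rleaf-dual (r⊕₂ r) (true ∷ p) = rleaf-dual r p

undualR : ∀ {A} (s : Res (dual A)) → Σ (Res A) λ r → ∀ p → rleaf r p ≡ rleaf s (flip p)
undualR {A} s with dual (dual A) | dual-dual A | dualR s | rleaf-dual s
... | _ | refl | r | e = r , λ p → trans (sym (cong (rleaf r) (flip-flip p))) (e (flip p))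

axS : ∀ {A} → ℕ → ℕ → Res A → Slice Occ
axS {A} x y r = record
  { Leaf = λ (n , p) → (n ≡ x × rleaf r (flip p)) ⊎ (n ≡ y × rleaf r p)
  ; Rel = λ (n , p) (m , q) → (n ≡ y × m ≡ x × q ≡ flip p × rleaf r p × Pos A p) ⊎
                              (n ≡ x × m ≡ y × p ≡ flip q × rleaf r q × Neg A q)
  ; Loop = ⊥
  ; src = λ where (inj₁ (e , _ , _ , l , _)) → inj₂ (e , l)
                  {_} {m , q} (inj₂ (e , _ , refl , l , _)) →
                    inj₁ (e , subst (rleaf r) (sym (flip-flip q)) l)
  ; tgt = λ where (inj₂ (_ , e , _ , l , _)) → inj₂ (e , l)
                  {n , p} (inj₁ (_ , e , refl , l , _)) → inj₁ (e , subst (rleaf r) (sym (flip-flip p)) l) }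

axNet : ℕ → ℕ → Fm → SNet Occ
axNet x y A = record { Ix = Res A ; at = axS x y }

axS-sym : ∀ {A} {x y} (r : Res A) (s : Res (dual A)) → (∀ p → rleaf r p ≡ rleaf s (flip p)) →
          axS x y r ≃ axS y x s
axS-sym {A} r s e = record
  { leaf~ = λ (n , p) →
      (λ where (inj₁ (a , l)) → inj₂ (a , from p l)
               (inj₂ (a , l)) → inj₁ (a , subst (λ X → X) (e p) l)) ,
      (λ where (inj₁ (a , l)) → inj₂ (a , subst (λ X → X) (sym (e p)) l)
               (inj₂ (a , l)) → inj₁ (a , to p l))
  ; rel~ = λ (n , p) (m , q) →
      (λ where (inj₁ (a , b , refl , l , k)) →
                 inj₂ (a , b , flip-swap refl , subst (λ X → X) (e p) l , pos-dual A p k)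
               (inj₂ (a , b , refl , l , k)) →
                 inj₁ (a , b , flip-swap refl , subst (λ X → X) (e q) l , neg-dual A q k)) ,
      (λ where (inj₁ (a , b , refl , l , k)) →
                 inj₂ (a , b , flip-swap refl , to p l , pos-undual A p k)
               (inj₂ (a , b , refl , l , k)) →
                 inj₁ (a , b , flip-swap refl , to q l , neg-undual A q k))
  ; loop~ = (λ x → x) , (λ x → x) }
  where
  from : ∀ p → rleaf r (flip p) → rleaf s p
  from p l = subst (rleaf s) (flip-flip p) (subst (λ X → X) (e (flip p)) l)
  to : ∀ p → rleaf s p → rleaf r (flip p)
  to p l = subst (λ X → X) (sym (e (flip p))) (subst (rleaf s) (sym (flip-flip p)) l)

axNet-sym : ∀ {x y} A → axNet x y A ≈ axNet y x (dual A)
axNet-sym A = (λ r → dualR r , axS-sym r (dualR r) (λ p → sym (rleaf-dual r p))) ,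
              (λ s → let (r , e) = undualR s in r , axS-sym r s e)

record Embeds {A F : Fm} (r : Res A) (R : Res F) (d : Bool) : Set₁ where
  field
    branch : ∀ p → rleaf R (d ∷ p) ≡ rleaf r p
    below  : ∀ p → sub F (d ∷ p) ≡ sub A p

module _ {A F : Fm} {r : Res A} {R : Res F} {d : Bool} (E : Embeds r R d)
         {u a x y : ℕ} (c : Occ → Occ)
         (cu : ∀ p → c (u , p) ≡ (x , not d ∷ p)) (ca : ∀ p → c (a , p) ≡ (y , d ∷ p)) where
  open Embeds E
  private
    to : ∀ p → rleaf r p → rleaf R (d ∷ p)
    to p = subst (λ X → X) (sym (branch p))

    cong-flip : ∀ {e e' : Bool} {p q} → e' ≡ not e → q ≡ flip p → e' ∷ q ≡ flip (e ∷ p)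
    cong-flip refl refl = refl

  axS-leaf→ : ∀ {w} → Leaf (axS u a r) w → Leaf (axS x y R) (c w)
  axS-leaf→ {_ , p} (inj₁ (refl , l)) rewrite cu p =
    inj₁ (refl , subst (λ e → rleaf R (e ∷ flip p)) (sym (not-involutive d)) (to _ l))
  axS-leaf→ {_ , p} (inj₂ (refl , l)) rewrite ca p = inj₂ (refl , to _ l)

  axS-rel→ : ∀ {w w'} → Rel (axS u a r) w w' → Rel (axS x y R) (c w) (c w')
  axS-rel→ {_ , p} {_ , q} (inj₁ (refl , refl , e , l , (k , s))) rewrite ca p | cu q =
    inj₁ (refl , refl , cong-flip refl e , to _ l , (k , trans (below p) s))
  axS-rel→ {_ , p} {_ , q} (inj₂ (refl , refl , e , l , (k , s))) rewrite ca q | cu p =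
    inj₂ (refl , refl , cong-flip refl e , to _ l , (k , trans (below q) s))

  axS-leaf←ˡ : ∀ {p} → rleaf R (flip (not d ∷ p)) → ∃[ w ] ((x , not d ∷ p) ≡ c w × Leaf (axS u a r) w)
  axS-leaf←ˡ {p} l = (u , p) , sym (cu p) ,
    inj₁ (refl , subst (λ X → X) (branch (flip p))
                   (subst (λ e → rleaf R (e ∷ flip p)) (not-involutive d) l))

  axS-leaf←ʳ : ∀ {p} → rleaf R (d ∷ p) → ∃[ w ] ((y , d ∷ p) ≡ c w × Leaf (axS u a r) w)
  axS-leaf←ʳ {p} l = (a , p) , sym (ca p) , inj₂ (refl , subst (λ X → X) (branch p) l)

  axS-rel←⁺ : ∀ {p} → rleaf R (d ∷ p) → Pos F (d ∷ p) →
    ∃[ w ] ∃[ w' ] ((y , d ∷ p) ≡ c w × (x , flip (d ∷ p)) ≡ c w' × Rel (axS u a r) w w')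
  axS-rel←⁺ {p} l (k , s) = (a , p) , (u , flip p) , sym (ca p) , sym (cu (flip p)) ,
    inj₁ (refl , refl , refl , subst (λ X → X) (branch p) l , (k , trans (sym (below p)) s))

  axS-rel←⁻ : ∀ {p} → rleaf R (d ∷ p) → Neg F (d ∷ p) →
    ∃[ w ] ∃[ w' ] ((x , flip (d ∷ p)) ≡ c w × (y , d ∷ p) ≡ c w' × Rel (axS u a r) w w')
  axS-rel←⁻ {p} l (k , s) = (u , flip p) , (a , p) , sym (cu (flip p)) , sym (ca p) ,
    inj₂ (refl , refl , refl , subst (λ X → X) (branch p) l , (k , trans (sym (below p)) s))

relabel-≃ : ∀ {W V} {T : Slice V} {S : Slice W} {h : W → V} →
  (∀ {w} → Leaf S w → Leaf T (h w)) → (∀ {v} → Leaf T v → ∃[ w ] (v ≡ h w × Leaf S w)) →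
  (∀ {w w'} → Rel S w w' → Rel T (h w) (h w')) →
  (∀ {v v'} → Rel T v v' → ∃[ w ] ∃[ w' ] (v ≡ h w × v' ≡ h w' × Rel S w w')) →
  (Loop T ↔ Loop S) → T ≃ wire (relabel h) S
relabel-≃ l→ l← r→ r← (p→ , p←) = record
  { leaf~ = λ v → l← , (λ { (w , refl , l) → l→ l })
  ; rel~ = λ u v → (λ r → let (w , w' , e , e' , r') = r← r in w , w' , e , e' , hop r') ,
                   (λ { (w , w' , refl , refl , hop r) → r→ r })
  ; loop~ = (λ l → inj₁ (p→ l)) , (λ { (inj₁ l) → p← l ; (inj₂ (_ , _ , _ , ())) }) }

relabel-routed : ∀ {W V} (S : Slice W) (h : W → V) → Routed (relabel h) S
relabel-routed _ h w _ = inj₁ (h w , refl)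

copair : ∀ {A B C : Set} → (A → C) → (B → C) → A ⊎ B → C
copair h k (inj₁ a) = h a
copair h k (inj₂ b) = k b

axS-pair : ∀ {A B F} {r : Res A} {s : Res B} {R : Res F} → Embeds r R false → Embeds s R true → ¬ rleaf R [] →
  ∀ {x y v a u b} (c₁ c₂ : Occ → Occ) →
  (∀ p → c₁ (v , p) ≡ (x , true ∷ p)) → (∀ p → c₁ (a , p) ≡ (y , false ∷ p)) →
  (∀ p → c₂ (u , p) ≡ (x , false ∷ p)) → (∀ p → c₂ (b , p) ≡ (y , true ∷ p)) →
  axS x y R ≃ wire (relabel (copair c₁ c₂)) (axS v a r ⊎ₛ axS u b s)
axS-pair {r = r} {s} {R} E₁ E₂ nil {x} {y} {v} {a} {u} {b} c₁ c₂ c₁v c₁a c₂u c₂b =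
  relabel-≃ (λ {w} → l→ {w}) (λ {w} → l← {w}) (λ {w} {w'} → r→ {w} {w'}) (λ {w} {w'} → r← {w} {w'})
    ((λ ()) , λ { (inj₁ ()) ; (inj₂ ()) })
  where
  c = copair c₁ c₂
  T = axS x y R
  S = axS v a r ⊎ₛ axS u b s
  l→ : ∀ {w} → Leaf S w → Leaf T (c w)
  l→ {inj₁ _} l = axS-leaf→ E₁ c₁ c₁v c₁a l
  l→ {inj₂ _} l = axS-leaf→ E₂ c₂ c₂u c₂b l
  l← : ∀ {w} → Leaf T w → ∃[ w' ] (w ≡ c w' × Leaf S w')
  l← {_ , []} (inj₁ (_ , l)) = ⊥-elim (nil l)
  l← {_ , []} (inj₂ (_ , l)) = ⊥-elim (nil l)
  l← {_ , true ∷ p} (inj₁ (refl , l)) = let (w , e , k) = axS-leaf←ˡ E₁ c₁ c₁v c₁a l in inj₁ w , e , k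
  l← {_ , false ∷ p} (inj₁ (refl , l)) = let (w , e , k) = axS-leaf←ˡ E₂ c₂ c₂u c₂b l in inj₂ w , e , k
  l← {_ , false ∷ p} (inj₂ (refl , l)) = let (w , e , k) = axS-leaf←ʳ E₁ c₁ c₁v c₁a l in inj₁ w , e , k
  l← {_ , true ∷ p} (inj₂ (refl , l)) = let (w , e , k) = axS-leaf←ʳ E₂ c₂ c₂u c₂b l in inj₂ w , e , k
  r→ : ∀ {w w'} → Rel S w w' → Rel T (c w) (c w')
  r→ {inj₁ _} {inj₁ _} l = axS-rel→ E₁ c₁ c₁v c₁a l
  r→ {inj₂ _} {inj₂ _} l = axS-rel→ E₂ c₂ c₂u c₂b l
  r← : ∀ {w w'} → Rel T w w' → ∃[ z ] ∃[ z' ] (w ≡ c z × w' ≡ c z' × Rel S z z')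
  r← {_ , []} (inj₁ (_ , _ , _ , l , _)) = ⊥-elim (nil l)
  r← {_} {_ , []} (inj₂ (_ , _ , _ , l , _)) = ⊥-elim (nil l)
  r← {_ , false ∷ p} (inj₁ (refl , refl , refl , l , k)) =
    let (w , w' , e , e' , k') = axS-rel←⁺ E₁ c₁ c₁v c₁a l k in inj₁ w , inj₁ w' , e , e' , k'
  r← {_ , true ∷ p} (inj₁ (refl , refl , refl , l , k)) =
    let (w , w' , e , e' , k') = axS-rel←⁺ E₂ c₂ c₂u c₂b l k in inj₂ w , inj₂ w' , e , e' , k'
  r← {_} {_ , false ∷ p} (inj₂ (refl , refl , refl , l , k)) =
    let (w , w' , e , e' , k') = axS-rel←⁻ E₁ c₁ c₁v c₁a l k in inj₁ w , inj₁ w' , e , e' , k'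
  r← {_} {_ , true ∷ p} (inj₂ (refl , refl , refl , l , k)) =
    let (w , w' , e , e' , k') = axS-rel←⁻ E₂ c₂ c₂u c₂b l k in inj₂ w , inj₂ w' , e , e' , k'

axS-one : ∀ {A F d} {r : Res A} {R : Res F} → Embeds r R d → ¬ rleaf R [] → (∀ p → ¬ rleaf R (not d ∷ p)) →
  ∀ {x y u a} (c : Occ → Occ) → (∀ p → c (u , p) ≡ (x , not d ∷ p)) → (∀ p → c (a , p) ≡ (y , d ∷ p)) →
  axS x y R ≃ wire (relabel c) (axS u a r)
axS-one {d = d} {r} {R} E nil other {x} {y} {u} {a} c cu ca =
  relabel-≃ (axS-leaf→ E c cu ca) (λ {w} → l← w) (axS-rel→ E c cu ca) (λ {w} {w'} → r← w w') ((λ ()) , (λ ()))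
  where
  on-branch : ∀ e p → rleaf R (e ∷ p) → e ≡ d
  on-branch e p l = go e d other l
    where
    go : ∀ e d → (∀ p → ¬ rleaf R (not d ∷ p)) → rleaf R (e ∷ p) → e ≡ d
    go false false _ _ = refl
    go true true _ _ = refl
    go false true o l = ⊥-elim (o p l)
    go true false o l = ⊥-elim (o p l)
  l← : ∀ w → Leaf (axS x y R) w → ∃[ w' ] (w ≡ c w' × Leaf (axS u a r) w')
  l← (_ , []) (inj₁ (_ , l)) = ⊥-elim (nil l)
  l← (_ , []) (inj₂ (_ , l)) = ⊥-elim (nil l)
  l← (_ , e ∷ p) (inj₁ (refl , l)) with trans (sym (not-involutive e)) (cong not (on-branch (not e) _ l))
  ... | refl = axS-leaf←ˡ E c cu ca l
  l← (_ , e ∷ p) (inj₂ (refl , l)) with on-branch e _ l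
  ... | refl = axS-leaf←ʳ E c cu ca l
  r← : ∀ w w' → Rel (axS x y R) w w' → ∃[ z ] ∃[ z' ] (w ≡ c z × w' ≡ c z' × Rel (axS u a r) z z')
  r← (_ , []) _ (inj₁ (_ , _ , _ , l , _)) = ⊥-elim (nil l)
  r← _ (_ , []) (inj₂ (_ , _ , _ , l , _)) = ⊥-elim (nil l)
  r← (_ , e ∷ p) _ (inj₁ (refl , refl , refl , l , k)) with on-branch e _ l
  ... | refl = axS-rel←⁺ E c cu ca l k
  r← _ (_ , e ∷ p) (inj₂ (refl , refl , refl , l , k)) with on-branch e _ l
  ... | refl = axS-rel←⁻ E c cu ca l k

axNet-⊗ : ∀ {x y v a u b A B} (c₁ c₂ : Occ → Occ) →
  (∀ p → c₁ (v , p) ≡ (x , true ∷ p)) → (∀ p → c₁ (a , p) ≡ (y , false ∷ p)) →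
  (∀ p → c₂ (u , p) ≡ (x , false ∷ p)) → (∀ p → c₂ (b , p) ≡ (y , true ∷ p)) →
  axNet x y (A ⊗ B) ≈ relN (copair c₁ c₂) (axNet v a A ⊎ₙ axNet u b B)
axNet-⊗ {x} {y} {v} {a} {u} {b} c₁ c₂ p q p' q' =
  (λ { (r⊗ r s) → ((r , s) , relabel-routed (axS v a r ⊎ₛ axS u b s) (copair c₁ c₂)) , eqv r s }) ,
  (λ { ((r , s) , _) → r⊗ r s , eqv r s })
  where
  eqv : ∀ r s → axS x y (r⊗ r s) ≃ wire (relabel (copair c₁ c₂)) (axS v a r ⊎ₛ axS u b s)
  eqv r s = axS-pair (record { branch = λ _ → refl ; below = λ _ → refl }) (record { branch = λ _ → refl ; below = λ _ → refl })
    (λ ()) c₁ c₂ p q p' q'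

axNet-⅋ : ∀ {x y v a u b A B} (c₁ c₂ : Occ → Occ) →
  (∀ p → c₁ (v , p) ≡ (x , true ∷ p)) → (∀ p → c₁ (a , p) ≡ (y , false ∷ p)) →
  (∀ p → c₂ (u , p) ≡ (x , false ∷ p)) → (∀ p → c₂ (b , p) ≡ (y , true ∷ p)) →
  axNet x y (A ⅋ B) ≈ relN (copair c₁ c₂) (axNet v a A ⊎ₙ axNet u b B)
axNet-⅋ {x} {y} {v} {a} {u} {b} c₁ c₂ p q p' q' =
  (λ { (r⅋ r s) → ((r , s) , relabel-routed (axS v a r ⊎ₛ axS u b s) (copair c₁ c₂)) , eqv r s }) ,
  (λ { ((r , s) , _) → r⅋ r s , eqv r s })
  where
  eqv : ∀ r s → axS x y (r⅋ r s) ≃ wire (relabel (copair c₁ c₂)) (axS v a r ⊎ₛ axS u b s)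
  eqv r s = axS-pair (record { branch = λ _ → refl ; below = λ _ → refl }) (record { branch = λ _ → refl ; below = λ _ → refl })
    (λ ()) c₁ c₂ p q p' q'

axNet-& : ∀ {x y v a u b A B} (c₁ c₂ : Occ → Occ) →
  (∀ p → c₁ (v , p) ≡ (x , true ∷ p)) → (∀ p → c₁ (a , p) ≡ (y , false ∷ p)) →
  (∀ p → c₂ (u , p) ≡ (x , false ∷ p)) → (∀ p → c₂ (b , p) ≡ (y , true ∷ p)) →
  axNet x y (A & B) ≈ relN c₁ (axNet v a A) ∪ₙ relN c₂ (axNet u b B)
axNet-& {x} {y} {v} {a} {u} {b} c₁ c₂ p q p' q' =
  (λ { (r&₁ r) → inj₁ (r , relabel-routed (axS v a r) c₁) , e₁ r ; (r&₂ s) → inj₂ (s , relabel-routed (axS u b s) c₂) , e₂ s }) ,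
  (λ { (inj₁ (r , _)) → r&₁ r , e₁ r ; (inj₂ (s , _)) → r&₂ s , e₂ s })
  where
  e₁ : ∀ r → axS x y (r&₁ r) ≃ wire (relabel c₁) (axS v a r)
  e₁ r = axS-one (record { branch = λ _ → refl ; below = λ _ → refl }) (λ ()) (λ _ ()) c₁ p q
  e₂ : ∀ s → axS x y (r&₂ s) ≃ wire (relabel c₂) (axS u b s)
  e₂ s = axS-one (record { branch = λ _ → refl ; below = λ _ → refl }) (λ ()) (λ _ ()) c₂ p' q'

axNet-⊕ : ∀ {x y v a u b A B} (c₁ c₂ : Occ → Occ) →
  (∀ p → c₁ (v , p) ≡ (x , true ∷ p)) → (∀ p → c₁ (a , p) ≡ (y , false ∷ p)) →
  (∀ p → c₂ (u , p) ≡ (x , false ∷ p)) → (∀ p → c₂ (b , p) ≡ (y , true ∷ p)) →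
  axNet x y (A ⊕ B) ≈ relN c₁ (axNet v a A) ∪ₙ relN c₂ (axNet u b B)
axNet-⊕ {x} {y} {v} {a} {u} {b} c₁ c₂ p q p' q' =
  (λ { (r⊕₁ r) → inj₁ (r , relabel-routed (axS v a r) c₁) , e₁ r ; (r⊕₂ s) → inj₂ (s , relabel-routed (axS u b s) c₂) , e₂ s }) ,
  (λ { (inj₁ (r , _)) → r⊕₁ r , e₁ r ; (inj₂ (s , _)) → r⊕₂ s , e₂ s })
  where
  e₁ : ∀ r → axS x y (r⊕₁ r) ≃ wire (relabel c₁) (axS v a r)
  e₁ r = axS-one (record { branch = λ _ → refl ; below = λ _ → refl }) (λ ()) (λ _ ()) c₁ p q
  e₂ : ∀ s → axS x y (r⊕₂ s) ≃ wire (relabel c₂) (axS u b s)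
  e₂ s = axS-one (record { branch = λ _ → refl ; below = λ _ → refl }) (λ ()) (λ _ ()) c₂ p' q'

η⊗-net : ∀ {x y a b u v A B} → u ≢ v → v ≢ a → u ≢ b → y ≢ u → y ≢ v →
         axNet x y (A ⊗ B) ≈ parN x u v (tensN y a b (axNet v a A) (axNet u b B))
η⊗-net {x} {y} {a} {b} {u} {v} u≢v v≢a u≢b y≢u y≢v =
  ≈-trans (axNet-⊗ (λ w → lab₂ u v x (lab a y false w)) (λ w → lab₂ u v x (lab b y true w))
            (λ p → trans (cong (lab₂ u v x) (lab-miss v≢a)) (lab₂-right (λ e → u≢v (sym e))))
            (λ p → trans (cong (lab₂ u v x) lab-hit) (lab₂-miss y≢u y≢v))
            (λ p → trans (cong (lab₂ u v x) (lab-miss u≢b)) lab₂-left)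
            (λ p → trans (cong (lab₂ u v x) lab-hit) (lab₂-miss y≢u y≢v)))
  (≈-trans (relN-agree (λ where _ (inj₁ _) _ → refl
                                _ (inj₂ _) _ → refl))
           (≈-sym (relN-∘ (tensL y a b) (lab₂ u v x))))

η&-net : ∀ {x y a b u v A B} → u ≢ a → v ≢ b → x ≢ a → x ≢ b →
         axNet x y (A & B) ≈ withN y a b (plusN x u true (axNet u a A)) (plusN x v false (axNet v b B))
η&-net {x} {y} {a} {b} {u} {v} u≢a v≢b x≢a x≢b =
  ≈-trans (axNet-& (λ w → lab a y false (lab u x true w)) (λ w → lab b y true (lab v x false w))
            (λ p → trans (cong (lab a y false) lab-hit) (lab-miss x≢a))
            (λ p → trans (cong (lab a y false) (lab-miss (λ e → u≢a (sym e)))) lab-hit)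
            (λ p → trans (cong (lab b y true) lab-hit) (lab-miss x≢b))
            (λ p → trans (cong (lab b y true) (lab-miss (λ e → v≢b (sym e)))) lab-hit))
          (≈-sym (∪ₙ-cong (relN-∘ (lab u x true) (lab a y false)) (relN-∘ (lab v x false) (lab b y true))))

relN-∪ : ∀ {W V} {N M : SNet W} (h : W → V) → relN h (N ∪ₙ M) ≈ relN h N ∪ₙ relN h M
relN-∪ h = wireN-∪ (relabel h)

abstract
  replace : ℕ → (ℕ → ℕ) → (ℕ → ℕ) → ℕ → ℕ
  replace y f g n with n ≟ y
  ... | yes _ = f n
  ... | no _  = g n

  replace-hit : ∀ {y f g} → replace y f g y ≡ f y
  replace-hit {y} with y ≟ y
  ... | yes _ = refl
  ... | no y≢y = ⊥-elim (y≢y refl)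

  replace-miss : ∀ {y f g n} → n ≢ y → replace y f g n ≡ g n
  replace-miss {y} {n = n} n≢y with n ≟ y
  ... | yes e = ⊥-elim (n≢y e)
  ... | no _ = refl

record Resolved (A : Fm) (y : ℕ) (S : Slice Occ) : Set where
  field
    res   : Res A
    leafs : ∀ p → Leaf S (y , p) ↔ rleaf res p
    pos-out : ∀ {p v} → Rel S (y , p) v → Pos A p
    neg-in  : ∀ {p v} → Rel S v (y , p) → Neg A p

cut-ax : ∀ {f g x z y A N} → x ≢ z → (∀ i → Resolved (dual A) y (at N i)) →
  cutN f g z y (axNet x z A) N ≈ relN (rename (replace y (λ _ → f x) g)) N
cut-ax {f} {g} {x} {z} {y} {A} {N} x≢z H =
  (λ ((r , i) , M) → (i , relabel-routed (at N i) h) ,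
     C.eqv r i (λ p → (λ l → toN r i M p l) , (λ l → fromN r i M p l))) ,
  (λ (i , _) → let (r , e) = choose i in ((r , i) , C.routed r i e) , C.eqv r i e)
  where
  h : Occ → Occ
  h = rename (replace y (λ _ → f x) g)
  D = cutW f g z y
  toN : ∀ r i → Routed D (axS x z r ⊎ₛ at N i) → ∀ p → rleaf r p → Leaf (at N i) (y , flip p)
  toN r i M p l with M (inj₁ (z , p)) (inj₂ (refl , l))
  ... | inj₁ (_ , q , _) = ⊥-elim (q refl)
  ... | inj₂ (inj₂ _ , (_ , refl , refl) , l') = l'
  fromN : ∀ r i → Routed D (axS x z r ⊎ₛ at N i) → ∀ p → Leaf (at N i) (y , flip p) → rleaf r p
  fromN r i M p l with M (inj₂ (y , flip p)) l
  ... | inj₁ (_ , q , _) = ⊥-elim (q refl)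
  ... | inj₂ (inj₁ (_ , p') , (refl , _ , e) , inj₁ (a , _)) = ⊥-elim (x≢z (sym a))
  ... | inj₂ (inj₁ (_ , p') , (refl , _ , e) , inj₂ (_ , l')) =
    subst (rleaf r) (trans (flip-swap e) (flip-flip p)) l'
  choose : ∀ i → Σ (Res A) λ r → ∀ p → rleaf r p ↔ Leaf (at N i) (y , flip p)
  choose i = let open Resolved (H i) ; (r , e) = undualR {A} res in
    r , λ p → (λ l → proj₂ (leafs (flip p)) (subst (λ X → X) (e p) l)) ,
              (λ l → subst (λ X → X) (sym (e p)) (proj₁ (leafs (flip p)) l))
  module C (r : Res A) (i : Ix N) (e : ∀ p → rleaf r p ↔ Leaf (at N i) (y , flip p)) where
    open Resolved (H i)
    S = axS x z r ⊎ₛ at N i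
    routed : Routed D S
    routed (inj₁ (_ , p)) (inj₁ (refl , l)) = inj₁ (_ , x≢z , refl)
    routed (inj₁ (_ , p)) (inj₂ (refl , l)) = inj₂ (inj₂ (y , flip p) , (refl , refl , refl) , proj₁ (e p) l)
    routed (inj₂ (n , p)) l with n ≟ y
    ... | no n≢y = inj₁ (_ , n≢y , refl)
    ... | yes refl = inj₂ (inj₁ (z , flip p) , (refl , refl , sym (flip-flip p)) ,
      inj₂ (refl , proj₂ (e (flip p)) (subst (λ q → Leaf (at N i) (y , q)) (sym (flip-flip p)) l)))
    h-y : ∀ {p} → h (y , p) ≡ (f x , p)
    h-y {p} = cong (_, p) (replace-hit {y} {λ _ → f x} {g})
    h-n : ∀ {n p} → n ≢ y → h (n , p) ≡ rename g (n , p)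
    h-n {n} {p} n≢y = cong (_, p) (replace-miss {y} {λ _ → f x} {g} n≢y)
    r-y : ∀ {p} → Leaf (at N i) (y , p) → rleaf r (flip p)
    r-y {p} l = proj₂ (e (flip p)) (subst (λ q → Leaf (at N i) (y , q)) (sym (flip-flip p)) l)
    from-N : ∀ {a w' u'} → Run D S (inj₂ a) w' → out D w' u' → ∃[ b ] (Rel (at N i) a b × u' ≡ h b)
    from-N {w' = inj₂ b} (hop r') (n≢y , refl) = b , r' , sym (h-n n≢y)
    from-N (step {v = inj₂ (m , q)} {v' = inj₁ _} r' (refl , refl , refl) (hop {v = inj₁ _} (inj₁ (_ , refl , refl , _)))) (q₁ , refl) =
      (m , q) , r' , sym h-y
    from-N (step {v = inj₂ _} {v' = inj₁ _} r' (refl , refl , refl) (hop {v = inj₁ _} (inj₂ (a , _)))) o =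
      ⊥-elim (x≢z (sym a))
    from-N (step {v = inj₂ _} {v' = inj₁ _} r' (refl , refl , refl) (step {v = inj₁ _} {v' = inj₂ _} (inj₁ (_ , refl , _)) (a , _) _)) o =
      ⊥-elim (x≢z a)
    from-N (step {v = inj₂ _} {v' = inj₁ _} r' (refl , refl , refl) (step {v = inj₁ _} {v' = inj₂ _} (inj₂ (a , _)) _ _)) o =
      ⊥-elim (x≢z (sym a))
    rel→ : ∀ {w w' u u'} → out D w u → out D w' u' → Run D S w w' → ∃[ a ] ∃[ b ] (u ≡ h a × u' ≡ h b × Rel (at N i) a b)
    rel→ {inj₂ a} (n≢y , refl) o' p = let (b , r' , e') = from-N p o' in a , b , sym (h-n n≢y) , e' , r'
    rel→ {inj₁ _} (q , refl) o' (hop {v = inj₁ _} (inj₁ (a , _))) = ⊥-elim (q a)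
    rel→ {inj₁ _} (q , refl) (q' , _) (hop {v = inj₁ _} (inj₂ (_ , a , _))) = ⊥-elim (q' a)
    rel→ {inj₁ _} (q , refl) o' (step {v = inj₁ _} {v' = inj₂ _} (inj₁ (a , _)) _ _) = ⊥-elim (q a)
    rel→ {inj₁ _} (q , refl) o' (step {v = inj₁ (_ , p₁)} {v' = inj₂ _} (inj₂ (refl , refl , refl , _)) (_ , refl , refl) p) =
      let (b , r' , e') = from-N p o' in _ , b , sym h-y , e' , r'
    tail : ∀ {a b} → Rel (at N i) a b → ∃[ w' ] (out D w' (h b) × Run D S (inj₂ a) w')
    tail {b = n , q} r' with n ≟ y
    ... | no n≢y = inj₂ (n , q) , (n≢y , h-n n≢y) , hop r'
    ... | yes refl = inj₁ (x , q) , (x≢z , h-y) ,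
      step {v = inj₂ (y , q)} {v' = inj₁ (z , flip q)} r' (refl , refl , sym (flip-flip q))
        (hop (inj₁ (refl , refl , sym (flip-flip q) , r-y (tgt (at N i) r') , neg-undual A q (neg-in r'))))
    rel← : ∀ {a b} → Rel (at N i) a b → ∃[ w ] ∃[ w' ] (out D w (h a) × out D w' (h b) × Run D S w w')
    rel← {n , p} r' with tail r'
    ... | w' , o' , t with n ≟ y
    ...   | no n≢y = inj₂ (n , p) , w' , (n≢y , h-n n≢y) , o' , t
    ...   | yes refl = inj₁ (x , p) , w' , (x≢z , h-y) , o' ,
      step {v = inj₁ (z , flip p)} {v' = inj₂ (y , p)}
        (inj₂ (refl , refl , sym (flip-flip p) , r-y (src (at N i) r') , pos-undual A p (pos-out r')))
        (refl , refl , sym (flip-flip p)) t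
    leaf→ : ∀ {u} → Leaf (wire D S) u → Leaf (wire (relabel h) (at N i)) u
    leaf→ (inj₁ (_ , p) , (q , refl) , inj₁ (refl , l)) =
      (y , p) , sym h-y , subst (λ q → Leaf (at N i) (y , q)) (flip-flip p) (proj₁ (e (flip p)) l)
    leaf→ (inj₁ _ , (q , refl) , inj₂ (a , _)) = ⊥-elim (q a)
    leaf→ (inj₂ v , (q , refl) , l) = v , sym (h-n q) , l
    leaf← : ∀ {u} → Leaf (wire (relabel h) (at N i)) u → Leaf (wire D S) u
    leaf← ((n , p) , refl , l) with n ≟ y
    ... | yes refl = inj₁ (x , p) , (x≢z , h-y) , inj₁ (refl , r-y l)
    ... | no n≢y = inj₂ (n , p) , (n≢y , h-n n≢y) , l
    never : ∀ {u v} → Run D S u v → joins D v u → ⊥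
    last-z : ∀ {a b q} → Run D S (inj₂ a) (inj₁ (b , q)) → b ≡ z → ⊥
    last-z (step {v = inj₂ _} {v' = inj₁ _} _ (refl , _) (hop (inj₁ (_ , b , _)))) refl = x≢z (sym b)
    last-z (step {v = inj₂ _} {v' = inj₁ _} _ (refl , _) (hop (inj₂ (b , _)))) refl = x≢z (sym b)
    last-z (step {v = inj₂ _} {v' = inj₁ _} _ (refl , _) (step {v = inj₁ _} {v' = inj₂ _} _ _ p)) e' = last-z p e'
    last-z (step {v = inj₁ _} () _ _) e'
    never {inj₁ _} {inj₂ _} (step {v = inj₁ _} {v' = inj₂ _} (inj₁ (_ , a , _)) (b , _) _) _ = x≢z (trans (sym a) b)
    never {inj₁ _} {inj₂ _} (step {v = inj₁ _} {v' = inj₂ _} (inj₂ (a , _)) _ _) (b , _) = x≢z (trans (sym a) b)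
    never {inj₂ _} {inj₁ _} p (a , _) = last-z p a
    loop→ : Loop (wire D S) → Loop (wire (relabel h) (at N i))
    loop→ (inj₁ (inj₂ l)) = inj₁ l
    loop→ (inj₂ (_ , _ , p , k)) = ⊥-elim (never p k)
    loop← : Loop (wire (relabel h) (at N i)) → Loop (wire D S)
    loop← (inj₁ l) = inj₁ (inj₂ l)
    eqv : wire D S ≃ wire (relabel h) (at N i)
    eqv = record
      { leaf~ = λ _ → leaf→ , leaf←
      ; rel~ = λ u v →
          (λ (w , w' , o , o' , p) → let (a , b , e₁ , e₂ , r') = rel→ o o' p in a , b , e₁ , e₂ , hop r') ,
          (λ { (a , b , refl , refl , hop r') → rel← r' })
      ; loop~ = loop→ , loop← }

-- Cut-free derivations

Fresh : ℕ → Ctx → Set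
Fresh z Γ = ∀ {A} → (z , A) ∈ Γ → ⊥

Apart : Ctx → Ctx → Set
Apart Γ Δ = ∀ {n A B} → (n , A) ∈ Γ → (n , B) ∈ Δ → ⊥

InjOn : (ℕ → ℕ) → Ctx → Set
InjOn f Γ = ∀ {n m A B} → (n , A) ∈ Γ → (m , B) ∈ Γ → f n ≡ f m → n ≡ m

mapN : (ℕ → ℕ) → Ctx → Ctx
mapN f = map (λ q → f (proj₁ q) , proj₂ q)

∈-mapN⁺ : ∀ {f Γ n A} → (n , A) ∈ Γ → (f n , A) ∈ mapN f Γ
∈-mapN⁺ = ∈-map⁺ _

∈-mapN⁻ : ∀ {f Γ m A} → (m , A) ∈ mapN f Γ → ∃[ n ] ((n , A) ∈ Γ × m ≡ f n)
∈-mapN⁻ i with ∈-map⁻ _ i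
... | (n , A) , j , refl = n , j , refl

Uniq : Ctx → Set
Uniq [] = ⊤
Uniq ((n , _) ∷ Γ) = Fresh n Γ × Uniq Γ

fresh-≢ : ∀ {x Γ n A} → Fresh x Γ → (n , A) ∈ Γ → n ≢ x
fresh-≢ f i refl = f i

uniq-fun : ∀ {Γ n A B} → Uniq Γ → (n , A) ∈ Γ → (n , B) ∈ Γ → A ≡ B
uniq-fun u (here refl) (here refl) = refl
uniq-fun (f , u) (here refl) (there j) = ⊥-elim (f j)
uniq-fun (f , u) (there i) (here refl) = ⊥-elim (f i)
uniq-fun (f , u) (there i) (there j) = uniq-fun u i j

uniq-++ : ∀ {Γ Δ} → Uniq Γ → Uniq Δ → Apart Γ Δ → Uniq (Γ ++ Δ)
uniq-++ {[]} _ v _ = v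
uniq-++ {(n , A) ∷ Γ} {Δ} (f , u) v d =
  fresh , uniq-++ u v (λ i j → d (there i) j)
  where
  fresh : Fresh n (Γ ++ Δ)
  fresh i with ∈-++⁻ Γ i
  ... | inj₁ j = f j
  ... | inj₂ j = d (here refl) j

uniq-mapN : ∀ {f Γ} → InjOn f Γ → Uniq Γ → Uniq (mapN f Γ)
uniq-mapN {f} {[]} _ _ = tt
uniq-mapN {f} {(n , A) ∷ Γ} inj (fr , u) =
  (λ i → let (m , j , e) = ∈-mapN⁻ {f} i in
     fr (subst (λ k → (k , _) ∈ Γ) (sym (inj (here refl) (there j) e)) j)) ,
  uniq-mapN (λ i j → inj (there i) (there j)) u

uniq-↭ : ∀ {Γ Δ} → Γ ↭ Δ → Uniq Γ → Uniq Δ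
uniq-↭ _↭_.refl u = u
uniq-↭ (prep _ p) (f , u) = (λ i → f (∈-resp-↭ (↭-sym p) i)) , uniq-↭ p u
uniq-↭ (swap (x , _) (y , _) p) (f , g , u) =
  (λ { (here refl) → f (here refl) ; (there i) → g (∈-resp-↭ (↭-sym p) i) }) ,
  (λ i → f (there (∈-resp-↭ (↭-sym p) i))) , uniq-↭ p u
uniq-↭ (_↭_.trans p q) u = uniq-↭ q (uniq-↭ p u)

data CF : Ctx → Set where
  cax   : ∀ {x y} k → x ≢ y → CF ((x , nvar k) ∷ (y , var k) ∷ [])
  crn   : ∀ {Γ} f → InjOn f Γ → CF Γ → CF (mapN f Γ)
  cex   : ∀ {Γ Δ} → Γ ↭ Δ → CF Γ → CF Δ
  ctens : ∀ {x y A B Γ Δ} z → CF ((x , A) ∷ Γ) → CF ((y , B) ∷ Δ) → Apart Γ Δ → Fresh z (Γ ++ Δ) →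
          CF ((z , A ⊗ B) ∷ Γ ++ Δ)
  cpar  : ∀ {x y A B Γ} z → CF ((x , A) ∷ (y , B) ∷ Γ) → Fresh z Γ → CF ((z , A ⅋ B) ∷ Γ)
  cwith : ∀ {x y A B Γ} z → CF ((x , A) ∷ Γ) → CF ((y , B) ∷ Γ) → Fresh z Γ → CF ((z , A & B) ∷ Γ)
  cplus : ∀ {x A B Γ} z d → CF ((x , (if d then B else A)) ∷ Γ) → Fresh z Γ → CF ((z , A ⊕ B) ∷ Γ)

sem : ∀ {Γ} → CF Γ → SNet Occ
sem (cax {x} {y} k _) = axNet x y (var k)
sem (crn f _ D) = relN (rename f) (sem D)
sem (cex _ D) = sem D
sem (ctens {x} {y} z D E _ _) = tensN z x y (sem D) (sem E)
sem (cpar {x} {y} z D _) = parN z x y (sem D)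
sem (cwith {x} {y} z D E _) = withN z x y (sem D) (sem E)
sem (cplus {x} z d D _) = plusN z x d (sem D)

uniq : ∀ {Γ} → CF Γ → Uniq Γ
uniq (cax k x≢y) = (λ { (here refl) → x≢y refl }) , (λ ()) , tt
uniq (crn f inj D) = uniq-mapN inj (uniq D)
uniq (cex p D) = uniq-↭ p (uniq D)
uniq (ctens z D E a f) = f , uniq-++ (proj₂ (uniq D)) (proj₂ (uniq E)) a
uniq (cpar z D f) = f , proj₂ (proj₂ (uniq D))
uniq (cwith z D E f) = f , proj₂ (uniq D)
uniq (cplus z d D f) = f , proj₂ (uniq D)

Atom : Ctx → Occ → Fm → Set
Atom Γ (n , p) a = ∃[ A ] ((n , A) ∈ Γ × sub A p ≡ just a)

record WT (Γ : Ctx) (S : Slice Occ) : Set where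
  field
    dom?   : ∀ {v} → Leaf S v → ∃[ A ] ((proj₁ v , A) ∈ Γ)
    shape  : ∀ {n A} → (n , A) ∈ Γ → Σ (Res A) λ r → ∀ p → Leaf S (n , p) ↔ rleaf r p
    atoms  : ∀ {u v} → Rel S u v → ∃[ k ] (Atom Γ u (var k) × Atom Γ v (nvar k))
    noloop : ¬ Loop S

WTN : Ctx → SNet Occ → Set
WTN Γ N = ∀ i → WT Γ (at N i)

wt-≃ : ∀ {Γ S T} → S ≃ T → WT Γ S → WT Γ T
wt-≃ e w = record
  { dom? = λ l → dom? (proj₂ (leaf~ e _) l)
  ; shape = λ i → let (r , f) = shape i in r , λ p →
      (λ l → proj₁ (f p) (proj₂ (leaf~ e _) l)) , (λ l → proj₁ (leaf~ e _) (proj₂ (f p) l))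
  ; atoms = λ r → atoms (proj₂ (rel~ e _ _) r)
  ; noloop = λ l → noloop (proj₂ (loop~ e) l) }
  where open WT w

wt-≈ : ∀ {Γ N M} → N ≈ M → WTN Γ N → WTN Γ M
wt-≈ (_ , g) w j = let (i , e) = g j in wt-≃ e (w i)

wt-∈ : ∀ {Γ Δ S} → (∀ {n A} → (n , A) ∈ Γ → (n , A) ∈ Δ) → (∀ {n A} → (n , A) ∈ Δ → (n , A) ∈ Γ) →
       WT Γ S → WT Δ S
wt-∈ f g w = record
  { dom? = λ l → let (A , i) = dom? l in A , f i
  ; shape = λ i → shape (g i)
  ; atoms = λ r → let (k , (A , i , e) , (B , j , e')) = atoms r in k , (A , f i , e) , (B , f j , e')
  ; noloop = noloop }
  where open WT w

wt-relabel : ∀ {W} {S : Slice W} {h : W → Occ} {Γ} →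
  (∀ w → Leaf S w → ∃[ A ] ((proj₁ (h w) , A) ∈ Γ)) →
  (∀ {n A} → (n , A) ∈ Γ → Σ (Res A) λ r →
     (∀ w → Leaf S w → proj₁ (h w) ≡ n → rleaf r (proj₂ (h w))) ×
     (∀ p → rleaf r p → ∃[ w ] ((n , p) ≡ h w × Leaf S w))) →
  (∀ u v → Rel S u v → ∃[ k ] (Atom Γ (h u) (var k) × Atom Γ (h v) (nvar k))) →
  ¬ Loop S → WT Γ (wire (relabel h) S)
wt-relabel d s a n = record
  { dom? = λ { (w , refl , l) → d w l }
  ; shape = λ i → let (r , f , g) = s i in r , λ p → (λ { (w , refl , l) → f w l refl }) , g p
  ; atoms = λ { (u , v , refl , refl , hop r) → a u v r }
  ; noloop = λ { (inj₁ l) → n l ; (inj₂ (_ , _ , _ , ())) } }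

wt-single : ∀ {Γ S x z d A F} {R : Res A → Res F} → Fresh x Γ → Fresh z Γ →
  (∀ r → Embeds r (R r) d) → (∀ r p → rleaf (R r) (not d ∷ p) → ⊥) → (∀ r → rleaf (R r) [] → ⊥) →
  WT ((x , A) ∷ Γ) S → WT ((z , F) ∷ Γ) (wire (relabel (lab x z d)) S)
wt-single {Γ} {S} {x} {z} {d} {A} {F} {R} fx fz E other nil w = wt-relabel dm sh at' noloop
  where
  open WT w
  h = lab x z d
  dm : ∀ v → Leaf S v → ∃[ C ] ((proj₁ (h v) , C) ∈ (z , F) ∷ Γ)
  dm (n , p) l with dom? l
  ... | _ , here refl rewrite lab-hit {x} {z} {d} {p} = F , here refl
  ... | C , there i rewrite lab-miss {x} {z} {d} {n} {p} (fresh-≢ fx i) = C , there i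
  r₀ = shape (here refl)
  sh : ∀ {n C} → (n , C) ∈ (z , F) ∷ Γ → Σ (Res C) λ r →
     (∀ v → Leaf S v → proj₁ (h v) ≡ n → rleaf r (proj₂ (h v))) ×
     (∀ p → rleaf r p → ∃[ v ] ((n , p) ≡ h v × Leaf S v))
  sh (here refl) = R (proj₁ r₀) , f , g
    where
    open Embeds (E (proj₁ r₀))
    f : ∀ v → Leaf S v → proj₁ (h v) ≡ z → rleaf (R (proj₁ r₀)) (proj₂ (h v))
    f (n , p) l e with dom? l
    ... | _ , here refl rewrite lab-hit {x} {z} {d} {p} =
      subst (λ X → X) (sym (branch p)) (proj₁ (proj₂ r₀ p) l)
    ... | C , there i rewrite lab-miss {x} {z} {d} {n} {p} (fresh-≢ fx i) = ⊥-elim (fresh-≢ fz i e)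
    g : ∀ p → rleaf (R (proj₁ r₀)) p → ∃[ v ] ((z , p) ≡ h v × Leaf S v)
    g [] l = ⊥-elim (nil _ l)
    g (e ∷ p) l with e ≟ᵇ d
    ... | yes refl = (x , p) , sym lab-hit , proj₂ (proj₂ r₀ p) (subst (λ X → X) (branch p) l)
    ... | no e≢d = ⊥-elim (other _ p (subst (λ b → rleaf (R (proj₁ r₀)) (b ∷ p)) (flipped e≢d) l))
      where
      flipped : ∀ {e d} → e ≢ d → e ≡ not d
      flipped {false} {false} q = ⊥-elim (q refl)
      flipped {false} {true} q = refl
      flipped {true} {false} q = refl
      flipped {true} {true} q = ⊥-elim (q refl)
  sh {n} {C} (there i) = let (r , k) = shape (there i) in r , f r k , λ p l →
      (n , p) , sym (lab-miss (fresh-≢ fx i)) , proj₂ (k p) l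
    where
    f : ∀ r → (∀ p → Leaf S (n , p) ↔ rleaf r p) → ∀ v → Leaf S v → proj₁ (h v) ≡ n → rleaf r (proj₂ (h v))
    f r k (m , p) l e with dom? l
    ... | _ , here refl rewrite lab-hit {x} {z} {d} {p} = ⊥-elim (fresh-≢ fz i (sym e))
    ... | C , there j rewrite lab-miss {x} {z} {d} {m} {p} (fresh-≢ fx j) =
      proj₁ (k p) (subst (λ m → Leaf S (m , p)) e l)
  atom : ∀ v {a} → Atom ((x , A) ∷ Γ) v a → Atom ((z , F) ∷ Γ) (h v) a
  atom (n , p) (_ , here refl , e) rewrite lab-hit {x} {z} {d} {p} =
    F , here refl , trans (Embeds.below (E (proj₁ r₀)) p) e
  atom (n , p) (C , there i , e) rewrite lab-miss {x} {z} {d} {n} {p} (fresh-≢ fx i) = C , there i , e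
  at' : ∀ u v → Rel S u v → ∃[ k ] (Atom ((z , F) ∷ Γ) (h u) (var k) × Atom ((z , F) ∷ Γ) (h v) (nvar k))
  at' u v r = let (k , a , b) = atoms r in k , atom u a , atom v b

wt-par : ∀ {Γ S x y z A B} → Uniq ((x , A) ∷ (y , B) ∷ Γ) → Fresh z Γ →
  WT ((x , A) ∷ (y , B) ∷ Γ) S → WT ((z , A ⅋ B) ∷ Γ) (wire (relabel (lab₂ x y z)) S)
wt-par {Γ} {S} {x} {y} {z} {A} {B} (fx , fy , _) fz w = wt-relabel dm sh at' noloop
  where
  open WT w
  h = lab₂ x y z
  y≢x : y ≢ x
  y≢x = fresh-≢ fx (here refl)
  miss : ∀ {n p C} → (n , C) ∈ Γ → h (n , p) ≡ (n , p)
  miss i = lab₂-miss (fresh-≢ fx (there i)) (fresh-≢ fy i)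
  dm : ∀ v → Leaf S v → ∃[ C ] ((proj₁ (h v) , C) ∈ (z , A ⅋ B) ∷ Γ)
  dm (n , p) l with dom? l
  ... | _ , here refl rewrite lab₂-left {x} {y} {z} {p} = _ , here refl
  ... | _ , there (here refl) rewrite lab₂-right {x} {y} {z} {p} y≢x = _ , here refl
  ... | C , there (there i) rewrite miss {p = p} i = C , there i
  r₁ = shape (here refl)
  r₂ = shape (there (here refl))
  sh : ∀ {n C} → (n , C) ∈ (z , A ⅋ B) ∷ Γ → Σ (Res C) λ r →
     (∀ v → Leaf S v → proj₁ (h v) ≡ n → rleaf r (proj₂ (h v))) ×
     (∀ p → rleaf r p → ∃[ v ] ((n , p) ≡ h v × Leaf S v))
  sh (here refl) = r⅋ (proj₁ r₁) (proj₁ r₂) , f , g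
    where
    f : ∀ v → Leaf S v → proj₁ (h v) ≡ z → rleaf (r⅋ (proj₁ r₁) (proj₁ r₂)) (proj₂ (h v))
    f (n , p) l e with dom? l
    ... | _ , here refl rewrite lab₂-left {x} {y} {z} {p} = proj₁ (proj₂ r₁ p) l
    ... | _ , there (here refl) rewrite lab₂-right {x} {y} {z} {p} y≢x = proj₁ (proj₂ r₂ p) l
    ... | C , there (there i) rewrite miss {p = p} i = ⊥-elim (fresh-≢ fz i e)
    g : ∀ p → rleaf (r⅋ (proj₁ r₁) (proj₁ r₂)) p → ∃[ v ] ((z , p) ≡ h v × Leaf S v)
    g (false ∷ p) l = (x , p) , sym lab₂-left , proj₂ (proj₂ r₁ p) l
    g (true ∷ p) l = (y , p) , sym (lab₂-right y≢x) , proj₂ (proj₂ r₂ p) l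
  sh {n} {C} (there i) = let (r , k) = shape (there (there i)) in r , f r k , λ p l →
      (n , p) , sym (miss i) , proj₂ (k p) l
    where
    f : ∀ r → (∀ p → Leaf S (n , p) ↔ rleaf r p) → ∀ v → Leaf S v → proj₁ (h v) ≡ n → rleaf r (proj₂ (h v))
    f r k (m , p) l e with dom? l
    ... | _ , here refl rewrite lab₂-left {x} {y} {z} {p} = ⊥-elim (fresh-≢ fz i (sym e))
    ... | _ , there (here refl) rewrite lab₂-right {x} {y} {z} {p} y≢x = ⊥-elim (fresh-≢ fz i (sym e))
    ... | C , there (there j) rewrite miss {p = p} j = proj₁ (k p) (subst (λ m → Leaf S (m , p)) e l)
  atom : ∀ v {a} → Atom ((x , A) ∷ (y , B) ∷ Γ) v a → Atom ((z , A ⅋ B) ∷ Γ) (h v) a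
  atom (n , p) (_ , here refl , e) rewrite lab₂-left {x} {y} {z} {p} = _ , here refl , e
  atom (n , p) (_ , there (here refl) , e) rewrite lab₂-right {x} {y} {z} {p} y≢x = _ , here refl , e
  atom (n , p) (C , there (there i) , e) rewrite miss {p = p} i = C , there i , e
  at' : ∀ u v → Rel S u v → ∃[ k ] (Atom ((z , A ⅋ B) ∷ Γ) (h u) (var k) × Atom ((z , A ⅋ B) ∷ Γ) (h v) (nvar k))
  at' u v r = let (k , a , b) = atoms r in k , atom u a , atom v b

wt-tens : ∀ {Γ Δ S T x y z A B} → Fresh x Γ → Fresh y Δ → Apart Γ Δ → Fresh z (Γ ++ Δ) →
  WT ((x , A) ∷ Γ) S → WT ((y , B) ∷ Δ) T → WT ((z , A ⊗ B) ∷ Γ ++ Δ) (wire (relabel (tensL z x y)) (S ⊎ₛ T))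
wt-tens {Γ} {Δ} {S} {T} {x} {y} {z} {A} {B} fx fy ap fz w w' =
  wt-relabel dm sh at' (λ { (inj₁ l) → W₁.noloop l ; (inj₂ l) → W₂.noloop l })
  where
  module W₁ = WT w
  module W₂ = WT w'
  Θ = (z , A ⊗ B) ∷ Γ ++ Δ
  h = tensL z x y
  miss₁ : ∀ {n p C} → (n , C) ∈ Γ → h (inj₁ (n , p)) ≡ (n , p)
  miss₁ i = lab-miss (fresh-≢ fx i)
  miss₂ : ∀ {n p C} → (n , C) ∈ Δ → h (inj₂ (n , p)) ≡ (n , p)
  miss₂ i = lab-miss (fresh-≢ fy i)
  inL : ∀ {n C} → (n , C) ∈ Γ → (n , C) ∈ Γ ++ Δ
  inL = ∈-++⁺ˡ
  inR : ∀ {n C} → (n , C) ∈ Δ → (n , C) ∈ Γ ++ Δ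
  inR = ∈-++⁺ʳ Γ
  dm : ∀ v → Leaf (S ⊎ₛ T) v → ∃[ C ] ((proj₁ (h v) , C) ∈ Θ)
  dm (inj₁ (n , p)) l with W₁.dom? l
  ... | _ , here refl rewrite lab-hit {x} {z} {false} {p} = _ , here refl
  ... | C , there i rewrite miss₁ {p = p} i = C , there (inL i)
  dm (inj₂ (n , p)) l with W₂.dom? l
  ... | _ , here refl rewrite lab-hit {y} {z} {true} {p} = _ , here refl
  ... | C , there i rewrite miss₂ {p = p} i = C , there (inR i)
  r₁ = W₁.shape (here refl)
  r₂ = W₂.shape (here refl)
  sh : ∀ {n C} → (n , C) ∈ Θ → Σ (Res C) λ r →
     (∀ v → Leaf (S ⊎ₛ T) v → proj₁ (h v) ≡ n → rleaf r (proj₂ (h v))) ×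
     (∀ p → rleaf r p → ∃[ v ] ((n , p) ≡ h v × Leaf (S ⊎ₛ T) v))
  sh (here refl) = r⊗ (proj₁ r₁) (proj₁ r₂) , f , g
    where
    f : ∀ v → Leaf (S ⊎ₛ T) v → proj₁ (h v) ≡ z → rleaf (r⊗ (proj₁ r₁) (proj₁ r₂)) (proj₂ (h v))
    f (inj₁ (n , p)) l e with W₁.dom? l
    ... | _ , here refl rewrite lab-hit {x} {z} {false} {p} = proj₁ (proj₂ r₁ p) l
    ... | C , there i rewrite miss₁ {p = p} i = ⊥-elim (fresh-≢ fz (inL i) e)
    f (inj₂ (n , p)) l e with W₂.dom? l
    ... | _ , here refl rewrite lab-hit {y} {z} {true} {p} = proj₁ (proj₂ r₂ p) l
    ... | C , there i rewrite miss₂ {p = p} i = ⊥-elim (fresh-≢ fz (inR i) e)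
    g : ∀ p → rleaf (r⊗ (proj₁ r₁) (proj₁ r₂)) p → ∃[ v ] ((z , p) ≡ h v × Leaf (S ⊎ₛ T) v)
    g (false ∷ p) l = inj₁ (x , p) , sym lab-hit , proj₂ (proj₂ r₁ p) l
    g (true ∷ p) l = inj₂ (y , p) , sym lab-hit , proj₂ (proj₂ r₂ p) l
  sh {n} {C} (there i) with ∈-++⁻ Γ i
  ... | inj₁ j = let (r , k) = W₁.shape (there j) in r , f r k , λ p l →
      inj₁ (n , p) , sym (miss₁ j) , proj₂ (k p) l
    where
    f : ∀ r → (∀ p → Leaf S (n , p) ↔ rleaf r p) →
        ∀ v → Leaf (S ⊎ₛ T) v → proj₁ (h v) ≡ n → rleaf r (proj₂ (h v))
    f r k (inj₁ (m , p)) l e with W₁.dom? l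
    ... | _ , here refl rewrite lab-hit {x} {z} {false} {p} = ⊥-elim (fresh-≢ fz i (sym e))
    ... | C , there j' rewrite miss₁ {p = p} j' = proj₁ (k p) (subst (λ m → Leaf S (m , p)) e l)
    f r k (inj₂ (m , p)) l e with W₂.dom? l
    ... | _ , here refl rewrite lab-hit {y} {z} {true} {p} = ⊥-elim (fresh-≢ fz i (sym e))
    ... | C , there j' rewrite miss₂ {p = p} j' = ⊥-elim (ap j (subst (λ m → (m , C) ∈ Δ) e j'))
  ... | inj₂ j = let (r , k) = W₂.shape (there j) in r , f r k , λ p l →
      inj₂ (n , p) , sym (miss₂ j) , proj₂ (k p) l
    where
    f : ∀ r → (∀ p → Leaf T (n , p) ↔ rleaf r p) →
        ∀ v → Leaf (S ⊎ₛ T) v → proj₁ (h v) ≡ n → rleaf r (proj₂ (h v))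
    f r k (inj₂ (m , p)) l e with W₂.dom? l
    ... | _ , here refl rewrite lab-hit {y} {z} {true} {p} = ⊥-elim (fresh-≢ fz i (sym e))
    ... | C , there j' rewrite miss₂ {p = p} j' = proj₁ (k p) (subst (λ m → Leaf T (m , p)) e l)
    f r k (inj₁ (m , p)) l e with W₁.dom? l
    ... | _ , here refl rewrite lab-hit {x} {z} {false} {p} = ⊥-elim (fresh-≢ fz i (sym e))
    ... | C , there j' rewrite miss₁ {p = p} j' = ⊥-elim (ap (subst (λ m → (m , C) ∈ Γ) e j') j)
  atom₁ : ∀ v {a} → Atom ((x , A) ∷ Γ) v a → Atom Θ (h (inj₁ v)) a
  atom₁ (n , p) (_ , here refl , e) rewrite lab-hit {x} {z} {false} {p} = _ , here refl , e
  atom₁ (n , p) (C , there i , e) rewrite miss₁ {p = p} i = C , there (inL i) , e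
  atom₂ : ∀ v {a} → Atom ((y , B) ∷ Δ) v a → Atom Θ (h (inj₂ v)) a
  atom₂ (n , p) (_ , here refl , e) rewrite lab-hit {y} {z} {true} {p} = _ , here refl , e
  atom₂ (n , p) (C , there i , e) rewrite miss₂ {p = p} i = C , there (inR i) , e
  at' : ∀ u v → Rel (S ⊎ₛ T) u v → ∃[ k ] (Atom Θ (h u) (var k) × Atom Θ (h v) (nvar k))
  at' (inj₁ u) (inj₁ v) r = let (k , a , b) = W₁.atoms r in k , atom₁ u a , atom₁ v b
  at' (inj₂ u) (inj₂ v) r = let (k , a , b) = W₂.atoms r in k , atom₂ u a , atom₂ v b

wt-rename : ∀ {Γ S f} → InjOn f Γ → WT Γ S → WT (mapN f Γ) (wire (relabel (rename f)) S)
wt-rename {Γ} {S} {f} inj w = wt-relabel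
  (λ v l → let (A , i) = dom? l in A , ∈-mapN⁺ i) sh
  (λ u v r → let (k , (A , i , e) , (B , j , e')) = atoms r in
     k , (A , ∈-mapN⁺ i , e) , (B , ∈-mapN⁺ j , e')) noloop
  where
  open WT w
  sh : ∀ {n A} → (n , A) ∈ mapN f Γ → Σ (Res A) λ r →
     (∀ v → Leaf S v → f (proj₁ v) ≡ n → rleaf r (proj₂ v)) ×
     (∀ p → rleaf r p → ∃[ v ] ((n , p) ≡ rename f v × Leaf S v))
  sh i with ∈-mapN⁻ {f} i
  ... | n , j , refl = let (r , k) = shape j in r ,
    (λ v l e → proj₁ (k (proj₂ v))
       (subst (λ m → Leaf S (m , proj₂ v)) (inj (proj₂ (dom? l)) j e) l)) ,
    (λ p l → (n , p) , refl , proj₂ (k p) l)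

wt-ax : ∀ {x y k} → x ≢ y → WT ((x , nvar k) ∷ (y , var k) ∷ []) (axS {var k} x y at⁺)
wt-ax {x} {y} {k} x≢y = record
  { dom? = λ { (inj₁ (refl , _)) → _ , here refl ; (inj₂ (refl , _)) → _ , there (here refl) }
  ; shape = λ where
      (here refl) → at⁻ , λ where
        [] → (λ _ → tt) , (λ _ → inj₁ (refl , tt))
        (_ ∷ _) → (λ { (inj₁ (_ , ())) ; (inj₂ (_ , ())) }) , (λ ())
      (there (here refl)) → at⁺ , λ where
        [] → (λ _ → tt) , (λ _ → inj₂ (refl , tt))
        (_ ∷ _) → (λ { (inj₁ (_ , ())) ; (inj₂ (_ , ())) }) , (λ ())
  ; atoms = at'
  ; noloop = λ () }
  where
  at' : ∀ {u v} → Rel (axS {var k} x y at⁺) u v →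
        ∃[ j ] (Atom ((x , nvar k) ∷ (y , var k) ∷ []) u (var j) × Atom ((x , nvar k) ∷ (y , var k) ∷ []) v (nvar j))
  at' {_ , []} {_ , []} (inj₁ (refl , refl , refl , _)) =
    k , (_ , there (here refl) , refl) , (_ , here refl , refl)
  at' {_ , []} {_ , []} (inj₂ (_ , _ , _ , _ , (_ , ())))

wt : ∀ {Γ} (D : CF Γ) → WTN Γ (sem D)
wt (cax k x≢y) at⁺ = wt-ax x≢y
wt (crn f inj D) (i , _) = wt-rename inj (wt D i)
wt (cex p D) i = wt-∈ (∈-resp-↭ p) (∈-resp-↭ (↭-sym p)) (wt D i)
wt (ctens z D E ap fz) ((i , j) , _) =
  wt-tens (proj₁ (uniq D)) (proj₁ (uniq E)) ap fz (wt D i) (wt E j)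
wt (cpar z D fz) (i , _) = wt-par (uniq D) fz (wt D i)
wt (cwith z D E fz) (inj₁ (i , _)) = wt-single {R = r&₁} (proj₁ (uniq D)) fz
  (λ r → record { branch = λ _ → refl ; below = λ _ → refl }) (λ _ _ ()) (λ _ ()) (wt D i)
wt (cwith z D E fz) (inj₂ (i , _)) = wt-single {R = r&₂} (proj₁ (uniq E)) fz
  (λ r → record { branch = λ _ → refl ; below = λ _ → refl }) (λ _ _ ()) (λ _ ()) (wt E i)
wt (cplus z false D fz) (i , _) = wt-single {R = r⊕₁} (proj₁ (uniq D)) fz
  (λ r → record { branch = λ _ → refl ; below = λ _ → refl }) (λ _ _ ()) (λ _ ()) (wt D i)
wt (cplus z true D fz) (i , _) = wt-single {R = r⊕₂} (proj₁ (uniq D)) fz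
  (λ r → record { branch = λ _ → refl ; below = λ _ → refl }) (λ _ _ ()) (λ _ ()) (wt D i)

wt-resolved : ∀ {Γ S n A} → Uniq Γ → WT Γ S → (n , A) ∈ Γ → Resolved A n S
wt-resolved u w i = record
  { res = proj₁ (shape i) ; leafs = proj₂ (shape i)
  ; pos-out = λ {p} r → let (k , (B , j , e) , _) = atoms r in
      k , subst (λ F → sub F p ≡ just (var k)) (uniq-fun u j i) e
  ; neg-in = λ {p} r → let (k , _ , (B , j , e)) = atoms r in
      k , subst (λ F → sub F p ≡ just (nvar k)) (uniq-fun u j i) e }
  where open WT w

Seqz : Ctx → SNet Occ → Set
Seqz Γ N = Σ (CF Γ) λ D → sem D ≈ N

-- Principal and commuting cuts

seq-≈ : ∀ {Γ N M} → N ≈ M → Seqz Γ N → Seqz Γ M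
seq-≈ e (D , d) = D , ≈-trans d e

seq-ex : ∀ {Γ Δ N} → Γ ↭ Δ → Seqz Γ N → Seqz Δ N
seq-ex p (D , d) = cex p D , d

seq-rn : ∀ {Γ N} f → InjOn f Γ → Seqz Γ N → Seqz (mapN f Γ) (relN (rename f) N)
seq-rn f inj (D , d) = crn f inj D , wireN-cong _ d

seq-tens : ∀ {x y A B Γ Δ N M} z → Seqz ((x , A) ∷ Γ) N → Seqz ((y , B) ∷ Δ) M → Apart Γ Δ →
           Fresh z (Γ ++ Δ) → Seqz ((z , A ⊗ B) ∷ Γ ++ Δ) (tensN z x y N M)
seq-tens z (D , d) (E , e) ap fz = ctens z D E ap fz , tensN-cong d e

seq-par : ∀ {x y A B Γ N} z → Seqz ((x , A) ∷ (y , B) ∷ Γ) N → Fresh z Γ →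
          Seqz ((z , A ⅋ B) ∷ Γ) (parN z x y N)
seq-par z (D , d) fz = cpar z D fz , wireN-cong _ d

seq-with : ∀ {x y A B Γ N M} z → Seqz ((x , A) ∷ Γ) N → Seqz ((y , B) ∷ Γ) M → Fresh z Γ →
           Seqz ((z , A & B) ∷ Γ) (withN z x y N M)
seq-with z (D , d) (E , e) fz = cwith z D E fz , withN-cong d e

seq-plus : ∀ {x A B Γ N} z d → Seqz ((x , (if d then B else A)) ∷ Γ) N → Fresh z Γ →
           Seqz ((z , A ⊕ B) ∷ Γ) (plusN z x d N)
seq-plus z d (D , e) fz = cplus z d D fz , wireN-cong _ e

seq-uniq : ∀ {Γ N} → Seqz Γ N → Uniq Γ
seq-uniq (D , _) = uniq D

seq-wt : ∀ {Γ N} → Seqz Γ N → WTN Γ N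
seq-wt (D , d) = wt-≈ d (wt D)

Injective : (ℕ → ℕ) → Set
Injective f = ∀ {n m} → f n ≡ f m → n ≡ m

Avoids : SNet Occ → ℕ → (ℕ → ℕ) → ℕ → Set
Avoids M y g c = LeafHyp M (λ v → proj₁ v ≢ y → g (proj₁ v) ≢ c)

module _ {f g : ℕ → ℕ} {x y : ℕ} (f-inj : Injective f) where

  comm-par : ∀ {a b z A B C Γ N M} → WTN ((a , A) ∷ (b , B) ∷ Γ) N → Uniq ((a , A) ∷ (b , B) ∷ Γ) →
    Fresh z Γ → (x , C) ∈ Γ → Avoids M y g (f a) → Avoids M y g (f b) →
    cutN f g x y (parN z a b N) M ≈ parN (f z) (f a) (f b) (cutN f g x y N M)
  comm-par {a} {b} {z} {N = N} {M} w (fa , fb , _) fz i Ma Mb =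
    cut-rel (lab₂ a b z) (lab₂ (f a) (f b) (f z)) hN
      (λ j v l n → lab₂-miss (Ma j v l n) (Mb j v l n))
    where
    z≢x : z ≢ x
    z≢x e = fresh-≢ fz i (sym e)
    hN : LeafHyp N (λ v → (proj₁ v ≡ x × lab₂ a b z v ≡ v) ⊎
      (proj₁ v ≢ x × proj₁ (lab₂ a b z v) ≢ x × lab₂ (f a) (f b) (f z) (rename f v) ≡ rename f (lab₂ a b z v)))
    hN j (n , p) l with WT.dom? (w j) l
    ... | _ , here refl rewrite lab₂-left {a} {b} {z} {p} =
      inj₂ ((λ e → fresh-≢ fa (there i) (sym e)) , z≢x , lab₂-left)
    ... | _ , there (here refl) rewrite lab₂-right {a} {b} {z} {p} (fresh-≢ fa (here refl)) =
      inj₂ ((λ e → fresh-≢ fb i (sym e)) , z≢x , lab₂-right (λ e → fresh-≢ fa (here refl) (f-inj e)))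
    ... | _ , there (there k) rewrite lab₂-miss {a} {b} {z} {n} {p} (fresh-≢ fa (there k)) (fresh-≢ fb k) with n ≟ x
    ...   | yes e = inj₁ (e , refl)
    ...   | no n≢x = inj₂ (n≢x , n≢x , lab₂-miss (λ e → fresh-≢ fa (there k) (f-inj e)) (λ e → fresh-≢ fb k (f-inj e)))

  comm-single : ∀ {a z d A C Γ N M} → WTN ((a , A) ∷ Γ) N → Fresh a Γ →
    Fresh z Γ → (x , C) ∈ Γ → Avoids M y g (f a) →
    cutN f g x y (plusN z a d N) M ≈ plusN (f z) (f a) d (cutN f g x y N M)
  comm-single {a} {z} {d} {N = N} {M} w fa fz i Ma =
    cut-rel (lab a z d) (lab (f a) (f z) d) hN (λ j v l n → lab-miss (Ma j v l n))
    where
    hN : LeafHyp N (λ v → (proj₁ v ≡ x × lab a z d v ≡ v) ⊎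
      (proj₁ v ≢ x × proj₁ (lab a z d v) ≢ x × lab (f a) (f z) d (rename f v) ≡ rename f (lab a z d v)))
    hN j (n , p) l with WT.dom? (w j) l
    ... | _ , here refl rewrite lab-hit {a} {z} {d} {p} =
      inj₂ ((λ e → fresh-≢ fa i (sym e)) , (λ e → fresh-≢ fz i (sym e)) , lab-hit)
    ... | _ , there k rewrite lab-miss {a} {z} {d} {n} {p} (fresh-≢ fa k) with n ≟ x
    ...   | yes e = inj₁ (e , refl)
    ...   | no n≢x = inj₂ (n≢x , n≢x , lab-miss (λ e → fresh-≢ fa k (f-inj e)))

  comm-with : ∀ {a b z A B C Γ N P M} → WTN ((a , A) ∷ Γ) N → WTN ((b , B) ∷ Γ) P →
    Fresh a Γ → Fresh b Γ → Fresh z Γ → (x , C) ∈ Γ → Avoids M y g (f a) → Avoids M y g (f b) →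
    cutN f g x y (withN z a b N P) M ≈ withN (f z) (f a) (f b) (cutN f g x y N M) (cutN f g x y P M)
  comm-with wN wP fa fb fz i Ma Mb =
    ≈-trans (wireN-cong (cutW f g x y) ⊎ₙ-distrib-∪)
    (≈-trans (wireN-∪ (cutW f g x y))
             (∪ₙ-cong (comm-single wN fa fz i Ma) (comm-single wP fb fz i Mb)))

  private
    side : ∀ {a z d n p} → a ≢ x → z ≢ x → n ≢ x ⊎ n ≡ x → n ≡ a ⊎ n ≢ a →
           (n ≡ x × lab a z d (n , p) ≡ (n , p)) ⊎
           (n ≢ x × proj₁ (lab a z d (n , p)) ≢ x ×
            lab (f a) (f z) d (f n , p) ≡ rename f (lab a z d (n , p)))
    side {a} {z} {d} {n} {p} a≢x z≢x _ (inj₁ refl) rewrite lab-hit {a} {z} {d} {p} = inj₂ (a≢x , z≢x , lab-hit)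
    side {a} {z} {d} {n} {p} a≢x z≢x (inj₁ n≢x) (inj₂ n≢a) rewrite lab-miss {a} {z} {d} {n} {p} n≢a =
      inj₂ (n≢x , n≢x , lab-miss (λ e → n≢a (f-inj e)))
    side {a} {z} {d} {n} {p} a≢x z≢x (inj₂ e) (inj₂ n≢a) = inj₁ (e , lab-miss n≢a)

    off : ∀ {a z d n p} → z ≢ x → n ≡ a ⊎ (n ≢ a × n ≢ x) →
          proj₁ (lab a z d (n , p)) ≢ x × lab (f a) (f z) d (f n , p) ≡ rename f (lab a z d (n , p))
    off {a} {z} {d} {n} {p} z≢x (inj₁ refl) rewrite lab-hit {a} {z} {d} {p} = z≢x , lab-hit
    off {a} {z} {d} {n} {p} z≢x (inj₂ (n≢a , n≢x)) rewrite lab-miss {a} {z} {d} {n} {p} n≢a =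
      n≢x , lab-miss (λ e → n≢a (f-inj e))

    dec : ∀ {n m : ℕ} → n ≢ m ⊎ n ≡ m
    dec {n} {m} with n ≟ m
    ... | yes e = inj₂ e
    ... | no e = inj₁ e

    hit-or-miss : ∀ {a Γ A S n p} → WT ((a , A) ∷ Γ) S → Fresh a Γ → Leaf S (n , p) → n ≡ a ⊎ n ≢ a
    hit-or-miss w fa l with WT.dom? w l
    ... | _ , here refl = inj₁ refl
    ... | _ , there k = inj₂ (fresh-≢ fa k)

    hit-or-off : ∀ {b Γ Δ B C S n p} → WT ((b , B) ∷ Δ) S → Fresh b Δ → Apart Γ Δ → (x , C) ∈ Γ →
                 Leaf S (n , p) → n ≡ b ⊎ (n ≢ b × n ≢ x)
    hit-or-off w fb ap i l with WT.dom? w l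
    ... | _ , here refl = inj₁ refl
    ... | _ , there k = inj₂ (fresh-≢ fb k , λ { refl → ap i k })

  comm-tens₁ : ∀ {a b z A B C Γ Δ N P M} → WTN ((a , A) ∷ Γ) N → WTN ((b , B) ∷ Δ) P →
    Fresh a Γ → Fresh b Δ → Apart Γ Δ → Fresh z (Γ ++ Δ) → (x , C) ∈ Γ → Avoids M y g (f a) →
    cutN f g x y (tensN z a b N P) M ≈ tensN (f z) (f a) (f b) (cutN f g x y N M) (relN (rename f) P)
  comm-tens₁ {a} {b} {z} wN wP fa fb ap fz i Ma = cut-tens (tensL z a b) (tensL (f z) (f a) (f b))
    (λ j v l → side (λ e → fresh-≢ fa i (sym e)) z≢x dec (hit-or-miss (wN j) fa l))
    (λ j v l → off z≢x (hit-or-off (wP j) fb ap i l))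
    (λ j v l n → lab-miss (Ma j v l n))
    where
    z≢x : z ≢ x
    z≢x e = fresh-≢ fz (∈-++⁺ˡ i) (sym e)

  comm-tens₂ : ∀ {a b z A B C Γ Δ N P M} → WTN ((a , A) ∷ Γ) N → WTN ((b , B) ∷ Δ) P →
    Fresh a Γ → Fresh b Δ → Apart Γ Δ → Fresh z (Γ ++ Δ) → (x , C) ∈ Δ → Avoids M y g (f b) →
    cutN f g x y (tensN z a b N P) M ≈ tensN (f z) (f a) (f b) (relN (rename f) N) (cutN f g x y P M)
  comm-tens₂ {a} {b} {z} {Γ = Γ} wN wP fa fb ap fz i Mb =
    ≈-trans (cutN-cong (relN-swap (tensL z a b)) ≈-refl)
    (≈-trans (cut-tens (λ w → tensL z a b (⊎-swap w)) (λ w → tensL (f z) (f a) (f b) (⊎-swap w))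
      (λ j v l → side (λ e → fresh-≢ fb i (sym e)) z≢x dec (hit-or-miss (wP j) fb l))
      (λ j v l → off z≢x (hit-or-off (wN j) fa (λ p q → ap q p) i l))
      (λ j v l n → lab-miss (Mb j v l n)))
    (≈-sym (relN-swap (tensL (f z) (f a) (f b)))))
    where
    z≢x : z ≢ x
    z≢x e = fresh-≢ fz (∈-++⁺ʳ Γ i) (sym e)

private
  tens-side : ∀ {a z d Γ A S f f' v} → WT ((a , A) ∷ Γ) S → Fresh a Γ → Fresh z Γ →
    (∀ {n A} → (n , A) ∈ Γ → f n ≡ f' n) → Leaf S v →
    (proj₁ v ≡ a × lab a z d v ≡ (z , d ∷ proj₂ v)) ⊎
    (proj₁ v ≢ a × (∃[ A ] (proj₁ v , A) ∈ Γ) × proj₁ (lab a z d v) ≢ z × rename f (lab a z d v) ≡ rename f' v)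
  tens-side {a} {z} {d} {v = n , p} w fa fz e l with WT.dom? w l
  ... | _ , here refl = inj₁ (refl , lab-hit)
  ... | C , there k rewrite lab-miss {a} {z} {d} {n} {p} (fresh-≢ fa k) =
    inj₂ (fresh-≢ fa k , (C , k) , fresh-≢ fz k , cong (_, p) (e k))

module _ {f g f₁ g₁ f₂ g₂ : ℕ → ℕ} {a b u v z w : ℕ} {A B U V : Fm} {Γ Δ Θ : Ctx} {N P R : SNet Occ}
         (wN : WTN ((a , A) ∷ Γ) N) (wP : WTN ((b , B) ∷ Δ) P) (wR : WTN ((u , U) ∷ (v , V) ∷ Θ) R)
         (fa : Fresh a Γ) (fb : Fresh b Δ) (uR : Uniq ((u , U) ∷ (v , V) ∷ Θ))
         (fz₁ : Fresh z Γ) (fz₂ : Fresh z Δ) (fw : Fresh w Θ) where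
  private
    u≢v : u ≢ v
    u≢v e = proj₁ uR (here (cong (_, V) e))

  cut-⊗⅋₁ : (∀ {n A} → (n , A) ∈ Γ → f n ≡ f₁ n) →
    (∀ {n A} → (n , A) ∈ Δ → f n ≡ g₁ (f₂ n) × f₂ n ≢ g₂ v) →
    (∀ {n A} → (n , A) ∈ Θ → g n ≡ g₁ (g₂ n) × g₂ n ≢ g₂ v) →
    cutN f g z w (tensN z a b N P) (parN w u v R) ≈ cutN f₁ g₁ a (g₂ v) N (cutN f₂ g₂ b u P R)
  cut-⊗⅋₁ hΓ hΔ hΘ = cut-assoc false (tensL z a b) (lab₂ u v w)
    (λ i s l → hN (tens-side (wN i) fa fz₁ hΓ l)) (λ i s l → hP (tens-side (wP i) fb fz₂ (λ k → proj₁ (hΔ k)) l)) hR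
    where
    hN : ∀ {X Y Z W : Set} → X ⊎ (Y × Z × W) → X ⊎ (Y × W)
    hN (inj₁ x) = inj₁ x
    hN (inj₂ (y , _ , e)) = inj₂ (y , e)
    hP : ∀ {X Y W : Set} {n} → X ⊎ (Y × (∃[ A ] (n , A) ∈ Δ) × W) → X ⊎ (Y × f₂ n ≢ g₂ v × W)
    hP (inj₁ x) = inj₁ x
    hP (inj₂ (y , (_ , k) , e)) = inj₂ (y , proj₂ (hΔ k) , e)
    hR : LeafHyp R (λ s → (proj₁ s ≢ u × g₂ (proj₁ s) ≡ g₂ v × lab₂ u v w s ≡ (w , true ∷ proj₂ s)) ⊎
      ((proj₁ s ≡ u × lab₂ u v w s ≡ (w , false ∷ proj₂ s)) ⊎
       (proj₁ s ≢ u × g₂ (proj₁ s) ≢ g₂ v × proj₁ (lab₂ u v w s) ≢ w ×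
        rename g (lab₂ u v w s) ≡ rename g₁ (rename g₂ s))))
    hR i (n , p) l with WT.dom? (wR i) l
    ... | _ , here refl rewrite lab₂-left {u} {v} {w} {p} = inj₂ (inj₁ (refl , refl))
    ... | _ , there (here refl) rewrite lab₂-right {u} {v} {w} {p} (λ e → u≢v (sym e)) =
      inj₁ ((λ e → u≢v (sym e)) , refl , refl)
    ... | _ , there (there k) rewrite lab₂-miss {u} {v} {w} {n} {p} (fresh-≢ (proj₁ uR) (there k)) (fresh-≢ (proj₁ (proj₂ uR)) k) =
      inj₂ (inj₂ (fresh-≢ (proj₁ uR) (there k) , proj₂ (hΘ k) , fresh-≢ fw k , cong (_, p) (proj₁ (hΘ k))))

  cut-⊗⅋₂ : (∀ {n A} → (n , A) ∈ Δ → f n ≡ f₁ n) →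
    (∀ {n A} → (n , A) ∈ Γ → f n ≡ g₁ (f₂ n) × f₂ n ≢ g₂ u) →
    (∀ {n A} → (n , A) ∈ Θ → g n ≡ g₁ (g₂ n) × g₂ n ≢ g₂ u) →
    cutN f g z w (tensN z a b N P) (parN w u v R) ≈ cutN f₁ g₁ b (g₂ u) P (cutN f₂ g₂ a v N R)
  cut-⊗⅋₂ hΔ hΓ hΘ = ≈-trans (cutN-cong (relN-swap (tensL z a b)) ≈-refl)
    (cut-assoc true (λ s → tensL z a b (⊎-swap s)) (lab₂ u v w)
    (λ i s l → hN (tens-side (wP i) fb fz₂ hΔ l)) (λ i s l → hP (tens-side (wN i) fa fz₁ (λ k → proj₁ (hΓ k)) l)) hR)
    where
    hN : ∀ {X Y Z W : Set} → X ⊎ (Y × Z × W) → X ⊎ (Y × W)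
    hN (inj₁ x) = inj₁ x
    hN (inj₂ (y , _ , e)) = inj₂ (y , e)
    hP : ∀ {X Y W : Set} {n} → X ⊎ (Y × (∃[ A ] (n , A) ∈ Γ) × W) → X ⊎ (Y × f₂ n ≢ g₂ u × W)
    hP (inj₁ x) = inj₁ x
    hP (inj₂ (y , (_ , k) , e)) = inj₂ (y , proj₂ (hΓ k) , e)
    hR : LeafHyp R (λ s → (proj₁ s ≢ v × g₂ (proj₁ s) ≡ g₂ u × lab₂ u v w s ≡ (w , false ∷ proj₂ s)) ⊎
      ((proj₁ s ≡ v × lab₂ u v w s ≡ (w , true ∷ proj₂ s)) ⊎
       (proj₁ s ≢ v × g₂ (proj₁ s) ≢ g₂ u × proj₁ (lab₂ u v w s) ≢ w ×
        rename g (lab₂ u v w s) ≡ rename g₁ (rename g₂ s))))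
    hR i (n , p) l with WT.dom? (wR i) l
    ... | _ , here refl rewrite lab₂-left {u} {v} {w} {p} = inj₁ (u≢v , refl , refl)
    ... | _ , there (here refl) rewrite lab₂-right {u} {v} {w} {p} (λ e → u≢v (sym e)) =
      inj₂ (inj₁ (refl , refl))
    ... | _ , there (there k) rewrite lab₂-miss {u} {v} {w} {n} {p} (fresh-≢ (proj₁ uR) (there k)) (fresh-≢ (proj₁ (proj₂ uR)) k) =
      inj₂ (inj₂ (fresh-≢ (proj₁ (proj₂ uR)) k , proj₂ (hΘ k) , fresh-≢ fw k , cong (_, p) (proj₁ (hΘ k))))

module _ {f g : ℕ → ℕ} {a b u z w : ℕ} {A B U : Fm} {Γ Θ : Ctx} {N P R : SNet Occ}
         (wN : WTN ((a , A) ∷ Γ) N) (wP : WTN ((b , B) ∷ Γ) P) (wR : WTN ((u , U) ∷ Θ) R)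
         (fa : Fresh a Γ) (fb : Fresh b Γ) (fu : Fresh u Θ) (fz : Fresh z Γ) (fw : Fresh w Θ) where
  private
    kind : ∀ {a z d Γ A S v} → WT ((a , A) ∷ Γ) S → Fresh a Γ → Fresh z Γ → Leaf S v →
      (proj₁ v ≡ a × lab a z d v ≡ (z , d ∷ proj₂ v)) ⊎ (proj₁ v ≢ a × proj₁ v ≢ z × lab a z d v ≡ v)
    kind w fa fz l with WT.dom? w l
    ... | _ , here refl = inj₁ (refl , lab-hit)
    ... | _ , there k = inj₂ (fresh-≢ fa k , fresh-≢ fz k , lab-miss (fresh-≢ fa k))

    kind' : ∀ {d v i} → Leaf (at R i) v → lab u w d v ≡ (w , d ∷ proj₂ v) ⊎ proj₁ (lab u w d v) ≢ w
    kind' {d} {v} {i} l with kind {d = d} (wR i) fu fw l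
    ... | inj₁ (_ , e) = inj₁ e
    ... | inj₂ (_ , v≢w , e) = inj₂ (λ e' → v≢w (trans (sym (cong proj₁ e)) e'))

    distribute : ∀ {d} → cutN f g z w (withN z a b N P) (plusN w u d R) ≈
      cutN f g z w (plusN z a false N) (plusN w u d R) ∪ₙ cutN f g z w (plusN z b true P) (plusN w u d R)
    distribute = ≈-trans (wireN-cong (cutW f g z w) ⊎ₙ-distrib-∪) (wireN-∪ (cutW f g z w))

    inhabited : ∀ {a A Γ S} → WT ((a , A) ∷ Γ) S → ∃[ p ] Leaf S (a , p)
    inhabited w = let (r , k) = WT.shape w (here refl) ; (p , l) = rleaf-nonempty r in p , proj₂ (k p) l

  cut-&₁ : cutN f g z w (withN z a b N P) (plusN w u true R) ≈ cutN f g a u N R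
  cut-&₁ = ≈-trans distribute (≈-trans
    (∪ₙ-emptyʳ (cut-clash (lab b z true) (lab u w true) true (λ i → inhabited (wP i)) (λ p → lab-hit)
                          (λ i v l → kind' {i = i} l)))
    (cut-choice (lab a z false) (lab u w true) false
       (λ i v l → kind (wN i) fa fz l) (λ i v l → kind (wR i) fu fw l)))

  cut-&₂ : cutN f g z w (withN z a b N P) (plusN w u false R) ≈ cutN f g b u P R
  cut-&₂ = ≈-trans distribute (≈-trans (∪ₙ-comm) (≈-trans
    (∪ₙ-emptyʳ (cut-clash (lab a z false) (lab u w false) false (λ i → inhabited (wN i)) (λ p → lab-hit)
                          (λ i v l → kind' {i = i} l)))
    (cut-choice (lab b z true) (lab u w false) true
       (λ i v l → kind (wP i) fb fz l) (λ i v l → kind (wR i) fu fw l))))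
    where
    ∪ₙ-comm : ∀ {W} {N M : SNet W} → N ∪ₙ M ≈ M ∪ₙ N
    ∪ₙ-comm = (λ where (inj₁ i) → inj₂ i , ≃-refl
                       (inj₂ i) → inj₁ i , ≃-refl) ,
              (λ where (inj₁ i) → inj₂ i , ≃-refl
                       (inj₂ i) → inj₁ i , ≃-refl)

-- Cut elimination

L R : ℕ → ℕ
L zero = zero
L (suc n) = suc (suc (L n))
R n = suc (L n)

tagged : (ℕ → ℕ) → (ℕ → ℕ) → ℕ → ℕ
tagged f g zero = f zero
tagged f g (suc zero) = g zero
tagged f g (suc (suc n)) = tagged (λ k → f (suc k)) (λ k → g (suc k)) n

tagged-L : ∀ f g n → tagged f g (L n) ≡ f n
tagged-L f g zero = refl
tagged-L f g (suc n) = tagged-L (λ k → f (suc k)) (λ k → g (suc k)) n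

tagged-R : ∀ f g n → tagged f g (R n) ≡ g n
tagged-R f g zero = refl
tagged-R f g (suc n) = tagged-R (λ k → f (suc k)) (λ k → g (suc k)) n

L-inj : Injective L
L-inj {zero} {zero} _ = refl
L-inj {suc n} {suc m} e = cong suc (L-inj (suc-injective (suc-injective e)))

R-inj : Injective R
R-inj e = L-inj (suc-injective e)

L≢R : ∀ n m → L n ≢ R m
L≢R zero m ()
L≢R (suc n) (suc m) e = L≢R n m (suc-injective (suc-injective e))

infixr 5 _⋈_
_⋈_ : Ctx → Ctx → Ctx
Γ ⋈ Δ = mapN L Γ ++ mapN R Δ

∈-⋈⁻ : ∀ Γ {Δ n A} → (n , A) ∈ Γ ⋈ Δ →
       (∃[ m ] ((m , A) ∈ Γ × n ≡ L m)) ⊎ (∃[ m ] ((m , A) ∈ Δ × n ≡ R m))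
∈-⋈⁻ Γ i with ∈-++⁻ (mapN L Γ) i
... | inj₁ j = inj₁ (∈-mapN⁻ j)
... | inj₂ j = inj₂ (∈-mapN⁻ j)

fresh-L : ∀ {z Γ Δ} → Fresh z Γ → Fresh (L z) (Γ ⋈ Δ)
fresh-L {z} {Γ} {Δ} fz i with ∈-⋈⁻ Γ {Δ} i
... | inj₁ (m , j , e) = fz (subst (λ k → (k , _) ∈ Γ) (L-inj (sym e)) j)
... | inj₂ (m , j , e) = L≢R z m e

mapN-∘ : ∀ (f g : ℕ → ℕ) Γ → mapN f (mapN g Γ) ≡ mapN (λ n → f (g n)) Γ
mapN-∘ f g Γ = sym (map-∘ Γ)

mapN-cong : ∀ {f g : ℕ → ℕ} → (∀ n → f n ≡ g n) → ∀ Γ → mapN f Γ ≡ mapN g Γ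
mapN-cong e = map-cong (λ q → cong (_, proj₂ q) (e (proj₁ q)))

mapN-++ : ∀ (f : ℕ → ℕ) Γ Δ → mapN f (Γ ++ Δ) ≡ mapN f Γ ++ mapN f Δ
mapN-++ f = map-++ _

retag : ∀ {x y Γ Δ N M} (f g : ℕ → ℕ) → InjOn f Γ → InjOn g Δ →
        (∀ {n m A B} → (n , A) ∈ Γ → (m , B) ∈ Δ → f n ≢ g m) →
        Seqz (Γ ⋈ Δ) (cutN L R x y N M) → Seqz (mapN f Γ ++ mapN g Δ) (cutN f g x y N M)
retag {x} {y} {Γ} {Δ} f g f-inj g-inj f≢g s =
  subst (λ Θ → Seqz Θ _) ctx (seq-≈ e (seq-rn t inj s))
  where
  t = tagged f g
  e : relN (rename t) (cutN L R x y _ _) ≈ cutN f g x y _ _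
  e = ≈-trans (cut-post t) (cut-agree (λ i v l _ → tagged-L f g (proj₁ v)) (λ i v l _ → tagged-R f g (proj₁ v)))
  ctx : mapN t (Γ ⋈ Δ) ≡ mapN f Γ ++ mapN g Δ
  ctx = trans (mapN-++ t (mapN L Γ) (mapN R Δ)) (cong₂ _++_
    (trans (mapN-∘ t L Γ) (mapN-cong (tagged-L f g) Γ)) (trans (mapN-∘ t R Δ) (mapN-cong (tagged-R f g) Δ)))
  inj : InjOn t (Γ ⋈ Δ)
  inj i j e with ∈-⋈⁻ Γ {Δ} i | ∈-⋈⁻ Γ {Δ} j
  ... | inj₁ (n , i' , refl) | inj₁ (m , j' , refl) =
    cong L (f-inj i' j' (trans (sym (tagged-L f g n)) (trans e (tagged-L f g m))))
  ... | inj₂ (n , i' , refl) | inj₂ (m , j' , refl) =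
    cong R (g-inj i' j' (trans (sym (tagged-R f g n)) (trans e (tagged-R f g m))))
  ... | inj₁ (n , i' , refl) | inj₂ (m , j' , refl) =
    ⊥-elim (f≢g i' j' (trans (sym (tagged-L f g n)) (trans e (tagged-R f g m))))
  ... | inj₂ (n , i' , refl) | inj₁ (m , j' , refl) =
    ⊥-elim (f≢g j' i' (trans (sym (tagged-L f g m)) (trans (sym e) (tagged-R f g n))))

cut-flip : ∀ {x y Γ Δ N M} → Seqz (Γ ⋈ Δ) (cutN L R x y N M) → Seqz (Δ ⋈ Γ) (cutN L R y x M N)
cut-flip {Γ = Γ} {Δ} s =
  seq-≈ cut-sym (seq-ex (++-comm (mapN R Γ) (mapN L Δ))
    (retag {Γ = Γ} {Δ} R L (λ _ _ → R-inj) (λ _ _ → L-inj) (λ {n} {m} _ _ e → L≢R m n (sym e)) s))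

cut-rename : ∀ {f g h x y N M} → LeafHyp N (λ v → h (proj₁ v) ≡ h x → proj₁ v ≡ x) →
             cutN f g (h x) y (relN (rename h) N) M ≈ cutN (λ n → f (h n)) g x y N M
cut-rename {f} {g} {h} {x} {y} {N} {M} H =
  ≈-trans (cutN-cong ≈-refl relN-as-id) (≈-trans (cutN-flat (rename h) (λ v → v)) (agreeN λ (i , j) → record
    { out~ = λ where
        (inj₁ v) l u → (λ (a , e) → (λ e' → a (cong h e')) , e) , (λ (a , e) → (λ e' → a (H i v l e')) , e)
        (inj₂ v) l u → (λ o → o) , (λ o → o)
    ; joins~ = λ where
        (inj₁ v) (inj₂ r) l _ → (λ (a , b , c) → H i v l a , b , c) , (λ (a , b , c) → cong h a , b , c)
        (inj₂ r) (inj₁ v) _ l → (λ (a , b , c) → H i v l a , b , c) , (λ (a , b , c) → cong h a , b , c)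
        (inj₁ _) (inj₁ _) _ _ → (λ ()) , (λ ())
        (inj₂ _) (inj₂ _) _ _ → (λ ()) , (λ ()) }))

∈⇒↭ : ∀ {q : Name × Fm} {Γ : Ctx} → q ∈ Γ → Σ Ctx (λ Δ → Γ ↭ q ∷ Δ)
∈⇒↭ {Γ = _ ∷ Γ} (here refl) = Γ , ↭-refl
∈⇒↭ {q} {r ∷ _} (there i) = let (Δ , p) = ∈⇒↭ i in r ∷ Δ , ↭-trans (prep r p) (swap r q ↭-refl)

pull : ∀ {q : Name × Fm} {Γ Δ : Ctx} → Γ ↭ q ∷ Δ → q ∈ Γ
pull p = ∈-resp-↭ (↭-sym p) (here refl)

uncons-↭ : ∀ {q r : Name × Fm} {Γ Δ : Ctx} → r ∷ Γ ↭ q ∷ Δ →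
           (r ≡ q × Γ ↭ Δ) ⊎ Σ Ctx (λ Γ' → (Γ ↭ q ∷ Γ') × (r ∷ Γ' ↭ Δ))
uncons-↭ {q} {r} p with pull p
... | here refl = inj₁ (refl , drop-∷ p)
... | there i with ∈⇒↭ i
...   | Γ' , s = inj₂ (Γ' , s , drop-∷ (↭-trans (swap q r ↭-refl) (↭-trans (prep r (↭-sym s)) p)))

split-↭ : ∀ {q : Name × Fm} (Γ : Ctx) {Δ Θ : Ctx} → Γ ++ Δ ↭ q ∷ Θ →
          Σ Ctx (λ Γ' → (Γ ↭ q ∷ Γ') × (Γ' ++ Δ ↭ Θ)) ⊎ Σ Ctx (λ Δ' → (Δ ↭ q ∷ Δ') × (Γ ++ Δ' ↭ Θ))
split-↭ {q} Γ {Δ} p with ∈-++⁻ Γ (pull p)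
... | inj₁ i = let (Γ' , s) = ∈⇒↭ i in
  inj₁ (Γ' , s , drop-∷ (↭-trans (++⁺ʳ Δ (↭-sym s)) p))
... | inj₂ i = let (Δ' , s) = ∈⇒↭ i in
  inj₂ (Δ' , s , drop-∷ (↭-trans (↭-sym (Perm.shift q Γ Δ')) (↭-trans (++⁺ˡ Γ (↭-sym s)) p)))

⋈-↭ : ∀ {Γ Γ' Δ Δ'} → Γ ↭ Γ' → Δ ↭ Δ' → Γ ⋈ Δ ↭ Γ' ⋈ Δ'
⋈-↭ p q = ++⁺ (map⁺ _ p) (map⁺ _ q)

fresh-↭ : ∀ {z Γ Δ} → Γ ↭ Δ → Fresh z Γ → Fresh z Δ
fresh-↭ p f i = f (∈-resp-↭ (↭-sym p) i)

avoids-tag : ∀ M {y} c → Avoids M y R (L c)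
avoids-tag _ c _ v _ _ e = L≢R c (proj₁ v) (sym e)

module _ {x y : ℕ} {C : Fm} {Δ : Ctx} {M : SNet Occ} where

  left-ax : ∀ {a A} → a ≢ x → Seqz ((y , dual A) ∷ Δ) M →
            Seqz (((a , dual A) ∷ []) ⋈ Δ) (cutN L R x y (axNet a x A) M)
  left-ax {a} {A} a≢x s@(D , _) = seq-≈ (≈-sym (cut-ax {A = A} a≢x λ i → wt-resolved (seq-uniq s) (seq-wt s i) (here refl)))
    (subst (λ Θ → Seqz Θ (relN (rename t) M)) ctx (seq-rn t inj s))
    where
    t = replace y (λ _ → L a) R
    fy : Fresh y Δ
    fy = proj₁ (seq-uniq s)
    miss : ∀ {n B} → (n , B) ∈ Δ → t n ≡ R n
    miss i = replace-miss {y} {λ _ → L a} {R} (fresh-≢ fy i)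
    hit : t y ≡ L a
    hit = replace-hit {y} {λ _ → L a} {R}
    go : ∀ Θ → (∀ {n B} → (n , B) ∈ Θ → t n ≡ R n) → mapN t Θ ≡ mapN R Θ
    go [] _ = refl
    go ((n , B) ∷ Θ) h = cong₂ _∷_ (cong (_, B) (h (here refl))) (go Θ (λ i → h (there i)))
    ctx : mapN t ((y , dual A) ∷ Δ) ≡ ((a , dual A) ∷ []) ⋈ Δ
    ctx = cong₂ _∷_ (cong (_, dual A) hit) (go Δ miss)
    inj : InjOn t ((y , dual A) ∷ Δ)
    inj (here refl) (here refl) e = refl
    inj (here refl) (there {x = _} j) e = ⊥-elim (L≢R a _ (trans (sym hit) (trans e (miss j))))
    inj (there i) (here refl) e = ⊥-elim (L≢R a _ (trans (sym hit) (trans (sym e) (miss i))))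
    inj (there i) (there j) e = R-inj (trans (sym (miss i)) (trans e (miss j)))

  left-rn : ∀ {h Γ Γ₁ N} → WTN Γ₁ N → InjOn h Γ₁ → Γ₁ ↭ (x , C) ∷ Γ →
            Seqz (Γ ⋈ Δ) (cutN L R x y N M) →
            Seqz (mapN h Γ ⋈ Δ) (cutN L R (h x) y (relN (rename h) N) M)
  left-rn {h} {Γ} w inj p s =
    seq-≈ (≈-sym (cut-rename {f = L} {h = h} (λ i v l e → inj (proj₂ (WT.dom? (w i) l)) (pull p) e)))
      (subst (λ Θ → Seqz (Θ ++ mapN R Δ) _) (sym (mapN-∘ L h Γ))
        (retag (λ n → L (h n)) R (λ i j e → inj (sub' i) (sub' j) (L-inj e)) (λ _ _ → R-inj)
          (λ {n} {m} _ _ → L≢R (h n) m) s))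
    where
    sub' : ∀ {n A} → (n , A) ∈ Γ → (n , A) ∈ _
    sub' i = ∈-resp-↭ (↭-sym p) (there i)

  left-par : ∀ {a b z A B Γp Γ N} → WTN ((a , A) ∷ (b , B) ∷ Γp) N → Uniq ((a , A) ∷ (b , B) ∷ Γp) →
    Fresh z Γp → Γp ↭ (x , C) ∷ Γ → Seqz (((a , A) ∷ (b , B) ∷ Γ) ⋈ Δ) (cutN L R x y N M) →
    Seqz (((z , A ⅋ B) ∷ Γ) ⋈ Δ) (cutN L R x y (parN z a b N) M)
  left-par {z = z} {Γ = Γ} w u fz p s = seq-≈ (≈-sym (comm-par L-inj w u fz (pull p) (avoids-tag M _) (avoids-tag M _)))
    (seq-par (L z) s (fresh-L {Γ = Γ} {Δ} (λ i → fresh-↭ p fz (there i))))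

  left-plus : ∀ {a z d A B Γp Γ N} → WTN ((a , (if d then B else A)) ∷ Γp) N → Fresh a Γp →
    Fresh z Γp → Γp ↭ (x , C) ∷ Γ → Seqz (((a , (if d then B else A)) ∷ Γ) ⋈ Δ) (cutN L R x y N M) →
    Seqz (((z , A ⊕ B) ∷ Γ) ⋈ Δ) (cutN L R x y (plusN z a d N) M)
  left-plus {z = z} {d} {Γ = Γ} w fa fz p s = seq-≈ (≈-sym (comm-single L-inj w fa fz (pull p) (avoids-tag M _)))
    (seq-plus (L z) d s (fresh-L {Γ = Γ} {Δ} (λ i → fresh-↭ p fz (there i))))

  left-with : ∀ {a b z A B Γp Γ N P} → WTN ((a , A) ∷ Γp) N → WTN ((b , B) ∷ Γp) P →
    Fresh a Γp → Fresh b Γp → Fresh z Γp → Γp ↭ (x , C) ∷ Γ →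
    Seqz (((a , A) ∷ Γ) ⋈ Δ) (cutN L R x y N M) → Seqz (((b , B) ∷ Γ) ⋈ Δ) (cutN L R x y P M) →
    Seqz (((z , A & B) ∷ Γ) ⋈ Δ) (cutN L R x y (withN z a b N P) M)
  left-with {z = z} {Γ = Γ} wN wP fa fb fz p s s' =
    seq-≈ (≈-sym (comm-with L-inj wN wP fa fb fz (pull p) (avoids-tag M _) (avoids-tag M _)))
      (seq-with (L z) s s' (fresh-L {Γ = Γ} {Δ} (λ i → fresh-↭ p fz (there i))))

  left-tens₁ : ∀ {a b z A B Γp Γ Θ N P} → WTN ((a , A) ∷ Γp) N → Seqz ((b , B) ∷ Θ) P →
    Fresh a Γp → Apart Γp Θ → Fresh z (Γp ++ Θ) → Γp ↭ (x , C) ∷ Γ →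
    Seqz (((a , A) ∷ Γ) ⋈ Δ) (cutN L R x y N M) →
    Seqz (((z , A ⊗ B) ∷ Γ ++ Θ) ⋈ Δ) (cutN L R x y (tensN z a b N P) M)
  left-tens₁ {z = z} {Γp = Γp} {Γ} {Θ} w sP fa ap fz p s =
    seq-≈ (≈-sym (comm-tens₁ L-inj w (seq-wt sP) fa (proj₁ (seq-uniq sP)) ap fz (pull p) (avoids-tag M _)))
      (seq-ex (prep _ perm) (seq-tens (L z) s (seq-rn L (λ _ _ → L-inj) sP) apart fresh))
    where
    in-p : ∀ {n A} → (n , A) ∈ Γ → (n , A) ∈ Γp
    in-p i = ∈-resp-↭ (↭-sym p) (there i)
    perm : (Γ ⋈ Δ) ++ mapN L Θ ↭ (Γ ++ Θ) ⋈ Δ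
    perm = ↭-trans (↭-reflexive (++-assoc (mapN L Γ) (mapN R Δ) (mapN L Θ)))
      (↭-trans (++⁺ˡ (mapN L Γ) (++-comm (mapN R Δ) (mapN L Θ)))
      (↭-reflexive (trans (sym (++-assoc (mapN L Γ) (mapN L Θ) (mapN R Δ)))
                          (cong (_++ mapN R Δ) (sym (mapN-++ L Γ Θ))))))
    apart : Apart (Γ ⋈ Δ) (mapN L Θ)
    apart i j with ∈-⋈⁻ Γ {Δ} i | ∈-mapN⁻ {L} j
    ... | inj₁ (n , k , refl) | m , k' , e = ap (in-p k) (subst (λ q → (q , _) ∈ Θ) (L-inj (sym e)) k')
    ... | inj₂ (n , k , refl) | m , k' , e = L≢R m n (sym e)
    fresh : Fresh (L z) ((Γ ⋈ Δ) ++ mapN L Θ)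
    fresh i with ∈-++⁻ (Γ ⋈ Δ) i
    ... | inj₁ j = fresh-L {Γ = Γ} {Δ} (λ k → fz (∈-++⁺ˡ (in-p k))) j
    ... | inj₂ j with ∈-mapN⁻ {L} j
    ...   | m , k , e = fz (∈-++⁺ʳ Γp (subst (λ q → (q , _) ∈ Θ) (L-inj (sym e)) k))

  left-tens₂ : ∀ {a b z A B Θ Γp Γ N P} → Seqz ((a , A) ∷ Θ) N → WTN ((b , B) ∷ Γp) P →
    Fresh b Γp → Apart Θ Γp → Fresh z (Θ ++ Γp) → Γp ↭ (x , C) ∷ Γ →
    Seqz (((b , B) ∷ Γ) ⋈ Δ) (cutN L R x y P M) →
    Seqz (((z , A ⊗ B) ∷ Θ ++ Γ) ⋈ Δ) (cutN L R x y (tensN z a b N P) M)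
  left-tens₂ {z = z} {Θ = Θ} {Γp} {Γ} sN w fb ap fz p s =
    seq-≈ (≈-sym (comm-tens₂ L-inj (seq-wt sN) w (proj₁ (seq-uniq sN)) fb ap fz (pull p) (avoids-tag M _)))
      (seq-ex (prep _ perm) (seq-tens (L z) (seq-rn L (λ _ _ → L-inj) sN) s apart fresh))
    where
    in-p : ∀ {n A} → (n , A) ∈ Γ → (n , A) ∈ Γp
    in-p i = ∈-resp-↭ (↭-sym p) (there i)
    perm : mapN L Θ ++ (Γ ⋈ Δ) ↭ (Θ ++ Γ) ⋈ Δ
    perm = ↭-reflexive (trans (sym (++-assoc (mapN L Θ) (mapN L Γ) (mapN R Δ)))
                              (cong (_++ mapN R Δ) (sym (mapN-++ L Θ Γ))))
    apart : Apart (mapN L Θ) (Γ ⋈ Δ)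
    apart j i with ∈-⋈⁻ Γ {Δ} i | ∈-mapN⁻ {L} j
    ... | inj₁ (n , k , refl) | m , k' , e = ap (subst (λ q → (q , _) ∈ Θ) (L-inj (sym e)) k') (in-p k)
    ... | inj₂ (n , k , refl) | m , k' , e = L≢R m n (sym e)
    fresh : Fresh (L z) (mapN L Θ ++ (Γ ⋈ Δ))
    fresh i with ∈-++⁻ (mapN L Θ) i
    ... | inj₂ j = fresh-L {Γ = Γ} {Δ} (λ k → fz (∈-++⁺ʳ Θ (in-p k))) j
    ... | inj₁ j with ∈-mapN⁻ {L} j
    ...   | m , k , e = fz (∈-++⁺ˡ (subst (λ q → (q , _) ∈ Θ) (L-inj (sym e)) k))

principal-⊗ : ∀ {a b u v z w A B U V Γ Δ Θ} (D : CF ((a , A) ∷ Γ)) (E : CF ((b , B) ∷ Δ))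
  (F : CF ((u , U) ∷ (v , V) ∷ Θ)) → Apart Γ Δ → Fresh z (Γ ++ Δ) → Fresh w Θ →
  Seqz (Δ ⋈ ((v , V) ∷ Θ)) (cutN L R b u (sem E) (sem F)) →
  (∀ {Ξ₁ Ξ} (G : CF Ξ₁) → Ξ₁ ↭ (R v , V) ∷ Ξ → Seqz (Γ ⋈ Ξ) (cutN L R a (R v) (sem D) (sem G))) →
  Seqz ((Γ ++ Δ) ⋈ Θ) (cutN L R z w (tensN z a b (sem D) (sem E)) (parN w u v (sem F)))
principal-⊗ {a} {b} {u} {v} {z} {w} {V = V} {Γ} {Δ} {Θ} D E F ap fz fw (G , e) ih =
  seq-≈ (≈-sym (cut-⊗⅋₁ {f₁ = L} {λ n → n} {L} {R} (wt D) (wt E) (wt F) (proj₁ (uniq D)) (proj₁ (uniq E)) (uniq F)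
                  (λ i → fz (∈-++⁺ˡ i)) (λ i → fz (∈-++⁺ʳ Γ i)) fw
                  (λ _ → refl) (λ {n} _ → refl , L≢R n v)
                  (λ i → refl , λ e' → proj₁ (proj₂ (uniq F)) (subst (λ k → (k , _) ∈ Θ) (R-inj e') i))))
    (subst (λ Ξ → Seqz Ξ (cutN L (λ n → n) a (R v) (sem D) (cutN L R b u (sem E) (sem F)))) ctx
      (seq-≈ (cutN-cong ≈-refl e)
        (retag L (λ n → n) (λ _ _ → L-inj) (λ _ _ e' → e') apart (ih G (Perm.shift (R v , V) (mapN L Δ) (mapN R Θ))))))
  where
  ctx : mapN L Γ ++ mapN (λ n → n) (Δ ⋈ Θ) ≡ (Γ ++ Δ) ⋈ Θ
  ctx = trans (cong (mapN L Γ ++_) (map-id (Δ ⋈ Θ)))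
    (trans (sym (++-assoc (mapN L Γ) (mapN L Δ) (mapN R Θ))) (cong (_++ mapN R Θ) (sym (mapN-++ L Γ Δ))))
  apart : ∀ {n m A B} → (n , A) ∈ Γ → (m , B) ∈ Δ ⋈ Θ → L n ≢ m
  apart {n} i j e' with ∈-⋈⁻ Δ {Θ} j
  ... | inj₁ (k , j' , refl) = ap i (subst (λ q → (q , _) ∈ Δ) (L-inj (sym e')) j')
  ... | inj₂ (k , j' , refl) = L≢R n k e'

data Prin (x : ℕ) : Fm → Ctx → SNet Occ → Set where
  p⊗ : ∀ {a b A B Γ Δ Θ} (D : CF ((a , A) ∷ Γ)) (E : CF ((b , B) ∷ Δ)) → Apart Γ Δ →
       Fresh x (Γ ++ Δ) → Γ ++ Δ ↭ Θ → Prin x (A ⊗ B) Θ (tensN x a b (sem D) (sem E))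
  p⅋ : ∀ {a b A B Γ Θ} (D : CF ((a , A) ∷ (b , B) ∷ Γ)) → Fresh x Γ → Γ ↭ Θ →
       Prin x (A ⅋ B) Θ (parN x a b (sem D))
  p& : ∀ {a b A B Γ Θ} (D : CF ((a , A) ∷ Γ)) (E : CF ((b , B) ∷ Γ)) → Fresh x Γ → Γ ↭ Θ →
       Prin x (A & B) Θ (withN x a b (sem D) (sem E))
  p⊕ : ∀ {a A B Γ Θ} d (D : CF ((a , (if d then B else A)) ∷ Γ)) → Fresh x Γ → Γ ↭ Θ →
       Prin x (A ⊕ B) Θ (plusN x a d (sem D))

prin-nvar : ∀ {x C Γ N k} → Prin x C Γ N → nvar k ≢ dual C
prin-nvar (p⊗ _ _ _ _ _) ()
prin-nvar (p⅋ _ _ _) ()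
prin-nvar (p& _ _ _ _) ()
prin-nvar (p⊕ _ _ _ _) ()

prin-var : ∀ {x C Γ N k} → Prin x C Γ N → var k ≢ dual C
prin-var (p⊗ _ _ _ _ _) ()
prin-var (p⅋ _ _ _) ()
prin-var (p& _ _ _ _) ()
prin-var (p⊕ _ _ _ _) ()

admit : ∀ C {x y Γ Δ Γ₁ Δ₁} (D : CF Γ₁) (E : CF Δ₁) → Γ₁ ↭ (x , C) ∷ Γ → Δ₁ ↭ (y , dual C) ∷ Δ →
        Seqz (Γ ⋈ Δ) (cutN L R x y (sem D) (sem E))
admitʳ : ∀ C {x y Γ Δ Δ₁ N} → Prin x C Γ N → (E : CF Δ₁) → Δ₁ ↭ (y , dual C) ∷ Δ →
         Seqz (Γ ⋈ Δ) (cutN L R x y N (sem E))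
admitᵖ : ∀ C {x y Γ Δ N M} → Prin x C Γ N → Prin y (dual C) Δ M → Seqz (Γ ⋈ Δ) (cutN L R x y N M)

admit C {x} {y} {Γ} {Δ} (cax {a} {b} k a≢b) E p q with pull p
... | here refl =
  seq-ex (⋈-↭ (drop-∷ p) ↭-refl)
    (seq-≈ (cutN-cong (≈-sym (axNet-sym (var k))) ≈-refl) (left-ax {x} {y} {C} {A = nvar k} (λ e → a≢b (sym e)) (seq-ex q (E , ≈-refl))))
... | there (here refl) =
  seq-ex (⋈-↭ (drop-∷ (↭-trans (swap _ _ ↭-refl) p)) ↭-refl)
    (left-ax {x} {y} {C} {A = var k} a≢b (seq-ex q (E , ≈-refl)))
admit C {Δ = Δ} (crn h inj D) E p q with ↭-map-inv _ p
... | (x , _) ∷ Γ , refl , p' = left-rn {C = C} {Δ} (wt D) inj p' (admit C D E p' q)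
admit C (cex r D) E p q = admit C D E (↭-trans r p) q
admit C {x} {Δ = Δ} (ctens {a} {b} {A} {B} {Γa} {Γb} z D D' ap fz) E p q with uncons-↭ p
... | inj₁ (refl , r) = admitʳ C (p⊗ D D' ap fz r) E q
... | inj₂ (Γ' , r , s) with split-↭ Γa r
...   | inj₁ (Γa' , t , t') =
  seq-ex (⋈-↭ (↭-trans (prep _ t') s) ↭-refl)
    (left-tens₁ {C = C} {Δ} (wt D) (D' , ≈-refl) (proj₁ (uniq D)) ap fz t
      (admit C D E (↭-trans (prep (a , A) t) (swap _ _ ↭-refl)) q))
...   | inj₂ (Γb' , t , t') =
  seq-ex (⋈-↭ (↭-trans (prep _ t') s) ↭-refl)
    (left-tens₂ {C = C} {Δ} (D , ≈-refl) (wt D') (proj₁ (uniq D')) ap fz t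
      (admit C D' E (↭-trans (prep (b , B) t) (swap _ _ ↭-refl)) q))
admit C {Δ = Δ} (cpar {a} {b} {A} {B} z D fz) E p q with uncons-↭ p
... | inj₁ (refl , r) = admitʳ C (p⅋ D fz r) E q
... | inj₂ (Γ' , r , s) = seq-ex (⋈-↭ s ↭-refl) (left-par {C = C} {Δ} (wt D) (uniq D) fz r
        (admit C D E (↭-trans (prep (a , A) (↭-trans (prep (b , B) r) (swap _ _ ↭-refl))) (swap _ _ ↭-refl)) q))
admit C {Δ = Δ} (cwith {a} {b} {A} {B} z D D' fz) E p q with uncons-↭ p
... | inj₁ (refl , r) = admitʳ C (p& D D' fz r) E q
... | inj₂ (Γ' , r , s) = seq-ex (⋈-↭ s ↭-refl) (left-with {C = C} {Δ} (wt D) (wt D') (proj₁ (uniq D)) (proj₁ (uniq D')) fz r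
        (admit C D E (↭-trans (prep (a , A) r) (swap _ _ ↭-refl)) q)
        (admit C D' E (↭-trans (prep (b , B) r) (swap _ _ ↭-refl)) q))
admit C {Δ = Δ} (cplus {a} {A} {B} z d D fz) E p q with uncons-↭ p
... | inj₁ (refl , r) = admitʳ C (p⊕ d D fz r) E q
... | inj₂ (Γ' , r , s) = seq-ex (⋈-↭ s ↭-refl) (left-plus {C = C} {Δ} {d = d} {A} {B} (wt D) (proj₁ (uniq D)) fz r
        (admit C D E (↭-trans (prep _ r) (swap _ _ ↭-refl)) q))

admitʳ C pr (cax k a≢b) q with pull q
... | here e = ⊥-elim (prin-nvar pr (sym (cong proj₂ e)))
... | there (here e) = ⊥-elim (prin-var pr (sym (cong proj₂ e)))
admitʳ C {x} {Γ = Γ} pr (crn h inj E) q with ↭-map-inv _ q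
... | (y , _) ∷ Δ , refl , q' =
  cut-flip {_} {x} {mapN h Δ} {Γ} (left-rn {C = dual C} {Γ} (wt E) inj q' (cut-flip {x} {y} {Γ} {Δ} (admitʳ C pr E q')))
admitʳ C pr (cex r E) q = admitʳ C pr E (↭-trans r q)
admitʳ C {x} {y} {Γ} {Δ} pr (ctens {a} {b} {A} {B} {Δa} {Δb} z E E' ap fz) q with uncons-↭ q
... | inj₁ (e , r) = admitᵖ C pr (subst (λ (n , F) → Prin n F Δ _) e (p⊗ E E' ap fz r))
... | inj₂ (Δ' , r , s) with split-↭ Δa r
...   | inj₁ (Δa' , t , t') = cut-flip {y} {x} {Δ} {Γ}
  (seq-ex (⋈-↭ (↭-trans (prep _ t') s) ↭-refl)
    (left-tens₁ {C = dual C} {Γ} (wt E) (E' , ≈-refl) (proj₁ (uniq E)) ap fz t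
      (cut-flip {x} {y} {Γ} {(a , A) ∷ Δa'} (admitʳ C pr E (↭-trans (prep (a , A) t) (swap _ _ ↭-refl))))))
...   | inj₂ (Δb' , t , t') = cut-flip {y} {x} {Δ} {Γ}
  (seq-ex (⋈-↭ (↭-trans (prep _ t') s) ↭-refl)
    (left-tens₂ {C = dual C} {Γ} (E , ≈-refl) (wt E') (proj₁ (uniq E')) ap fz t
      (cut-flip {x} {y} {Γ} {(b , B) ∷ Δb'} (admitʳ C pr E' (↭-trans (prep (b , B) t) (swap _ _ ↭-refl))))))
admitʳ C {x} {y} {Γ} {Δ} pr (cpar {a} {b} {A} {B} z E fz) q with uncons-↭ q
... | inj₁ (e , r) = admitᵖ C pr (subst (λ (n , F) → Prin n F Δ _) e (p⅋ E fz r))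
... | inj₂ (Δ' , r , s) = cut-flip {y} {x} {Δ} {Γ} (seq-ex (⋈-↭ s ↭-refl) (left-par {C = dual C} {Γ} (wt E) (uniq E) fz r
        (cut-flip {x} {y} {Γ} {(a , A) ∷ (b , B) ∷ Δ'}
          (admitʳ C pr E (↭-trans (prep (a , A) (↭-trans (prep (b , B) r) (swap _ _ ↭-refl))) (swap _ _ ↭-refl))))))
admitʳ C {x} {y} {Γ} {Δ} pr (cwith {a} {b} {A} {B} z E E' fz) q with uncons-↭ q
... | inj₁ (e , r) = admitᵖ C pr (subst (λ (n , F) → Prin n F Δ _) e (p& E E' fz r))
... | inj₂ (Δ' , r , s) = cut-flip {y} {x} {Δ} {Γ} (seq-ex (⋈-↭ s ↭-refl)
        (left-with {C = dual C} {Γ} (wt E) (wt E') (proj₁ (uniq E)) (proj₁ (uniq E')) fz r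
          (cut-flip {x} {y} {Γ} {(a , A) ∷ Δ'} (admitʳ C pr E (↭-trans (prep (a , A) r) (swap _ _ ↭-refl))))
          (cut-flip {x} {y} {Γ} {(b , B) ∷ Δ'} (admitʳ C pr E' (↭-trans (prep (b , B) r) (swap _ _ ↭-refl))))))
admitʳ C {x} {y} {Γ} {Δ} pr (cplus {a} {A} {B} z d E fz) q with uncons-↭ q
... | inj₁ (e , r) = admitᵖ C pr (subst (λ (n , F) → Prin n F Δ _) e (p⊕ d E fz r))
... | inj₂ (Δ' , r , s) = cut-flip {y} {x} {Δ} {Γ} (seq-ex (⋈-↭ s ↭-refl)
        (left-plus {C = dual C} {Γ} {d = d} {A} {B} (wt E) (proj₁ (uniq E)) fz r
          (cut-flip {x} {y} {Γ} {(a , (if d then B else A)) ∷ Δ'} (admitʳ C pr E (↭-trans (prep _ r) (swap _ _ ↭-refl))))))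

admitᵖ (A ⊗ B) (p⊗ D E ap fz p) (p⅋ F fw q) =
  seq-ex (⋈-↭ p q) (principal-⊗ D E F ap fz fw (admit B E F ↭-refl ↭-refl) (λ G r → admit A D G ↭-refl r))
admitᵖ (A ⅋ B) {x} {y} (p⅋ {u} {v} {Γ = Θ} F fw q) (p⊗ {a} {b} {Γ = Γ} {Δ} D E ap fz p) =
  seq-ex (⋈-↭ q p) (cut-flip {y} {x} {Γ ++ Δ} {Θ} (principal-⊗ D E F ap fz fw
    (cut-flip {u} {b} {(v , B) ∷ Θ} {Δ} (admit A F E ↭-refl ↭-refl))
    (λ {_} {Ξ} G r → cut-flip {R v} {a} {Ξ} {Γ} (admit B G D r ↭-refl))))
admitᵖ (A & B) (p& D E fz p) (p⊕ true F fw q) =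
  seq-ex (⋈-↭ p q) (seq-≈ (≈-sym (cut-&₁ (wt D) (wt E) (wt F) (proj₁ (uniq D)) (proj₁ (uniq E)) (proj₁ (uniq F)) fz fw))
    (admit A D F ↭-refl ↭-refl))
admitᵖ (A & B) (p& D E fz p) (p⊕ false F fw q) =
  seq-ex (⋈-↭ p q) (seq-≈ (≈-sym (cut-&₂ (wt D) (wt E) (wt F) (proj₁ (uniq D)) (proj₁ (uniq E)) (proj₁ (uniq F)) fz fw))
    (admit B E F ↭-refl ↭-refl))
admitᵖ (A ⊕ B) {x} {y} (p⊕ {u} {Γ = Θ} true F fw q) (p& {a} {b} {Γ = Γ} D E fz p) =
  seq-ex (⋈-↭ q p) (cut-flip {y} {x} {Γ} {Θ}
    (seq-≈ (≈-sym (cut-&₁ (wt D) (wt E) (wt F) (proj₁ (uniq D)) (proj₁ (uniq E)) (proj₁ (uniq F)) fz fw))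
      (cut-flip {u} {a} {Θ} {Γ} (admit B F D ↭-refl ↭-refl))))
admitᵖ (A ⊕ B) {x} {y} (p⊕ {u} {Γ = Θ} false F fw q) (p& {a} {b} {Γ = Γ} D E fz p) =
  seq-ex (⋈-↭ q p) (cut-flip {y} {x} {Γ} {Θ}
    (seq-≈ (≈-sym (cut-&₂ (wt D) (wt E) (wt F) (proj₁ (uniq D)) (proj₁ (uniq E)) (proj₁ (uniq F)) fz fw))
      (cut-flip {u} {b} {Θ} {Γ} (admit A F E ↭-refl ↭-refl))))

-- Denotation of proof terms

⟦_⟧ : Tm → SNet Occ
⟦ ax x y A ⟧ = axNet x y A
⟦ cut C x P y Q ⟧ = cutN (λ n → n) (λ n → n) x y ⟦ P ⟧ ⟦ Q ⟧
⟦ tens z x P y Q ⟧ = tensN z x y ⟦ P ⟧ ⟦ Q ⟧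
⟦ par z x y P ⟧ = parN z x y ⟦ P ⟧
⟦ wth z x P y Q ⟧ = withN z x y ⟦ P ⟧ ⟦ Q ⟧
⟦ inl z B x P ⟧ = plusN z x false ⟦ P ⟧
⟦ inr z A x P ⟧ = plusN z x true ⟦ P ⟧

Expands : Fm → Set
Expands A = ∀ {x y} → x ≢ y → Seqz ((x , dual A) ∷ (y , A) ∷ []) (axNet x y A)

expands-dual : ∀ {A} → Expands A → Expands (dual A)
expands-dual {A} e {x} {y} x≢y =
  subst (λ F → Seqz ((x , F) ∷ (y , dual A) ∷ []) (axNet x y (dual A))) (sym (dual-dual A))
    (seq-≈ (axNet-sym A) (seq-ex (swap _ _ ↭-refl) (e (λ q → x≢y (sym q)))))

n≢sucn : ∀ {n : ℕ} → n ≢ suc n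
n≢sucn {suc n} e = n≢sucn (suc-injective e)

n≢sucsucn : ∀ {n : ℕ} → n ≢ suc (suc n)
n≢sucsucn {suc n} e = n≢sucsucn (suc-injective e)

expands-⊗ : ∀ {A B} → Expands A → Expands B → Expands (A ⊗ B)
expands-⊗ {A} {B} eA eB {x} {y} x≢y =
  seq-≈ (≈-sym (η⊗-net {a = u} {v} {u} {v} n≢sucn (λ e → n≢sucn (sym e)) n≢sucn n≢sucn n≢sucsucn))
    (seq-par x (seq-ex perm (seq-tens y
        (seq-ex (swap _ _ ↭-refl) (eA {v} {u} (λ e → n≢sucn (sym e))))
        (seq-ex (swap _ _ ↭-refl) (eB {u} {v} n≢sucn))
        (λ { (here refl) (here e) → n≢sucn (sym (cong proj₁ e)) })
        (λ { (here e) → n≢sucsucn (cong proj₁ e) ; (there (here e)) → n≢sucn (cong proj₁ e) })))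
      (λ { (here refl) → x≢y refl }))
  where
  u = suc y
  v = suc (suc y)
  perm : (y , A ⊗ B) ∷ (v , dual A) ∷ (u , dual B) ∷ [] ↭ (u , dual B) ∷ (v , dual A) ∷ (y , A ⊗ B) ∷ []
  perm = ↭-trans (prep _ (swap _ _ ↭-refl)) (↭-trans (swap _ _ ↭-refl) (prep _ (swap _ _ ↭-refl)))

expands-& : ∀ {A B} → Expands A → Expands B → Expands (A & B)
expands-& {A} {B} eA eB {x} {y} x≢y =
  seq-≈ (≈-sym (η&-net {a = a} {a} {x} {x} n≢sucn n≢sucn n≢sucn n≢sucn))
    (seq-ex (swap _ _ ↭-refl) (seq-with y
      (seq-ex (swap _ _ ↭-refl) (seq-plus {A = dual B} {dual A} x true (eA n≢sucn) (λ { (here e) → n≢sucn (cong proj₁ e) })))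
      (seq-ex (swap _ _ ↭-refl) (seq-plus {A = dual B} {dual A} x false (eB n≢sucn) (λ { (here e) → n≢sucn (cong proj₁ e) })))
      (λ { (here refl) → x≢y refl })))
  where
  a = suc x

expands-undual : ∀ {A} F → F ≡ dual A → Expands F → Expands A
expands-undual {A} F refl e {x} {y} x≢y =
  subst (λ G → Seqz ((x , dual G) ∷ (y , G) ∷ []) (axNet x y G)) (dual-dual A) (expands-dual e x≢y)

expands : ∀ A → Expands A
expands (var k) x≢y = cax k x≢y , ≈-refl
expands (nvar k) = expands-undual (var k) refl (λ x≢y → cax k x≢y , ≈-refl)
expands (A ⊗ B) = expands-⊗ (expands A) (expands B)
expands (A ⅋ B) = expands-undual (dual B ⊗ dual A) refl (expands-⊗ (expands-dual (expands B)) (expands-dual (expands A)))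
expands (A & B) = expands-& (expands A) (expands B)
expands (A ⊕ B) = expands-undual (dual B & dual A) refl (expands-& (expands-dual (expands B)) (expands-dual (expands A)))

∈-dom : ∀ {n A} {Γ : Ctx} → (n , A) ∈ Γ → n ∈ dom Γ
∈-dom = ∈-map⁺ proj₁

∉⇒fresh : ∀ {z} {Γ : Ctx} → z ∉ dom Γ → Fresh z Γ
∉⇒fresh f i = f (∈-dom i)

disj⇒apart : ∀ {Γ Δ} → Disj Γ Δ → Apart Γ Δ
disj⇒apart (f ∷ _) (here refl) j = f (∈-dom j)
disj⇒apart (_ ∷ d) (there i) j = disj⇒apart d i j

seq-cut : ∀ {x y A Γ Δ N M} → Seqz ((x , A) ∷ Γ) N → Seqz ((y , dual A) ∷ Δ) M → Apart Γ Δ →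
          Seqz (Γ ++ Δ) (cutN (λ n → n) (λ n → n) x y N M)
seq-cut {A = A} {Γ} {Δ} (D , d) (E , e) ap =
  subst (λ Θ → Seqz Θ _) (cong₂ _++_ (map-id Γ) (map-id Δ))
    (seq-≈ (cutN-cong d e)
      (retag {Γ = Γ} {Δ} (λ n → n) (λ n → n) (λ _ _ q → q) (λ _ _ q → q) (λ { i j refl → ap i j })
        (admit A D E ↭-refl ↭-refl)))

adequate : ∀ {P Γ} → P ⊢ Γ → Seqz Γ ⟦ P ⟧
adequate (⊢ax A x≢y) = expands A x≢y
adequate (⊢ex d p) = seq-ex p (adequate d)
adequate (⊢cut d e disj) = seq-cut (adequate d) (adequate e) (disj⇒apart disj)
adequate (⊢tens {z = z} d e disj f) = seq-tens z (adequate d) (adequate e) (disj⇒apart disj) (∉⇒fresh f)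
adequate (⊢par {z = z} d f) = seq-par z (adequate d) (∉⇒fresh f)
adequate (⊢wth {z = z} d e f) = seq-with z (adequate d) (adequate e) (∉⇒fresh f)
adequate (⊢inl {z = z} {A} {B} d f) = seq-plus {A = A} {B} z false (adequate d) (∉⇒fresh f)
adequate (⊢inr {z = z} {A} {B} d f) = seq-plus {A = A} {B} z true (adequate d) (∉⇒fresh f)

inhabitant : ∀ {Γ} (D : CF Γ) → Ix (sem D)
inhabitant (cax k _) = at⁺
inhabitant (crn f _ D) = inhabitant D , relabel-routed (at (sem D) (inhabitant D)) (rename f)
inhabitant (cex _ D) = inhabitant D
inhabitant (ctens z D E _ _) = (inhabitant D , inhabitant E) , relabel-routed (_ ⊎ₛ _) (tensL z _ _)
inhabitant (cpar z D _) = inhabitant D , relabel-routed (at (sem D) (inhabitant D)) (lab₂ _ _ z)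
inhabitant (cwith z D E _) = inj₁ (inhabitant D , relabel-routed (at (sem D) (inhabitant D)) (lab _ z false))
inhabitant (cplus z d D _) = inhabitant D , relabel-routed (at (sem D) (inhabitant D)) (lab _ z d)

same-names : ∀ {Γ Δ N} → Seqz Γ N → Seqz Δ N → ∀ {n A} → (n , A) ∈ Γ → ∃[ B ] ((n , B) ∈ Δ)
same-names s@(D , _ , g) s' i =
  let j = proj₁ (_≈_.forth (proj₂ s) (inhabitant D))
      (r , k) = WT.shape (seq-wt s j) i
      (p , l) = rleaf-nonempty r
  in WT.dom? (seq-wt s' j) (proj₂ (k p) l)

∈-names : ∀ {P Γ n A} → P ⊢ Γ → (n , A) ∈ Γ → n ∈ names P
∈-names (⊢ax A _) (here refl) = here refl
∈-names (⊢ax A _) (there (here refl)) = there (here refl)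
∈-names (⊢ex d p) i = ∈-names d (∈-resp-↭ (↭-sym p) i)
∈-names (⊢cut {P} {Γ = Γ} d e _) i with ∈-++⁻ Γ i
... | inj₁ j = there (there (∈-++⁺ˡ (∈-names d (there j))))
... | inj₂ j = there (there (∈-++⁺ʳ (names P) (∈-names e (there j))))
∈-names (⊢tens d e _ _) (here refl) = here refl
∈-names (⊢tens {P} {Γ = Γ} d e _ _) (there i) with ∈-++⁻ Γ i
... | inj₁ j = there (there (there (∈-++⁺ˡ (∈-names d (there j)))))
... | inj₂ j = there (there (there (∈-++⁺ʳ (names P) (∈-names e (there j)))))
∈-names (⊢par d _) (here refl) = here refl
∈-names (⊢par d _) (there i) = there (there (there (∈-names d (there (there i)))))
∈-names (⊢wth d e _) (here refl) = here refl
∈-names (⊢wth d e _) (there i) = there (there (there (∈-++⁺ˡ (∈-names d (there i)))))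
∈-names (⊢inl d _) (here refl) = here refl
∈-names (⊢inl d _) (there i) = there (there (∈-names d (there i)))
∈-names (⊢inr d _) (here refl) = here refl
∈-names (⊢inr d _) (there i) = there (there (∈-names d (there i)))

leaf-names : ∀ {P Γ} → P ⊢ Γ → LeafHyp ⟦ P ⟧ (λ v → proj₁ v ∈ names P)
leaf-names d i v l = ∈-names d (proj₂ (WT.dom? (seq-wt (adequate d) i) l))

inv-ax : ∀ {x y A Γ} → ax x y A ⊢ Γ → x ≢ y × (x , dual A) ∷ (y , A) ∷ [] ↭ Γ
inv-ax (⊢ax A x≢y) = x≢y , ↭-refl
inv-ax (⊢ex d p) = let (n , q) = inv-ax d in n , ↭-trans q p

inv-cut : ∀ {C x P y Q Θ} → cut C x P y Q ⊢ Θ →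
  Σ Ctx λ Γ → Σ Ctx λ Δ → (P ⊢ (x , C) ∷ Γ) × (Q ⊢ (y , dual C) ∷ Δ) × Apart Γ Δ × (Γ ++ Δ ↭ Θ)
inv-cut (⊢cut d e disj) = _ , _ , d , e , disj⇒apart disj , ↭-refl
inv-cut (⊢ex d p) = let (Γ , Δ , d , e , a , q) = inv-cut d in Γ , Δ , d , e , a , ↭-trans q p

inv-tens : ∀ {z x P y Q Θ} → tens z x P y Q ⊢ Θ →
  Σ Fm λ A → Σ Fm λ B → Σ Ctx λ Γ → Σ Ctx λ Δ → (P ⊢ (x , A) ∷ Γ) × (Q ⊢ (y , B) ∷ Δ) × Apart Γ Δ ×
    Fresh z (Γ ++ Δ) × ((z , A ⊗ B) ∷ Γ ++ Δ ↭ Θ)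
inv-tens (⊢tens d e disj f) = _ , _ , _ , _ , d , e , disj⇒apart disj , ∉⇒fresh f , ↭-refl
inv-tens (⊢ex d p) = let (A , B , Γ , Δ , d , e , a , f , q) = inv-tens d in A , B , Γ , Δ , d , e , a , f , ↭-trans q p

inv-par : ∀ {z x y P Θ} → par z x y P ⊢ Θ →
  Σ Fm λ A → Σ Fm λ B → Σ Ctx λ Γ → (P ⊢ (x , A) ∷ (y , B) ∷ Γ) × Fresh z Γ × ((z , A ⅋ B) ∷ Γ ↭ Θ)
inv-par (⊢par d f) = _ , _ , _ , d , ∉⇒fresh f , ↭-refl
inv-par (⊢ex d p) = let (A , B , Γ , d , f , q) = inv-par d in A , B , Γ , d , f , ↭-trans q p

inv-wth : ∀ {z x P y Q Θ} → wth z x P y Q ⊢ Θ →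
  Σ Fm λ A → Σ Fm λ B → Σ Ctx λ Γ → (P ⊢ (x , A) ∷ Γ) × (Q ⊢ (y , B) ∷ Γ) × Fresh z Γ × ((z , A & B) ∷ Γ ↭ Θ)
inv-wth (⊢wth d e f) = _ , _ , _ , d , e , ∉⇒fresh f , ↭-refl
inv-wth (⊢ex d p) = let (A , B , Γ , d , e , f , q) = inv-wth d in A , B , Γ , d , e , f , ↭-trans q p

inv-inl : ∀ {z B x P Θ} → inl z B x P ⊢ Θ →
  Σ Fm λ A → Σ Ctx λ Γ → (P ⊢ (x , A) ∷ Γ) × Fresh z Γ × ((z , A ⊕ B) ∷ Γ ↭ Θ)
inv-inl (⊢inl d f) = _ , _ , d , ∉⇒fresh f , ↭-refl
inv-inl (⊢ex d p) = let (A , Γ , d , f , q) = inv-inl d in A , Γ , d , f , ↭-trans q p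

inv-inr : ∀ {z A x P Θ} → inr z A x P ⊢ Θ →
  Σ Fm λ B → Σ Ctx λ Γ → (P ⊢ (x , B) ∷ Γ) × Fresh z Γ × ((z , A ⊕ B) ∷ Γ ↭ Θ)
inv-inr (⊢inr d f) = _ , _ , d , ∉⇒fresh f , ↭-refl
inv-inr (⊢ex d p) = let (B , Γ , d , f , q) = inv-inr d in B , Γ , d , f , ↭-trans q p

swapName : ℕ → ℕ → ℕ → ℕ
swapName a b = replace a (λ _ → b) (λ n → n)

module _ (a b : ℕ) where
  ρ : ℕ → ℕ
  ρ = swapName a b

  ρ-hit : ρ a ≡ b
  ρ-hit = replace-hit {a} {λ _ → b} {λ n → n}

  ρ-miss : ∀ {n} → n ≢ a → ρ n ≡ n
  ρ-miss = replace-miss {a} {λ _ → b} {λ n → n}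

  ≡ᵇ-true : ∀ {n} → (n ≡ᵇ a) ≡ true → n ≡ a
  ≡ᵇ-true {n} e = ≡ᵇ⇒≡ n a (subst (λ c → IsTrue c) (sym e) tt)

  ≡ᵇ-false : ∀ {n} → (n ≡ᵇ a) ≡ false → n ≢ a
  ≡ᵇ-false {n} e refl = subst (λ c → IsTrue c) e (≡⇒≡ᵇ n n refl)

  if-ρ : ∀ n → (if n ≡ᵇ a then b else n) ≡ ρ n
  if-ρ n with n ≡ᵇ a in e
  ... | true = sym (trans (cong ρ (≡ᵇ-true e)) ρ-hit)
  ... | false = sym (ρ-miss (≡ᵇ-false e))

  lab-ρ : ∀ {x z d} → x ≢ a → x ≢ b → ∀ v → lab x (ρ z) d (rename ρ v) ≡ rename ρ (lab x z d v)
  lab-ρ {x} {z} {d} x≢a x≢b (n , p) with n ≟ x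
  ... | yes refl rewrite ρ-miss x≢a | lab-hit {x} {z} {d} {p} = lab-hit
  ... | no n≢x rewrite lab-miss {x} {z} {d} {n} {p} n≢x = lab-miss out'
    where
    out' : ρ n ≢ x
    out' e with n ≟ a
    ... | yes refl = x≢b (trans (sym e) ρ-hit)
    ... | no n≢a = n≢x (trans (sym (ρ-miss n≢a)) e)

  lab-bound : ∀ {z d} v → lab a (ρ z) d v ≡ rename ρ (lab a z d v)
  lab-bound {z} {d} (n , p) with n ≟ a
  ... | yes refl rewrite lab-hit {n} {z} {d} {p} = lab-hit
  ... | no n≢a rewrite lab-miss {a} {z} {d} {n} {p} n≢a =
    trans (lab-miss n≢a) (cong (_, p) (sym (ρ-miss n≢a)))

  lab₂-ρ : ∀ {x y z} → x ≢ a → x ≢ b → y ≢ a → y ≢ b → ∀ v →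
           lab₂ x y (ρ z) (rename ρ v) ≡ rename ρ (lab₂ x y z v)
  lab₂-ρ {x} {y} {z} x≢a x≢b y≢a y≢b (n , p) with n ≟ x
  ... | yes refl rewrite ρ-miss x≢a | lab₂-left {x} {y} {z} {p} = lab₂-left
  ... | no n≢x with n ≟ y
  ...   | yes refl rewrite ρ-miss y≢a | lab₂-right {x} {y} {z} {p} n≢x = lab₂-right n≢x
  ...   | no n≢y rewrite lab₂-miss {x} {y} {z} {n} {p} n≢x n≢y = lab₂-miss (out' n≢x x≢b) (out' n≢y y≢b)
    where
    out' : ∀ {x} → n ≢ x → x ≢ b → ρ n ≢ x
    out' n≢x x≢b e with n ≟ a
    ... | yes refl = x≢b (trans (sym e) ρ-hit)
    ... | no n≢a = n≢x (trans (sym (ρ-miss n≢a)) e)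

  lab₂-bound : ∀ {x y z} → x ≡ a ⊎ y ≡ a → ∀ v → lab₂ x y (ρ z) v ≡ rename ρ (lab₂ x y z v)
  lab₂-bound {x} {y} {z} h (n , p) with n ≟ x
  ... | yes refl rewrite lab₂-left {n} {y} {z} {p} = lab₂-left
  ... | no n≢x with n ≟ y
  ...   | yes refl rewrite lab₂-right {x} {n} {z} {p} n≢x = lab₂-right n≢x
  ...   | no n≢y rewrite lab₂-miss {x} {y} {z} {n} {p} n≢x n≢y =
    trans (lab₂-miss n≢x n≢y) (cong (_, p) (sym (ρ-miss (n≢a h))))
    where
    n≢a : x ≡ a ⊎ y ≡ a → n ≢ a
    n≢a (inj₁ refl) = n≢x
    n≢a (inj₂ refl) = n≢y

  ax-ρ : ∀ {x y} A → axNet (ρ x) (ρ y) A ≈ relN (rename ρ) (axNet x y A)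
  ax-ρ {x} {y} A = (λ r → (r , relabel-routed (axS x y r) (rename ρ)) , e r) , (λ (r , _) → r , e r)
    where
    e : ∀ r → axS (ρ x) (ρ y) r ≃ wire (relabel (rename ρ)) (axS x y r)
    e r = relabel-≃
      (λ { (inj₁ (refl , l)) → inj₁ (refl , l) ; (inj₂ (refl , l)) → inj₂ (refl , l) })
      (λ { {_ , p} (inj₁ (refl , l)) → (x , p) , refl , inj₁ (refl , l)
         ; {_ , p} (inj₂ (refl , l)) → (y , p) , refl , inj₂ (refl , l) })
      (λ { (inj₁ (refl , refl , l)) → inj₁ (refl , refl , l) ; (inj₂ (refl , refl , l)) → inj₂ (refl , refl , l) })
      (λ { {_ , p} {_ , q} (inj₁ (refl , refl , l)) → (y , p) , (x , q) , refl , refl , inj₁ (refl , refl , l)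
         ; {_ , p} {_ , q} (inj₂ (refl , refl , l)) → (x , p) , (y , q) , refl , refl , inj₂ (refl , refl , l) })
      ((λ ()) , (λ ()))

  cut-ρ₁ : ∀ {x y f g N M} → x ≢ a → x ≢ b →
           cutN f g x y (relN (rename ρ) N) M ≈ cutN (λ n → f (ρ n)) g x y N M
  cut-ρ₁ {x} {y} {f} {g} {N} {M} x≢a x≢b =
    subst (λ k → cutN f g k y (relN (rename ρ) N) M ≈ cutN (λ n → f (ρ n)) g x y N M) (ρ-miss x≢a)
      (cut-rename (λ i v _ e → only (proj₁ v) (trans e (ρ-miss x≢a))))
    where
    only : ∀ n → ρ n ≡ x → n ≡ x
    only n e with n ≟ a
    ... | yes refl = ⊥-elim (x≢b (trans (sym e) ρ-hit))
    ... | no n≢a = trans (sym (ρ-miss n≢a)) e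

  Renamed : ℕ → SNet Occ → SNet Occ → Set₁
  Renamed x N' N = Σ (ℕ → ℕ) λ σ → (N' ≈ relN (rename σ) N) ×
    (∀ z d v → lab x (ρ z) d (rename σ v) ≡ rename ρ (lab x z d v)) ×
    (∀ f g y M → cutN f g x y N' M ≈ cutN (λ n → f (ρ n)) g x y N M)

  renamed : ∀ {x P} → x ≢ b → (⟦ ren a b P ⟧ ≈ relN (rename ρ) ⟦ P ⟧) →
            Renamed x ⟦ if x ≡ᵇ a then P else ren a b P ⟧ ⟦ P ⟧
  renamed {x} {P} x≢b e with x ≡ᵇ a in q
  ... | true = (λ n → n) , relN-as-id ,
    (λ z d v → subst (λ k → lab k (ρ z) d v ≡ rename ρ (lab k z d v)) (sym (≡ᵇ-true q)) (lab-bound v)) ,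
    (λ f g y M → cut-agree (λ i v _ n → cong f (sym (ρ-miss (λ n≡a → n (trans n≡a (sym (≡ᵇ-true q))))))) (λ _ _ _ _ → refl))
  ... | false = ρ , e , (λ z d v → lab-ρ (≡ᵇ-false q) x≢b v) ,
    (λ f g y M → ≈-trans (cutN-cong e ≈-refl) (cut-ρ₁ (≡ᵇ-false q) x≢b))

  plus-ρ : ∀ {x z d N' N} → Renamed x N' N → plusN (ρ z) x d N' ≈ relN (rename ρ) (plusN z x d N)
  plus-ρ {x} {z} {d} (σ , e , h , _) = ≈-trans (wireN-cong _ e) (≈-trans (relN-∘ (rename σ) (lab x (ρ z) d))
    (≈-trans (relN-agree (λ _ v _ → h z d v)) (≈-sym (relN-∘ (lab x z d) (rename ρ)))))

  par-ρ : ∀ {x y P z} → x ≢ b → y ≢ b → (⟦ ren a b P ⟧ ≈ relN (rename ρ) ⟦ P ⟧) →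
          parN (ρ z) x y ⟦ if (x ≡ᵇ a) ∨ (y ≡ᵇ a) then P else ren a b P ⟧ ≈ relN (rename ρ) (parN z x y ⟦ P ⟧)
  par-ρ {x} {y} {P} {z} x≢b y≢b e with x ≡ᵇ a in q | y ≡ᵇ a in q'
  ... | true | _ = ≈-trans (relN-agree (λ _ v _ → lab₂-bound (inj₁ (≡ᵇ-true q)) v)) (≈-sym (relN-∘ (lab₂ x y z) (rename ρ)))
  ... | false | true = ≈-trans (relN-agree (λ _ v _ → lab₂-bound (inj₂ (≡ᵇ-true q')) v)) (≈-sym (relN-∘ (lab₂ x y z) (rename ρ)))
  ... | false | false = ≈-trans (wireN-cong _ e) (≈-trans (relN-∘ (rename ρ) (lab₂ x y (ρ z)))
    (≈-trans (relN-agree (λ _ v _ → lab₂-ρ (≡ᵇ-false q) x≢b (≡ᵇ-false q') y≢b v)) (≈-sym (relN-∘ (lab₂ x y z) (rename ρ)))))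

  tens-ρ : ∀ {x y z N' N M' M} → Renamed x N' N → Renamed y M' M →
           tensN (ρ z) x y N' M' ≈ relN (rename ρ) (tensN z x y N M)
  tens-ρ {x} {y} {z} (σ , e , h , _) (τ , e' , h' , _) =
    ≈-trans (wireN-cong _ (≈-trans (⊎ₙ-cong e e') (relN-⊎ (rename σ) (rename τ))))
    (≈-trans (relN-∘ (sum-map (rename σ) (rename τ)) (tensL (ρ z) x y))
    (≈-trans (relN-agree (λ where _ (inj₁ v) _ → h z false v
                                  _ (inj₂ v) _ → h' z true v))
             (≈-sym (relN-∘ (tensL z x y) (rename ρ)))))

  cut-ρ : ∀ {x y N' N M' M} → Renamed x N' N → Renamed y M' M →
          cutN (λ n → n) (λ n → n) x y N' M' ≈ relN (rename ρ) (cutN (λ n → n) (λ n → n) x y N M)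
  cut-ρ (_ , _ , _ , h) (_ , _ , _ , h') = ≈-trans (h _ _ _ _) (≈-trans cut-sym (≈-trans (h' _ _ _ _)
    (≈-trans cut-sym (≈-sym (cut-post ρ)))))

  ren-sound : ∀ P → b ∉ names P → ⟦ ren a b P ⟧ ≈ relN (rename ρ) ⟦ P ⟧
  ren-sound (ax x y A) f rewrite if-ρ x | if-ρ y = ax-ρ A
  ren-sound (cut C x P y Q) f = cut-ρ
    (renamed {P = P} (λ e → f (here (sym e))) (ren-sound P (λ i → f (there (there (∈-++⁺ˡ i))))))
    (renamed {P = Q} (λ e → f (there (here (sym e)))) (ren-sound Q (λ i → f (there (there (∈-++⁺ʳ (names P) i))))))
  ren-sound (tens z x P y Q) f rewrite if-ρ z = tens-ρ
    (renamed {P = P} (λ e → f (there (here (sym e)))) (ren-sound P (λ i → f (there (there (there (∈-++⁺ˡ i)))))))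
    (renamed {P = Q} (λ e → f (there (there (here (sym e))))) (ren-sound Q (λ i → f (there (there (there (∈-++⁺ʳ (names P) i)))))))
  ren-sound (par z x y P) f rewrite if-ρ z =
    par-ρ {P = P} (λ e → f (there (here (sym e)))) (λ e → f (there (there (here (sym e)))))
      (ren-sound P (λ i → f (there (there (there i)))))
  ren-sound (wth z x P y Q) f rewrite if-ρ z = ≈-trans (∪ₙ-cong
      (plus-ρ (renamed {P = P} (λ e → f (there (here (sym e)))) (ren-sound P (λ i → f (there (there (there (∈-++⁺ˡ i))))))))
      (plus-ρ (renamed {P = Q} (λ e → f (there (there (here (sym e))))) (ren-sound Q (λ i → f (there (there (there (∈-++⁺ʳ (names P) i)))))))))
    (≈-sym (relN-∪ (rename ρ)))
  ren-sound (inl z B x P) f rewrite if-ρ z =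
    plus-ρ (renamed {P = P} (λ e → f (there (here (sym e)))) (ren-sound P (λ i → f (there (there i)))))
  ren-sound (inr z A x P) f rewrite if-ρ z =
    plus-ρ (renamed {P = P} (λ e → f (there (here (sym e)))) (ren-sound P (λ i → f (there (there i)))))

-- Invariance under cut-elimination and axiom-expansion

cut₀ : ℕ → ℕ → SNet Occ → SNet Occ → SNet Occ
cut₀ = cutN (λ n → n) (λ n → n)

flip-sides : ∀ {x y N M N'} → cut₀ y x M N ≈ N' → cut₀ x y N M ≈ N'
flip-sides e = ≈-trans cut-sym e

ax-cut₀ : ∀ {x z y A F Q Δ} → x ≢ z → Q ⊢ (y , F) ∷ Δ → F ≡ dual A → x ∉ names Q →
          cut₀ z y (axNet x z A) ⟦ Q ⟧ ≈ ⟦ ren y x Q ⟧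
ax-cut₀ {x} {z} {y} {A} {Q = Q} x≢z d refl x∉ =
  ≈-trans (cut-ax {A = A} x≢z (λ i → wt-resolved (seq-uniq s) (seq-wt s i) (here refl)))
          (≈-sym (ren-sound y x Q x∉))
  where
  s = adequate d

ax-cut₀' : ∀ {x z y A F Q Δ} → x ≢ z → Q ⊢ (y , F) ∷ Δ → F ≡ A → z ∉ names Q →
           cut₀ x y (axNet x z A) ⟦ Q ⟧ ≈ ⟦ ren y z Q ⟧
ax-cut₀' {A = A} x≢z d refl z∉ =
  ≈-trans (cutN-cong (axNet-sym A) ≈-refl) (ax-cut₀ {A = dual A} (λ e → x≢z (sym e)) d (sym (dual-dual A)) z∉)

typed-uniq : ∀ {P Γ} → P ⊢ Γ → Uniq Γ
typed-uniq d = seq-uniq (adequate d)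

avoids-fresh : ∀ {Q Δ y a} → Q ⊢ Δ → a ∉ names Q → Avoids ⟦ Q ⟧ y (λ n → n) a
avoids-fresh {Q} d f j v l _ e = f (subst (_∈ names Q) e (leaf-names d j v l))

other : ∀ {z F x C} {Γ' Γ : Ctx} → z ≢ x → (z , F) ∷ Γ' ↭ (x , C) ∷ Γ → (x , C) ∈ Γ'
other z≢x p with pull p
... | here refl = ⊥-elim (z≢x refl)
... | there i = i

ax-right : ∀ {x z A C Γ} → ax x z A ⊢ (z , C) ∷ Γ → x ≢ z × C ≡ A
ax-right d with inv-ax d
... | x≢z , p with pull p
...   | here refl = ⊥-elim (x≢z refl)
...   | there (here refl) = x≢z , refl

ax-left : ∀ {x z A C Γ} → ax x z A ⊢ (x , C) ∷ Γ → x ≢ z × C ≡ dual A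
ax-left d with inv-ax d
... | x≢z , p with pull p
...   | here refl = x≢z , refl
...   | there (here refl) = ⊥-elim (x≢z refl)

module _ {Q : Tm} {Δ : Ctx} {x y : ℕ} {C : Fm} (dQ : Q ⊢ Δ) where

  par-out : ∀ {z a b P Γ} → par z a b P ⊢ (x , C) ∷ Γ → z ≢ x → a ∉ names Q → b ∉ names Q →
            cut₀ x y (parN z a b ⟦ P ⟧) ⟦ Q ⟧ ≈ parN z a b (cut₀ x y ⟦ P ⟧ ⟦ Q ⟧)
  par-out d z≢x a∉ b∉ with inv-par d
  ... | _ , _ , _ , dP , fz , p =
    comm-par (λ e → e) (seq-wt (adequate dP)) (typed-uniq dP) fz (other z≢x p) (avoids-fresh dQ a∉) (avoids-fresh dQ b∉)

  single-out : ∀ {z a e A F P Γ Γ'} → P ⊢ (a , A) ∷ Γ' → Fresh z Γ' → (z , F) ∷ Γ' ↭ (x , C) ∷ Γ → z ≢ x →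
               a ∉ names Q → cut₀ x y (plusN z a e ⟦ P ⟧) ⟦ Q ⟧ ≈ plusN z a e (cut₀ x y ⟦ P ⟧ ⟦ Q ⟧)
  single-out dP fz p z≢x a∉ =
    comm-single (λ e → e) (seq-wt (adequate dP)) (proj₁ (typed-uniq dP)) fz (other z≢x p) (avoids-fresh dQ a∉)

  with-out : ∀ {z a b P P' Γ} → wth z a P b P' ⊢ (x , C) ∷ Γ → z ≢ x → a ∉ names Q → b ∉ names Q →
             cut₀ x y (withN z a b ⟦ P ⟧ ⟦ P' ⟧) ⟦ Q ⟧ ≈ withN z a b (cut₀ x y ⟦ P ⟧ ⟦ Q ⟧) (cut₀ x y ⟦ P' ⟧ ⟦ Q ⟧)
  with-out d z≢x a∉ b∉ with inv-wth d
  ... | _ , _ , _ , dP , dP' , fz , p =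
    comm-with (λ e → e) (seq-wt (adequate dP)) (seq-wt (adequate dP')) (proj₁ (typed-uniq dP)) (proj₁ (typed-uniq dP'))
      fz (other z≢x p) (avoids-fresh dQ a∉) (avoids-fresh dQ b∉)

  tens-out₁ : ∀ {z a b P P' Γ} → tens z a P b P' ⊢ (x , C) ∷ Γ → z ≢ x → x ∉ names P' → a ∉ names Q →
              cut₀ x y (tensN z a b ⟦ P ⟧ ⟦ P' ⟧) ⟦ Q ⟧ ≈ tensN z a b (cut₀ x y ⟦ P ⟧ ⟦ Q ⟧) ⟦ P' ⟧
  tens-out₁ d z≢x x∉ a∉ with inv-tens d
  ... | _ , _ , Γ₁ , _ , dP , dP' , ap , fz , p with ∈-++⁻ Γ₁ (other z≢x p)
  ...   | inj₂ i = ⊥-elim (x∉ (∈-names dP' (there i)))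
  ...   | inj₁ i = ≈-trans
    (comm-tens₁ (λ e → e) (seq-wt (adequate dP)) (seq-wt (adequate dP')) (proj₁ (typed-uniq dP)) (proj₁ (typed-uniq dP'))
      ap fz i (avoids-fresh dQ a∉))
    (tensN-cong ≈-refl (relN-id (λ _ _ _ → refl)))

  tens-out₂ : ∀ {z a b P P' Γ} → tens z a P b P' ⊢ (x , C) ∷ Γ → z ≢ x → x ∉ names P → b ∉ names Q →
              cut₀ x y (tensN z a b ⟦ P ⟧ ⟦ P' ⟧) ⟦ Q ⟧ ≈ tensN z a b ⟦ P ⟧ (cut₀ x y ⟦ P' ⟧ ⟦ Q ⟧)
  tens-out₂ d z≢x x∉ b∉ with inv-tens d
  ... | _ , _ , Γ₁ , _ , dP , dP' , ap , fz , p with ∈-++⁻ Γ₁ (other z≢x p)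
  ...   | inj₁ i = ⊥-elim (x∉ (∈-names dP (there i)))
  ...   | inj₂ i = ≈-trans
    (comm-tens₂ (λ e → e) (seq-wt (adequate dP)) (seq-wt (adequate dP')) (proj₁ (typed-uniq dP)) (proj₁ (typed-uniq dP'))
      ap fz i (avoids-fresh dQ b∉))
    (tensN-cong (relN-id (λ _ _ _ → refl)) ≈-refl)

-- The reduct's typing cuts v against R, so v cannot also be a conclusion of the other premise Q.
separate : ∀ {B B₀ y u v Q R U V Θ Γ Ξ} → R ⊢ (u , U) ∷ (v , V) ∷ Θ → Q ⊢ (y , B₀) ∷ Γ →
  cut B y Q u R ⊢ Ξ → ∀ {n A} → (n , A) ∈ Γ → n ≢ v
separate {v = v} {V = V} dR dQ d i refl with inv-cut d
... | Γ' , Δ' , dQ' , dR' , ap , _ with same-names (adequate dR) (adequate dR') (there (here refl))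
                                      | same-names (adequate dQ) (adequate dQ') (there i)
...   | _ , here e | _ = proj₁ (typed-uniq dR) (here (cong (_, V) (sym (cong proj₁ e))))
...   | _ , there j | _ , there k = ap k j
...   | _ , there j | _ , here e = proj₁ (typed-uniq dQ) (subst (λ n → (n , _) ∈ _) (cong proj₁ e) i)

cut-comm : ∀ {B y u Q R Ξ} → cut B y Q u R ⊢ Ξ → cut (dual B) u R y Q ⊢ Ξ
cut-comm {B} {y} {Q = Q} d with inv-cut d
... | Γ , Δ , dQ , dR , ap , p =
  ⊢ex (⊢cut dR (subst (λ F → Q ⊢ (y , F) ∷ Γ) (sym (dual-dual B)) dQ) (apart⇒disj (λ i j → ap j i)))
      (↭-trans (++-comm Δ Γ) p)
  where
  apart⇒disj : ∀ {Γ Δ} → Apart Γ Δ → Disj Γ Δ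
  apart⇒disj {[]} _ = []
  apart⇒disj {(n , A) ∷ Γ} ap = (λ i → let (q , j , e) = ∈-map⁻ proj₁ i in
      ap (here refl) (subst (λ m → (m , proj₂ q) ∈ _) (sym e) j)) ∷ apart⇒disj (λ i j → ap (there i) j)

module _ {z x y w u v : ℕ} {P Q R' : Tm} {Γ Δ : Ctx} where

  ⊗⅋-first : tens z x P y Q ⊢ Γ → par w u v R' ⊢ Δ → ∀ {B Ξ} → cut B y Q u R' ⊢ Ξ →
    cut₀ z w (tensN z x y ⟦ P ⟧ ⟦ Q ⟧) (parN w u v ⟦ R' ⟧) ≈ cut₀ x v ⟦ P ⟧ (cut₀ y u ⟦ Q ⟧ ⟦ R' ⟧)
  ⊗⅋-first d e c with inv-tens d | inv-par e
  ... | _ , _ , Γ₁ , Γ₂ , dP , dQ , ap , fz , _ | _ , _ , Θ , dR , fw , _ =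
    cut-⊗⅋₁ (seq-wt (adequate dP)) (seq-wt (adequate dQ)) (seq-wt (adequate dR))
      (proj₁ (typed-uniq dP)) (proj₁ (typed-uniq dQ)) (typed-uniq dR)
      (λ i → fz (∈-++⁺ˡ i)) (λ i → fz (∈-++⁺ʳ Γ₁ i)) fw (λ _ → refl)
      (λ i → refl , separate dR dQ c i)
      (λ i → refl , fresh-≢ (proj₁ (proj₂ (typed-uniq dR))) i)

  ⊗⅋-second : tens z x P y Q ⊢ Γ → par w u v R' ⊢ Δ → ∀ {A Ξ} → cut A x P v R' ⊢ Ξ →
    cut₀ z w (tensN z x y ⟦ P ⟧ ⟦ Q ⟧) (parN w u v ⟦ R' ⟧) ≈ cut₀ y u ⟦ Q ⟧ (cut₀ x v ⟦ P ⟧ ⟦ R' ⟧)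
  ⊗⅋-second d e c with inv-tens d | inv-par e
  ... | _ , _ , Γ₁ , Γ₂ , dP , dQ , ap , fz , _ | _ , _ , Θ , dR , fw , _ =
    cut-⊗⅋₂ (seq-wt (adequate dP)) (seq-wt (adequate dQ)) (seq-wt (adequate dR))
      (proj₁ (typed-uniq dP)) (proj₁ (typed-uniq dQ)) (typed-uniq dR)
      (λ i → fz (∈-++⁺ˡ i)) (λ i → fz (∈-++⁺ʳ Γ₁ i)) fw (λ _ → refl)
      (λ i → refl , separate (⊢ex dR (swap _ _ ↭-refl)) dP c i)
      (λ i → refl , fresh-≢ (proj₁ (typed-uniq dR)) (there i))

with-inl : ∀ {z x y w u P Q R D Γ Δ} → wth z x P y Q ⊢ Γ → inl w D u R ⊢ Δ →
  cut₀ z w (withN z x y ⟦ P ⟧ ⟦ Q ⟧) (plusN w u false ⟦ R ⟧) ≈ cut₀ y u ⟦ Q ⟧ ⟦ R ⟧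
with-inl d e with inv-wth d | inv-inl e
... | _ , _ , _ , dP , dQ , fz , _ | _ , _ , dR , fw , _ =
  cut-&₂ (seq-wt (adequate dP)) (seq-wt (adequate dQ)) (seq-wt (adequate dR))
    (proj₁ (typed-uniq dP)) (proj₁ (typed-uniq dQ)) (proj₁ (typed-uniq dR)) fz fw

with-inr : ∀ {z x y w u P Q R D Γ Δ} → wth z x P y Q ⊢ Γ → inr w D u R ⊢ Δ →
  cut₀ z w (withN z x y ⟦ P ⟧ ⟦ Q ⟧) (plusN w u true ⟦ R ⟧) ≈ cut₀ x u ⟦ P ⟧ ⟦ R ⟧
with-inr d e with inv-wth d | inv-inr e
... | _ , _ , _ , dP , dQ , fz , _ | _ , _ , dR , fw , _ =
  cut-&₁ (seq-wt (adequate dP)) (seq-wt (adequate dQ)) (seq-wt (adequate dR))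
    (proj₁ (typed-uniq dP)) (proj₁ (typed-uniq dQ)) (proj₁ (typed-uniq dR)) fz fw

ax-other-left : ∀ {x z A a F Γ} → ax x z A ⊢ (a , F) ∷ Γ → a ≢ x → ∃[ B ] ((x , B) ∈ Γ)
ax-other-left d a≢x with inv-ax d
... | _ , p with ∈-resp-↭ p (here refl)
...   | here e = ⊥-elim (a≢x (sym (cong proj₁ e)))
...   | there i = _ , i

ax-other-right : ∀ {x z A a F Γ} → ax x z A ⊢ (a , F) ∷ Γ → a ≢ z → ∃[ B ] ((z , B) ∈ Γ)
ax-other-right d a≢z with inv-ax d
... | _ , p with ∈-resp-↭ p (there (here refl))
...   | here e = ⊥-elim (a≢z (sym (cong proj₁ e)))
...   | there i = _ , i

fresh-clash : ∀ {y n} {Γ : Ctx} → Fresh y Γ → ∃[ B ] ((n , B) ∈ Γ) → y ≢ n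
fresh-clash f (_ , i) refl = f i

η⊗-sound : ∀ {x y A B u v a b Γ} → par x u v (tens y a (ax v a A) b (ax u b B)) ⊢ Γ →
           axNet x y (A ⊗ B) ≈ parN x u v (tensN y a b (axNet v a A) (axNet u b B))
η⊗-sound {a = a} {b} d with inv-par d
... | _ , _ , _ , d₁ , _ , _ with inv-tens d₁
...   | _ , _ , Γ₁ , Γ₂ , e , e' , ap , fz , _ with inv-ax e | inv-ax e'
...     | v≢a , _ | u≢b , _ = η⊗-net (λ q → proj₁ (typed-uniq d₁) (here (cong (_, _) q))) v≢a u≢b
  (fresh-clash (λ {A} i → fz {A} (∈-++⁺ʳ Γ₁ i)) (ax-other-left e' (λ r → u≢b (sym r))))
  (fresh-clash (λ {A} i → fz {A} (∈-++⁺ˡ i)) (ax-other-left e (λ r → v≢a (sym r))))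

η⅋-sound : ∀ {x y A B u v a b Γ} → par y a b (tens x u (ax u b B) v (ax v a A)) ⊢ Γ →
           axNet x y (A ⅋ B) ≈ parN y a b (tensN x u v (axNet u b B) (axNet v a A))
η⅋-sound {A = A} {B} d with inv-par d
... | _ , _ , _ , d₁ , _ , _ with inv-tens d₁
...   | _ , _ , Γ₁ , Γ₂ , e , e' , ap , fz , _ with inv-ax e | inv-ax e'
...     | u≢b , _ | v≢a , _ = ≈-trans (axNet-sym (A ⅋ B)) (≈-trans
  (η⊗-net (λ q → proj₁ (typed-uniq d₁) (here (cong (_, _) q))) (λ q → u≢b (sym q)) (λ q → v≢a (sym q))
    (fresh-clash (λ {A} i → fz {A} (∈-++⁺ʳ Γ₁ i)) (ax-other-right e' v≢a))
    (fresh-clash (λ {A} i → fz {A} (∈-++⁺ˡ i)) (ax-other-right e u≢b)))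
  (wireN-cong _ (tensN-cong (≈-sym (axNet-sym B)) (≈-sym (axNet-sym A)))))

η&-sound : ∀ {x y A B u v a b Γ} → wth y a (inr x (dual B) u (ax u a A)) b (inl x (dual A) v (ax v b B)) ⊢ Γ →
           axNet x y (A & B) ≈ withN y a b (plusN x u true (axNet u a A)) (plusN x v false (axNet v b B))
η&-sound d = let (_ , _ , _ , d₁ , d₂ , _ , _) = inv-wth d ; (_ , Γ₁ , e , f , _) = inv-inr d₁ ; (_ , Γ₂ , e' , f' , _) = inv-inl d₂ ; (u≢a , _) = inv-ax e ; (v≢b , _) = inv-ax e' in
  η&-net u≢a v≢b
    (fresh-clash f (ax-other-right e u≢a))
    (fresh-clash f' (ax-other-right e' v≢b))

η⊕-sound : ∀ {x y A B u v a b Γ} → wth x u (inr y A a (ax u a B)) v (inl y B b (ax v b A)) ⊢ Γ →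
           axNet x y (A ⊕ B) ≈ withN x u v (plusN y a true (axNet u a B)) (plusN y b false (axNet v b A))
η⊕-sound {A = A} {B} d = let (_ , _ , _ , d₁ , d₂ , _ , _) = inv-wth d ; (_ , Γ₁ , e , f , _) = inv-inr d₁ ; (_ , Γ₂ , e' , f' , _) = inv-inl d₂ ; (u≢a , _) = inv-ax e ; (v≢b , _) = inv-ax e' in
  ≈-trans (axNet-sym (A ⊕ B)) (≈-trans
    (η&-net (λ q → u≢a (sym q)) (λ q → v≢b (sym q))
      (fresh-clash f (ax-other-left e (λ r → u≢a (sym r))))
      (fresh-clash f' (ax-other-left e' (λ r → v≢b (sym r)))))
    (withN-cong (wireN-cong _ (≈-sym (axNet-sym B))) (wireN-cong _ (≈-sym (axNet-sym A)))))

module _ {P : Tm} {x x' : ℕ} (x'∉ : x' ∉ names P) where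
  private
    N' = ⟦ ren x x' P ⟧
    r = swapName x x'
    e : N' ≈ relN (rename r) ⟦ P ⟧
    e = ren-sound x x' P x'∉

  α-lab : ∀ {z d Γ} → P ⊢ Γ → LeafHyp ⟦ P ⟧ (λ v → lab x' z d (rename r v) ≡ lab x z d v)
  α-lab {z} {d} dP i (n , p) l with n ≟ x
  ... | yes refl rewrite ρ-hit n x' | lab-hit {n} {z} {d} {p} = lab-hit
  ... | no n≢x rewrite ρ-miss x x' n≢x | lab-miss {x} {z} {d} {n} {p} n≢x =
    lab-miss (λ q → x'∉ (subst (_∈ names P) q (leaf-names dP i (n , p) l)))

  α-plus : ∀ {z d Γ} → P ⊢ Γ → plusN z x d ⟦ P ⟧ ≈ plusN z x' d N'
  α-plus {z} {d} dP = ≈-sym (≈-trans (wireN-cong _ e) (≈-trans (relN-∘ (rename r) (lab x' z d)) (relN-agree (α-lab dP))))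

  α-tens₁ : ∀ {z y M Γ} → P ⊢ Γ → tensN z x y ⟦ P ⟧ M ≈ tensN z x' y N' M
  α-tens₁ {z} {y} dP = ≈-sym (≈-trans (wireN-cong _ (≈-trans (⊎ₙ-cong e relN-as-id) (relN-⊎ (rename r) (λ v → v))))
    (≈-trans (relN-∘ (sum-map (rename r) (λ v → v)) (tensL z x' y))
             (relN-agree λ where (i , _) (inj₁ v) l → α-lab dP i v l
                                 _ (inj₂ v) _ → refl)))

  α-tens₂ : ∀ {z y M Γ} → P ⊢ Γ → tensN z y x M ⟦ P ⟧ ≈ tensN z y x' M N'
  α-tens₂ {z} {y} dP = ≈-sym (≈-trans (wireN-cong _ (≈-trans (⊎ₙ-cong relN-as-id e) (relN-⊎ (λ v → v) (rename r))))
    (≈-trans (relN-∘ (sum-map (λ v → v) (rename r)) (tensL z y x'))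
             (relN-agree λ where (_ , i) (inj₂ v) l → α-lab dP i v l
                                 _ (inj₁ v) _ → refl)))

  α-cut : ∀ {y M Γ} → P ⊢ Γ → cut₀ x y ⟦ P ⟧ M ≈ cut₀ x' y N' M
  α-cut {y} {M} dP = ≈-sym (≈-trans (cutN-cong e ≈-refl)
    (≈-trans (subst (λ k → cut₀ k y (relN (rename r) ⟦ P ⟧) M ≈ cutN r (λ n → n) x y ⟦ P ⟧ M) (ρ-hit x x')
               (cut-rename {f = λ n → n} {h = r} only))
             (cut-agree (λ _ v _ n → ρ-miss x x' n) (λ _ _ _ _ → refl))))
    where
    only : LeafHyp ⟦ P ⟧ (λ v → r (proj₁ v) ≡ r x → proj₁ v ≡ x)
    only i (n , p) l q with n ≟ x
    ... | yes n≡x = n≡x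
    ... | no n≢x = ⊥-elim (x'∉ (subst (_∈ names P)
      (trans (sym (ρ-miss x x' n≢x)) (trans q (ρ-hit x x'))) (leaf-names dP i (n , p) l)))

  α-par₁ : ∀ {z y Γ A B} → P ⊢ (x , A) ∷ (y , B) ∷ Γ → parN z x y ⟦ P ⟧ ≈ parN z x' y N'
  α-par₁ {z} {y} dP = ≈-sym (≈-trans (wireN-cong _ e) (≈-trans (relN-∘ (rename r) (lab₂ x' y z)) (relN-agree go)))
    where
    y≢x' : y ≢ x'
    y≢x' q = x'∉ (subst (_∈ names P) q (∈-names dP (there (here refl))))
    go : LeafHyp ⟦ P ⟧ (λ v → lab₂ x' y z (rename r v) ≡ lab₂ x y z v)
    go i (n , p) l with n ≟ x
    ... | yes refl rewrite ρ-hit n x' | lab₂-left {n} {y} {z} {p} = lab₂-left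
    ... | no n≢x with n ≟ y
    ...   | yes refl rewrite ρ-miss x x' n≢x | lab₂-right {x} {n} {z} {p} n≢x = lab₂-right y≢x'
    ...   | no n≢y rewrite ρ-miss x x' n≢x | lab₂-miss {x} {y} {z} {n} {p} n≢x n≢y =
      lab₂-miss (λ q → x'∉ (subst (_∈ names P) q (leaf-names dP i (n , p) l))) n≢y

  α-par₂ : ∀ {z y Γ A B} → P ⊢ (y , A) ∷ (x , B) ∷ Γ → parN z y x ⟦ P ⟧ ≈ parN z y x' N'
  α-par₂ {z} {y} dP = ≈-sym (≈-trans (wireN-cong _ e) (≈-trans (relN-∘ (rename r) (lab₂ y x' z)) (relN-agree go)))
    where
    y≢x' : y ≢ x'
    y≢x' q = x'∉ (subst (_∈ names P) q (∈-names dP (here refl)))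
    x≢y : x ≢ y
    x≢y = fresh-≢ (proj₁ (typed-uniq dP)) (here refl)
    go : LeafHyp ⟦ P ⟧ (λ v → lab₂ y x' z (rename r v) ≡ lab₂ y x z v)
    go i (n , p) l with n ≟ x
    ... | yes refl rewrite ρ-hit n x' | lab₂-right {y} {n} {z} {p} x≢y = lab₂-right (λ q → y≢x' (sym q))
    ... | no n≢x with n ≟ y
    ...   | yes refl rewrite ρ-miss x x' n≢x | lab₂-left {n} {x} {z} {p} = lab₂-left
    ...   | no n≢y rewrite ρ-miss x x' n≢x | lab₂-miss {y} {x} {z} {n} {p} n≢y n≢x =
      lab₂-miss n≢y (λ q → x'∉ (subst (_∈ names P) q (leaf-names dP i (n , p) l)))

-- r is let-bound so that its type is inferred before it is compared with the goal, without unfolding nets.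
step-sound : ∀ {P Q Γ Δ} → Step P Q → P ⊢ Γ → Q ⊢ Δ → ⟦ P ⟧ ≈ ⟦ Q ⟧
step-sound (ax-l {A = A} f) d e with inv-cut d
... | _ , _ , dx , dQ , _ with ax-right dx
...   | x≢z , refl = ax-cut₀ {A = A} x≢z dQ refl f
step-sound (ax-l' {A = A} f) d e with inv-cut d
... | _ , _ , dx , dQ , _ with ax-left dx
...   | x≢z , refl = ax-cut₀' {A = A} x≢z dQ (dual-dual A) f
step-sound (ax-r {C} {A} f) d e with inv-cut d
... | _ , _ , dQ , dx , _ with ax-right dx
...   | x≢z , refl = flip-sides (ax-cut₀ {A = A} x≢z dQ (sym (dual-dual C)) f)
step-sound (ax-r' {C} {A} f) d e with inv-cut d
... | _ , _ , dQ , dx , _ with ax-left dx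
...   | x≢z , q = flip-sides (ax-cut₀' {A = A} x≢z dQ (trans (sym (dual-dual C)) (trans (cong dual q) (dual-dual A))) f)
step-sound ⊗⅋₁ d e = let (_ , _ , d₁ , d₂ , _) = inv-cut d ; (_ , _ , _ , c , _) = inv-cut e ; r = ⊗⅋-first d₁ d₂ c in r
step-sound ⊗⅋₂ d e = let (_ , _ , d₁ , d₂ , _) = inv-cut d ; (_ , _ , _ , c , _) = inv-cut e ; r = ⊗⅋-second d₁ d₂ c in r
step-sound ⅋⊗₁ d e = let (_ , _ , d₁ , d₂ , _) = inv-cut d ; (_ , _ , c , _) = inv-cut e ; r = ⊗⅋-first d₂ d₁ (cut-comm c) in
  flip-sides (≈-trans r (≈-trans cut-sym (cutN-cong cut-sym ≈-refl)))
step-sound ⅋⊗₂ d e = let (_ , _ , d₁ , d₂ , _) = inv-cut d ; (_ , _ , c , _) = inv-cut e ; r = ⊗⅋-second d₂ d₁ (cut-comm c) in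
  flip-sides (≈-trans r (≈-trans cut-sym (cutN-cong cut-sym ≈-refl)))
step-sound &inl d e = let (_ , _ , d₁ , d₂ , _) = inv-cut d ; r = with-inl d₁ d₂ in r
step-sound &inr d e = let (_ , _ , d₁ , d₂ , _) = inv-cut d ; r = with-inr d₁ d₂ in r
step-sound inl& d e = let (_ , _ , d₁ , d₂ , _) = inv-cut d ; r = with-inl d₂ d₁ in flip-sides (≈-trans r cut-sym)
step-sound inr& d e = let (_ , _ , d₁ , d₂ , _) = inv-cut d ; r = with-inr d₂ d₁ in flip-sides (≈-trans r cut-sym)
step-sound (parL n f g) d e = let (_ , _ , d₁ , d₂ , _) = inv-cut d ; r = par-out d₂ d₁ n f g in r
step-sound (tensL₁ n f g) d e = let (_ , _ , d₁ , d₂ , _) = inv-cut d ; r = tens-out₁ d₂ d₁ n f g in r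
step-sound (tensL₂ n f g) d e = let (_ , _ , d₁ , d₂ , _) = inv-cut d ; r = tens-out₂ d₂ d₁ n f g in r
step-sound (wthL n f g) d e = let (_ , _ , d₁ , d₂ , _) = inv-cut d ; r = with-out d₂ d₁ n f g in r
step-sound (inlL n f) d e = let (_ , _ , d₁ , d₂ , _) = inv-cut d ; (_ , _ , dP , fz , p) = inv-inl d₁ ; r = single-out d₂ dP fz p n f in r
step-sound (inrL n f) d e = let (_ , _ , d₁ , d₂ , _) = inv-cut d ; (_ , _ , dP , fz , p) = inv-inr d₁ ; r = single-out d₂ dP fz p n f in r
step-sound (parR n f g) d e = let (_ , _ , d₁ , d₂ , _) = inv-cut d ; r = par-out d₁ d₂ n f g in flip-sides (≈-trans r (wireN-cong _ cut-sym))
step-sound (tensR₁ n f g) d e = let (_ , _ , d₁ , d₂ , _) = inv-cut d ; r = tens-out₁ d₁ d₂ n f g in flip-sides (≈-trans r (tensN-cong cut-sym ≈-refl))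
step-sound (tensR₂ n f g) d e = let (_ , _ , d₁ , d₂ , _) = inv-cut d ; r = tens-out₂ d₁ d₂ n f g in flip-sides (≈-trans r (tensN-cong ≈-refl cut-sym))
step-sound (wthR n f g) d e = let (_ , _ , d₁ , d₂ , _) = inv-cut d ; r = with-out d₁ d₂ n f g in flip-sides (≈-trans r (withN-cong cut-sym cut-sym))
step-sound (inlR n f) d e = let (_ , _ , d₁ , d₂ , _) = inv-cut d ; (_ , _ , dP , fz , p) = inv-inl d₂ ; r = single-out d₁ dP fz p n f in
  flip-sides (≈-trans r (wireN-cong _ cut-sym))
step-sound (inrR n f) d e = let (_ , _ , d₁ , d₂ , _) = inv-cut d ; (_ , _ , dP , fz , p) = inv-inr d₂ ; r = single-out d₁ dP fz p n f in
  flip-sides (≈-trans r (wireN-cong _ cut-sym))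
step-sound (η⊗ u v a b) d e = η⊗-sound e
step-sound (η⅋ u v a b) d e = η⅋-sound e
step-sound (η& u v a b) d e = η&-sound e
step-sound (η⊕ u v a b) d e = η⊕-sound e
step-sound (axsym {A = A}) d e = axNet-sym A
step-sound (αcut₁ {P = P} f) d e = let (_ , _ , d₁ , _) = inv-cut d in α-cut {P} f d₁
step-sound (αcut₂ {Q = Q} f) d e = let (_ , _ , _ , d₂ , _) = inv-cut d in flip-sides (≈-trans (α-cut {Q} f d₂) cut-sym)
step-sound (αtens₁ {P = P} f) d e = let (_ , _ , _ , _ , d₁ , _) = inv-tens d in α-tens₁ {P} f d₁
step-sound (αtens₂ {Q = Q} f) d e = let (_ , _ , _ , _ , _ , d₂ , _) = inv-tens d in α-tens₂ {Q} f d₂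
step-sound (αpar₁ {P = P} f) d e = let (_ , _ , _ , d₁ , _) = inv-par d in α-par₁ {P} f d₁
step-sound (αpar₂ {P = P} f) d e = let (_ , _ , _ , d₁ , _) = inv-par d in α-par₂ {P} f d₁
step-sound (αwth₁ {P = P} f) d e = let (_ , _ , _ , d₁ , _) = inv-wth d in ∪ₙ-cong (α-plus {P} f d₁) ≈-refl
step-sound (αwth₂ {Q = Q} f) d e = let (_ , _ , _ , _ , d₂ , _) = inv-wth d in ∪ₙ-cong ≈-refl (α-plus {Q} f d₂)
step-sound (αinl {P = P} f) d e = let (_ , _ , d₁ , _) = inv-inl d in α-plus {P} f d₁
step-sound (αinr {P = P} f) d e = let (_ , _ , d₁ , _) = inv-inr d in α-plus {P} f d₁
step-sound (c-cut₁ s) d e = let (_ , _ , d₁ , _) = inv-cut d ; (_ , _ , e₁ , _) = inv-cut e in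
  cutN-cong (step-sound s d₁ e₁) ≈-refl
step-sound (c-cut₂ s) d e = let (_ , _ , _ , d₂ , _) = inv-cut d ; (_ , _ , _ , e₂ , _) = inv-cut e in
  cutN-cong ≈-refl (step-sound s d₂ e₂)
step-sound (c-tens₁ s) d e = let (_ , _ , _ , _ , d₁ , _) = inv-tens d ; (_ , _ , _ , _ , e₁ , _) = inv-tens e in
  tensN-cong (step-sound s d₁ e₁) ≈-refl
step-sound (c-tens₂ s) d e = let (_ , _ , _ , _ , _ , d₂ , _) = inv-tens d ; (_ , _ , _ , _ , _ , e₂ , _) = inv-tens e in
  tensN-cong ≈-refl (step-sound s d₂ e₂)
step-sound (c-par s) d e = let (_ , _ , _ , d₁ , _) = inv-par d ; (_ , _ , _ , e₁ , _) = inv-par e in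
  wireN-cong _ (step-sound s d₁ e₁)
step-sound (c-wth₁ s) d e = let (_ , _ , _ , d₁ , _) = inv-wth d ; (_ , _ , _ , e₁ , _) = inv-wth e in
  withN-cong (step-sound s d₁ e₁) ≈-refl
step-sound (c-wth₂ s) d e = let (_ , _ , _ , _ , d₂ , _) = inv-wth d ; (_ , _ , _ , _ , e₂ , _) = inv-wth e in
  withN-cong ≈-refl (step-sound s d₂ e₂)
step-sound (c-inl s) d e = let (_ , _ , d₁ , _) = inv-inl d ; (_ , _ , e₁ , _) = inv-inl e in
  wireN-cong _ (step-sound s d₁ e₁)
step-sound (c-inr s) d e = let (_ , _ , d₁ , _) = inv-inr d ; (_ , _ , e₁ , _) = inv-inr e in
  wireN-cong _ (step-sound s d₁ e₁)

conv-sound : ∀ {Γ P Q} → Conv Γ P Q → ⟦ P ⟧ ≈ ⟦ Q ⟧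
conv-sound (conv-refl _) = ≈-refl
conv-sound (conv-step d e s) = step-sound s d e
conv-sound (conv-sym c) = ≈-sym (conv-sound c)
conv-sound (conv-trans c c') = ≈-trans (conv-sound c) (conv-sound c')

-- Switching cycles

private
  variable
    X Y : Set

unique-resp-↭ : ∀ {xs ys : List X} → xs ↭ ys → Unique xs → Unique ys
unique-resp-↭ _↭_.refl u = u
unique-resp-↭ (prep x p) (a ∷ u) = All-resp-↭ p a ∷ unique-resp-↭ p u
unique-resp-↭ (swap x y p) ((x≢y ∷ a) ∷ b ∷ u) =
  ((λ e → x≢y (sym e)) ∷ All-resp-↭ p b) ∷ All-resp-↭ p a ∷ unique-resp-↭ p u
unique-resp-↭ (_↭_.trans p q) u = unique-resp-↭ q (unique-resp-↭ p u)

unique-map⁻ : ∀ {f : X → Y} {xs} → Unique (map f xs) → Unique xs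
unique-map⁻ {f = f} u = AllPairsM.map (λ n e → n (cong f e)) (AllPairsP.map⁻ u)

unique-∉ : ∀ {x : X} {xs} → Unique (x ∷ xs) → x ∉ xs
unique-∉ (a ∷ _) i = AllM.lookup a i refl

Steps : Set
Steps = List (Edge × Vertex)

edges : Steps → List Edge
edges = map proj₁

stops : Steps → List Vertex
stops = map proj₂

walk-++ : ∀ {E : Edge → Set} {u w xs ys} → Walk E u (xs ++ ys) w → ∃[ m ] (Walk E u xs m × Walk E m ys w)
walk-++ {xs = []} p = _ , refl , p
walk-++ {xs = _ ∷ xs} (e , j , p) = let (m , q , r) = walk-++ {xs = xs} p in m , (e , j , q) , r

walk-join : ∀ {E : Edge → Set} {u m w xs ys} → Walk E u xs m → Walk E m ys w → Walk E u (xs ++ ys) w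
walk-join {xs = []} refl q = q
walk-join {xs = _ ∷ xs} (e , j , p) q = e , j , walk-join {xs = xs} p q

walk-edge : ∀ {E : Edge → Set} {u w xs e} → Walk E u xs w → e ∈ edges xs → E e
walk-edge {xs = _ ∷ _} (x , _ , _) (here refl) = x
walk-edge {xs = _ ∷ xs} (_ , _ , p) (there i) = walk-edge {xs = xs} p i

joins-stop : ∀ e {u v w} → Joins e u v → w ≡ proj₁ (endpoints e) ⊎ w ≡ proj₂ (endpoints e) → w ≡ u ⊎ w ≡ v
joins-stop _ (inj₁ (p , q)) (inj₁ r) = inj₁ (trans r (sym p))
joins-stop _ (inj₁ (p , q)) (inj₂ r) = inj₂ (trans r (sym q))
joins-stop _ (inj₂ (p , q)) (inj₁ r) = inj₂ (trans r (sym q))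
joins-stop _ (inj₂ (p , q)) (inj₂ r) = inj₁ (trans r (sym p))

record Rotated (E : Edge → Set) (c : Cycle E) (v : Vertex) : Set where
  field
    last-edge : Edge
    front     : Steps
    rot-walk  : Walk E v (front ++ (last-edge , v) ∷ []) v
    rot-↭     : front ++ (last-edge , v) ∷ [] ↭ steps c

∈-split : ∀ {v} {xs : Steps} → v ∈ stops xs → ∃[ as ] ∃[ e ] ∃[ bs ] (xs ≡ as ++ (e , v) ∷ bs)
∈-split {xs = (e , _) ∷ xs} (here refl) = [] , e , xs , refl
∈-split {xs = x ∷ xs} (there i) = let (as , e , bs , q) = ∈-split i in x ∷ as , e , bs , cong (x ∷_) q

rotate : ∀ {E : Edge → Set} (c : Cycle E) {v} → v ∈ stops (steps c) → Rotated E c v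
rotate {E} c {v} i with ∈-split i
... | as , e , bs , q = record
  { last-edge = e ; front = bs ++ as
  ; rot-walk = walk
  ; rot-↭ = ↭-trans (↭-reflexive (++-assoc bs as _)) (↭-trans (++-comm bs (as ++ (e , v) ∷ []))
      (↭-reflexive (trans (++-assoc as _ bs) (sym q)))) }
  where
  walk : Walk E v ((bs ++ as) ++ (e , v) ∷ []) v
  walk with walk-++ {xs = as} (subst (λ xs → Walk E (start c) xs (start c)) q (closed c))
  ... | m , p , (x , j , r) = subst (λ xs → Walk E v xs v) (sym (++-assoc bs as _))
    (walk-join {xs = bs} r (walk-join {xs = as} p (x , j , refl)))

_≟ˡ_ : (p q : List Bool) → Dec (p ≡ q)
_≟ˡ_ = ListP.≡-dec _≟ᵇ_

_≟ʳ_ : (r s : Root) → Dec (r ≡ s)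
concl i ≟ʳ concl j with i ≟ j
... | yes refl = yes refl
... | no n = no λ { refl → n refl }
cutside c s ≟ʳ cutside d t with c ≟ˡ d | s ≟ᵇ t
... | yes refl | yes refl = yes refl
... | no n | _ = no λ { refl → n refl }
... | _ | no n = no λ { refl → n refl }
concl _ ≟ʳ cutside _ _ = no λ ()
cutside _ _ ≟ʳ concl _ = no λ ()

_≟ᵛ_ : (v w : Vertex) → Dec (v ≡ w)
_≟ᵛ_ = ProdP.≡-dec _≟ʳ_ _≟ˡ_

_≟ᵏ_ : (a b : Link) → Dec (a ≡ b)
lk p q ≟ᵏ lk p' q' with p ≟ᵛ p' | q ≟ᵛ q'
... | yes refl | yes refl = yes refl
... | no n | _ = no λ { refl → n refl }
... | _ | no n = no λ { refl → n refl }

same? : (λ₁ λ₂ : Linking) → Dec (SameLinking λ₁ λ₂)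
same? λ₁ λ₂ with AllM.all? (λ a → DecMem._∈?_ _≟ᵏ_ a λ₂) λ₁ | AllM.all? (λ a → DecMem._∈?_ _≟ᵏ_ a λ₁) λ₂
... | yes p | yes q = yes λ a → mk⇔ (AllM.lookup p) (AllM.lookup q)
... | no n | _ = no λ s → n (AllM.tabulate λ {a} i → Equivalence.to (s a) i)
... | _ | no n = no λ s → n (AllM.tabulate λ {a} i → Equivalence.from (s a) i)

same-refl : ∀ {λ₁} → SameLinking λ₁ λ₁
same-refl a = mk⇔ (λ i → i) (λ i → i)

same-sym : ∀ {λ₁ λ₂} → SameLinking λ₁ λ₂ → SameLinking λ₂ λ₁
same-sym s a = mk⇔ (Equivalence.from (s a)) (Equivalence.to (s a))

leaves-pos : ∀ {a λ₀} → a ∈ λ₀ → pos a ∈ leaves λ₀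
leaves-pos i = ∈-concatMap⁺ ends (lose i (here refl))
leaves-neg : ∀ {a λ₀} → a ∈ λ₀ → neg a ∈ leaves λ₀
leaves-neg i = ∈-concatMap⁺ ends (lose i (there (here refl)))

leaves⁻ : ∀ {v λ₀} → v ∈ leaves λ₀ → ∃[ a ] (a ∈ λ₀ × v ∈ ends a)
leaves⁻ {λ₀ = λ₀} i = find (∈-concatMap⁻ ends {xs = λ₀} i)

leaves-ends : ∀ {v a λ₀} → a ∈ λ₀ → v ∈ ends a → v ∈ leaves λ₀
leaves-ends i (here refl) = leaves-pos i
leaves-ends i (there (here refl)) = leaves-neg i

mapl : (Vertex → Vertex) → Linking → Linking
mapl f = map (mapLink f)

DisjointLinks : Linking → Set
DisjointLinks λ₀ = ∀ a b v → a ∈ λ₀ → b ∈ λ₀ → v ∈ ends a → v ∈ ends b → a ≡ b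

below-root : Vertex → List Bool → Vertex
below-root (r , p) q = r , p ++ q

unique-inj : ∀ {f : X → Y} {xs x y} → Unique (map f xs) → x ∈ xs → y ∈ xs → f x ≡ f y → x ≡ y
unique-inj u (here refl) (here refl) _ = refl
unique-inj {f = f} {_ ∷ xs} u (here refl) (there j) q = ⊥-elim (unique-∉ u (subst (_∈ map f xs) (sym q) (∈-map⁺ f j)))
unique-inj {f = f} {_ ∷ xs} u (there i) (here refl) q = ⊥-elim (unique-∉ u (subst (_∈ map f xs) q (∈-map⁺ f i)))
unique-inj (_ ∷ u) (there i) (there j) q = unique-inj u i j q

P1At : CutSeq → (Vertex → Bool) → Net → Set
P1At S ρ θ = ∃[ λ₀ ] (λ₀ ∈ θ × OnAmp S ρ λ₀ × (∀ λ₁ → λ₁ ∈ θ → OnAmp S ρ λ₁ → SameLinking λ₁ λ₀))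

-- Combination of two nets under embeddings e false, e true of their forests into a larger one;
-- Rt singles out the vertex (if any) added by the rule.
module Join
  (S₀ : Bool → CutSeq) (S : CutSeq) (e : Bool → Vertex → Vertex) (Sc : Bool → Root → Set) (Rt : Vertex → Set)
  (e-++ : ∀ i v q → Sc i (proj₁ v) → e i (below-root v q) ≡ below-root (e i v) q)
  (e-inj : ∀ {i j v w} → Sc i (proj₁ v) → Sc j (proj₁ w) → e i v ≡ e j w → _≡_ {A = Bool × Vertex} (i , v) (j , w))
  (e-lab : ∀ {i v} → Sc i (proj₁ v) → vfm S (e i v) ≡ vfm (S₀ i) v)
  (lift : ∀ {i l} → Sc i (proj₁ l) → ∀ W d q → e i l ≡ below-root W (d ∷ q) →
          (∃[ v ] (proj₁ v ≡ proj₁ l × W ≡ e i v × l ≡ below-root v (d ∷ q))) ⊎ Rt W)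
  (rt-off : ∀ {i v} → Sc i (proj₁ v) → ¬ Rt (e i v))
  (rt-uniq : ∀ {v w} → Rt v → Rt w → v ≡ w)
  (no-cutside : ∀ {i l c s} → Sc i (proj₁ l) → proj₁ (e i l) ≢ cutside c s)
  (sc-concl : ∀ {i c s} → ¬ Sc i (cutside c s))
  where

  Pair : Set
  Pair = Bool → Linking

  comb : Pair → Linking
  comb f = mapl (e false) (f false) ++ mapl (e true) (f true)

  comb-∈⁺ : ∀ f i {a} → a ∈ f i → mapLink (e i) a ∈ comb f
  comb-∈⁺ f false k = ∈-++⁺ˡ (∈-map⁺ _ k)
  comb-∈⁺ f true k = ∈-++⁺ʳ (mapl (e false) (f false)) (∈-map⁺ _ k)

  comb-∈⁻ : ∀ {f b} → b ∈ comb f → ∃[ i ] ∃[ a ] (a ∈ f i × b ≡ mapLink (e i) a)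
  comb-∈⁻ {f} k with ∈-++⁻ (mapl (e false) (f false)) k
  ... | inj₁ k' = let (a , j , q) = ∈-map⁻ _ k' in false , a , j , q
  ... | inj₂ k' = let (a , j , q) = ∈-map⁻ _ k' in true , a , j , q

  ends-map⁻ : ∀ (f : Vertex → Vertex) {a v} → v ∈ ends (mapLink f a) → ∃[ l ] (l ∈ ends a × v ≡ f l)
  ends-map⁻ f (here refl) = _ , here refl , refl
  ends-map⁻ f (there (here refl)) = _ , there (here refl) , refl

  ends-map⁺ : ∀ {f : Vertex → Vertex} {a l} → l ∈ ends a → f l ∈ ends (mapLink f a)
  ends-map⁺ (here refl) = here refl
  ends-map⁺ (there (here refl)) = there (here refl)

  comb-leaf⁺ : ∀ {f} i {l} → l ∈ leaves (f i) → e i l ∈ leaves (comb f)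
  comb-leaf⁺ {f} i k = let (a , j , m) = leaves⁻ {λ₀ = f i} k in leaves-ends {λ₀ = comb f} (comb-∈⁺ f i j) (ends-map⁺ {e i} {a} m)

  comb-leaf⁻ : ∀ {f v} → v ∈ leaves (comb f) → ∃[ i ] ∃[ l ] (l ∈ leaves (f i) × v ≡ e i l)
  comb-leaf⁻ {f} k with leaves⁻ {λ₀ = comb f} k
  ... | b , j , m with comb-∈⁻ {f} j
  ...   | i , a , j' , refl = let (l , n , q) = ends-map⁻ (e i) m in i , l , leaves-ends j' n , q

  Scoped : Pair → Set
  Scoped f = ∀ i {l} → l ∈ leaves (f i) → Sc i (proj₁ l)

  same-comb : ∀ {f g} → (∀ i → SameLinking (f i) (g i)) → SameLinking (comb f) (comb g)
  same-comb {f} {g} s b = mk⇔ (to' f g s) (to' g f (λ i → same-sym (s i)))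
    where
    to' : ∀ f g → (∀ i → SameLinking (f i) (g i)) → b ∈ comb f → b ∈ comb g
    to' f g s k with comb-∈⁻ {f} k
    ... | i , a , j , refl = comb-∈⁺ g i (Equivalence.to (s i a) j)

  disjoint-comb : ∀ {f} → Scoped f → (∀ i → DisjointLinks (f i)) → DisjointLinks (comb f)
  disjoint-comb {f} sc d a b v ia ib ma mb with comb-∈⁻ {f} ia | comb-∈⁻ {f} ib
  ... | i , a' , ja , refl | j , b' , jb , refl with ends-map⁻ (e i) ma | ends-map⁻ (e j) mb
  ...   | l , na , q | l' , nb , q' with e-inj {i} {j} {l} {l'} (sc i (leaves-ends ja na)) (sc j (leaves-ends jb nb)) (trans (sym q) q')
  ...     | refl = cong (mapLink (e i)) (d i a' b' l ja jb na nb)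

  module _ (Λp : List Pair) (sc : ∀ {f} → f ∈ Λp → Scoped f) where

    proj : Bool → List Linking
    proj i = map (λ f → f i) Λp

    Λ' : List Linking
    Λ' = map comb Λp

    vert-scope : ∀ {i v} → Vert (proj i) v → Sc i (proj₁ v)
    vert-scope {i} (_ , m , q , k) with ∈-map⁻ _ m
    ... | f , j , refl = sc j i k

    vert⁺ : ∀ {i v} → Vert (proj i) v → Vert Λ' (e i v)
    vert⁺ {i} {v} V@(_ , m , q , k) with ∈-map⁻ _ m
    ... | f , j , refl = comb f , ∈-map⁺ _ j , q ,
      subst (_∈ leaves (comb f)) (e-++ i v q (vert-scope V)) (comb-leaf⁺ {f} i k)

    e-▹ : ∀ {i v d} → Sc i (proj₁ v) → e i (v ▹ d) ≡ e i v ▹ d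
    e-▹ {i} {v} {d} s = e-++ i v (d ∷ []) s

    vert⁻ : ∀ {W d} → Vert Λ' (W ▹ d) →
            (∃[ i ] ∃[ v ] (W ≡ e i v × Sc i (proj₁ v) × Vert (proj i) (v ▹ d))) ⊎ Rt W
    vert⁻ {W} {d} (_ , m , q , k) with ∈-map⁻ _ m
    ... | f , j , refl with comb-leaf⁻ {f} (subst (λ p → (proj₁ W , p) ∈ leaves (comb f)) (++-assoc (proj₂ W) (d ∷ []) q) k)
    ...   | i , l , k' , eq with lift (sc j i k') W d q (sym eq)
    ...     | inj₂ r = inj₂ r
    ...     | inj₁ (v , p , p' , p'') = inj₁ (i , v , p' , subst (Sc i) (sym p) (sc j i k') ,
      (f i , ∈-map⁺ _ j , q , subst (_∈ leaves (f i))
        (trans p'' (cong (proj₁ v ,_) (sym (++-assoc (proj₂ v) (d ∷ []) q)))) k'))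

    with⁺ : ∀ {i v} → Sc i (proj₁ v) → IsWith (S₀ i) v → IsWith S (e i v)
    with⁺ s (A , B , q) = A , B , trans (e-lab s) q

    with⁻ : ∀ {i v} → Sc i (proj₁ v) → IsWith S (e i v) → IsWith (S₀ i) v
    with⁻ s (A , B , q) = A , B , trans (sym (e-lab s)) q

    toggles⁺ : ∀ {i W} → Toggles (S₀ i) (proj i) W → Toggles S Λ' (e i W)
    toggles⁺ {i} {W} (w , V₀ , V₁) =
      with⁺ (vert-scope V₀) w ,
      subst (Vert Λ') (e-▹ {i} {W} (vert-scope V₀)) (vert⁺ V₀) , subst (Vert Λ') (e-▹ {i} {W} (vert-scope V₁)) (vert⁺ V₁)

    toggles⁻ : ∀ {W'} → Toggles S Λ' W' → ¬ Rt W' →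
               ∃[ i ] ∃[ W ] (W' ≡ e i W × Sc i (proj₁ W) × Toggles (S₀ i) (proj i) W)
    toggles⁻ {W'} (w , V₀ , V₁) nr with vert⁻ {W'} V₀ | vert⁻ {W'} V₁
    ... | inj₂ r | _ = ⊥-elim (nr r)
    ... | _ | inj₂ r = ⊥-elim (nr r)
    ... | inj₁ (i , W , refl , s , V₀') | inj₁ (j , W₁ , q , s₁ , V₁') with e-inj {i} {j} {W} {W₁} s s₁ q
    ...   | refl = i , W , refl , s , with⁻ s w , V₀' , V₁'

  emap : Bool → Edge → Edge
  emap i (tree v d) = tree (e i v) d
  emap i (link a) = link (mapLink (e i) a)
  emap i (jump l W) = jump (e i l) (e i W)
  emap i (cutE c) = cutE c

  ScE : Bool → Edge → Set
  ScE i (tree v d) = Sc i (proj₁ v)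
  ScE i (link a) = Sc i (proj₁ (pos a)) × Sc i (proj₁ (neg a))
  ScE i (jump l W) = Sc i (proj₁ l) × Sc i (proj₁ W)
  ScE i (cutE c) = ⊥

  endpoints-emap : ∀ i E → ScE i E →
    (proj₁ (endpoints (emap i E)) ≡ e i (proj₁ (endpoints E)) × Sc i (proj₁ (proj₁ (endpoints E)))) ×
    (proj₂ (endpoints (emap i E)) ≡ e i (proj₂ (endpoints E)) × Sc i (proj₁ (proj₂ (endpoints E))))
  endpoints-emap i (tree v d) s = (sym (e-++ i v (d ∷ []) s) , s) , (refl , s)
  endpoints-emap i (link a) (s , t) = (refl , s) , (refl , t)
  endpoints-emap i (jump l W) (s , t) = (refl , s) , (refl , t)

  SameIfUntoggled : List Pair → Set
  SameIfUntoggled Λp = ∀ {f g} → f ∈ Λp → g ∈ Λp → ∀ i →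
    (∀ W → ¬ Toggles (S₀ i) (f i ∷ g i ∷ []) W) → SameLinking (f i) (g i)

  RootUntoggled : List Pair → Set
  RootUntoggled Λp = ∀ {W} → Rt W → ¬ Toggles S (map comb Λp) W

  module _ (Λp : List Pair) (sc : ∀ {f} → f ∈ Λp → Scoped f) (same : SameIfUntoggled Λp)
           (rt : ∀ {f g} → f ∈ Λp → g ∈ Λp → RootUntoggled (f ∷ g ∷ [])) where
    private
      pick₂ : ∀ {f g h} → f ∈ Λp → g ∈ Λp → h ∈ f ∷ g ∷ [] → Scoped h
      pick₂ i j (here refl) = sc i
      pick₂ i j (there (here refl)) = sc j

    -- A jump never crosses components: if the toggled & lies in the other component,
    -- the linkings restricted to this one toggle nothing, hence coincide.
    depends⁻ : ∀ {a' W'} → DependsOn S (Λ' Λp sc) a' W' →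
      ∃[ i ] ∃[ a ] ∃[ W ] (a' ≡ mapLink (e i) a × W' ≡ e i W × Sc i (proj₁ W) × DependsOn (S₀ i) (proj Λp sc i) a W)
    depends⁻ {a'} {W'} (_ , _ , m₁ , m₂ , ia , na , tg , un) with ∈-map⁻ _ m₁ | ∈-map⁻ _ m₂
    ... | f , jf , refl | g , jg , refl with comb-∈⁻ {f} ia | toggles⁻ (f ∷ g ∷ []) (pick₂ jf jg) tg (λ r → rt jf jg r tg)
    ...   | i , a , ka , refl | j , W , refl , s , tgW with i ≟ᵇ j
    ...     | yes refl = i , a , W , refl , refl , s ,
      (f i , g i , ∈-map⁺ _ jf , ∈-map⁺ _ jg , ka , (λ k → na (comb-∈⁺ g i k)) , tgW ,
       λ W₂ t → cong proj₂ (e-inj {v = W₂} {W} (vert-scope (f ∷ g ∷ []) (pick₂ jf jg) {i} (proj₁ (proj₂ t))) s (un (e i W₂) (toggles⁺ (f ∷ g ∷ []) (pick₂ jf jg) {i} t))))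
    ...     | no i≢j = ⊥-elim (na (comb-∈⁺ g i (Equivalence.to (same jf jg i none a) ka)))
      where
      none : ∀ W₂ → ¬ Toggles (S₀ i) (f i ∷ g i ∷ []) W₂
      none W₂ t = i≢j (cong proj₁ (e-inj {v = W₂} {W} (vert-scope (f ∷ g ∷ []) (pick₂ jf jg) {i} (proj₁ (proj₂ t))) s
        (un (e i W₂) (toggles⁺ (f ∷ g ∷ []) (pick₂ jf jg) {i} t))))

    edge⁻ : ∀ E → EdgeIn S (Λ' Λp sc) E →
      (∃[ i ] ∃[ E₀ ] (E ≡ emap i E₀ × ScE i E₀ × EdgeIn (S₀ i) (proj Λp sc i) E₀)) ⊎
      (∃[ v ] ∃[ d ] (Rt v × E ≡ tree v d))
    edge⁻ (tree W d) V with vert⁻ Λp sc {W} V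
    ... | inj₁ (i , v , refl , s , V₀) = inj₁ (i , tree v d , refl , s , V₀)
    ... | inj₂ r = inj₂ (W , d , r , refl)
    edge⁻ (link b) (_ , m , k) with ∈-map⁻ _ m
    ... | f , j , refl with comb-∈⁻ {f} k
    ...   | i , a , k' , refl = inj₁ (i , link a , refl , (sc j i (leaves-pos k') , sc j i (leaves-neg k')) ,
      (f i , ∈-map⁺ _ j , k'))
    edge⁻ (jump l' W') (a' , (_ , m , k) , l∈ , dep) with depends⁻ dep
    ... | i , a , W , refl , refl , s , dep₀@(_ , _ , m₁ , _ , ka , _) with ends-map⁻ (e i) l∈ | ∈-map⁻ _ m₁
    ...   | l , l∈a , refl | f , jf , refl =
      inj₁ (i , jump l W , refl , (sc jf i (leaves-ends ka l∈a) , s) , (a , (f i , m₁ , ka) , l∈a , dep₀))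
    edge⁻ (cutE c) (_ , m , q , k) with ∈-map⁻ _ m
    ... | f , j , refl with comb-leaf⁻ {f} k
    ...   | i , l , k' , eq = ⊥-elim (no-cutside {i} {l} {c} {false} (sc j i k') (sym (cong proj₁ eq)))

  -- Cycles in a graph whose edges are images of component edges or tree edges at the root.
  module _ (E' : Edge → Set) (E₀ : Bool → Edge → Set)
           (cls : ∀ E → E' E → (∃[ i ] ∃[ F ] (E ≡ emap i F × ScE i F × E₀ i F)) ⊎ (∃[ v ] ∃[ d ] (Rt v × E ≡ tree v d)))
           where
    private
      joins⁻ : ∀ i F j u₀ {v} → ScE i F → Sc j (proj₁ u₀) → Joins (emap i F) (e j u₀) v →
               (i ≡ j) × ∃[ v₀ ] (v ≡ e i v₀ × Sc i (proj₁ v₀) × Joins F u₀ v₀)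
      joins⁻ i F j u₀ s su J with endpoints-emap i F s
      joins⁻ i F j u₀ s su (inj₁ (p , q)) | (a , sa) , (b , sb) with e-inj {j} {i} {u₀} {proj₁ (endpoints F)} su sa (trans p a)
      ... | refl = refl , _ , trans q b , sb , inj₁ (refl , refl)
      joins⁻ i F j u₀ s su (inj₂ (p , q)) | (a , sa) , (b , sb) with e-inj {j} {i} {u₀} {proj₂ (endpoints F)} su sb (trans p b)
      ... | refl = refl , _ , trans q a , sa , inj₂ (refl , refl)

      joins-ends : ∀ i F {u v} → ScE i F → Joins (emap i F) u v →
                   (∃[ u₀ ] (u ≡ e i u₀ × Sc i (proj₁ u₀))) × (∃[ v₀ ] (v ≡ e i v₀ × Sc i (proj₁ v₀)))
      joins-ends i F s J with endpoints-emap i F s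
      joins-ends i F s (inj₁ (p , q)) | (a , sa) , (b , sb) = (_ , trans p a , sa) , (_ , trans q b , sb)
      joins-ends i F s (inj₂ (p , q)) | (a , sa) , (b , sb) = (_ , trans p b , sb) , (_ , trans q a , sa)

      not-root-end : ∀ i F {u v} → ScE i F → Joins (emap i F) u v → ¬ Rt u × ¬ Rt v
      not-root-end i F s J with joins-ends i F s J
      ... | (_ , refl , su) , (_ , refl , sv) = rt-off su , rt-off sv

      root-stop : ∀ {v d u w} → Joins (tree v d) u w → v ≡ u ⊎ v ≡ w
      root-stop {v} {d} J = joins-stop (tree v d) J (inj₂ refl)

    pullback : ∀ {i} xs {u₀ w} → Sc i (proj₁ u₀) → Walk E' (e i u₀) xs w → (∀ {E v d} → E ∈ edges xs → Rt v → E ≢ tree v d) →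
      ∃[ ys ] ∃[ w₀ ] (w ≡ e i w₀ × Sc i (proj₁ w₀) × Walk (E₀ i) u₀ ys w₀ ×
        edges xs ≡ map (emap i) (edges ys) × stops xs ≡ map (e i) (stops ys) ×
        (∀ {v} → v ∈ stops ys → Sc i (proj₁ v)))
    pullback [] s refl _ = [] , _ , refl , s , refl , refl , refl , (λ ())
    pullback {i} ((E , v) ∷ xs) {u₀} s (x , J , p) nr with cls E x
    ... | inj₂ (r , d , R , q) = ⊥-elim (nr (here refl) R q)
    ... | inj₁ (j , F , refl , sF , x₀) with joins⁻ j F i u₀ sF s J
    ...   | refl , v₀ , refl , sv , J₀ with pullback xs sv p (λ i → nr (there i))
    ...     | ys , w₀ , q , sw , p₀ , qe , qs , al = (F , v₀) ∷ ys , w₀ , q , sw , (x₀ , J₀ , p₀) ,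
      cong (emap j F ∷_) qe , cong (e j v₀ ∷_) qs , λ { (here refl) → sv ; (there i) → al i }

    find-root : ∀ xs {u w} → Walk E' u xs w →
      (∃[ v ] (Rt v × (v ≡ u ⊎ v ∈ stops xs))) ⊎ (∀ {E v d} → E ∈ edges xs → Rt v → E ≢ tree v d)
    find-root [] _ = inj₂ (λ ())
    find-root ((E , v) ∷ xs) (x , J , p) with cls E x | find-root xs p
    ... | _ | inj₁ (r , R , inj₁ q) = inj₁ (r , R , inj₂ (here q))
    ... | _ | inj₁ (r , R , inj₂ k) = inj₁ (r , R , inj₂ (there k))
    ... | inj₂ (r , d , R , refl) | inj₂ _ with root-stop {r} {d} J
    ...   | inj₁ q = inj₁ (r , R , inj₁ q)
    ...   | inj₂ q = inj₁ (r , R , inj₂ (here q))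
    find-root ((E , v) ∷ xs) (x , J , p) | inj₁ (i , F , refl , sF , _) | inj₂ nr = inj₂ λ where
      (there k) → nr k
      {_} {r} {d} (here refl) R q → proj₂ (not-root-end i F {e i (proj₁ (endpoints F))} {e i (proj₂ (endpoints F))}
        sF (inj₁ (sym (proj₁ (proj₁ (endpoints-emap i F sF))) , sym (proj₁ (proj₂ (endpoints-emap i F sF))))))
        (subst Rt (trans (cong (λ E → proj₂ (endpoints E)) (sym q)) (proj₁ (proj₂ (endpoints-emap i F sF)))) R)

    start∈ : ∀ (c : Cycle E') → start c ∈ stops (steps c)
    start∈ c = go (steps c) (nonempty c) (closed c)
      where
      go : ∀ xs {u w} → xs ≢ [] → Walk E' u xs w → w ∈ stops xs
      go [] n _ = ⊥-elim (n refl)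
      go (_ ∷ []) _ (_ , _ , refl) = here refl
      go (_ ∷ x ∷ xs) _ (_ , _ , p) = there (go (x ∷ xs) (λ ()) p)

    data CycleKind (c : Cycle E') : Set where
      inside : ∀ i (c₀ : Cycle (E₀ i)) → edges (steps c) ≡ map (emap i) (edges (steps c₀)) →
               stops (steps c) ≡ map (e i) (stops (steps c₀)) →
               (∀ {v} → v ∈ stops (steps c₀) → Sc i (proj₁ v)) → CycleKind c
      through : ∀ v → Rt v → tree v false ∈ edges (steps c) → tree v true ∈ edges (steps c) →
                (∃[ i ] ∃[ u ] ∃[ w ] (Sc i (proj₁ u) × Sc i (proj₁ w) × v ▹ false ≡ e i u × v ▹ true ≡ e i w)) → CycleKind c

    private
      tree-child : ∀ {v d u} → Joins (tree v d) v u → u ≡ v ▹ d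
      tree-child (inj₁ (p , _)) = ⊥-elim (longer _ _ (cong proj₂ p))
        where
        longer : ∀ (p : List Bool) d → p ≢ p ++ d ∷ []
        longer (b ∷ p) d q = longer p d (∷-injectiveʳ q)
      tree-child (inj₂ (_ , q)) = q

      joins-sym : ∀ E {u v} → Joins E u v → Joins E v u
      joins-sym _ (inj₁ (p , q)) = inj₂ (q , p)
      joins-sym _ (inj₂ (p , q)) = inj₁ (q , p)

      root-edge : ∀ {E v u} → Rt v → E' E → Joins E v u → ∃[ d ] (E ≡ tree v d × u ≡ v ▹ d)
      root-edge {E} R x J with cls E x
      ... | inj₁ (i , F , refl , s , _) = ⊥-elim (proj₁ (not-root-end i F s J) R)
      ... | inj₂ (r , d , R' , refl) with rt-uniq R R'
      ...   | refl = d , refl , tree-child J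

      middle : ∀ xs {m w v} → Rt v → Walk E' m xs w → v ≢ m → v ∉ stops xs → xs ≢ [] →
               ∃[ i ] ∃[ u ] ∃[ u' ] (Sc i (proj₁ u) × Sc i (proj₁ u') × m ≡ e i u × w ≡ e i u')
      middle [] _ _ _ _ n = ⊥-elim (n refl)
      middle ((E , x) ∷ xs) R p@(y , J , _) v≢m v∉ _ with cls E y
      ... | inj₂ (r , d , R' , refl) with root-stop {r} {d} J | rt-uniq R R'
      ...   | inj₁ q | refl = ⊥-elim (v≢m q)
      ...   | inj₂ q | refl = ⊥-elim (v∉ (here q))
      middle ((E , x) ∷ xs) {m} {w} {v} R p@(y , J , _) v≢m v∉ _ | inj₁ (i , F , refl , s , _) with joins-ends i F s J
      ...   | (u , refl , su) , _ with pullback ((emap i F , x) ∷ xs) su p no-root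
        where
        no-root : ∀ {E v' d} → E ∈ edges ((emap i F , x) ∷ xs) → Rt v' → E ≢ tree v' d
        no-root k R' refl with rt-uniq R R'
        ... | refl = avoid ((emap i F , x) ∷ xs) p v≢m v∉ k
          where
          avoid : ∀ xs {m w d} → Walk E' m xs w → v ≢ m → v ∉ stops xs → tree v d ∈ edges xs → ⊥
          avoid ((_ , x) ∷ xs) (_ , J , _) a b (here refl) with joins-stop (tree v _) J (inj₂ refl)
          ... | inj₁ q = a q
          ... | inj₂ q = b (here q)
          avoid ((_ , x) ∷ xs) (_ , _ , p) a b (there k) = avoid xs p (λ q → b (here q)) (λ j → b (there j)) k
      ...     | _ , w₀ , q , sw , _ = i , u , w₀ , su , sw , refl , q

      orient : ∀ {v d d' i u w} {es : List Edge} → Rt v → d ≢ d' → tree v d ∈ es → tree v d' ∈ es →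
        Sc i (proj₁ u) → Sc i (proj₁ w) → v ▹ d ≡ e i u → v ▹ d' ≡ e i w →
        tree v false ∈ es × tree v true ∈ es ×
        (∃[ i ] ∃[ u ] ∃[ w ] (Sc i (proj₁ u) × Sc i (proj₁ w) × v ▹ false ≡ e i u × v ▹ true ≡ e i w))
      orient {d = false} {false} R n _ _ _ _ _ _ = ⊥-elim (n refl)
      orient {d = true} {true} R n _ _ _ _ _ _ = ⊥-elim (n refl)
      orient {d = false} {true} R n k k' s s' q q' = k , k' , (_ , _ , _ , s , s' , q , q')
      orient {d = true} {false} R n k k' s s' q q' = k' , k , (_ , _ , _ , s' , s , q' , q)

      through-root : ∀ (c : Cycle E') v → Rt v → v ∈ stops (steps c) → CycleKind c
      through-root c v R k = split (Rotated.front r) (Rotated.rot-walk r) (Rotated.rot-↭ r)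
        where
        r = rotate c k
        ℓ = Rotated.last-edge r
        split : ∀ fr → Walk E' v (fr ++ (ℓ , v) ∷ []) v → fr ++ (ℓ , v) ∷ [] ↭ steps c → CycleKind c
        split [] (x , J , _) _ with root-edge R x J
        ... | d , _ , q = ⊥-elim (▹-≢ v d q)
          where
          ▹-≢ : ∀ v d → v ≢ v ▹ d
          ▹-≢ (r , b ∷ p) d q = ▹-≢ (r , p) d (cong (r ,_) (∷-injectiveʳ (cong proj₂ q)))
        split ((E , m) ∷ fr) (x , J , p) perm with walk-++ {xs = fr} p
        ... | w , pf , (xl , Jl , _) with root-edge R x J | root-edge R xl (joins-sym ℓ Jl)
        ...   | d , refl , refl | d' , qℓ , refl =
          let (i , u , u' , s , s' , q , q') = middle fr R pf v≢m v∉fr fr≢[]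
              (a , b , t) = orient R d≢d' (in-c (here refl)) (in-c (∈-map⁺ proj₁ (∈-++⁺ʳ ((E , m) ∷ fr) (here (cong (_, v) (sym qℓ)))))) s s' q q'
          in through v R a b t
          where
          whole = (tree v d , v ▹ d) ∷ fr ++ (ℓ , v) ∷ []
          uE : Unique (edges whole)
          uE = unique-resp-↭ (map⁺ proj₁ (↭-sym perm)) (distE c)
          uV : Unique (stops whole)
          uV = unique-resp-↭ (map⁺ proj₂ (↭-sym perm)) (distV c)
          in-c : ∀ {F} → F ∈ edges whole → F ∈ edges (steps c)
          in-c = ∈-resp-↭ (map⁺ proj₁ perm)
          d≢d' : d ≢ d'
          d≢d' refl = unique-∉ uE (∈-map⁺ proj₁ (∈-++⁺ʳ fr (here (cong (_, v) (sym qℓ)))))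
          uV' : Unique (v ∷ stops ((tree v d , v ▹ d) ∷ fr))
          uV' = unique-resp-↭ (↭-trans (↭-reflexive (map-++ proj₂ ((tree v d , v ▹ d) ∷ fr) ((ℓ , v) ∷ []))) (++-comm (stops ((tree v d , v ▹ d) ∷ fr)) (v ∷ []))) uV
          v≢m : v ≢ v ▹ d
          v≢m q = unique-∉ uV' (here q)
          v∉fr : v ∉ stops fr
          v∉fr j = unique-∉ uV' (there j)
          fr≢[] : fr ≢ []
          fr≢[] q = d≢d' (∷-injectiveˡ (++-cancelˡ (proj₂ v) _ _ (cong proj₂ (m≡w q pf))))
            where
            m≡w : ∀ {xs} → xs ≡ [] → Walk E' (v ▹ d) xs (v ▹ d') → v ▹ d ≡ v ▹ d'
            m≡w refl q = q

    kind : ∀ c → CycleKind c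
    kind c with find-root (steps c) (closed c)
    ... | inj₁ (v , R , inj₂ k) = through-root c v R k
    ... | inj₁ (v , R , inj₁ refl) = through-root c v R (start∈ c)
    ... | inj₂ nr = go (steps c) refl
      where
      go : ∀ xs → steps c ≡ xs → CycleKind c
      go [] q = ⊥-elim (nonempty c q)
      go ((E , v) ∷ xs) q with subst (λ xs → Walk E' (start c) xs (start c)) q (closed c)
      ... | x , J , _ with cls E x
      ...   | inj₂ (r , d , R , q') = ⊥-elim (nr (subst (λ xs → E ∈ edges xs) (sym q) (here refl)) R q')
      ...   | inj₁ (i , F , refl , s , _) with joins-ends i F s J
      ...     | (u₀ , qu , su) , _ with pullback (steps c) su (subst (λ u → Walk E' u (steps c) (start c)) qu (closed c)) nr
      ...       | ys , w₀ , qw , sw , p , qe , qs , al = inside i c₀ qe qs al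
        where
        c₀ : Cycle (E₀ i)
        c₀ = record
          { start = u₀ ; steps = ys
          ; nonempty = λ { refl → nonempty c (empty (steps c) qe) }
          ; closed = subst (Walk (E₀ i) u₀ ys) (sym (cong proj₂ (e-inj {v = u₀} {w₀} su sw (trans (sym qu) qw)))) p
          ; distE = unique-map⁻ (subst Unique qe (distE c))
          ; distV = unique-map⁻ (subst Unique qs (distV c)) }
          where
          empty : ∀ (zs : Steps) → edges zs ≡ [] → zs ≡ []
          empty [] _ = refl

  module Nets
    (θ₀ : Bool → Net) (θ' : Net)
    (mem→ : ∀ {λ'} → λ' ∈ θ' → ∃[ f ] ((∀ i → f i ∈ θ₀ i) × λ' ≡ comb f))
    (mem← : ∀ f → (∀ i → f i ∈ θ₀ i) → comb f ∈ θ')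
    (scoped : ∀ i {λ₀} → λ₀ ∈ θ₀ i → ∀ {l} → l ∈ leaves λ₀ → Sc i (proj₁ l))
    (p₁ : ∀ i → P1 (S₀ i) (θ₀ i)) (p₂ : ∀ i → P2 (S₀ i) (θ₀ i)) (p₃ : ∀ i → P3 (S₀ i) (θ₀ i))
    (rt-kind : ∀ v → Rt v → IsPar S v ⊎
       ((∃[ d ] (∀ f → (∀ i → f i ∈ θ₀ i) → ¬ Vert (comb f ∷ []) (v ▹ d))) ⊎
        (∀ d i w → Sc i (proj₁ w) → v ▹ d ≡ e i w → i ≡ d)))
    (rt-with : ∀ v → Rt v → IsWith S v → ∃[ d ] (∀ f → (∀ i → f i ∈ θ₀ i) → ¬ Vert (comb f ∷ []) (v ▹ d)))
    where

    Member : Pair → Set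
    Member f = ∀ i → f i ∈ θ₀ i

    member-scoped : ∀ {f} → Member f → Scoped f
    member-scoped m i k = scoped i (m i) k

    par⁺ : ∀ {i v} → Sc i (proj₁ v) → IsPar (S₀ i) v → IsPar S (e i v)
    par⁺ s (A , B , q) = A , B , trans (e-lab s) q

    par⁻ : ∀ {i v} → Sc i (proj₁ v) → IsPar S (e i v) → IsPar (S₀ i) v
    par⁻ s (A , B , q) = A , B , trans (sym (e-lab s)) q

    untoggled-same : ∀ i {λ₁ λ₂} → λ₁ ∈ θ₀ i → λ₂ ∈ θ₀ i →
      (∀ W → ¬ Toggles (S₀ i) (λ₁ ∷ λ₂ ∷ []) W) → SameLinking λ₁ λ₂
    untoggled-same i {λ₁} {λ₂} m₁ m₂ none with same? λ₁ λ₂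
    ... | yes s = s
    ... | no n = let (W , t , _) = p₃ i (λ₁ ∷ λ₂ ∷ [])
                       (λ { _ (here refl) → m₁ ; _ (there (here refl)) → m₂ })
                       (λ₁ , λ₂ , here refl , there (here refl) , n)
                 in ⊥-elim (none W t)

    root-untoggled : ∀ Λp → (∀ {f} → f ∈ Λp → Member f) → RootUntoggled Λp
    root-untoggled Λp mb {W} R (w , V₀ , V₁) with rt-with W R w
    ... | d , no-d = absurd d V₀ V₁ no-d
      where
      one : ∀ d → Vert (map comb Λp) (W ▹ d) → (∀ f → Member f → ¬ Vert (comb f ∷ []) (W ▹ d)) → ⊥
      one d (_ , m , V) no-d with ∈-map⁻ _ m
      ... | f , j , refl = no-d f (mb j) (comb f , here refl , V)
      absurd : ∀ d → Vert (map comb Λp) (W ▹ false) → Vert (map comb Λp) (W ▹ true) →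
               (∀ f → Member f → ¬ Vert (comb f ∷ []) (W ▹ d)) → ⊥
      absurd false V₀ V₁ = one false V₀
      absurd true V₀ V₁ = one true V₁

    module _ (Λp : List Pair) (mb : ∀ {f} → f ∈ Λp → Member f) where
      sc' : ∀ {f} → f ∈ Λp → Scoped f
      sc' i = member-scoped (mb i)

      same' : SameIfUntoggled Λp
      same' i j k = untoggled-same k (mb i k) (mb j k)

      rt' : ∀ {f g} → f ∈ Λp → g ∈ Λp → RootUntoggled (f ∷ g ∷ [])
      rt' i j = root-untoggled _ (λ { (here refl) → mb i ; (there (here refl)) → mb j })

      edge-cls : ∀ E → EdgeIn S (map comb Λp) E →
        (∃[ i ] ∃[ F ] (E ≡ emap i F × ScE i F × EdgeIn (S₀ i) (proj Λp sc' i) F)) ⊎ (∃[ v ] ∃[ d ] (Rt v × E ≡ tree v d))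
      edge-cls = edge⁻ Λp sc' same' rt'

      edge-scope : ∀ {i} F → EdgeIn (S₀ i) (proj Λp sc' i) F → ScE i F
      edge-scope {i} (tree v d) V = vert-scope Λp sc' V
      edge-scope {i} (link a) (_ , m , k) with ∈-map⁻ _ m
      ... | f , j , refl = sc' j i (leaves-pos k) , sc' j i (leaves-neg k)
      edge-scope {i} (jump l W) (a , (_ , m , k) , l∈ , (_ , _ , m₁ , m₂ , _ , _ , t , _)) with ∈-map⁻ _ m | ∈-map⁻ _ m₁ | ∈-map⁻ _ m₂
      ... | f , j , refl | g , j₁ , refl | h , j₂ , refl = sc' j i (leaves-ends k l∈) ,
        vert-scope (g ∷ h ∷ []) (λ { (here refl) → sc' j₁ ; (there (here refl)) → sc' j₂ }) {i} (proj₁ (proj₂ t))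
      edge-scope {i} (cutE c) V = ⊥-elim (sc-concl (vert-scope Λp sc' V))

      no-through : ∀ {v} (es : List Edge) → Rt v → (∀ {E} → E ∈ es → EdgeIn S (map comb Λp) E) →
        (IsPar S v → tree v false ∈ es → tree v true ∈ es → ⊥) →
        tree v false ∈ es → tree v true ∈ es →
        (∃[ i ] ∃[ u ] ∃[ w ] (Sc i (proj₁ u) × Sc i (proj₁ w) × v ▹ false ≡ e i u × v ▹ true ≡ e i w)) → ⊥
      no-through {v} es R sub' par' a b (i , u , w , su , sw , qu , qw) with rt-kind v R
      ... | inj₁ p = par' p a b
      ... | inj₂ (inj₂ split) = clash (split false i u su qu) (split true i w sw qw)
        where
        clash : ∀ {i} → i ≡ false → i ≡ true → ⊥
        clash refl ()
      ... | inj₂ (inj₁ (d , no-d)) = missing d no-d a b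
        where
        one : ∀ d → (∀ f → Member f → ¬ Vert (comb f ∷ []) (v ▹ d)) → tree v d ∈ es → ⊥
        one d no-d k with sub' k
        ... | (_ , m , V) with ∈-map⁻ _ m
        ...   | f , j , refl = no-d f (mb j) (comb f , here refl , V)
        missing : ∀ d → (∀ f → Member f → ¬ Vert (comb f ∷ []) (v ▹ d)) → tree v false ∈ es → tree v true ∈ es → ⊥
        missing false n a b = one false n a
        missing true n a b = one true n b

    pairs : ∀ Λ → (∀ λ₀ → λ₀ ∈ Λ → λ₀ ∈ θ') → ∃[ Λp ] ((∀ {f} → f ∈ Λp → Member f) × Λ ≡ map comb Λp)
    pairs [] _ = [] , (λ ()) , refl
    pairs (λ₀ ∷ Λ) h with mem→ (h λ₀ (here refl)) | pairs Λ (λ _ k → h _ (there k))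
    ... | f , m , refl | Λp , mb , refl = f ∷ Λp , (λ { (here refl) → m ; (there k) → mb k }) , refl

    module _ (Λp : List Pair) (mb : ∀ {f} → f ∈ Λp → Member f) (i : Bool) {W : Vertex}
             (tg : Toggles (S₀ i) (proj Λp (sc' Λp mb) i) W)
             (nc : (c : Cycle (EdgeIn (S₀ i) (proj Λp (sc' Λp mb) i))) →
                   IsSwitchingCycle (S₀ i) (EdgeIn (S₀ i) (proj Λp (sc' Λp mb) i)) c → W ∉ stops (steps c)) where
      private
        Λ₀ = map comb Λp

        switch⁺ : ∀ {F w} → ScE i F → SwitchOf (S₀ i) F w → SwitchOf S (emap i F) (e i w)
        switch⁺ {tree v d} s (inj₁ p , refl) = inj₁ (par⁺ s p) , refl
        switch⁺ {tree v d} s (inj₂ p , refl) = inj₂ (with⁺ Λp (sc' Λp mb) s p) , refl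
        switch⁺ {jump l v} (_ , s) (inj₁ p , refl) = inj₁ (par⁺ s p) , refl
        switch⁺ {jump l v} (_ , s) (inj₂ p , refl) = inj₂ (with⁺ Λp (sc' Λp mb) s p) , refl

      join-toggle : Toggles S Λ₀ (e i W) ×
        ((c : Cycle (EdgeIn S Λ₀)) → IsSwitchingCycle S (EdgeIn S Λ₀) c → e i W ∉ stops (steps c))
      join-toggle = toggles⁺ Λp (sc' Λp mb) tg , go
        where
        go : (c : Cycle (EdgeIn S Λ₀)) → IsSwitchingCycle S (EdgeIn S Λ₀) c → e i W ∉ stops (steps c)
        go c sw k with kind (EdgeIn S Λ₀) (λ j → EdgeIn (S₀ j) (proj Λp (sc' Λp mb) j)) (edge-cls Λp mb) c
        ... | through v R a b t = no-through Λp mb (edges (steps c)) R (walk-edge {xs = steps c} (closed c))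
              (λ p a' b' → tree≢ (sw v (tree v false) (tree v true) a' b' (inj₁ p , refl) (inj₁ p , refl))) a b t
          where
          tree≢ : ∀ {v} → tree v false ≢ tree v true
          tree≢ ()
        ... | inside j c₀ qe qs al with ∈-map⁻ (e j) (subst (e i W ∈_) qs k)
        ...   | W₁ , k₁ , q with e-inj {v = W} {W₁} (vert-scope Λp (sc' Λp mb) (proj₁ (proj₂ tg))) (al k₁) q
        ...     | refl = nc c₀ sw₀ k₁
          where
          sw₀ : IsSwitchingCycle (S₀ i) (EdgeIn (S₀ i) (proj Λp (sc' Λp mb) i)) c₀
          sw₀ w F F' m m' s s' = unique-inj (subst Unique qe (distE c)) m m'
            (sw (e i w) (emap i F) (emap i F') (in-c m) (in-c m') (switch⁺ (scF m) s) (switch⁺ (scF m') s'))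
            where
            in-c : ∀ {F} → F ∈ edges (steps c₀) → emap i F ∈ edges (steps c)
            in-c m = subst (_ ∈_) (sym qe) (∈-map⁺ (emap i) m)
            scF : ∀ {F} → F ∈ edges (steps c₀) → ScE i F
            scF {F} m = edge-scope Λp mb F (walk-edge {xs = steps c₀} (closed c₀) m)

    private
      Separated : List Linking → Set
      Separated Λ = ∃[ W ] (Toggles S Λ W ×
        ((c : Cycle (EdgeIn S Λ)) → IsSwitchingCycle S (EdgeIn S Λ) c → W ∉ stops (steps c)))

      separated : ∀ Λp → (∀ {f} → f ∈ Λp → Member f) → ∀ {f g} → f ∈ Λp → g ∈ Λp →
                  ∀ i → ¬ SameLinking (f i) (g i) → Separated (map comb Λp)
      separated Λp mb {f} {g} jf jg i n =
        let (W , tg , nc) = p₃ i (map (λ h → h i) Λp)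
              (λ λ₀ k → let (h , j , q) = ∈-map⁻ _ k in subst (_∈ θ₀ i) (sym q) (mb j i))
              (f i , g i , ∈-map⁺ _ jf , ∈-map⁺ _ jg , n)
        in e i W , join-toggle Λp mb i tg nc

    join-P3 : P3 S θ'
    join-P3 Λ h diff with pairs Λ h
    join-P3 Λ h (_ , _ , m₁ , m₂ , ne) | Λp , mb , refl with ∈-map⁻ _ m₁ | ∈-map⁻ _ m₂
    ... | f , jf , refl | g , jg , refl with same? (f false) (g false) | same? (f true) (g true)
    ...   | no n | _ = separated Λp mb jf jg false n
    ...   | yes _ | no n = separated Λp mb jf jg true n
    ...   | yes s | yes s' = ⊥-elim (ne (same-comb {f} {g} λ { false → s ; true → s' }))

    module Switched (f : Pair) (m : Member f) (sw : Vertex → Bool) where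
      mb₁ : ∀ {g} → g ∈ f ∷ [] → Member g
      mb₁ (here refl) = m

      E' : Edge → Set
      E' = SwEdges S (comb f) sw

      E₀ : Bool → Edge → Set
      E₀ i = SwEdges (S₀ i) (f i) (λ v → sw (e i v))

      cls : ∀ E → E' E → (∃[ i ] ∃[ F ] (E ≡ emap i F × ScE i F × E₀ i F)) ⊎ (∃[ v ] ∃[ d ] (Rt v × E ≡ tree v d))
      cls E x with edge-cls (f ∷ []) mb₁ E (proj₁ x)
      ... | inj₂ r = inj₂ r
      ... | inj₁ (i , F , refl , s , x₀) = inj₁ (i , F , refl , s , keep F s x x₀)
        where
        keep : ∀ F → ScE i F → E' (emap i F) → EdgeIn (S₀ i) (f i ∷ []) F → E₀ i F
        keep (tree v d) s (_ , nd) x₀ = x₀ , λ (p , q) → nd (par⁺ s p , q)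
        keep (link _) s _ x₀ = x₀ , λ ()
        keep (jump _ _) s _ x₀ = x₀ , λ ()
        keep (cutE _) s _ x₀ = x₀ , λ ()

      acyclic : Cycle E' → ⊥
      acyclic c with kind E' E₀ cls c
      ... | inside i c₀ _ _ _ = proj₂ (p₂ i (f i) (m i) (λ v → sw (e i v))) c₀
      ... | through v R a b t = no-through (f ∷ []) mb₁ (edges (steps c)) R
              (λ k → proj₁ (walk-edge {xs = steps c} (closed c) k)) both a b t
        where
        deleted : ∀ d → IsPar S v → tree v d ∈ edges (steps c) → d ≢ sw v
        deleted d p k q = proj₂ (walk-edge {xs = steps c} (closed c) k) (p , q)
        both : IsPar S v → tree v false ∈ edges (steps c) → tree v true ∈ edges (steps c) → ⊥
        both p a b with sw v in q
        ... | false = deleted false p a (sym q)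
        ... | true = deleted true p b (sym q)

      lift-adj : ∀ i {u v} → Adj (E₀ i) u v → Adj E' (e i u) (e i v)
      lift-adj i {u} {v} (F , x , J) = emap i F , edge⁺ F s x , joins⁺ F s J
        where
        s = edge-scope (f ∷ []) mb₁ {i} F (proj₁ x)
        edge⁺ : ∀ F → ScE i F → E₀ i F → E' (emap i F)
        edge⁺ (tree v d) s (V , nd) = subst (Vert (comb f ∷ [])) (e-▹ (f ∷ []) (sc' (f ∷ []) mb₁) {i} {v} {d} s)
                               (vert⁺ (f ∷ []) (sc' (f ∷ []) mb₁) {i} V) , λ (p , q) → nd (par⁻ s p , q)
        edge⁺ (link a) _ ((_ , here refl , k) , _) = (_ , here refl , comb-∈⁺ f i k) , λ ()
        edge⁺ (jump l W) _ ((a , _ , _ , (_ , _ , here refl , here refl , k , nk , _)) , _) = ⊥-elim (nk k)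
        joins⁺ : ∀ F {u v} → ScE i F → Joins F u v → Joins (emap i F) (e i u) (e i v)
        joins⁺ F s J with endpoints-emap i F s
        joins⁺ F s (inj₁ (refl , refl)) | (a , _) , (b , _) = inj₁ (sym a , sym b)
        joins⁺ F s (inj₂ (refl , refl)) | (a , _) , (b , _) = inj₂ (sym b , sym a)

      connected⁺ : ∀ i {u v} → Vert (f i ∷ []) u → Vert (f i ∷ []) v → Star (Adj E') (e i u) (e i v)
      connected⁺ i {u} {v} U V = go (proj₁ (p₂ i (f i) (m i) (λ v → sw (e i v))) u v U V)
        where
        go : ∀ {u v} → Star (Adj (E₀ i)) u v → Star (Adj E') (e i u) (e i v)
        go ε = ε
        go (x ◅ p) = lift-adj i x ◅ go p

      vert-cases : ∀ {u} → Vert (comb f ∷ []) u → (∃[ i ] ∃[ u₀ ] (u ≡ e i u₀ × Vert (f i ∷ []) u₀)) ⊎ Rt u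
      vert-cases {u} (_ , here refl , q , k) with comb-leaf⁻ {f} k
      ... | i , l , k' , eq = go q eq
        where
        go : ∀ q → below-root u q ≡ e i l → (∃[ i ] ∃[ u₀ ] (u ≡ e i u₀ × Vert (f i ∷ []) u₀)) ⊎ Rt u
        go [] eq = inj₁ (i , l , trans (cong (proj₁ u ,_) (sym (++-identityʳ (proj₂ u)))) eq ,
                     (f i , here refl , [] , subst (λ p → (proj₁ l , p) ∈ leaves (f i)) (sym (++-identityʳ (proj₂ l))) k'))
        go (d ∷ q) eq with lift (member-scoped m i k') u d q (sym eq)
        ... | inj₂ r = inj₂ r
        ... | inj₁ (v , p , p' , p'') = inj₁ (i , v , p' , (f i , here refl , d ∷ q , subst (_∈ leaves (f i)) p'' k'))

      child-adj : ∀ {v d} → Vert (comb f ∷ []) (v ▹ d) → (IsPar S v → d ≢ sw v) → Adj E' (v ▹ d) v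
      child-adj {v} {d} V nd = tree v d , (V , λ (p , q) → nd p q) , inj₁ (refl , refl)

    adj-sym : ∀ {E u v} → Star (Adj E) u v → Star (Adj E) v u
    adj-sym ε = ε
    adj-sym ((F , x , J) ◅ p) = adj-sym p ◅◅ ((F , x , joins-sym' F J) ◅ ε)
      where
      joins-sym' : ∀ F {u v} → Joins F u v → Joins F v u
      joins-sym' F (inj₁ (p , q)) = inj₂ (q , p)
      joins-sym' F (inj₂ (p , q)) = inj₁ (q , p)

    join-P2 : (∀ f (m : Member f) sw → let open Switched f m sw in
                 ∀ u v → Vert (comb f ∷ []) u → Vert (comb f ∷ []) v → Star (Adj E') u v) → P2 S θ'
    join-P2 conn λ₀ k sw with mem→ k
    ... | f , m , refl = conn f m sw , Switched.acyclic f m sw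

    join-P1 : ∀ ρ → (∀ W d f → Member f → Rt W → IsWith S W → InRes (comb f) (W ▹ d) → d ≡ ρ W) → P1At S ρ θ'
    join-P1 ρ hρ = comb f , mem← f m , on f m (λ i → proj₁ (proj₂ (proj₂ (q i)))) , uni
      where
      q : ∀ i → P1At (S₀ i) (λ v → ρ (e i v)) (θ₀ i)
      q i = p₁ i (λ v → ρ (e i v))
      f : Pair
      f i = proj₁ (q i)
      m : Member f
      m i = proj₁ (proj₂ (q i))
      on : ∀ f → Member f → (∀ i → OnAmp (S₀ i) (λ v → ρ (e i v)) (f i)) → OnAmp S ρ (comb f)
      on f m h W d w V with vert⁻ (f ∷ []) (λ { (here refl) → member-scoped m }) {W} {d} (comb f , here refl , V)
      ... | inj₂ R = hρ W d f m R w V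
      ... | inj₁ (i , v , refl , s , (_ , here refl , V₀)) = h i v d (with⁻ (f ∷ []) (λ { (here refl) → member-scoped m }) s w) V₀
      uni : ∀ λ₁ → λ₁ ∈ θ' → OnAmp S ρ λ₁ → SameLinking λ₁ (comb f)
      uni λ₁ k on₁ with mem→ k
      ... | g , mg , refl = same-comb {g} {f} λ i → proj₂ (proj₂ (proj₂ (q i))) (g i) (mg i) (back i)
        where
        sg : ∀ {h} → h ∈ g ∷ [] → Scoped h
        sg (here refl) = member-scoped mg
        single : ∀ {v} → Vert (comb g ∷ []) v → InRes (comb g) v
        single (_ , here refl , V) = V
        back : ∀ i → OnAmp (S₀ i) (λ v → ρ (e i v)) (g i)
        back i v d w V = on₁ (e i v) d (with⁺ (g ∷ []) sg s w)
            (single (subst (Vert (comb g ∷ [])) (e-▹ (g ∷ []) sg {i} {v} {d} s) (vert⁺ (g ∷ []) sg {i} (g i , here refl , V))))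
          where
          s = vert-scope (g ∷ []) sg {i} {v} (g i , here refl , (d ∷ proj₁ V) , subst (λ p → (proj₁ v , p) ∈ leaves (g i)) (++-assoc (proj₂ v) (d ∷ []) (proj₁ V)) (proj₂ V))

-- Linkings of cut-free derivations

ext : (ℕ → Occ) → Vertex → Vertex
ext k (concl n , p) = concl (proj₁ (k n)) , proj₂ (k n) ++ p
ext k (cutside c s , p) = cutside c s , p

extO : (Occ → Occ) → Vertex → Vertex
extO h = ext (λ n → h (n , []))

unaryL : (Occ → Occ) → Net → Net
unaryL h = map (mapl (extO h))

joinL : (Vertex → Vertex) → (Vertex → Vertex) → Net → Net → Net
joinL F G θ ψ = concatMap (λ λ₀ → map (λ μ → mapl F λ₀ ++ mapl G μ) ψ) θ

binaryL : (Occ → Occ) → (Occ → Occ) → Net → Net → Net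
binaryL h k = joinL (extO h) (extO k)

netL : ∀ {Γ} → CF Γ → Net
netL (cax {x} {y} k _) = (lk (concl y , []) (concl x , []) ∷ []) ∷ []
netL (crn f _ D) = unaryL (rename f) (netL D)
netL (cex _ D) = netL D
netL (ctens {x} {y} z D E _ _) = binaryL (lab x z false) (lab y z true) (netL D) (netL E)
netL (cpar {x} {y} z D _) = unaryL (lab₂ x y z) (netL D)
netL (cwith {x} {y} z D E _) = unaryL (lab x z false) (netL D) ++ unaryL (lab y z true) (netL E)
netL (cplus {x} z d D _) = unaryL (lab x z d) (netL D)

-- The root name n is the conclusion with index n.
toSlice : Linking → Slice Occ
toSlice λ₀ = record
  { Leaf = λ (n , p) → (concl n , p) ∈ leaves λ₀
  ; Rel = λ (n , p) (m , q) → lk (concl n , p) (concl m , q) ∈ λ₀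
  ; Loop = ⊥
  ; src = leaves-pos
  ; tgt = leaves-neg }

toNet : Net → SNet Occ
toNet θ = record { Ix = ∃[ λ₀ ] (λ₀ ∈ θ) ; at = λ (λ₀ , _) → toSlice λ₀ }

Natural : (Occ → Occ) → Set
Natural h = ∀ n p → h (n , p) ≡ (proj₁ (h (n , [])) , proj₂ (h (n , [])) ++ p)

rename-natural : ∀ {f} → Natural (rename f)
rename-natural n p = refl

lab-natural : ∀ {x z d} → Natural (lab x z d)
lab-natural {x} {z} {d} n p with n ≟ x
... | yes refl rewrite lab-hit {n} {z} {d} {p} | lab-hit {n} {z} {d} {[]} = refl
... | no e rewrite lab-miss {x} {z} {d} {n} {p} e | lab-miss {x} {z} {d} {n} {[]} e = refl

lab₂-natural : ∀ {x y z} → Natural (lab₂ x y z)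
lab₂-natural {x} {y} {z} n p with n ≟ x
... | yes refl rewrite lab₂-left {n} {y} {z} {p} | lab₂-left {n} {y} {z} {[]} = refl
... | no e with n ≟ y
...   | yes refl rewrite lab₂-right {x} {n} {z} {p} e | lab₂-right {x} {n} {z} {[]} e = refl
...   | no e' rewrite lab₂-miss {x} {y} {z} {n} {p} e e' | lab₂-miss {x} {y} {z} {n} {[]} e e' = refl

vx : Occ → Vertex
vx (n , p) = concl n , p

vx-inj : ∀ {v w} → vx v ≡ vx w → v ≡ w
vx-inj refl = refl

extO-vx : ∀ {h} → Natural h → ∀ v → extO h (vx v) ≡ vx (h v)
extO-vx nat (n , p) = cong vx (sym (nat n p))

extO-inv : ∀ {h} → Natural h → ∀ {w v} → vx w ≡ extO h v → ∃[ v₀ ] (v ≡ vx v₀ × w ≡ h v₀)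
extO-inv nat {v = concl n , p} q = (n , p) , refl , vx-inj (trans q (extO-vx nat (n , p)))

leaves-++ : ∀ λ₀ {μ v} → v ∈ leaves (λ₀ ++ μ) → v ∈ leaves λ₀ ⊎ v ∈ leaves μ
leaves-++ λ₀ {μ} i with leaves⁻ {λ₀ = λ₀ ++ μ} i
... | a , k , m with ∈-++⁻ λ₀ k
...   | inj₁ k' = inj₁ (leaves-ends k' m)
...   | inj₂ k' = inj₂ (leaves-ends k' m)

leaves-++ˡ : ∀ λ₀ μ {v} → v ∈ leaves λ₀ → v ∈ leaves (λ₀ ++ μ)
leaves-++ˡ λ₀ μ i = let (a , k , m) = leaves⁻ {λ₀ = λ₀} i in leaves-ends {λ₀ = λ₀ ++ μ} (∈-++⁺ˡ k) m

leaves-++ʳ : ∀ λ₀ μ {v} → v ∈ leaves μ → v ∈ leaves (λ₀ ++ μ)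
leaves-++ʳ λ₀ μ i = let (a , k , m) = leaves⁻ {λ₀ = μ} i in leaves-ends {λ₀ = λ₀ ++ μ} (∈-++⁺ʳ λ₀ k) m

leaves-mapl⁺ : ∀ f λ₀ {v} → v ∈ leaves λ₀ → f v ∈ leaves (mapl f λ₀)
leaves-mapl⁺ f λ₀ i with leaves⁻ {λ₀ = λ₀} i
... | a , k , here refl = leaves-pos (∈-map⁺ (mapLink f) k)
... | a , k , there (here refl) = leaves-neg (∈-map⁺ (mapLink f) k)

leaves-mapl⁻ : ∀ f {λ₀ w} → w ∈ leaves (mapl f λ₀) → ∃[ v ] (v ∈ leaves λ₀ × w ≡ f v)
leaves-mapl⁻ f {λ₀} i with leaves⁻ {λ₀ = mapl f λ₀} i
... | b , k , m with ∈-map⁻ (mapLink f) k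
...   | a , k' , refl with m
...     | here refl = pos a , leaves-pos k' , refl
...     | there (here refl) = neg a , leaves-neg k' , refl

toSlice-mapl : ∀ {h} → Natural h → ∀ λ₀ → toSlice (mapl (extO h) λ₀) ≃ wire (relabel h) (toSlice λ₀)
toSlice-mapl {h} nat λ₀ = relabel-≃
  (λ {w} l → subst (_∈ leaves (mapl (extO h) λ₀)) (extO-vx nat w) (leaves-mapl⁺ (extO h) λ₀ l))
  (λ {w} l → let (v , k , q) = leaves-mapl⁻ (extO h) {λ₀} l ; (v₀ , q' , q'') = extO-inv nat {w} q in
     v₀ , q'' , subst (_∈ leaves λ₀) q' k)
  (λ {v} {w} r → subst (_∈ mapl (extO h) λ₀) (cong₂ lk (extO-vx nat v) (extO-vx nat w)) (∈-map⁺ (mapLink (extO h)) r))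
  (λ {v} {w} r → rel v w r)
  ((λ ()) , (λ ()))
  where
  rel : ∀ v w → lk (vx v) (vx w) ∈ mapl (extO h) λ₀ →
        ∃[ v₀ ] ∃[ w₀ ] (v ≡ h v₀ × w ≡ h w₀ × lk (vx v₀) (vx w₀) ∈ λ₀)
  rel v w r with ∈-map⁻ (mapLink (extO h)) r
  ... | lk a b , k , q with extO-inv nat {v} {a} (cong pos q) | extO-inv nat {w} {b} (cong neg q)
  ...   | v₀ , refl , e | w₀ , refl , e' = v₀ , w₀ , e , e' , k

toSlice-++ : ∀ {h k} → Natural h → Natural k → ∀ λ₀ μ →
  toSlice (mapl (extO h) λ₀ ++ mapl (extO k) μ) ≃ wire (relabel (copair h k)) (toSlice λ₀ ⊎ₛ toSlice μ)
toSlice-++ {h} {k} nh nk λ₀ μ = relabel-≃ (λ {w} → lf→ w) (λ {w} → lf← w) (λ {v} {w} → rl→ v w) (λ {v} {w} → rl← v w)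
  ((λ ()) , λ { (inj₁ ()) ; (inj₂ ()) })
  where
  module H = Sim (toSlice-mapl nh λ₀)
  module K = Sim (toSlice-mapl nk μ)
  lf→ : ∀ w → Leaf (toSlice λ₀ ⊎ₛ toSlice μ) w → vx (copair h k w) ∈ leaves (mapl (extO h) λ₀ ++ mapl (extO k) μ)
  lf→ (inj₁ w) l = leaves-++ˡ (mapl (extO h) λ₀) (mapl (extO k) μ) (proj₂ (H.leaf~ (h w)) (w , refl , l))
  lf→ (inj₂ w) l = leaves-++ʳ (mapl (extO h) λ₀) (mapl (extO k) μ) (proj₂ (K.leaf~ (k w)) (w , refl , l))
  lf← : ∀ v → vx v ∈ leaves (mapl (extO h) λ₀ ++ mapl (extO k) μ) →
        ∃[ w ] (v ≡ copair h k w × Leaf (toSlice λ₀ ⊎ₛ toSlice μ) w)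
  lf← v i with leaves-++ (mapl (extO h) λ₀) i
  ... | inj₁ j = let (w , e , l) = proj₁ (H.leaf~ v) j in inj₁ w , e , l
  ... | inj₂ j = let (w , e , l) = proj₁ (K.leaf~ v) j in inj₂ w , e , l
  rl→ : ∀ v w → Rel (toSlice λ₀ ⊎ₛ toSlice μ) v w →
        lk (vx (copair h k v)) (vx (copair h k w)) ∈ mapl (extO h) λ₀ ++ mapl (extO k) μ
  rl→ (inj₁ v) (inj₁ w) r = ∈-++⁺ˡ (proj₂ (H.rel~ (h v) (h w)) (v , w , refl , refl , hop r))
  rl→ (inj₂ v) (inj₂ w) r = ∈-++⁺ʳ (mapl (extO h) λ₀) (proj₂ (K.rel~ (k v) (k w)) (v , w , refl , refl , hop r))
  rl← : ∀ v w → lk (vx v) (vx w) ∈ mapl (extO h) λ₀ ++ mapl (extO k) μ →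
        ∃[ v₀ ] ∃[ w₀ ] (v ≡ copair h k v₀ × w ≡ copair h k w₀ × Rel (toSlice λ₀ ⊎ₛ toSlice μ) v₀ w₀)
  rl← v w i with ∈-++⁻ (mapl (extO h) λ₀) i
  ... | inj₁ j with proj₁ (H.rel~ v w) j
  ...   | v₀ , w₀ , e , e' , hop r = inj₁ v₀ , inj₁ w₀ , e , e' , r
  rl← v w i | inj₂ j with proj₁ (K.rel~ v w) j
  ...   | v₀ , w₀ , e , e' , hop r = inj₂ v₀ , inj₂ w₀ , e , e' , r

unaryL-sem : ∀ {h} → Natural h → ∀ θ → toNet (unaryL h θ) ≈ relN h (toNet θ)
unaryL-sem {h} nat θ =
  (λ (λ' , i) → let (λ₀ , j , q) = ∈-map⁻ _ i in
     ((λ₀ , j) , relabel-routed (toSlice λ₀) h) , subst (λ μ → toSlice μ ≃ wire (relabel h) (toSlice λ₀)) (sym q) (toSlice-mapl nat λ₀)) ,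
  (λ ((λ₀ , j) , _) → (_ , ∈-map⁺ _ j) , toSlice-mapl nat λ₀)

∈-joinL⁻ : ∀ F G θ ψ {λ'} → λ' ∈ joinL F G θ ψ → ∃[ λ₀ ] ∃[ μ ] (λ₀ ∈ θ × μ ∈ ψ × λ' ≡ mapl F λ₀ ++ mapl G μ)
∈-joinL⁻ F G θ ψ i with find (∈-concatMap⁻ (λ λ₀ → map (λ μ → mapl F λ₀ ++ mapl G μ) ψ) {xs = θ} i)
... | λ₀ , j , m with ∈-map⁻ _ m
...   | μ , j' , q = λ₀ , μ , j , j' , q

∈-joinL⁺ : ∀ F G {θ ψ λ₀ μ} → λ₀ ∈ θ → μ ∈ ψ → mapl F λ₀ ++ mapl G μ ∈ joinL F G θ ψ
∈-joinL⁺ F G i j = ∈-concatMap⁺ _ (lose i (∈-map⁺ _ j))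

binaryL-sem : ∀ {h k} → Natural h → Natural k → ∀ θ ψ →
  toNet (binaryL h k θ ψ) ≈ relN (copair h k) (toNet θ ⊎ₙ toNet ψ)
binaryL-sem {h} {k} nh nk θ ψ =
  (λ (λ' , i) → let (λ₀ , μ , j , j' , q) = ∈-joinL⁻ (extO h) (extO k) θ ψ i in
     (((λ₀ , j) , (μ , j')) , relabel-routed (toSlice λ₀ ⊎ₛ toSlice μ) (copair h k)) ,
     subst (λ μ' → toSlice μ' ≃ wire (relabel (copair h k)) (toSlice λ₀ ⊎ₛ toSlice μ)) (sym q) (toSlice-++ nh nk λ₀ μ)) ,
  (λ (((λ₀ , j) , (μ , j')) , _) → (_ , ∈-joinL⁺ (extO h) (extO k) j j') , toSlice-++ nh nk λ₀ μ)

++-sem : ∀ θ ψ → toNet (θ ++ ψ) ≈ toNet θ ∪ₙ toNet ψ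
++-sem θ ψ = to' , (λ where (inj₁ (λ₀ , i)) → (λ₀ , ∈-++⁺ˡ i) , ≃-refl
                            (inj₂ (λ₀ , i)) → (λ₀ , ∈-++⁺ʳ θ i) , ≃-refl)
  where
  to' : ∀ i → ∃[ j ] (at (toNet (θ ++ ψ)) i ≃ at (toNet θ ∪ₙ toNet ψ) j)
  to' (λ₀ , i) with ∈-++⁻ θ i
  ... | inj₁ j = inj₁ (λ₀ , j) , ≃-refl
  ... | inj₂ j = inj₂ (λ₀ , j) , ≃-refl

ax-sem : ∀ x y k → toSlice (lk (concl y , []) (concl x , []) ∷ []) ≃ axS {var k} x y at⁺
ax-sem x y k = record
  { leaf~ = λ (n , p) → lf→ , lf← p
  ; rel~ = λ (n , p) (m , q) → (λ { (here refl) → inj₁ (refl , refl , refl , tt , (k , refl)) }) , rl← p q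
  ; loop~ = (λ ()) , (λ ()) }
  where
  lf→ : ∀ {n p} → (concl n , p) ∈ leaves (lk (concl y , []) (concl x , []) ∷ []) → Leaf (axS {var k} x y at⁺) (n , p)
  lf→ (here refl) = inj₂ (refl , tt)
  lf→ (there (here refl)) = inj₁ (refl , tt)
  lf← : ∀ {n} p → Leaf (axS {var k} x y at⁺) (n , p) → (concl n , p) ∈ leaves (lk (concl y , []) (concl x , []) ∷ [])
  lf← [] (inj₁ (refl , _)) = there (here refl)
  lf← [] (inj₂ (refl , _)) = here refl
  lf← (_ ∷ _) (inj₁ (_ , ()))
  lf← (_ ∷ _) (inj₂ (_ , ()))
  rl← : ∀ {n m} p q → Rel (axS {var k} x y at⁺) (n , p) (m , q) →
        lk (concl n , p) (concl m , q) ∈ lk (concl y , []) (concl x , []) ∷ []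
  rl← [] [] (inj₁ (refl , refl , _)) = here refl
  rl← [] [] (inj₂ (_ , _ , _ , _ , (_ , ())))
  rl← (_ ∷ _) q (inj₁ (_ , _ , _ , () , _))
  rl← p (_ ∷ _) (inj₂ (_ , _ , _ , () , _))
  rl← [] (_ ∷ _) (inj₁ (_ , _ , () , _))
  rl← (_ ∷ _) [] (inj₂ (_ , _ , () , _))

netL-sem : ∀ {Γ} (D : CF Γ) → toNet (netL D) ≈ sem D
netL-sem (cax {x} {y} k _) = (λ { (_ , here refl) → at⁺ , ax-sem x y k }) , (λ { at⁺ → (_ , here refl) , ax-sem x y k })
netL-sem (crn f _ D) = ≈-trans (unaryL-sem rename-natural (netL D)) (wireN-cong _ (netL-sem D))
netL-sem (cex _ D) = netL-sem D
netL-sem (ctens {x} {y} z D E _ _) = ≈-trans (binaryL-sem lab-natural lab-natural (netL D) (netL E))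
  (≈-trans (relN-agree (λ where _ (inj₁ _) _ → refl
                                _ (inj₂ _) _ → refl))
           (tensN-cong (netL-sem D) (netL-sem E)))
netL-sem (cpar z D _) = ≈-trans (unaryL-sem lab₂-natural (netL D)) (wireN-cong _ (netL-sem D))
netL-sem (cwith {x} {y} z D E _) = ≈-trans (++-sem (unaryL (lab x z false) (netL D)) (unaryL (lab y z true) (netL E)))
  (∪ₙ-cong (≈-trans (unaryL-sem lab-natural (netL D)) (wireN-cong _ (netL-sem D)))
           (≈-trans (unaryL-sem lab-natural (netL E)) (wireN-cong _ (netL-sem E))))
netL-sem (cplus z d D _) = ≈-trans (unaryL-sem lab-natural (netL D)) (wireN-cong _ (netL-sem D))

-- Proof-net conditions rule by rule

InCtx : Ctx → Root → Set
InCtx Γ r = ∃[ n ] ∃[ A ] (r ≡ concl n × (n , A) ∈ Γ)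

_⊒_ : CutSeq → Ctx → Set
S ⊒ Γ = ∀ {n A} → (n , A) ∈ Γ → nth (concls S) n ≡ just A

put : ℕ → Fm → List Fm → List Fm
put zero A [] = A ∷ []
put zero A (_ ∷ l) = A ∷ l
put (suc n) A [] = A ∷ put n A []
put (suc n) A (B ∷ l) = B ∷ put n A l

nth-put : ∀ n A l → nth (put n A l) n ≡ just A
nth-put zero A [] = refl
nth-put zero A (_ ∷ l) = refl
nth-put (suc n) A [] = nth-put n A []
nth-put (suc n) A (_ ∷ l) = nth-put n A l

nth-put-other : ∀ n m A {B} l → m ≢ n → nth l m ≡ just B → nth (put n A l) m ≡ just B
nth-put-other zero zero A l ne q = ⊥-elim (ne refl)
nth-put-other zero (suc m) A (_ ∷ l) ne q = q
nth-put-other (suc n) zero A (_ ∷ l) ne q = q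
nth-put-other (suc n) (suc m) A (_ ∷ l) ne q = nth-put-other n m A l (λ e → ne (cong suc e)) q

slots : Ctx → List Fm
slots [] = []
slots ((n , A) ∷ Γ) = put n A (slots Γ)

-- Any sequent showing the formulas of Γ at the indices named in Γ would do; unused indices hold junk.
seqOf : Ctx → CutSeq
seqOf Γ = cs [] (slots Γ)

seqOf-⊒ : ∀ {Γ} → Uniq Γ → seqOf Γ ⊒ Γ
seqOf-⊒ {(n , A) ∷ Γ} _ (here refl) = nth-put n A (slots Γ)
seqOf-⊒ {(n , A) ∷ Γ} (f , u) (there {x = _} i) = nth-put-other n _ A (slots Γ) (fresh-≢ f i) (seqOf-⊒ u i)

record GoodNet (Γ : Ctx) (θ : Net) : Set where
  field
    scoped   : ∀ {λ₀} → λ₀ ∈ θ → ∀ {l} → l ∈ leaves λ₀ → InCtx Γ (proj₁ l)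
    covered  : ∀ {λ₀ n A} → λ₀ ∈ θ → (n , A) ∈ Γ → ∃[ p ] ((concl n , p) ∈ leaves λ₀)
    disjoint : ∀ {λ₀} → λ₀ ∈ θ → DisjointLinks λ₀
    good₁    : ∀ {S} → S ⊒ Γ → P1 S θ
    good₂    : ∀ {S} → S ⊒ Γ → P2 S θ
    good₃    : ∀ {S} → S ⊒ Γ → P3 S θ

data Img (Γ : Ctx) (RtN : ℕ → Set) (ok : Bool → Set) (A : Fm) (o : Occ) : Set where
  side : ∀ {m} → o ≡ (m , []) → (m , A) ∈ Γ → ¬ RtN m → Img Γ RtN ok A o
  main : ∀ {z d F} → o ≡ (z , d ∷ []) → (z , F) ∈ Γ → RtN z → (∀ p → sub F (d ∷ p) ≡ sub A p) → ok d →
         Img Γ RtN ok A o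

record Layout (Γs : Bool → Ctx) (Γ : Ctx) (k : Bool → ℕ → Occ) (RtN : ℕ → Set) (ok : Bool → Bool → Set) : Set where
  field
    uniqs : ∀ i → Uniq (Γs i)
    img   : ∀ {i n A} → (n , A) ∈ Γs i → Img Γ RtN (ok i) A (k i n)
    k-inj : ∀ {i j n m A B} → (n , A) ∈ Γs i → (m , B) ∈ Γs j → k i n ≡ k j m → _≡_ {A = Bool × ℕ} (i , n) (j , m)
    onto  : ∀ {m A} → (m , A) ∈ Γ → ∃[ i ] ∃[ n ] ∃[ B ] ((n , B) ∈ Γs i × proj₁ (k i n) ≡ m)
    rtN-uniq : ∀ {m m'} → RtN m → RtN m' → m ≡ m'

module Rule {Γs : Bool → Ctx} {Γ : Ctx} {k : Bool → ℕ → Occ} {RtN : ℕ → Set} {ok : Bool → Bool → Set}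
  (layout : Layout Γs Γ k RtN ok) {S : CutSeq} (S⊒ : S ⊒ Γ)
  (θ₀ : Bool → Net) (θ' : Net) (g : ∀ i → GoodNet (Γs i) (θ₀ i)) where
  open Layout layout

  S₀ : Bool → CutSeq
  S₀ i = seqOf (Γs i)

  e : Bool → Vertex → Vertex
  e i = ext (k i)

  Sc : Bool → Root → Set
  Sc i = InCtx (Γs i)

  Rt : Vertex → Set
  Rt v = ∃[ z ] (RtN z × v ≡ (concl z , []))

  private
    e-++ : ∀ i v q → Sc i (proj₁ v) → e i (below-root v q) ≡ below-root (e i v) q
    e-++ i (_ , p) q (n , _ , refl , _) = cong (concl (proj₁ (k i n)) ,_) (sym (++-assoc (proj₂ (k i n)) p q))

    inj-cases : ∀ {i j n m A B o o'} p q → (n , A) ∈ Γs i → (m , B) ∈ Γs j → o ≡ k i n → o' ≡ k j m →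
      Img Γ RtN (ok i) A o → Img Γ RtN (ok j) B o' →
      proj₁ o ≡ proj₁ o' → proj₂ o ++ p ≡ proj₂ o' ++ q → (k i n ≡ k j m) × p ≡ q
    inj-cases p q a b refl refl (side x _ _) (side y _ _) e₁ e₂ rewrite x | y = cong (_, []) e₁ , e₂
    inj-cases p q a b refl refl (main x _ _ _ _) (main y _ _ _ _) e₁ e₂ rewrite x | y =
      cong₂ (λ z d → z , d ∷ []) e₁ (∷-injectiveˡ e₂) , ∷-injectiveʳ e₂
    inj-cases p q a b refl refl (side x _ nr) (main y _ R _ _) e₁ e₂ rewrite x | y = ⊥-elim (nr (subst RtN (sym e₁) R))
    inj-cases p q a b refl refl (main x _ R _ _) (side y _ nr) e₁ e₂ rewrite x | y = ⊥-elim (nr (subst RtN e₁ R))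

    concl-inj : ∀ {n m} → concl n ≡ concl m → n ≡ m
    concl-inj refl = refl

    e-inj : ∀ {i j v w} → Sc i (proj₁ v) → Sc j (proj₁ w) → e i v ≡ e j w → _≡_ {A = Bool × Vertex} (i , v) (j , w)
    e-inj {i} {j} {_ , p} {_ , q} (n , A , refl , a) (m , B , refl , b) eq
      with inj-cases p q a b refl refl (img a) (img b) (concl-inj (cong proj₁ eq)) (cong proj₂ eq)
    ... | kk , refl with k-inj a b kk
    ...   | refl = refl

    e-lab : ∀ {i v} → Sc i (proj₁ v) → vfm S (e i v) ≡ vfm (S₀ i) v
    e-lab {i} {_ , p} (n , A , refl , a) rewrite seqOf-⊒ (uniqs i) a with img a
    ... | side x m _ rewrite x | S⊒ m = refl
    ... | main x m _ s _ rewrite x | S⊒ m = s p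

    lift : ∀ {i l} → Sc i (proj₁ l) → ∀ W d q → e i l ≡ below-root W (d ∷ q) →
          (∃[ v ] (proj₁ v ≡ proj₁ l × W ≡ e i v × l ≡ below-root v (d ∷ q))) ⊎ Rt W
    lift {i} {_ , p} (n , A , refl , a) (r , w) d q eq with k i n in kin | img a
    ... | o | side refl m _ = inj₁ ((concl n , w) , refl ,
      trans (cong (_, w) (sym (cong proj₁ eq))) (sym (cong (λ o → concl (proj₁ o) , proj₂ o ++ w) kin)) ,
      cong (concl n ,_) (cong proj₂ eq))
    lift {i} {_ , p} (n , A , refl , a) (r , []) d q eq | o | main {z} refl m R _ _ = inj₂ (z , R , cong (_, []) (sym (cong proj₁ eq)))
    lift {i} {_ , p} (n , A , refl , a) (r , b ∷ w) d q eq | o | main {z} {d'} refl m R _ _ = inj₁ ((concl n , w) , refl ,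
      trans (cong₂ (λ r b → r , b ∷ w) (sym (cong proj₁ eq)) (sym (∷-injectiveˡ (cong proj₂ eq))))
            (sym (cong (λ o → concl (proj₁ o) , proj₂ o ++ w) kin)) ,
      cong (concl n ,_) (∷-injectiveʳ (cong proj₂ eq)))

    rt-off : ∀ {i v} → Sc i (proj₁ v) → ¬ Rt (e i v)
    rt-off {i} {_ , p} (n , A , refl , a) (z , R , eq) with k i n | img a
    ... | _ | side refl m nr = nr (subst RtN (concl-inj (sym (cong proj₁ eq))) R)
    ... | _ | main refl m _ _ _ with cong proj₂ eq
    ...   | ()

    rt-uniq : ∀ {v w} → Rt v → Rt w → v ≡ w
    rt-uniq (z , R , refl) (z' , R' , refl) = cong (λ m → concl m , []) (rtN-uniq R R')

    no-cutside : ∀ {i l c s} → Sc i (proj₁ l) → proj₁ (e i l) ≢ cutside c s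
    no-cutside (n , A , refl , a) ()

    sc-concl : ∀ {i c s} → ¬ Sc i (cutside c s)
    sc-concl (_ , _ , () , _)

  module J = Join S₀ S e Sc Rt e-++ (λ {i} {j} {v} {w} → e-inj {i} {j} {v} {w}) (λ {i} {v} → e-lab {i} {v})
    (λ {i} {l} → lift {i} {l}) (λ {i} {v} → rt-off {i} {v}) rt-uniq (λ {i} {l} → no-cutside {i} {l}) sc-concl

  Members : (Bool → Linking) → Set
  Members f = ∀ i → f i ∈ θ₀ i

  scoped' : ∀ i {λ₀} → λ₀ ∈ θ₀ i → ∀ {l} → l ∈ leaves λ₀ → Sc i (proj₁ l)
  scoped' i = GoodNet.scoped (g i)

  comb-scoped : ∀ f → Members f → ∀ {l} → l ∈ leaves (J.comb f) → InCtx Γ (proj₁ l)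
  comb-scoped f m l∈ with J.comb-leaf⁻ {f} l∈
  ... | i , l , l∈' , refl with scoped' i (m i) l∈'
  ...   | n , A , refl , a with k i n | img a
  ...     | _ | side refl a' _ = _ , _ , refl , a'
  ...     | _ | main refl a' _ _ _ = _ , _ , refl , a'

  comb-covered : ∀ f → Members f → ∀ {m A} → (m , A) ∈ Γ → ∃[ p ] ((concl m , p) ∈ leaves (J.comb f))
  comb-covered f mb a with onto a
  ... | i , n , B , b , refl with GoodNet.covered (g i) (mb i) b
  ...   | p , k' = _ , J.comb-leaf⁺ {f} i k'

  comb-disjoint : ∀ f → Members f → DisjointLinks (J.comb f)
  comb-disjoint f m = J.disjoint-comb {f} (λ i k → scoped' i (m i) k) (λ i → GoodNet.disjoint (g i) (m i))

  -- Only the branches allowed by ok can occur below the root vertex.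
  root-branch : ∀ f → Members f → ∀ {v d} → Rt v → Vert (J.comb f ∷ []) (v ▹ d) → ∃[ i ] ok i d
  root-branch f m {v} {d} (z , R , refl) (_ , here refl , q , k') with J.comb-leaf⁻ {f} k'
  ... | i , (_ , p) , l∈ , eq with scoped' i (m i) l∈
  ...   | n , A , refl , a with k i n | img a
  ...     | _ | side refl _ nr = ⊥-elim (nr (subst RtN (concl-inj (cong proj₁ eq)) R))
  ...     | _ | main refl _ _ _ o = i , subst (ok i) (sym (∷-injectiveˡ (cong proj₂ eq))) o

  child-branch : ∀ {v d i w} → Rt v → Sc i (proj₁ w) → v ▹ d ≡ e i w → ok i d
  child-branch {d = d} {i} {_ , p} (z , R , refl) (n , A , refl , a) eq with k i n | img a
  ... | _ | side refl _ nr = ⊥-elim (nr (subst RtN (concl-inj (cong proj₁ eq)) R))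
  ... | _ | main refl _ _ _ o = subst (ok i) (sym (∷-injectiveˡ (cong proj₂ eq))) o

  module _
    (mem→ : ∀ {λ'} → λ' ∈ θ' → ∃[ f ] (Members f × λ' ≡ J.comb f)) (mem← : ∀ f → Members f → J.comb f ∈ θ')
    (rt-kind : ∀ v → Rt v → IsPar S v ⊎
       ((∃[ d ] (∀ f → Members f → ¬ Vert (J.comb f ∷ []) (v ▹ d))) ⊎
        (∀ d i w → Sc i (proj₁ w) → v ▹ d ≡ e i w → i ≡ d)))
    (rt-with : ∀ v → Rt v → IsWith S v → ∃[ d ] (∀ f → Members f → ¬ Vert (J.comb f ∷ []) (v ▹ d)))
    where

    module N = J.Nets θ₀ θ' mem→ mem← scoped'
      (λ i → GoodNet.good₁ (g i) (seqOf-⊒ (uniqs i))) (λ i → GoodNet.good₂ (g i) (seqOf-⊒ (uniqs i)))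
      (λ i → GoodNet.good₃ (g i) (seqOf-⊒ (uniqs i))) rt-kind rt-with

    rule₁ : ∀ ρ → (∀ v → Rt v → IsWith S v → ∀ i d → ok i d → d ≡ ρ v) → P1At S ρ θ'
    rule₁ ρ h = N.join-P1 ρ (λ W d f m R w V → let (i , o) = root-branch f m R (J.comb f , here refl , V) in h W R w i d o)

    rule₃ : P3 S θ'
    rule₃ = N.join-P3

    -- Every premise is connected to the root vertex through some undeleted edge.
    Hooked : Set
    Hooked = ∀ (sw : Vertex → Bool) i {n A} → (n , A) ∈ Γs i → ∃[ z ] ∃[ x ] ∃[ B ] ∃[ d ]
      ((x , B) ∈ Γs i × k i x ≡ (z , d ∷ []) × RtN z × (IsPar S (concl z , []) → d ≢ sw (concl z , [])))

    rule₂ : Hooked → P2 S θ'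
    rule₂ hook = N.join-P2 conn
      where
      conn : ∀ f (m : N.Member f) sw → let open N.Switched f m sw in
             ∀ u v → Vert (J.comb f ∷ []) u → Vert (J.comb f ∷ []) v → Star (Adj E') u v
      conn f m sw u v U V with hub U | hub V
        where
        open N.Switched f m sw
        hub : ∀ {u} → Vert (J.comb f ∷ []) u → ∃[ r ] (Rt r × Star (Adj E') u r)
        hub {u} U with vert-cases {u} U
        ... | inj₂ R = u , R , ε
        ... | inj₁ (i , u₀ , refl , U₀@(_ , here refl , q , l∈)) with scoped' i (m i) l∈
        ...   | n , A , refl , a with hook sw i a
        ...     | z , x , B , d , b , kx , R , nd with GoodNet.covered (g i) (m i) b
        ...       | p , x∈ = (concl z , []) , (z , R , refl) ,
          (connected⁺ i U₀ (f i , here refl , p , x∈) ◅◅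
           subst (λ w → Star (Adj E') w (concl z , [])) (sym here-is) (child-adj child nd ◅ ε))
          where
          here-is : e i (concl x , []) ≡ (concl z , []) ▹ d
          here-is = cong (λ o → concl (proj₁ o) , proj₂ o ++ []) kx
          child : Vert (J.comb f ∷ []) ((concl z , []) ▹ d)
          child = J.comb f , here refl , p , subst (_∈ leaves (J.comb f)) (cong (λ o → concl (proj₁ o) , proj₂ o ++ p) kx) (J.comb-leaf⁺ {f} i x∈)
      ... | r , R , p | r' , R' , p' with rt-uniq R R'
      ...   | refl = p ◅◅ N.adj-sym p'

    rule₂-rootless : (∀ {z} → ¬ RtN z) → (∀ {n A} → ¬ (n , A) ∈ Γs true) → P2 S θ'
    rule₂-rootless no-root no-right = N.join-P2 conn
      where
      conn : ∀ f (m : N.Member f) sw → let open N.Switched f m sw in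
             ∀ u v → Vert (J.comb f ∷ []) u → Vert (J.comb f ∷ []) v → Star (Adj E') u v
      conn f m sw u v U V with N.Switched.vert-cases f m sw {u} U | N.Switched.vert-cases f m sw {v} V
      ... | inj₂ (_ , R , _) | _ = ⊥-elim (no-root R)
      ... | _ | inj₂ (_ , R , _) = ⊥-elim (no-root R)
      ... | inj₁ (false , u₀ , refl , U₀) | inj₁ (false , v₀ , refl , V₀) = N.Switched.connected⁺ f m sw false U₀ V₀
      ... | inj₁ (true , _ , _ , (_ , here refl , _ , l∈)) | _ with scoped' true (m true) l∈
      ...   | _ , _ , _ , a = ⊥-elim (no-right a)
      conn f m sw u v U V | inj₁ (false , _ , _ , _) | inj₁ (true , _ , _ , (_ , here refl , _ , l∈)) with scoped' true (m true) l∈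
      ...   | _ , _ , _ , a = ⊥-elim (no-right a)

two : ∀ {X : Set} → X → X → Bool → X
two a b false = a
two a b true = b

empty-good : GoodNet [] ([] ∷ [])
empty-good = record
  { scoped = λ { (here refl) () }
  ; covered = λ _ ()
  ; disjoint = λ { (here refl) _ _ _ () }
  ; good₁ = λ _ ρ → [] , here refl , (λ { _ _ _ (_ , ()) }) , (λ { _ (here refl) _ → same-refl })
  ; good₂ = λ { _ _ (here refl) sw → (λ { _ _ (_ , here refl , _ , ()) }) , no-cycle }
  ; good₃ = λ { _ Λ h (λ₁ , λ₂ , m₁ , m₂ , ne) → ⊥-elim (differ (h λ₁ m₁) (h λ₂ m₂) ne) } }
  where
  differ : ∀ {λ₁ λ₂ : Linking} → λ₁ ∈ [] ∷ [] → λ₂ ∈ [] ∷ [] → ¬ SameLinking λ₁ λ₂ → ⊥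
  differ (here refl) (here refl) ne = ne same-refl
  no-edge : ∀ {S sw} E → ¬ SwEdges S [] sw E
  no-edge (tree v d) ((_ , here refl , _ , ()) , _)
  no-edge (link a) ((_ , here refl , ()) , _)
  no-edge (jump l W) ((_ , (_ , here refl , ()) , _) , _)
  no-edge (cutE c) ((_ , here refl , _ , ()) , _)
  no-cycle : ∀ {S sw} → Cycle (SwEdges S [] sw) → ⊥
  no-cycle c = go (steps c) refl
    where
    go : ∀ xs → steps c ≡ xs → ⊥
    go [] q = nonempty c q
    go ((E , _) ∷ xs) q = no-edge E (proj₁ (subst (λ xs → Walk _ (start c) xs (start c)) q (closed c)))

comb₀ : (Bool → ℕ → Occ) → (Bool → Linking) → Linking
comb₀ k f = mapl (ext (k false)) (f false) ++ mapl (ext (k true)) (f true)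

root-formula : ∀ {S Γ z F} → S ⊒ Γ → (z , F) ∈ Γ → vfm S (concl z , []) ≡ just F
root-formula S⊒ a rewrite S⊒ a = refl

Hooks : (Bool → Ctx) → Ctx → (Bool → ℕ → Occ) → (ℕ → Set) → (ℕ → Bool) → Bool → Set
Hooks Γs Γ k RtN c i = ∃[ z ] ∃[ x ] ∃[ B ] ∃[ d ] ∃[ F ]
  ((x , B) ∈ Γs i × k i x ≡ (z , d ∷ []) × RtN z × (z , F) ∈ Γ × (∀ A B → F ≡ A ⅋ B → d ≢ c z))

module Part {Γs : Bool → Ctx} {Γ : Ctx} {k : Bool → ℕ → Occ} {RtN : ℕ → Set} {ok : Bool → Bool → Set}
  (layout : Layout Γs Γ k RtN ok) (uΓ : Uniq Γ) (θ₀ : Bool → Net) (θ' : Net) (g : ∀ i → GoodNet (Γs i) (θ₀ i))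
  (mem→ : ∀ {λ'} → λ' ∈ θ' → ∃[ f ] ((∀ i → f i ∈ θ₀ i) × λ' ≡ comb₀ k f))
  (mem← : ∀ f → (∀ i → f i ∈ θ₀ i) → comb₀ k f ∈ θ')
  (kind : (∀ {z} → RtN z → ∃[ A ] ∃[ B ] ((z , A ⅋ B) ∈ Γ)) ⊎
          ((∃[ d ] (∀ i d' → ok i d' → d' ≡ d)) ⊎
           ((∀ i d → ok i d → i ≡ d) × (∀ {z} → RtN z → ∃[ A ] ∃[ B ] ((z , A ⊗ B) ∈ Γ)))))
  where

  private
    module M {S : CutSeq} (S⊒ : S ⊒ Γ) where
      module Q = Rule layout {S} S⊒ θ₀ θ' g

      off-branch : ∀ d → (∀ i d' → ok i d' → d' ≡ d) → ∀ v → Q.Rt v →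
                   ∀ f → (∀ i → f i ∈ θ₀ i) → ¬ Vert (comb₀ k f ∷ []) (v ▹ not d)
      off-branch d h v R f m V = let (i , o) = Q.root-branch f m R V in not-≢ d (sym (h i (not d) o))

      Kind : Set
      Kind = (∀ {z} → RtN z → ∃[ A ] ∃[ B ] ((z , A ⅋ B) ∈ Γ)) ⊎
          ((∃[ d ] (∀ i d' → ok i d' → d' ≡ d)) ⊎
           ((∀ i d → ok i d → i ≡ d) × (∀ {z} → RtN z → ∃[ A ] ∃[ B ] ((z , A ⊗ B) ∈ Γ))))

      kind-of : Kind → ∀ v → Q.Rt v → IsPar S v ⊎
         ((∃[ d ] (∀ f → (∀ i → f i ∈ θ₀ i) → ¬ Vert (comb₀ k f ∷ []) (v ▹ d))) ⊎
          (∀ d i w → Q.Sc i (proj₁ w) → v ▹ d ≡ Q.e i w → i ≡ d))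
      kind-of (inj₁ h) v (z , r , refl) = let (A , B , a) = h r in inj₁ (A , B , root-formula {S} S⊒ a)
      kind-of (inj₂ (inj₁ (d , h))) v R = inj₂ (inj₁ (not d , off-branch d h v R))
      kind-of (inj₂ (inj₂ (h , _))) v R = inj₂ (inj₂ λ d i w s q → h i d (Q.child-branch {w = w} R s q))

      with-of : Kind → ∀ v → Q.Rt v → IsWith S v → ∃[ d ] (∀ f → (∀ i → f i ∈ θ₀ i) → ¬ Vert (comb₀ k f ∷ []) (v ▹ d))
      with-of (inj₁ h) v (z , r , refl) (_ , _ , q) with h r
      ... | A , B , a with trans (sym (root-formula {S} S⊒ a)) q
      ...   | ()
      with-of (inj₂ (inj₁ (d , h))) v R w = not d , off-branch d h v R
      with-of (inj₂ (inj₂ (_ , h))) v (z , r , refl) (_ , _ , q) with h r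
      ... | A , B , a with trans (sym (root-formula {S} S⊒ a)) q
      ...   | ()

      rt-kind = kind-of kind
      rt-with = with-of kind

  part₁ : ∀ {S} (S⊒ : S ⊒ Γ) ρ → (∀ {z} → RtN z → IsWith S (concl z , []) → ∀ i d → ok i d → d ≡ ρ (concl z , [])) →
          P1At S ρ θ'
  part₁ {S} S⊒ ρ h = M.Q.rule₁ {S} S⊒ mem→ mem← (M.rt-kind {S} S⊒) (M.rt-with {S} S⊒) ρ λ { _ (z , r , refl) w → h r w }

  part₃ : ∀ {S} → S ⊒ Γ → P3 S θ'
  part₃ {S} S⊒ = M.Q.rule₃ {S} S⊒ mem→ mem← (M.rt-kind {S} S⊒) (M.rt-with {S} S⊒)

  part₂ : (∀ c i {n A} → (n , A) ∈ Γs i → Hooks Γs Γ k RtN c i) →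
          ∀ {S} → S ⊒ Γ → P2 S θ'
  part₂ hook {S} S⊒ = M.Q.rule₂ {S} S⊒ mem→ mem← (M.rt-kind {S} S⊒) (M.rt-with {S} S⊒) λ sw i a →
    let (z , x , B , d , F , b , q , r , zF , nd) = hook (λ z → sw (concl z , [])) i a in
    z , x , B , d , b , q , r , λ (A' , B' , e) → nd A' B' (just-injective (trans (sym (root-formula {S} S⊒ zF)) e))

  part₂-rootless : (∀ {z} → ¬ RtN z) → (∀ {n A} → ¬ (n , A) ∈ Γs true) → ∀ {S} → S ⊒ Γ → P2 S θ'
  part₂-rootless nr ne {S} S⊒ = M.Q.rule₂-rootless {S} S⊒ mem→ mem← (M.rt-kind {S} S⊒) (M.rt-with {S} S⊒) nr ne

  private
    module Q = Rule layout {seqOf Γ} (seqOf-⊒ uΓ) θ₀ θ' g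

  part-scoped : ∀ {λ₀} → λ₀ ∈ θ' → ∀ {l} → l ∈ leaves λ₀ → InCtx Γ (proj₁ l)
  part-scoped i l with mem→ i
  ... | f , m , refl = Q.comb-scoped f m l

  part-covered : ∀ {λ₀ n A} → λ₀ ∈ θ' → (n , A) ∈ Γ → ∃[ p ] ((concl n , p) ∈ leaves λ₀)
  part-covered i a with mem→ i
  ... | f , m , refl = Q.comb-covered f m a

  part-disjoint : ∀ {λ₀} → λ₀ ∈ θ' → DisjointLinks λ₀
  part-disjoint i with mem→ i
  ... | f , m , refl = Q.comb-disjoint f m

unary-mem→ : ∀ h {θ : Net} {λ'} → λ' ∈ unaryL h θ →
  ∃[ f ] ((∀ i → f i ∈ two θ ([] ∷ []) i) × λ' ≡ comb₀ (λ _ n → h (n , [])) f)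
unary-mem→ h i with ∈-map⁻ _ i
... | λ₀ , j , refl = two λ₀ [] , (λ { false → j ; true → here refl }) , sym (++-identityʳ _)

unary-mem← : ∀ h {θ : Net} f → (∀ i → f i ∈ two θ ([] ∷ []) i) → comb₀ (λ _ n → h (n , [])) f ∈ unaryL h θ
unary-mem← h {θ} f m with f true | m true
... | _ | here refl = subst (_∈ unaryL h θ) (sym (++-identityʳ _)) (∈-map⁺ _ (m false))

unary-good : ∀ {Γ θ} → GoodNet Γ θ → ∀ i → GoodNet (two Γ [] i) (two θ ([] ∷ []) i)
unary-good g false = g
unary-good g true = empty-good

root-occ : Occ → Occ → Occ
root-occ (x , _) (n , []) = n , []
root-occ (x , _) (n , _ ∷ _) = x , []

single-layout : ∀ {x A Γ z F} d → Uniq ((x , A) ∷ Γ) → Fresh z Γ → (∀ p → sub F (d ∷ p) ≡ sub A p) →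
  Layout (two ((x , A) ∷ Γ) []) ((z , F) ∷ Γ) (λ _ n → lab x z d (n , [])) (_≡ z) (λ _ d' → d' ≡ d)
single-layout {x} {A} {Γ} {z} {F} d (fx , u) fz s = record
  { uniqs = λ { false → fx , u ; true → tt }
  ; img = λ { {false} (here refl) → main lab-hit (here refl) refl s refl
            ; {false} (there i) → side (lab-miss (fresh-≢ fx i)) (there i) (fresh-≢ fz i)
            ; {true} () }
  ; k-inj = inj
  ; onto = λ { (here refl) → false , x , A , here refl , cong proj₁ lab-hit
             ; (there i) → false , _ , _ , there i , cong proj₁ (lab-miss (fresh-≢ fx i)) }
  ; rtN-uniq = λ { refl refl → refl } }
  where
  decode : ∀ {n B} → (n , B) ∈ (x , A) ∷ Γ → proj₁ (root-occ (x , []) (lab x z d (n , []))) ≡ n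
  decode (here refl) rewrite lab-hit {x} {z} {d} {[]} = refl
  decode {n} (there i) rewrite lab-miss {x} {z} {d} {n} {[]} (fresh-≢ fx i) = refl
  inj : ∀ {i j n m B C} → (n , B) ∈ two ((x , A) ∷ Γ) [] i → (m , C) ∈ two ((x , A) ∷ Γ) [] j →
        lab x z d (n , []) ≡ lab x z d (m , []) → (i , n) ≡ (j , m)
  inj {false} {false} a b q = cong (false ,_) (trans (sym (decode a)) (trans (cong (λ o → proj₁ (root-occ (x , []) o)) q) (decode b)))

par-layout : ∀ {x y A B Γ z} → Uniq ((x , A) ∷ (y , B) ∷ Γ) → Fresh z Γ →
  Layout (two ((x , A) ∷ (y , B) ∷ Γ) []) ((z , A ⅋ B) ∷ Γ) (λ _ n → lab₂ x y z (n , [])) (_≡ z) (λ _ _ → ⊤)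
par-layout {x} {y} {A} {B} {Γ} {z} U@(fx , fy , u) fz = record
  { uniqs = λ { false → U ; true → tt }
  ; img = λ { {false} (here refl) → main lab₂-left (here refl) refl (λ _ → refl) tt
            ; {false} (there (here refl)) → main (lab₂-right y≢x) (here refl) refl (λ _ → refl) tt
            ; {false} (there (there i)) → side (miss i) (there i) (fresh-≢ fz i)
            ; {true} () }
  ; k-inj = inj
  ; onto = λ { (here refl) → false , x , A , here refl , cong proj₁ lab₂-left
             ; (there i) → false , _ , _ , there (there i) , cong proj₁ (miss i) }
  ; rtN-uniq = λ { refl refl → refl } }
  where
  y≢x : y ≢ x
  y≢x = fresh-≢ fx (here refl)
  miss : ∀ {n C} → (n , C) ∈ Γ → lab₂ x y z (n , []) ≡ (n , [])
  miss i = lab₂-miss (fresh-≢ fx (there i)) (fresh-≢ fy i)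
  name : Occ → ℕ
  name (n , []) = n
  name (_ , false ∷ _) = x
  name (_ , true ∷ _) = y
  decode : ∀ {n C} → (n , C) ∈ (x , A) ∷ (y , B) ∷ Γ → name (lab₂ x y z (n , [])) ≡ n
  decode (here refl) rewrite lab₂-left {x} {y} {z} {[]} = refl
  decode (there (here refl)) rewrite lab₂-right {x} {y} {z} {[]} y≢x = refl
  decode (there (there i)) rewrite miss i = refl
  inj : ∀ {i j n m C D} → (n , C) ∈ two ((x , A) ∷ (y , B) ∷ Γ) [] i → (m , D) ∈ two ((x , A) ∷ (y , B) ∷ Γ) [] j →
        lab₂ x y z (n , []) ≡ lab₂ x y z (m , []) → (i , n) ≡ (j , m)
  inj {false} {false} a b q = cong (false ,_) (trans (sym (decode a)) (trans (cong name q) (decode b)))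

rename-layout : ∀ {f Γ} → Uniq Γ → InjOn f Γ → Layout (two Γ []) (mapN f Γ) (λ _ n → f n , []) (λ _ → ⊥) (λ _ _ → ⊤)
rename-layout {f} {Γ} u f-inj = record
  { uniqs = λ { false → u ; true → tt }
  ; img = λ { {false} i → side refl (∈-mapN⁺ i) (λ ()) ; {true} () }
  ; k-inj = λ { {false} {false} a b q → cong (false ,_) (f-inj a b (cong proj₁ q)) ; {true} () ; {false} {true} _ () }
  ; onto = λ i → let (n , j , q) = ∈-mapN⁻ {f} i in false , n , _ , j , sym q
  ; rtN-uniq = λ () }

tens-occ : ℕ → ℕ → ℕ → Bool → ℕ → Occ
tens-occ x y z i n = two (lab x z false) (lab y z true) i (n , [])

tens-layout : ∀ {x y A B Γ Δ z} → Uniq ((x , A) ∷ Γ) → Uniq ((y , B) ∷ Δ) → Apart Γ Δ → Fresh z (Γ ++ Δ) →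
  Layout (two ((x , A) ∷ Γ) ((y , B) ∷ Δ)) ((z , A ⊗ B) ∷ Γ ++ Δ) (tens-occ x y z) (_≡ z) _≡_
tens-layout {x} {y} {A} {B} {Γ} {Δ} {z} (fx , u) (fy , v) ap fz = record
  { uniqs = λ { false → fx , u ; true → fy , v }
  ; img = λ { {false} (here refl) → main lab-hit (here refl) refl (λ _ → refl) refl
            ; {false} (there i) → side (miss₁ i) (there (∈-++⁺ˡ i)) (λ q → fz (subst (λ n → (n , _) ∈ Γ ++ Δ) q (∈-++⁺ˡ i)))
            ; {true} (here refl) → main lab-hit (here refl) refl (λ _ → refl) refl
            ; {true} (there i) → side (miss₂ i) (there (∈-++⁺ʳ Γ i)) (λ q → fz (subst (λ n → (n , _) ∈ Γ ++ Δ) q (∈-++⁺ʳ Γ i))) }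
  ; k-inj = inj
  ; onto = on
  ; rtN-uniq = λ { refl refl → refl } }
  where
  miss₁ : ∀ {n C} → (n , C) ∈ Γ → lab x z false (n , []) ≡ (n , [])
  miss₁ i = lab-miss (fresh-≢ fx i)
  miss₂ : ∀ {n C} → (n , C) ∈ Δ → lab y z true (n , []) ≡ (n , [])
  miss₂ i = lab-miss (fresh-≢ fy i)
  on : ∀ {m C} → (m , C) ∈ (z , A ⊗ B) ∷ Γ ++ Δ →
       ∃[ i ] ∃[ n ] ∃[ D ] ((n , D) ∈ two ((x , A) ∷ Γ) ((y , B) ∷ Δ) i × proj₁ (tens-occ x y z i n) ≡ m)
  on (here refl) = false , x , A , here refl , cong proj₁ lab-hit
  on (there i) with ∈-++⁻ Γ i
  ... | inj₁ j = false , _ , _ , there j , cong proj₁ (miss₁ j)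
  ... | inj₂ j = true , _ , _ , there j , cong proj₁ (miss₂ j)
  decode₁ : ∀ {n C} → (n , C) ∈ (x , A) ∷ Γ → proj₁ (root-occ (x , []) (lab x z false (n , []))) ≡ n
  decode₁ (here refl) rewrite lab-hit {x} {z} {false} {[]} = refl
  decode₁ (there i) rewrite miss₁ i = refl
  decode₂ : ∀ {n C} → (n , C) ∈ (y , B) ∷ Δ → proj₁ (root-occ (y , []) (lab y z true (n , []))) ≡ n
  decode₂ (here refl) rewrite lab-hit {y} {z} {true} {[]} = refl
  decode₂ (there i) rewrite miss₂ i = refl
  cross : ∀ {n m C D} → (n , C) ∈ (x , A) ∷ Γ → (m , D) ∈ (y , B) ∷ Δ → lab x z false (n , []) ≢ lab y z true (m , [])
  cross (here refl) (here refl) q with trans (sym lab-hit) (trans q lab-hit)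
  ... | ()
  cross (here refl) (there j) q with trans (sym lab-hit) (trans q (miss₂ j))
  ... | ()
  cross (there i) (here refl) q with trans (sym (miss₁ i)) (trans q lab-hit)
  ... | ()
  cross (there i) (there j) q with trans (sym (miss₁ i)) (trans q (miss₂ j))
  ... | refl = ap i j
  inj : ∀ {i j n m C D} → (n , C) ∈ two ((x , A) ∷ Γ) ((y , B) ∷ Δ) i → (m , D) ∈ two ((x , A) ∷ Γ) ((y , B) ∷ Δ) j →
        tens-occ x y z i n ≡ tens-occ x y z j m → (i , n) ≡ (j , m)
  inj {false} {false} a b q = cong (false ,_) (trans (sym (decode₁ a)) (trans (cong (λ o → proj₁ (root-occ (x , []) o)) q) (decode₁ b)))
  inj {true} {true} a b q = cong (true ,_) (trans (sym (decode₂ a)) (trans (cong (λ o → proj₁ (root-occ (y , []) o)) q) (decode₂ b)))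
  inj {false} {true} a b q = ⊥-elim (cross a b q)
  inj {true} {false} a b q = ⊥-elim (cross b a (sym q))

good-∈ : ∀ {Γ Δ θ} → (∀ {n A} → (n , A) ∈ Γ → (n , A) ∈ Δ) → (∀ {n A} → (n , A) ∈ Δ → (n , A) ∈ Γ) →
         GoodNet Γ θ → GoodNet Δ θ
good-∈ f b g = record
  { scoped = λ m l → let (n , A , q , i) = scoped m l in n , A , q , f i
  ; covered = λ m i → covered m (b i)
  ; disjoint = disjoint
  ; good₁ = λ {S} h → good₁ {S} (λ i → h (f i))
  ; good₂ = λ {S} h → good₂ {S} (λ i → h (f i))
  ; good₃ = λ {S} h → good₃ {S} (λ i → h (f i)) }
  where open GoodNet g

good-ax : ∀ {x y} k → x ≢ y → GoodNet ((x , nvar k) ∷ (y , var k) ∷ []) ((lk (concl y , []) (concl x , []) ∷ []) ∷ [])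
good-ax {x} {y} k x≢y = record
  { scoped = λ { (here refl) (here refl) → y , var k , refl , there (here refl)
               ; (here refl) (there (here refl)) → x , nvar k , refl , here refl }
  ; covered = λ { (here refl) (here refl) → [] , there (here refl) ; (here refl) (there (here refl)) → [] , here refl }
  ; disjoint = λ { (here refl) _ _ _ (here refl) (here refl) _ _ → refl }
  ; good₁ = λ {S} h ρ → _ , here refl , (λ W d _ (q , l) → ⊥-elim (no-branch W d q l)) , (λ { _ (here refl) _ → same-refl })
  ; good₂ = λ { {S} h _ (here refl) sw → conn S sw , acyclic S sw }
  ; good₃ = λ { {S} h Λ s (λ₁ , λ₂ , m₁ , m₂ , ne) → ⊥-elim (differ (s λ₁ m₁) (s λ₂ m₂) ne) } }
  where
  ℓ = lk (concl y , []) (concl x , [])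
  differ : ∀ {λ₁ λ₂ : Linking} → λ₁ ∈ (ℓ ∷ []) ∷ [] → λ₂ ∈ (ℓ ∷ []) ∷ [] → ¬ SameLinking λ₁ λ₂ → ⊥
  differ (here refl) (here refl) ne = ne same-refl
  no-branch : ∀ (W : Vertex) d q → below-root (W ▹ d) q ∉ leaves (ℓ ∷ [])
  no-branch (_ , p) d q i = long p (leaf-root i)
    where
    leaf-root : ∀ {v} → v ∈ leaves (ℓ ∷ []) → proj₂ v ≡ []
    leaf-root (here refl) = refl
    leaf-root (there (here refl)) = refl
    long : ∀ p → (p ++ d ∷ []) ++ q ≢ []
    long [] ()
    long (_ ∷ _) ()
  only : ∀ S sw E → SwEdges S (ℓ ∷ []) sw E → E ≡ link ℓ
  only S sw (tree v d) ((_ , here refl , q , l) , _) = ⊥-elim (no-branch v d q l)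
  only S sw (link a) ((_ , here refl , here refl) , _) = refl
  only S sw (jump l W) ((_ , _ , _ , (_ , _ , here refl , here refl , i , n , _)) , _) = ⊥-elim (n i)
  only S sw (cutE c) ((_ , here refl , q , here ()) , _)
  only S sw (cutE c) ((_ , here refl , q , there (here ())) , _)
  ends-of : ∀ {u} → Vert ((ℓ ∷ []) ∷ []) u → u ≡ (concl y , []) ⊎ u ≡ (concl x , [])
  ends-of {_ , []} (_ , here refl , [] , here refl) = inj₁ refl
  ends-of {_ , []} (_ , here refl , [] , there (here refl)) = inj₂ refl
  ends-of {_ , []} (_ , here refl , _ ∷ _ , here ())
  ends-of {_ , []} (_ , here refl , _ ∷ _ , there (here ()))
  ends-of {_ , _ ∷ _} (_ , here refl , _ , here ())
  ends-of {_ , _ ∷ _} (_ , here refl , _ , there (here ()))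
  conn : ∀ S sw u v → Vert ((ℓ ∷ []) ∷ []) u → Vert ((ℓ ∷ []) ∷ []) v → Star (Adj (SwEdges S (ℓ ∷ []) sw)) u v
  conn S sw u v U V with ends-of U | ends-of V
  ... | inj₁ refl | inj₁ refl = ε
  ... | inj₂ refl | inj₂ refl = ε
  ... | inj₁ refl | inj₂ refl = (link ℓ , ((_ , here refl , here refl) , λ ()) , inj₁ (refl , refl)) ◅ ε
  ... | inj₂ refl | inj₁ refl = (link ℓ , ((_ , here refl , here refl) , λ ()) , inj₂ (refl , refl)) ◅ ε
  acyclic : ∀ S sw → Cycle (SwEdges S (ℓ ∷ []) sw) → ⊥
  acyclic S sw c = go (steps c) refl
    where
    name-of : ∀ {u v : Vertex} → Joins (link ℓ) u v → u ≢ v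
    name-of (inj₁ (refl , refl)) refl = x≢y refl
    name-of (inj₂ (refl , refl)) refl = x≢y refl
    go : ∀ xs → steps c ≡ xs → ⊥
    go [] q = nonempty c q
    go ((E , v) ∷ []) q with subst (λ xs → Walk _ (start c) xs (start c)) q (closed c)
    ... | e , J , p with only S sw E e
    ...   | refl = name-of J (sym p)
    go ((E , _) ∷ (E' , _) ∷ xs) q with subst (λ xs → Walk _ (start c) xs (start c)) q (closed c)
    ... | e , _ , e' , _ with only S sw E e | only S sw E' e'
    ...   | refl | refl = unique-∉ (subst (λ xs → Unique (edges xs)) q (distE c)) (here refl)

module Single {x A Γ z F} (d : Bool) (u : Uniq ((x , A) ∷ Γ)) (fz : Fresh z Γ) (s : ∀ p → sub F (d ∷ p) ≡ sub A p)
              (F-not-par : ∀ A B → F ≢ A ⅋ B) {θ} (g : GoodNet ((x , A) ∷ Γ) θ) where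
  open Part (single-layout {x} {A} {Γ} {z} {F} d u fz s) (fz , proj₂ u) (two θ ([] ∷ [])) (unaryL (lab x z d) θ) (unary-good g)
    (unary-mem→ (lab x z d)) (unary-mem← (lab x z d)) (inj₂ (inj₁ (d , λ _ _ q → q))) public

  single₂ : ∀ {S} → S ⊒ ((z , F) ∷ Γ) → P2 S (unaryL (lab x z d) θ)
  single₂ {S} = part₂ (λ { c false _ → z , x , A , d , F , here refl , lab-hit , refl , here refl , λ A B q → ⊥-elim (F-not-par A B q)
                    ; c true () }) {S}

good : ∀ {Γ} (D : CF Γ) → GoodNet Γ (netL D)
good (cax k x≢y) = good-ax k x≢y
good (cex p D) = good-∈ (∈-resp-↭ p) (∈-resp-↭ (↭-sym p)) (good D)
good (crn {Γ} f f-inj D) = record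
  { scoped = part-scoped ; covered = part-covered ; disjoint = part-disjoint
  ; good₁ = λ {S} S⊒ ρ → part₁ {S} S⊒ ρ (λ ()) ; good₂ = λ {S} → part₂-rootless (λ ()) (λ ()) {S} ; good₃ = λ {S} → part₃ {S} }
  where
  open Part (rename-layout (uniq D) f-inj) (uniq (crn f f-inj D)) (two (netL D) ([] ∷ [])) (unaryL (rename f) (netL D))
    (unary-good (good D)) (unary-mem→ (rename f)) (unary-mem← (rename f)) (inj₁ (λ ()))
good (cpar {x} {y} {A} {B} {Γ} z D fz) = record
  { scoped = part-scoped ; covered = part-covered ; disjoint = part-disjoint
  ; good₁ = λ {S} S⊒ ρ → part₁ {S} S⊒ ρ (λ { refl w → ⊥-elim (not-with {S} S⊒ w) }) ; good₂ = λ {S} → part₂ hook {S} ; good₃ = λ {S} → part₃ {S} }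
  where
  root-par : ∀ {m} → m ≡ z → ∃[ A' ] ∃[ B' ] ((m , A' ⅋ B') ∈ (z , A ⅋ B) ∷ Γ)
  root-par refl = A , B , here refl
  open Part (par-layout (uniq D) fz) (uniq (cpar z D fz)) (two (netL D) ([] ∷ [])) (unaryL (lab₂ x y z) (netL D))
    (unary-good (good D)) (unary-mem→ (lab₂ x y z)) (unary-mem← (lab₂ x y z)) (inj₁ root-par)
  not-with : ∀ {S} → S ⊒ ((z , A ⅋ B) ∷ Γ) → ¬ IsWith S (concl z , [])
  not-with {S} S⊒ (_ , _ , q) with trans (sym (root-formula {S} S⊒ (here refl))) q
  ... | ()
  y≢x : y ≢ x
  y≢x = fresh-≢ (proj₁ (uniq D)) (here refl)
  hook : ∀ c i {n C} → (n , C) ∈ two ((x , A) ∷ (y , B) ∷ Γ) [] i →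
         Hooks (two ((x , A) ∷ (y , B) ∷ Γ) []) ((z , A ⅋ B) ∷ Γ) (λ _ n → lab₂ x y z (n , [])) (_≡ z) c i
  hook c true ()
  hook c false _ with c z in q
  ... | true = z , x , A , false , A ⅋ B , here refl , lab₂-left , refl , here refl , λ _ _ _ q' → false≢true (trans q' q)
    where
    false≢true : false ≢ true
    false≢true ()
  ... | false = z , y , B , true , A ⅋ B , there (here refl) , lab₂-right y≢x , refl , here refl , λ _ _ _ q' → true≢false (trans q' q)
    where
    true≢false : true ≢ false
    true≢false ()
good (cplus {x} {A} {B} {Γ} z d D fz) = record
  { scoped = part-scoped ; covered = part-covered ; disjoint = part-disjoint
  ; good₁ = λ {S} S⊒ ρ → part₁ {S} S⊒ ρ (λ { refl w → ⊥-elim (not-with {S} S⊒ w) }) ; good₂ = λ {S} → single₂ {S} ; good₃ = λ {S} → part₃ {S} }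
  where
  branch : ∀ d p → sub (A ⊕ B) (d ∷ p) ≡ sub (if d then B else A) p
  branch d p = refl
  open Single {x} {if d then B else A} {Γ} {z} {A ⊕ B} d (uniq D) fz (branch d) (λ _ _ ()) (good D)
  not-with : ∀ {S} → S ⊒ ((z , A ⊕ B) ∷ Γ) → ¬ IsWith S (concl z , [])
  not-with {S} S⊒ (_ , _ , q) with trans (sym (root-formula {S} S⊒ (here refl))) q
  ... | ()
good (ctens {x} {y} {A} {B} {Γ} {Δ} z D E ap fz) = record
  { scoped = part-scoped ; covered = part-covered ; disjoint = part-disjoint
  ; good₁ = λ {S} S⊒ ρ → part₁ {S} S⊒ ρ (λ { refl w → ⊥-elim (not-with {S} S⊒ w) }) ; good₂ = λ {S} → part₂ hook {S} ; good₃ = λ {S} → part₃ {S} }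
  where
  θ' = binaryL (lab x z false) (lab y z true) (netL D) (netL E)
  mem→ : ∀ {λ'} → λ' ∈ θ' → ∃[ f ] ((∀ i → f i ∈ two (netL D) (netL E) i) × λ' ≡ comb₀ (tens-occ x y z) f)
  mem→ i with ∈-joinL⁻ (extO (lab x z false)) (extO (lab y z true)) (netL D) (netL E) i
  ... | λ₀ , μ , j , j' , refl = two λ₀ μ , (λ { false → j ; true → j' }) , refl
  root-tens : ∀ {m} → m ≡ z → ∃[ A' ] ∃[ B' ] ((m , A' ⊗ B') ∈ (z , A ⊗ B) ∷ Γ ++ Δ)
  root-tens refl = A , B , here refl
  both : ∀ i → GoodNet (two ((x , A) ∷ Γ) ((y , B) ∷ Δ) i) (two (netL D) (netL E) i)
  both false = good D
  both true = good E
  open Part (tens-layout (uniq D) (uniq E) ap fz) (uniq (ctens z D E ap fz)) (two (netL D) (netL E)) θ'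
    both mem→ (λ f m → ∈-joinL⁺ (extO (lab x z false)) (extO (lab y z true)) (m false) (m true))
    (inj₂ (inj₂ ((λ _ _ q → q) , root-tens)))
  not-with : ∀ {S} → S ⊒ ((z , A ⊗ B) ∷ Γ ++ Δ) → ¬ IsWith S (concl z , [])
  not-with {S} S⊒ (_ , _ , q) with trans (sym (root-formula {S} S⊒ (here refl))) q
  ... | ()
  hook : ∀ c i {n C} → (n , C) ∈ two ((x , A) ∷ Γ) ((y , B) ∷ Δ) i →
         Hooks (two ((x , A) ∷ Γ) ((y , B) ∷ Δ)) ((z , A ⊗ B) ∷ Γ ++ Δ) (tens-occ x y z) (_≡ z) c i
  hook c false _ = z , x , A , false , A ⊗ B , here refl , lab-hit , refl , here refl , λ _ _ ()
  hook c true _ = z , y , B , true , A ⊗ B , here refl , lab-hit , refl , here refl , λ _ _ ()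
good (cwith {x} {y} {A} {B} {Γ} z D E fz) = record
  { scoped = λ i → [ P.part-scoped , Q.part-scoped ]∈ (∈-++⁻ θ₁ i)
  ; covered = cov
  ; disjoint = dis
  ; good₁ = λ {S} → g₁ {S} ; good₂ = λ {S} → g₂ {S} ; good₃ = λ {S} → g₃ {S} }
  where
  θ₁ = unaryL (lab x z false) (netL D)
  θ₂ = unaryL (lab y z true) (netL E)
  module P = Single {x} {A} {Γ} {z} {A & B} false (uniq D) fz (λ _ → refl) (λ _ _ ()) (good D)
  module Q = Single {y} {B} {Γ} {z} {A & B} true (uniq E) fz (λ _ → refl) (λ _ _ ()) (good E)
  Θ = (z , A & B) ∷ Γ
  [_,_]∈ : ∀ {X Y Z : Set} → (X → Z) → (Y → Z) → X ⊎ Y → Z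
  [ f , g ]∈ (inj₁ a) = f a
  [ f , g ]∈ (inj₂ b) = g b
  cov : ∀ {λ₀ n C} → λ₀ ∈ θ₁ ++ θ₂ → (n , C) ∈ Θ → ∃[ p ] ((concl n , p) ∈ leaves λ₀)
  cov i a with ∈-++⁻ θ₁ i
  ... | inj₁ j = P.part-covered j a
  ... | inj₂ j = Q.part-covered j a
  dis : ∀ {λ₀} → λ₀ ∈ θ₁ ++ θ₂ → DisjointLinks λ₀
  dis i with ∈-++⁻ θ₁ i
  ... | inj₁ j = P.part-disjoint j
  ... | inj₂ j = Q.part-disjoint j
  below : ∀ {w d h e θ} {λ₀ : Linking} → Natural (lab w z e) → GoodNet ((w , h) ∷ Γ) θ →
          λ₀ ∈ unaryL (lab w z e) θ → d ≡ e → InRes λ₀ ((concl z , []) ▹ d)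
  below {w} {e = e} nat g i refl with ∈-map⁻ _ i
  ... | λ₀ , j , refl with GoodNet.covered g j (here refl)
  ...   | p , l = p , subst (_∈ leaves (mapl (extO (lab w z e)) λ₀))
    (trans (extO-vx nat (w , p)) (cong vx lab-hit)) (leaves-mapl⁺ (extO (lab w z e)) λ₀ l)
  g₁ : ∀ {S} → S ⊒ Θ → P1 S (θ₁ ++ θ₂)
  g₁ {S} S⊒ ρ with ρ (concl z , []) in q
  ... | false = let (λ₀ , m , on , un) = P.part₁ {S} S⊒ ρ (λ { refl _ _ _ refl → sym q }) in
    λ₀ , ∈-++⁺ˡ m , on , uni un
    where
    uni : ∀ {λ₀} → (∀ λ₁ → λ₁ ∈ θ₁ → OnAmp S ρ λ₁ → SameLinking λ₁ λ₀) → ∀ λ₁ → λ₁ ∈ θ₁ ++ θ₂ → OnAmp S ρ λ₁ → SameLinking λ₁ λ₀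
    uni un λ₁ i on with ∈-++⁻ θ₁ i
    ... | inj₁ j = un λ₁ j on
    ... | inj₂ j with trans (on (concl z , []) true (A , B , root-formula {S} S⊒ (here refl)) (below lab-natural (good E) j refl)) q
    ...   | ()
  ... | true = let (λ₀ , m , on , un) = Q.part₁ {S} S⊒ ρ (λ { refl _ _ _ refl → sym q }) in
    λ₀ , ∈-++⁺ʳ θ₁ m , on , uni un
    where
    uni : ∀ {λ₀} → (∀ λ₁ → λ₁ ∈ θ₂ → OnAmp S ρ λ₁ → SameLinking λ₁ λ₀) → ∀ λ₁ → λ₁ ∈ θ₁ ++ θ₂ → OnAmp S ρ λ₁ → SameLinking λ₁ λ₀
    uni un λ₁ i on with ∈-++⁻ θ₁ i
    ... | inj₂ j = un λ₁ j on
    ... | inj₁ j with trans (on (concl z , []) false (A , B , root-formula {S} S⊒ (here refl)) (below lab-natural (good D) j refl)) q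
    ...   | ()
  g₂ : ∀ {S} → S ⊒ Θ → P2 S (θ₁ ++ θ₂)
  g₂ {S} S⊒ λ₀ i with ∈-++⁻ θ₁ i
  ... | inj₁ j = P.single₂ {S} S⊒ λ₀ j
  ... | inj₂ j = Q.single₂ {S} S⊒ λ₀ j
  -- If Λ meets both sides then the new & is toggled; being a root it has only switch edges.
  g₃ : ∀ {S} → S ⊒ Θ → P3 S (θ₁ ++ θ₂)
  g₃ {S} S⊒ Λ h diff with sides Λ h
    where
    sides : ∀ Λ → (∀ λ₀ → λ₀ ∈ Λ → λ₀ ∈ θ₁ ++ θ₂) →
      (∀ λ₀ → λ₀ ∈ Λ → λ₀ ∈ θ₁) ⊎ ((∀ λ₀ → λ₀ ∈ Λ → λ₀ ∈ θ₂) ⊎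
      (∃[ λ₁ ] ∃[ λ₂ ] (λ₁ ∈ Λ × λ₂ ∈ Λ × λ₁ ∈ θ₁ × λ₂ ∈ θ₂)))
    sides [] h = inj₁ (λ _ ())
    sides (λ₀ ∷ Λ) h with ∈-++⁻ θ₁ (h λ₀ (here refl)) | sides Λ (λ _ k → h _ (there k))
    ... | inj₁ j | inj₁ a = inj₁ λ { _ (here refl) → j ; _ (there k) → a _ k }
    ... | inj₂ j | inj₂ (inj₁ a) = inj₂ (inj₁ λ { _ (here refl) → j ; _ (there k) → a _ k })
    ... | _ | inj₂ (inj₂ (λ₁ , λ₂ , a , b , c)) = inj₂ (inj₂ (λ₁ , λ₂ , there a , there b , c))
    sides (λ₀ ∷ []) h | inj₂ j | inj₁ a = inj₂ (inj₁ λ { _ (here refl) → j ; _ (there ()) })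
    sides (λ₀ ∷ λ₁ ∷ Λ) h | inj₂ j | inj₁ a = inj₂ (inj₂ (λ₁ , λ₀ , there (here refl) , here refl , a λ₁ (here refl) , j))
    sides (λ₀ ∷ []) h | inj₁ j | inj₂ (inj₁ a) = inj₁ λ { _ (here refl) → j ; _ (there ()) }
    sides (λ₀ ∷ λ₁ ∷ Λ) h | inj₁ j | inj₂ (inj₁ a) = inj₂ (inj₂ (λ₀ , λ₁ , here refl , there (here refl) , j , a λ₁ (here refl)))
  ... | inj₁ a = P.part₃ {S} S⊒ Λ a diff
  ... | inj₂ (inj₁ a) = Q.part₃ {S} S⊒ Λ a diff
  ... | inj₂ (inj₂ (λ₁ , λ₂ , m₁ , m₂ , j₁ , j₂)) = W , (isW , (λ₁ , m₁ , below lab-natural (good D) j₁ refl) ,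
          (λ₂ , m₂ , below lab-natural (good E) j₂ refl)) , no-cycle
    where
    W : Vertex
    W = concl z , []
    isW : IsWith S W
    isW = A , B , root-formula {S} S⊒ (here refl)
    no-child : ∀ (v : Vertex) d → W ≢ v ▹ d
    no-child (_ , []) d ()
    no-child (_ , _ ∷ _) d ()
    no-root : ∀ x d θ {C λ₀} → λ₀ ∈ unaryL (lab x z d) θ → GoodNet ((x , C) ∷ Γ) θ → W ∉ leaves λ₀
    no-root x d θ j g l with ∈-map⁻ _ j
    ... | μ , j' , refl with leaves-mapl⁻ (extO (lab x z d)) {μ} l
    ...   | (r , p) , l' , q with GoodNet.scoped g j' l'
    ...     | n , _ , refl , i with n ≟ x
    ...       | yes refl with trans q (trans (extO-vx lab-natural (n , p)) (cong vx lab-hit))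
    ...         | ()
    no-root x d θ j g l | μ , j' , refl | (r , p) , l' , q | n , _ , refl , here refl | no n≢x = n≢x refl
    no-root x d θ j g l | μ , j' , refl | (r , p) , l' , q | n , _ , refl , there i | no n≢x
      with trans q (trans (extO-vx lab-natural (n , p)) (cong vx (lab-miss n≢x)))
    ... | refl = fz i
    leaf-atom : ∀ {λ₀ a} → λ₀ ∈ Λ → a ∈ λ₀ → W ∉ ends a
    leaf-atom {λ₀} m k l with ∈-++⁻ θ₁ (h λ₀ m)
    ... | inj₁ j = no-root x false (netL D) j (good D) (leaves-ends k l)
    ... | inj₂ j = no-root y true (netL E) j (good E) (leaves-ends k l)
    switch : ∀ E u → EdgeIn S Λ E → Joins E W u → SwitchOf S E W
    switch (tree v d) u x (inj₁ (p , _)) = ⊥-elim (no-child v d p)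
    switch (tree v d) u x (inj₂ (refl , _)) = inj₂ isW , refl
    switch (link a) u (_ , m , k) (inj₁ (p , _)) = ⊥-elim (leaf-atom m k (here p))
    switch (link a) u (_ , m , k) (inj₂ (p , _)) = ⊥-elim (leaf-atom m k (there (here p)))
    switch (jump l V) u (_ , (_ , m , k) , i , _) (inj₁ (refl , _)) = ⊥-elim (leaf-atom m k i)
    switch (jump l V) u x (inj₂ (refl , _)) = inj₂ isW , refl
    switch (cutE c) u x (inj₁ (() , _))
    switch (cutE c) u x (inj₂ (() , _))
    no-loop : ∀ E → EdgeIn S Λ E → ¬ Joins E W W
    no-loop (tree v d) x (inj₁ (p , _)) = no-child v d p
    no-loop (tree v d) x (inj₂ (_ , p)) = no-child v d p
    no-loop (link a) (_ , m , k) (inj₁ (p , _)) = leaf-atom m k (here p)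
    no-loop (link a) (_ , m , k) (inj₂ (p , _)) = leaf-atom m k (there (here p))
    no-loop (jump l V) (_ , (_ , m , k) , i , _) (inj₁ (refl , _)) = leaf-atom m k i
    no-loop (jump l V) (_ , (_ , m , k) , i , _) (inj₂ (_ , refl)) = leaf-atom m k i
    no-loop (cutE c) x (inj₁ (() , _))
    no-loop (cutE c) x (inj₂ (() , _))
    no-cycle : (c : Cycle (EdgeIn S Λ)) → IsSwitchingCycle S (EdgeIn S Λ) c → W ∉ stops (steps c)
    no-cycle c sw k = go (Rotated.front r) (Rotated.rot-walk r) (Rotated.rot-↭ r)
      where
      r = rotate c k
      ℓ = Rotated.last-edge r
      joins-sym' : ∀ E {u v} → Joins E u v → Joins E v u
      joins-sym' E (inj₁ (p , q)) = inj₂ (q , p)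
      joins-sym' E (inj₂ (p , q)) = inj₁ (q , p)
      go : ∀ fr → Walk (EdgeIn S Λ) W (fr ++ (ℓ , W) ∷ []) W → fr ++ (ℓ , W) ∷ [] ↭ steps c → ⊥
      go [] (x , J , _) _ = no-loop ℓ x J
      go ((E , v) ∷ fr) (x , J , p) perm with walk-++ {xs = fr} p
      ... | _ , _ , (xℓ , Jℓ , _) =
        unique-∉ (unique-resp-↭ (map⁺ proj₁ (↭-sym perm)) (distE c)) (subst (_∈ edges (fr ++ (ℓ , W) ∷ [])) (sym same) last∈)
        where
        last∈ : ℓ ∈ edges (fr ++ (ℓ , W) ∷ [])
        last∈ = ∈-map⁺ proj₁ (∈-++⁺ʳ fr (here refl))
        same : E ≡ ℓ
        same = sw W E ℓ (∈-resp-↭ (map⁺ proj₁ perm) (here refl)) (∈-resp-↭ (map⁺ proj₁ perm) (there last∈))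
                 (switch E v x J) (switch ℓ _ xℓ (joins-sym' ℓ Jℓ))

-- Identity nets and equality of linkings

pickR : ∀ {A} → Res A → List Bool → Bool
pickR (r&₁ r) [] = false
pickR (r&₂ r) [] = true
pickR (r⊕₁ r) [] = false
pickR (r⊕₂ r) [] = true
pickR (r⊗ r s) (false ∷ p) = pickR r p
pickR (r⊗ r s) (true ∷ p) = pickR s p
pickR (r⅋ r s) (false ∷ p) = pickR r p
pickR (r⅋ r s) (true ∷ p) = pickR s p
pickR (r&₁ r) (_ ∷ p) = pickR r p
pickR (r&₂ r) (_ ∷ p) = pickR r p
pickR (r⊕₁ r) (_ ∷ p) = pickR r p
pickR (r⊕₂ r) (_ ∷ p) = pickR r p
pickR _ _ = false

module _ (pk : Vertex → Bool) (root : Root) where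
  private
    Picks : ∀ {A} → List Bool → Res A → Set
    Picks acc r = ∀ q → pk (root , acc ++ q) ≡ pickR r q

    deeper : ∀ {A B acc} {r : Res A} {s : Res B} d → Picks acc r → (∀ q → pickR r (d ∷ q) ≡ pickR s q) → Picks (acc ++ d ∷ []) s
    deeper {acc = acc} d h k q = trans (cong (λ p → pk (root , p)) (++-assoc acc (d ∷ []) q)) (trans (h (d ∷ q)) (k q))

    here-pick : ∀ {A acc} {r : Res A} → Picks acc r → pk (root , acc) ≡ pickR r []
    here-pick {acc = acc} h = trans (cong (λ p → pk (root , p)) (sym (++-identityʳ acc))) (h [])

  pathOK⇒rleaf : ∀ {A} (r : Res A) acc → Picks acc r → ∀ p → PathOK pk root acc A p → Pos A p ⊎ Neg A p → rleaf r p
  pathOK⇒rleaf at⁺ acc h [] _ _ = tt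
  pathOK⇒rleaf at⁻ acc h [] _ _ = tt
  pathOK⇒rleaf (r⊗ r s) acc h [] _ (inj₁ (_ , ()))
  pathOK⇒rleaf (r⊗ r s) acc h [] _ (inj₂ (_ , ()))
  pathOK⇒rleaf (r⊗ r s) acc h (false ∷ p) k a = pathOK⇒rleaf r _ (deeper {r = r⊗ r s} {r} false h (λ _ → refl)) p k a
  pathOK⇒rleaf (r⊗ r s) acc h (true ∷ p) k a = pathOK⇒rleaf s _ (deeper {r = r⊗ r s} {s} true h (λ _ → refl)) p k a
  pathOK⇒rleaf (r⅋ r s) acc h [] _ (inj₁ (_ , ()))
  pathOK⇒rleaf (r⅋ r s) acc h [] _ (inj₂ (_ , ()))
  pathOK⇒rleaf (r⅋ r s) acc h (false ∷ p) k a = pathOK⇒rleaf r _ (deeper {r = r⅋ r s} {r} false h (λ _ → refl)) p k a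
  pathOK⇒rleaf (r⅋ r s) acc h (true ∷ p) k a = pathOK⇒rleaf s _ (deeper {r = r⅋ r s} {s} true h (λ _ → refl)) p k a
  pathOK⇒rleaf (r&₁ r) acc h [] _ (inj₁ (_ , ()))
  pathOK⇒rleaf (r&₁ r) acc h [] _ (inj₂ (_ , ()))
  pathOK⇒rleaf (r&₁ {B = B} r) acc h (false ∷ p) (_ , k) a = pathOK⇒rleaf r _ (deeper {r = r&₁ {B = B} r} {r} false h (λ _ → refl)) p k a
  pathOK⇒rleaf (r&₁ r) acc h (true ∷ p) (e , k) a with trans e (here-pick {r = r&₁ r} h)
  ... | ()
  pathOK⇒rleaf (r&₂ r) acc h [] _ (inj₁ (_ , ()))
  pathOK⇒rleaf (r&₂ r) acc h [] _ (inj₂ (_ , ()))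
  pathOK⇒rleaf (r&₂ r) acc h (false ∷ p) (e , k) a with trans e (here-pick {r = r&₂ r} h)
  ... | ()
  pathOK⇒rleaf (r&₂ {A} r) acc h (true ∷ p) (_ , k) a = pathOK⇒rleaf r _ (deeper {r = r&₂ {A} r} {r} true h (λ _ → refl)) p k a
  pathOK⇒rleaf (r⊕₁ r) acc h [] _ (inj₁ (_ , ()))
  pathOK⇒rleaf (r⊕₁ r) acc h [] _ (inj₂ (_ , ()))
  pathOK⇒rleaf (r⊕₁ {B = B} r) acc h (false ∷ p) (_ , k) a = pathOK⇒rleaf r _ (deeper {r = r⊕₁ {B = B} r} {r} false h (λ _ → refl)) p k a
  pathOK⇒rleaf (r⊕₁ r) acc h (true ∷ p) (e , k) a with trans e (here-pick {r = r⊕₁ r} h)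
  ... | ()
  pathOK⇒rleaf (r⊕₂ r) acc h [] _ (inj₁ (_ , ()))
  pathOK⇒rleaf (r⊕₂ r) acc h [] _ (inj₂ (_ , ()))
  pathOK⇒rleaf (r⊕₂ r) acc h (false ∷ p) (e , k) a with trans e (here-pick {r = r⊕₂ r} h)
  ... | ()
  pathOK⇒rleaf (r⊕₂ {A} r) acc h (true ∷ p) (_ , k) a = pathOK⇒rleaf r _ (deeper {r = r⊕₂ {A} r} {r} true h (λ _ → refl)) p k a

  rleaf⇒pathOK : ∀ {A} (r : Res A) acc → Picks acc r → ∀ p → rleaf r p → PathOK pk root acc A p
  rleaf⇒pathOK at⁺ acc h [] _ = tt
  rleaf⇒pathOK at⁻ acc h [] _ = tt
  rleaf⇒pathOK (r⊗ r s) acc h (false ∷ p) l = rleaf⇒pathOK r _ (deeper {r = r⊗ r s} {r} false h (λ _ → refl)) p l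
  rleaf⇒pathOK (r⊗ r s) acc h (true ∷ p) l = rleaf⇒pathOK s _ (deeper {r = r⊗ r s} {s} true h (λ _ → refl)) p l
  rleaf⇒pathOK (r⅋ r s) acc h (false ∷ p) l = rleaf⇒pathOK r _ (deeper {r = r⅋ r s} {r} false h (λ _ → refl)) p l
  rleaf⇒pathOK (r⅋ r s) acc h (true ∷ p) l = rleaf⇒pathOK s _ (deeper {r = r⅋ r s} {s} true h (λ _ → refl)) p l
  rleaf⇒pathOK (r&₁ {B = B} r) acc h (false ∷ p) l = sym (here-pick {r = r&₁ {B = B} r} h) , rleaf⇒pathOK r _ (deeper {r = r&₁ {B = B} r} {r} false h (λ _ → refl)) p l
  rleaf⇒pathOK (r&₂ {A} r) acc h (true ∷ p) l = sym (here-pick {r = r&₂ {A} r} h) , rleaf⇒pathOK r _ (deeper {r = r&₂ {A} r} {r} true h (λ _ → refl)) p l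
  rleaf⇒pathOK (r⊕₁ {B = B} r) acc h (false ∷ p) l = sym (here-pick {r = r⊕₁ {B = B} r} h) , rleaf⇒pathOK r _ (deeper {r = r⊕₁ {B = B} r} {r} false h (λ _ → refl)) p l
  rleaf⇒pathOK (r⊕₂ {A} r) acc h (true ∷ p) l = sym (here-pick {r = r⊕₂ {A} r} h) , rleaf⇒pathOK r _ (deeper {r = r⊕₂ {A} r} {r} true h (λ _ → refl)) p l

netL-wt : ∀ {Γ} (D : CF Γ) → WTN Γ (toNet (netL D))
netL-wt D = wt-≈ (≈-sym (netL-sem D)) (wt D)

pair-ctx : Fm → Fm → Ctx
pair-ctx F G = (0 , F) ∷ (1 , G) ∷ []

pair-seq : Fm → Fm → CutSeq
pair-seq F G = cs [] (F ∷ G ∷ [])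

pair-⊒ : ∀ {F G} → pair-seq F G ⊒ pair-ctx F G
pair-⊒ (here refl) = refl
pair-⊒ (there (here refl)) = refl

module _ {F G : Fm} (D : CF (pair-ctx F G)) where
  private
    S = pair-seq F G
    Γ = pair-ctx F G

  netL-wf : ∀ {λ₀} → λ₀ ∈ netL D → ∀ {a} → a ∈ λ₀ →
    ∃[ v ] ∃[ w ] ∃[ k ] (a ≡ lk (vx v) (vx w) × Atom Γ v (var k) × Atom Γ w (nvar k))
  netL-wf {λ₀} i {lk (r , p) (s , q)} j with GoodNet.scoped (good D) i (leaves-pos j) | GoodNet.scoped (good D) i (leaves-neg j)
  ... | n , _ , refl , _ | m , _ , refl , _ =
    let (k , a , b) = WT.atoms (netL-wt D (λ₀ , i)) {n , p} {m , q} j in (n , p) , (m , q) , k , refl , a , b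

  atom-vfm : ∀ {v F'} → Atom Γ v F' → vfm S (vx v) ≡ just F'
  atom-vfm (A , i , e) rewrite pair-⊒ {F} {G} i = e

  netL-linking : All (IsLinking S) (netL D)
  netL-linking = AllM.tabulate linking
    where
    linking : ∀ {λ₀} → λ₀ ∈ netL D → IsLinking S λ₀
    linking {λ₀} i = AllM.tabulate wf , GoodNet.disjoint (good D) i , Rs , λ v → mk⇔ (to' v) (from' v)
      where
      wf : ∀ {a} → a ∈ λ₀ → WfLink S a
      wf j with netL-wf i j
      ... | v , w , k , refl , a , b = k , atom-vfm {v} a , atom-vfm {w} b
      module W = WT (netL-wt D (λ₀ , i))
      r₀ = W.shape (here refl)
      r₁ = W.shape (there (here refl))
      pick' : Vertex → Bool
      pick' (concl 0 , p) = pickR (proj₁ r₀) p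
      pick' (concl 1 , p) = pickR (proj₁ r₁) p
      pick' _ = false
      Rs : AddRes
      Rs = record { keepCut = λ _ → false ; pick = pick' }
      atom-at : ∀ A p → ∃[ n ] (sub A p ≡ just (var n) ⊎ sub A p ≡ just (nvar n)) → Pos A p ⊎ Neg A p
      atom-at _ _ (n , inj₁ e) = inj₁ (n , e)
      atom-at _ _ (n , inj₂ e) = inj₂ (n , e)
      leaf-at : ∀ {A} (r : Res A) {p} → rleaf r p → ∃[ n ] (sub A p ≡ just (var n) ⊎ sub A p ≡ just (nvar n))
      leaf-at r {p} l with rleaf-atom r p l
      ... | inj₁ (n , e) = n , inj₁ e
      ... | inj₂ (n , e) = n , inj₂ e
      to' : ∀ v → IsLeaf S v × InAddRes S Rs v → v ∈ leaves λ₀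
      to' (concl 0 , p) (lf , _ , _ , refl , ok) = proj₂ (proj₂ r₀ p) (pathOK⇒rleaf pick' (concl 0) (proj₁ r₀) [] (λ _ → refl) p ok (atom-at F p lf))
      to' (concl 1 , p) (lf , _ , _ , refl , ok) = proj₂ (proj₂ r₁ p) (pathOK⇒rleaf pick' (concl 1) (proj₁ r₁) [] (λ _ → refl) p ok (atom-at G p lf))
      to' (concl (suc (suc n)) , p) (_ , _ , _ , () , _)
      to' (cutside c s , p) (_ , _ , _ , () , _)
      from' : ∀ v → v ∈ leaves λ₀ → IsLeaf S v × InAddRes S Rs v
      from' (r , p) l with GoodNet.scoped (good D) i l
      ... | _ , _ , refl , here refl = let k = proj₁ (proj₂ r₀ p) l in
        leaf-at (proj₁ r₀) k , tt , _ , refl , rleaf⇒pathOK pick' (concl 0) (proj₁ r₀) [] (λ _ → refl) p k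
      ... | _ , _ , refl , there (here refl) = let k = proj₁ (proj₂ r₁ p) l in
        leaf-at (proj₁ r₁) k , tt , _ , refl , rleaf⇒pathOK pick' (concl 1) (proj₁ r₁) [] (λ _ → refl) p k

  netL-proofnet : IsProofNet S (netL D)
  netL-proofnet = netL-linking , (λ _ _ ()) , good₁ {S} pair-⊒ , good₂ {S} pair-⊒ , good₃ {S} pair-⊒
    where open GoodNet (good D)

graft : Bool → Bool → Occ → Occ
graft b₀ b₁ (0 , p) = 0 , b₀ ∷ p
graft b₀ b₁ (1 , p) = 1 , b₁ ∷ p
graft b₀ b₁ v = v

graft-natural : ∀ {b₀ b₁} → Natural (graft b₀ b₁)
graft-natural 0 p = refl
graft-natural 1 p = refl
graft-natural (suc (suc n)) p = refl

mapLink-cong : ∀ {f g : Vertex → Vertex} → (∀ v → f v ≡ g v) → ∀ a → mapLink f a ≡ mapLink g a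
mapLink-cong e (lk p q) = cong₂ lk (e p) (e q)

shift-graft : ∀ b₀ b₁ λ₀ → map (shift b₀ b₁) λ₀ ≡ mapl (extO (graft b₀ b₁)) λ₀
shift-graft b₀ b₁ = map-cong (mapLink-cong λ
  { (concl 0 , p) → refl ; (concl 1 , p) → refl ; (concl (suc (suc n)) , p) → refl ; (cutside c s , p) → refl })

idNet-pair : ∀ θ ψ →
  concatMap (λ λ₀ → map (λ μ → map (shift true false) λ₀ ++ map (shift false true) μ) ψ) θ ≡
  binaryL (graft true false) (graft false true) θ ψ
idNet-pair θ ψ = concatMap-cong (λ λ₀ → map-cong (λ μ → cong₂ _++_ (shift-graft true false λ₀) (shift-graft false true μ)) ψ) θ

idNet-sum : ∀ θ ψ → map (map (shift true false)) θ ++ map (map (shift false true)) ψ ≡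
                    unaryL (graft true false) θ ++ unaryL (graft false true) ψ
idNet-sum θ ψ = cong₂ _++_ (map-cong (shift-graft true false) θ) (map-cong (shift-graft false true) ψ)

pair-sem : ∀ {B C} θ ψ → toNet θ ≈ axNet 0 1 B → toNet ψ ≈ axNet 0 1 C →
  toNet (binaryL (graft true false) (graft false true) θ ψ) ≈
  relN (copair (graft true false) (graft false true)) (axNet 0 1 B ⊎ₙ axNet 0 1 C)
pair-sem θ ψ e e' = ≈-trans (binaryL-sem graft-natural graft-natural θ ψ) (wireN-cong _ (⊎ₙ-cong e e'))

sum-sem : ∀ {B C} θ ψ → toNet θ ≈ axNet 0 1 B → toNet ψ ≈ axNet 0 1 C →
  toNet (unaryL (graft true false) θ ++ unaryL (graft false true) ψ) ≈
  relN (graft true false) (axNet 0 1 B) ∪ₙ relN (graft false true) (axNet 0 1 C)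
sum-sem θ ψ e e' = ≈-trans (++-sem (unaryL (graft true false) θ) (unaryL (graft false true) ψ))
  (∪ₙ-cong (≈-trans (unaryL-sem graft-natural θ) (wireN-cong _ e)) (≈-trans (unaryL-sem graft-natural ψ) (wireN-cong _ e')))

idNet-sem : ∀ A → toNet (idNet A) ≈ axNet 0 1 A
idNet-sem (var k) = (λ { (_ , here refl) → at⁺ , ax-sem 0 1 k }) , (λ { at⁺ → (_ , here refl) , ax-sem 0 1 k })
idNet-sem (nvar k) = ≈-trans ((λ { (_ , here refl) → at⁺ , ax-sem 1 0 k }) , (λ { at⁺ → (_ , here refl) , ax-sem 1 0 k })) (axNet-sym (var k))
idNet-sem (B ⊗ C) = subst (λ θ → toNet θ ≈ axNet 0 1 (B ⊗ C)) (sym (idNet-pair (idNet B) (idNet C)))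
  (≈-trans (pair-sem (idNet B) (idNet C) (idNet-sem B) (idNet-sem C))
    (≈-sym (axNet-⊗ (graft true false) (graft false true) (λ _ → refl) (λ _ → refl) (λ _ → refl) (λ _ → refl))))
idNet-sem (B ⅋ C) = subst (λ θ → toNet θ ≈ axNet 0 1 (B ⅋ C)) (sym (idNet-pair (idNet B) (idNet C)))
  (≈-trans (pair-sem (idNet B) (idNet C) (idNet-sem B) (idNet-sem C))
    (≈-sym (axNet-⅋ (graft true false) (graft false true) (λ _ → refl) (λ _ → refl) (λ _ → refl) (λ _ → refl))))
idNet-sem (B & C) = subst (λ θ → toNet θ ≈ axNet 0 1 (B & C)) (sym (idNet-sum (idNet B) (idNet C)))
  (≈-trans (sum-sem (idNet B) (idNet C) (idNet-sem B) (idNet-sem C))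
    (≈-sym (axNet-& (graft true false) (graft false true) (λ _ → refl) (λ _ → refl) (λ _ → refl) (λ _ → refl))))
idNet-sem (B ⊕ C) = subst (λ θ → toNet θ ≈ axNet 0 1 (B ⊕ C)) (sym (idNet-sum (idNet B) (idNet C)))
  (≈-trans (sum-sem (idNet B) (idNet C) (idNet-sem B) (idNet-sem C))
    (≈-sym (axNet-⊕ (graft true false) (graft false true) (λ _ → refl) (λ _ → refl) (λ _ → refl) (λ _ → refl))))

Visible : Net → Set
Visible θ = ∀ {λ₀} → λ₀ ∈ θ → ∀ {l} → l ∈ leaves λ₀ → ∃[ n ] (proj₁ l ≡ concl n)

visible-mapl : ∀ h {λ₀} → (∀ {l} → l ∈ leaves λ₀ → ∃[ n ] (proj₁ l ≡ concl n)) →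
               ∀ {l} → l ∈ leaves (mapl (extO h) λ₀) → ∃[ n ] (proj₁ l ≡ concl n)
visible-mapl h {λ₀} v l∈ with leaves-mapl⁻ (extO h) {λ₀} l∈
... | (r , p) , k , refl with v k
...   | n , refl = _ , refl

binary-visible : ∀ h k θ ψ → Visible θ → Visible ψ → Visible (binaryL h k θ ψ)
binary-visible h k θ ψ v w i l with ∈-joinL⁻ (extO h) (extO k) θ ψ i
... | λ₀ , μ , j , j' , refl with leaves-++ (mapl (extO h) λ₀) l
...   | inj₁ l' = visible-mapl h {λ₀} (v j) l'
...   | inj₂ l' = visible-mapl k {μ} (w j') l'

sum-visible : ∀ h k θ ψ → Visible θ → Visible ψ → Visible (unaryL h θ ++ unaryL k ψ)
sum-visible h k θ ψ v w i l with ∈-++⁻ (unaryL h θ) i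
... | inj₁ j with ∈-map⁻ _ j
...   | λ₀ , j' , refl = visible-mapl h {λ₀} (v j') l
sum-visible h k θ ψ v w i l | inj₂ j with ∈-map⁻ _ j
...   | λ₀ , j' , refl = visible-mapl k {λ₀} (w j') l

idNet-visible : ∀ A → Visible (idNet A)
idNet-visible (var k) (here refl) (here refl) = _ , refl
idNet-visible (var k) (here refl) (there (here refl)) = _ , refl
idNet-visible (nvar k) (here refl) (here refl) = _ , refl
idNet-visible (nvar k) (here refl) (there (here refl)) = _ , refl
idNet-visible (B ⊗ C) = subst Visible (sym (idNet-pair (idNet B) (idNet C))) (binary-visible (graft true false) (graft false true) (idNet B) (idNet C) (idNet-visible B) (idNet-visible C))
idNet-visible (B ⅋ C) = subst Visible (sym (idNet-pair (idNet B) (idNet C))) (binary-visible (graft true false) (graft false true) (idNet B) (idNet C) (idNet-visible B) (idNet-visible C))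
idNet-visible (B & C) = subst Visible (sym (idNet-sum (idNet B) (idNet C))) (sum-visible (graft true false) (graft false true) (idNet B) (idNet C) (idNet-visible B) (idNet-visible C))
idNet-visible (B ⊕ C) = subst Visible (sym (idNet-sum (idNet B) (idNet C))) (sum-visible (graft true false) (graft false true) (idNet B) (idNet C) (idNet-visible B) (idNet-visible C))

≃⇒same : ∀ {λ₁ λ₂} → (∀ {l} → l ∈ leaves λ₁ → ∃[ n ] (proj₁ l ≡ concl n)) →
         (∀ {l} → l ∈ leaves λ₂ → ∃[ n ] (proj₁ l ≡ concl n)) → toSlice λ₁ ≃ toSlice λ₂ → SameLinking λ₁ λ₂
≃⇒same {λ₁} {λ₂} v w e a = mk⇔ (to' λ₁ λ₂ v (λ p q → proj₁ (Sim.rel~ e p q)) a) (to' λ₂ λ₁ w (λ p q → proj₂ (Sim.rel~ e p q)) a)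
  where
  to' : ∀ λ₁ λ₂ → (∀ {l} → l ∈ leaves λ₁ → ∃[ n ] (proj₁ l ≡ concl n)) →
        (∀ p q → lk (vx p) (vx q) ∈ λ₁ → lk (vx p) (vx q) ∈ λ₂) → ∀ a → a ∈ λ₁ → a ∈ λ₂
  to' λ₁ λ₂ v h (lk (r , p) (s , q)) i with v (leaves-pos i) | v (leaves-neg i)
  ... | n , refl | m , refl = h (n , p) (m , q) i

≈⇒SameNet : ∀ {θ θ'} → Visible θ → Visible θ' → toNet θ ≈ toNet θ' → SameNet θ θ'
≈⇒SameNet v w (f , g) =
  (λ λ₁ i → let ((λ₂ , j) , e) = f (λ₁ , i) in λ₂ , j , ≃⇒same (v i) (w j) e) ,
  (λ λ₂ j → let ((λ₁ , i) , e) = g (λ₂ , j) in λ₁ , i , ≃⇒same (v i) (w j) e)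

-- Cut-elimination of proof-nets

∈-filterᵇ⁺ : ∀ {X : Set} (p : X → Bool) {x xs} → x ∈ xs → p x ≡ true → x ∈ filterᵇ p xs
∈-filterᵇ⁺ p {x} i e = ∈-filter⁺ (λ y → T? (p y)) i (subst IsTrue (sym e) tt)

true-T : ∀ {b} → IsTrue b → b ≡ true
true-T {true} _ = refl

∈-filterᵇ⁻ : ∀ {X : Set} (p : X → Bool) {x xs} → x ∈ filterᵇ p xs → x ∈ xs × p x ≡ true
∈-filterᵇ⁻ p {xs = xs} i = let (j , t) = ∈-filter⁻ (λ y → T? (p y)) {xs = xs} i in j , true-T t

any⁻ : ∀ {X : Set} (p : X → Bool) xs → any p xs ≡ true → ∃[ x ] (x ∈ xs × p x ≡ true)
any⁻ p (x ∷ xs) e with p x in q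
... | true = x , here refl , q
... | false = let (y , i , q') = any⁻ p xs e in y , there i , q'

any⁺ : ∀ {X : Set} (p : X → Bool) {x xs} → x ∈ xs → p x ≡ true → any p xs ≡ true
any⁺ p (here refl) e rewrite e = refl
any⁺ p {xs = y ∷ _} (there i) e with p y
... | true = refl
... | false = any⁺ p i e

eqCN-refl : ∀ c → eqCN c c ≡ true
eqCN-refl [] = refl
eqCN-refl (true ∷ c) = eqCN-refl c
eqCN-refl (false ∷ c) = eqCN-refl c

eqCN-true : ∀ c d → eqCN c d ≡ true → c ≡ d
eqCN-true [] [] _ = refl
eqCN-true (true ∷ c) (true ∷ d) e = cong (true ∷_) (eqCN-true c d e)
eqCN-true (false ∷ c) (false ∷ d) e = cong (false ∷_) (eqCN-true c d e)

eqCN-false : ∀ {c d} → c ≢ d → eqCN c d ≡ false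
eqCN-false {c} {d} n with eqCN c d in e
... | true = ⊥-elim (n (eqCN-true c d e))
... | false = refl

eqB-refl : ∀ s → eqB s s ≡ true
eqB-refl true = refl
eqB-refl false = refl

eqB-not : ∀ s → eqB s (not s) ≡ false
eqB-not true = refl
eqB-not false = refl

∈-dropCut⁻ : ∀ {c d B Σ'} → (d , B) ∈ dropCut c Σ' → (d , B) ∈ Σ' × c ≢ d
∈-dropCut⁻ {c} {d} {B} {Σ'} i with ∈-filterᵇ⁻ (λ p → not (eqCN c (proj₁ p))) {xs = Σ'} i
... | j , e = j , λ { refl → bad (trans (cong not (sym (eqCN-refl c))) e) }
  where
  bad : false ≡ true → ⊥
  bad ()

∈-dropCut⁺ : ∀ {c d B Σ'} → (d , B) ∈ Σ' → c ≢ d → (d , B) ∈ dropCut c Σ'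
∈-dropCut⁺ i n = ∈-filterᵇ⁺ _ i (cong not (eqCN-false n))

-- The execution wiring: the dual leaves of every cut pair are joined, the conclusions exported.
stW : Wiring Vertex Occ
stW = record { out = o ; joins = k ; functional = λ {w} → fun w ; exclusive = λ {w} {w'} {v} → exc w w' v }
  where
  o : Vertex → Occ → Set
  o (concl n , p) v = v ≡ (n , p)
  o (cutside _ _ , _) _ = ⊥
  k : Vertex → Vertex → Set
  k (cutside c s , p) (cutside d t , q) = c ≡ d × t ≡ not s × q ≡ flip p
  k (concl _ , _) _ = ⊥
  k (cutside _ _ , _) (concl _ , _) = ⊥
  fun : ∀ w {v v'} → o w v → o w v' → v ≡ v'
  fun (concl _ , _) refl refl = refl
  exc : ∀ w w' v → o w v → k w w' → ⊥
  exc (concl _ , _) _ _ _ ()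
  exc (cutside _ _ , _) _ _ ()

toV : Linking → Slice Vertex
toV λ₀ = record { Leaf = λ v → v ∈ leaves λ₀ ; Rel = λ u v → lk u v ∈ λ₀ ; Loop = ⊥
                ; src = leaves-pos ; tgt = leaves-neg }

netV : Net → SNet Vertex
netV θ = record { Ix = ∃[ λ₀ ] (λ₀ ∈ θ) ; at = λ (λ₀ , _) → toV λ₀ }

stN : Net → SNet Occ
stN θ = wireN stW (netV θ)

toV-mapl : ∀ F λ₀ → toV (mapl F λ₀) ≃ wire (relabel F) (toV λ₀)
toV-mapl F λ₀ = relabel-≃ (leaves-mapl⁺ F λ₀)
  (λ l → let (v , k , q) = leaves-mapl⁻ F {λ₀} l in v , q , k) (∈-map⁺ (mapLink F))
  (λ {v} {w} r → rel v w r) ((λ ()) , (λ ()))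
  where
  rel : ∀ v w → lk v w ∈ mapl F λ₀ → ∃[ v₀ ] ∃[ w₀ ] (v ≡ F v₀ × w ≡ F w₀ × lk v₀ w₀ ∈ λ₀)
  rel v w r with ∈-map⁻ (mapLink F) r
  ... | lk a b , k , refl = a , b , refl , refl , k

netV-map : ∀ F θ → netV (map (mapl F) θ) ≈ relN F (netV θ)
netV-map F θ =
  (λ (λ' , i) → let (λ₀ , j , q) = ∈-map⁻ _ i in
     ((λ₀ , j) , relabel-routed (toV λ₀) F) , subst (λ μ → toV μ ≃ wire (relabel F) (toV λ₀)) (sym q) (toV-mapl F λ₀)) ,
  (λ ((λ₀ , j) , _) → (_ , ∈-map⁺ _ j) , toV-mapl F λ₀)

Cuts : Set
Cuts = List (CutName × Fm)

Absent : Linking → CutName → Set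
Absent λ₀ c = ∀ s p → (cutside c s , p) ∉ leaves λ₀

SideShape : Linking → CutName → Bool → Fm → Set
SideShape λ₀ c s A = Σ (Res A) λ r → ∀ p → ((cutside c s , p) ∈ leaves λ₀) ↔ rleaf r p

record Inv (Σ' : Cuts) (θ : Net) : Set where
  field
    indep : ∀ {c A d B} xs → (c , A) ∈ Σ' → (d , B) ∈ Σ' → c ≡ xs ++ d → _≡_ {A = CutName × Fm} (c , A) (d , B)
    named : ∀ {λ₀ c s p} → λ₀ ∈ θ → (cutside c s , p) ∈ leaves λ₀ → ∃[ A ] ((c , A) ∈ Σ')
    state : ∀ {λ₀ c A} → λ₀ ∈ θ → (c , A) ∈ Σ' → Absent λ₀ c ⊎ (∀ s → SideShape λ₀ c s (sideFm s A))
    polar⁺ : ∀ {λ₀ c s p v A} → λ₀ ∈ θ → lk (cutside c s , p) v ∈ λ₀ → (c , A) ∈ Σ' → Pos (sideFm s A) p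
    polar⁻ : ∀ {λ₀ c s p v A} → λ₀ ∈ θ → lk v (cutside c s , p) ∈ λ₀ → (c , A) ∈ Σ' → Neg (sideFm s A) p

inv-⊆ : ∀ {Σ' θ θ'} → (∀ {λ₀} → λ₀ ∈ θ' → λ₀ ∈ θ) → Inv Σ' θ → Inv Σ' θ'
inv-⊆ h i = record { indep = indep ; named = λ m → named (h m) ; state = λ m → state (h m)
                   ; polar⁺ = λ m → polar⁺ (h m) ; polar⁻ = λ m → polar⁻ (h m) }
  where open Inv i

present? : Net → CutName × Fm → Bool
present? θ p = any (λ λ₀ → any (λ v → onCut (proj₁ p) (proj₁ v)) (leaves λ₀)) θ

inv-prune : ∀ {Σ' θ} → Inv Σ' θ → Inv (prune Σ' θ) θ
inv-prune {Σ'} {θ} i = record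
  { indep = λ xs a b → indep xs (sub' a) (sub' b)
  ; named = λ {λ₀} {c} m l → let (A , a) = named m l in
      A , ∈-filterᵇ⁺ (present? θ) a (any⁺ _ m (any⁺ (λ v → onCut c (proj₁ v)) l (eqCN-refl c)))
  ; state = λ m a → state m (sub' a)
  ; polar⁺ = λ m k a → polar⁺ m k (sub' a) ; polar⁻ = λ m k a → polar⁻ m k (sub' a) }
  where
  open Inv i
  sub' : ∀ {q} → q ∈ prune Σ' θ → q ∈ Σ'
  sub' a = proj₁ (∈-filterᵇ⁻ (present? θ) {xs = Σ'} a)

module Split {Σ' : Cuts} {θ : Net} (inv : Inv Σ' θ) {c : CutName} {A : Fm} (cA : (c , A) ∈ Σ') (s : Bool)
  (Ch : Bool → Fm)
  (sub-self : ∀ e p → sub (sideFm s A) (e ∷ p) ≡ sub (Ch e) p)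
  (sub-opp : ∀ e p → sub (sideFm (not s) A) (not e ∷ p) ≡ sub (dual (Ch e)) p)
  (nil : ∀ t (r : Res (sideFm t A)) → ¬ rleaf r [])
  (halves : ∀ {λ₀} → λ₀ ∈ θ → (∀ t → SideShape λ₀ c t (sideFm t A)) → ∀ e →
     ((∀ p → (cutside c s , e ∷ p) ∉ leaves λ₀) × (∀ p → (cutside c (not s) , not e ∷ p) ∉ leaves λ₀)) ⊎
     ((Σ (Res (Ch e)) λ r → ∀ p → ((cutside c s , e ∷ p) ∈ leaves λ₀) ↔ rleaf r p) ×
      (Σ (Res (dual (Ch e))) λ r → ∀ p → ((cutside c (not s) , not e ∷ p) ∈ leaves λ₀) ↔ rleaf r p)))
  where
  open Inv inv
  F : Vertex → Vertex
  F = remap c s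

  Σ'' : Cuts
  Σ'' = splitCuts c (Ch false) (Ch true) Σ'

  F-self : ∀ e p → F (cutside c s , e ∷ p) ≡ (cutside (e ∷ c) false , p)
  F-self e p rewrite eqCN-refl c | eqB-refl s = refl

  F-opp : ∀ e p → F (cutside c (not s) , e ∷ p) ≡ (cutside (not e ∷ c) true , p)
  F-opp e p rewrite eqCN-refl c | eqB-not s = refl

  F-other : ∀ {d t} p → c ≢ d → F (cutside d t , p) ≡ (cutside d t , p)
  F-other [] n = refl
  F-other (e ∷ p) n rewrite eqCN-false n = refl

  data View (l : Vertex) : Set where
    free  : ∀ n p → l ≡ (concl n , p) → F l ≡ l → View l
    elsewhere : ∀ d t p B → l ≡ (cutside d t , p) → (d , B) ∈ Σ' → c ≢ d → F l ≡ l → View l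
    self  : ∀ e p → l ≡ (cutside c s , e ∷ p) → F l ≡ (cutside (e ∷ c) false , p) → View l
    opp   : ∀ e p → l ≡ (cutside c (not s) , not e ∷ p) → F l ≡ (cutside (e ∷ c) true , p) → View l

  bool-cases : ∀ s t → t ≡ s ⊎ t ≡ not s
  bool-cases false false = inj₁ refl
  bool-cases false true = inj₂ refl
  bool-cases true true = inj₁ refl
  bool-cases true false = inj₂ refl

  view : ∀ {λ₀} → λ₀ ∈ θ → ∀ l → l ∈ leaves λ₀ → View l
  view m (concl n , p) l∈ = free n p refl refl
  view {λ₀} m (cutside d t , p) l∈ with c ≟ˡ d
  ... | no c≢d = let (B , b) = named m l∈ in elsewhere d t p B refl b c≢d (F-other p c≢d)
  ... | yes refl with state m cA
  ...   | inj₁ ab = ⊥-elim (ab t p l∈)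
  ...   | inj₂ sh with p | bool-cases s t
  ...     | [] | _ = ⊥-elim (nil t (proj₁ (sh t)) (proj₁ (proj₂ (sh t) []) l∈))
  ...     | e ∷ p' | inj₁ refl = self e p' refl (F-self e p')
  ...     | e ∷ p' | inj₂ refl = opp (not e) p' (cong (λ b → cutside c (not s) , b ∷ p') (sym (not-involutive e))) (F-opp e p')

  fresh-name : ∀ {d B} e xs → (d , B) ∈ Σ' → d ≢ xs ++ e ∷ c
  fresh-name {d} e xs b q with indep (xs ++ e ∷ []) b cA (trans q (sym (++-assoc xs (e ∷ []) c)))
  ... | refl = too-long xs c q
    where
    too-long : ∀ xs c → c ≢ xs ++ e ∷ c
    too-long xs c q = m+1+n≢n (length xs) (length c) (trans (sym (trans (length-++ xs) (+-suc (length xs) (length c)))) (cong length (sym q)))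
      where
      m+1+n≢n : ∀ m n → suc (m + n) ≢ n
      m+1+n≢n m (suc n) e = m+1+n≢n m n (trans (sym (+-suc m n)) (suc-injective e))

  in-Σ'' : ∀ {d B} → (d , B) ∈ Σ'' → (∃[ e ] (d ≡ e ∷ c × B ≡ Ch e)) ⊎ ((d , B) ∈ Σ' × c ≢ d)
  in-Σ'' (here refl) = inj₁ (false , refl , refl)
  in-Σ'' (there (here refl)) = inj₁ (true , refl , refl)
  in-Σ'' (there (there i)) = inj₂ (∈-dropCut⁻ i)

  child-∈ : ∀ e → (e ∷ c , Ch e) ∈ Σ''
  child-∈ false = here refl
  child-∈ true = there (here refl)

  -- Leaves over the new pair come from the corresponding branches of the old one.
  back-self : ∀ {λ₀} → λ₀ ∈ θ → ∀ e p → (cutside (e ∷ c) false , p) ∈ leaves (mapl F λ₀) → (cutside c s , e ∷ p) ∈ leaves λ₀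
  back-self {λ₀} m e p i with leaves-mapl⁻ F {λ₀} i
  ... | l , l∈ , q with view m l l∈
  ...   | free n p' refl fl with trans q fl
  ...     | ()
  back-self {λ₀} m e p i | l , l∈ , q | elsewhere d t p' B refl b n fl with trans q fl
  ...     | refl = ⊥-elim (fresh-name e [] b refl)
  back-self {λ₀} m e p i | l , l∈ , q | self e' p' refl fl with trans q fl
  ...     | refl = l∈
  back-self {λ₀} m e p i | l , l∈ , q | opp e' p' refl fl with trans q fl
  ...     | ()

  back-opp : ∀ {λ₀} → λ₀ ∈ θ → ∀ e p → (cutside (e ∷ c) true , p) ∈ leaves (mapl F λ₀) → (cutside c (not s) , not e ∷ p) ∈ leaves λ₀
  back-opp {λ₀} m e p i with leaves-mapl⁻ F {λ₀} i
  ... | l , l∈ , q with view m l l∈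
  ...   | free n p' refl fl with trans q fl
  ...     | ()
  back-opp {λ₀} m e p i | l , l∈ , q | elsewhere d t p' B refl b n fl with trans q fl
  ...     | refl = ⊥-elim (fresh-name e [] b refl)
  back-opp {λ₀} m e p i | l , l∈ , q | self e' p' refl fl with trans q fl
  ...     | ()
  back-opp {λ₀} m e p i | l , l∈ , q | opp e' p' refl fl with trans q fl
  ...     | refl = l∈

  back-other : ∀ {λ₀ d t p B} → λ₀ ∈ θ → (d , B) ∈ Σ' → c ≢ d → (cutside d t , p) ∈ leaves (mapl F λ₀) → (cutside d t , p) ∈ leaves λ₀
  back-other {λ₀} m b n i with leaves-mapl⁻ F {λ₀} i
  ... | l , l∈ , q with view m l l∈
  ...   | free n' p' refl fl with trans q fl
  ...     | ()
  back-other {λ₀} m b n i | l , l∈ , q | elsewhere d' t' p' B' refl b' n' fl with trans q fl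
  ...     | refl = l∈
  back-other {λ₀} m b n i | l , l∈ , q | self e' p' refl fl with trans q fl
  ...     | refl = ⊥-elim (fresh-name e' [] b refl)
  back-other {λ₀} m b n i | l , l∈ , q | opp e' p' refl fl with trans q fl
  ...     | refl = ⊥-elim (fresh-name e' [] b refl)

  indep'' : ∀ {d B d' B'} xs → (d , B) ∈ Σ'' → (d' , B') ∈ Σ'' → d ≡ xs ++ d' → (d , B) ≡ (d' , B')
  indep'' xs a b q with in-Σ'' a | in-Σ'' b
  ... | inj₂ (a' , _) | inj₂ (b' , _) = indep xs a' b' q
  ... | inj₂ (a' , _) | inj₁ (e , refl , _) = ⊥-elim (fresh-name e xs a' q)
  indep'' [] a b q | inj₁ (e , refl , refl) | inj₂ (b' , n) = ⊥-elim (fresh-name e [] b' (sym q))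
  indep'' (x ∷ xs) a b q | inj₁ (e , refl , refl) | inj₂ (b' , n) = ⊥-elim (n (cong proj₁ (indep xs cA b' (∷-injectiveʳ q))))
  indep'' [] a b refl | inj₁ (e , refl , refl) | inj₁ (e' , refl , refl) = refl
  indep'' (x ∷ xs) a b q | inj₁ (e , refl , refl) | inj₁ (e' , refl , refl) = ⊥-elim (fresh-name e' xs cA (∷-injectiveʳ q))

  child-neq : ∀ {e d B} → (d , B) ∈ Σ' → e ∷ c ≢ d
  child-neq {e} b q = fresh-name e [] b (sym q)

  inv'' : Inv Σ'' (map (mapl F) θ)
  inv'' = record { indep = indep'' ; named = named'' ; state = state'' ; polar⁺ = polar⁺'' ; polar⁻ = polar⁻'' }
    where
    named'' : ∀ {λ₀ d t p} → λ₀ ∈ map (mapl F) θ → (cutside d t , p) ∈ leaves λ₀ → ∃[ B ] ((d , B) ∈ Σ'')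
    named'' m i with ∈-map⁻ _ m
    ... | λ₀ , j , refl with leaves-mapl⁻ F {λ₀} i
    ...   | l , l∈ , q with view j l l∈
    ...     | free n p' refl fl with trans q fl
    ...       | ()
    named'' m i | λ₀ , j , refl | l , l∈ , q | elsewhere d' t' p' B' refl b' n' fl with trans q fl
    ...       | refl = B' , there (there (∈-dropCut⁺ b' n'))
    named'' m i | λ₀ , j , refl | l , l∈ , q | self e' p' refl fl with trans q fl
    ...       | refl = Ch e' , child-∈ e'
    named'' m i | λ₀ , j , refl | l , l∈ , q | opp e' p' refl fl with trans q fl
    ...       | refl = Ch e' , child-∈ e'

    image : ∀ {λ₀ l l'} → l ∈ leaves λ₀ → F l ≡ l' → l' ∈ leaves (mapl F λ₀)
    image {λ₀} l∈ q = subst (_∈ leaves (mapl F λ₀)) q (leaves-mapl⁺ F λ₀ l∈)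

    opp-image : ∀ {λ₀} e p → (cutside c (not s) , not e ∷ p) ∈ leaves λ₀ → (cutside (e ∷ c) true , p) ∈ leaves (mapl F λ₀)
    opp-image {λ₀} e p l = image {λ₀} l (trans (F-opp (not e) p) (cong (λ b → cutside (b ∷ c) true , p) (not-involutive e)))

    state'' : ∀ {λ₀ d B} → λ₀ ∈ map (mapl F) θ → (d , B) ∈ Σ'' → Absent λ₀ d ⊎ (∀ t → SideShape λ₀ d t (sideFm t B))
    state'' m a with ∈-map⁻ _ m | in-Σ'' a
    ... | λ₀ , j , refl | inj₂ (b , n) with state j b
    ...   | inj₁ ab = inj₁ λ t p i → ab t p (back-other j b n i)
    ...   | inj₂ sh = inj₂ λ t → let (r , k) = sh t in r , λ p →
              (λ i → proj₁ (k p) (back-other j b n i)) , (λ l → image {λ₀} (proj₂ (k p) l) (F-other p n))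
    state'' m a | λ₀ , j , refl | inj₁ (e , refl , refl) with state j cA
    ...   | inj₁ ab = inj₁ λ where
              false p i → ab s (e ∷ p) (back-self j e p i)
              true p i → ab (not s) (not e ∷ p) (back-opp j e p i)
    ...   | inj₂ sh with halves j sh e
    ...     | inj₁ (n₁ , n₂) = inj₁ λ where
              false p i → n₁ p (back-self j e p i)
              true p i → n₂ p (back-opp j e p i)
    ...     | inj₂ ((r , k) , (r' , k')) = inj₂ λ where
              false → r , λ p → (λ i → proj₁ (k p) (back-self j e p i)) , (λ l → image {λ₀} (proj₂ (k p) l) (F-self e p))
              true → r' , λ p → (λ i → proj₁ (k' p) (back-opp j e p i)) , (λ l → opp-image {λ₀} e p (proj₂ (k' p) l))

    polarity : ∀ (P : Maybe Fm → Set) {λ₀} → λ₀ ∈ θ → ∀ u → View u → ∀ {d t p B} → F u ≡ (cutside d t , p) → (d , B) ∈ Σ'' →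
      (∀ {d' t' p' B'} → u ≡ (cutside d' t' , p') → (d' , B') ∈ Σ' → P (sub (sideFm t' B') p')) → P (sub (sideFm t B) p)
    polarity P m u (free n p' refl fl) q b h with trans (sym q) fl
    ... | ()
    polarity P m u (elsewhere d' t' p' B' refl b' n fl) q b h with trans (sym q) fl | in-Σ'' b
    ... | refl | inj₂ (b₁ , _) = h refl b₁
    ... | refl | inj₁ (e , r , _) = ⊥-elim (child-neq b' (sym r))
    polarity P m u (self e p' refl fl) q b h with trans (sym q) fl | in-Σ'' b
    ... | refl | inj₂ (b₁ , _) = ⊥-elim (child-neq b₁ refl)
    ... | refl | inj₁ (e , refl , refl) = subst P (sub-self e p') (h refl cA)
    polarity P m u (opp e p' refl fl) q b h with trans (sym q) fl | in-Σ'' b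
    ... | refl | inj₂ (b₁ , _) = ⊥-elim (child-neq b₁ refl)
    ... | refl | inj₁ (e , refl , refl) = subst P (sub-opp e p') (h refl cA)

    polar⁺'' : ∀ {λ₀ d t p v B} → λ₀ ∈ map (mapl F) θ → lk (cutside d t , p) v ∈ λ₀ → (d , B) ∈ Σ'' → Pos (sideFm t B) p
    polar⁺'' m i b with ∈-map⁻ _ m
    ... | λ₀ , j , refl with ∈-map⁻ (mapLink F) i
    ...   | lk u w , k , q = polarity (λ a → ∃[ x ] (a ≡ just (var x))) j u (view j u (leaves-pos k)) (sym (cong pos q)) b
                               (λ { refl b' → polar⁺ j k b' })

    polar⁻'' : ∀ {λ₀ d t p v B} → λ₀ ∈ map (mapl F) θ → lk v (cutside d t , p) ∈ λ₀ → (d , B) ∈ Σ'' → Neg (sideFm t B) p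
    polar⁻'' m i b with ∈-map⁻ _ m
    ... | λ₀ , j , refl with ∈-map⁻ (mapLink F) i
    ...   | lk w u , k , q = polarity (λ a → ∃[ x ] (a ≡ just (nvar x))) j u (view j u (leaves-neg k)) (sym (cong neg q)) b
                               (λ { refl b' → polar⁻ j k b' })

  split-sem : stN (map (mapl F) θ) ≈ stN θ
  split-sem = ≈-trans (wireN-cong stW (netV-map F θ)) (≈-trans (pre stW F) (agreeN λ (λ₀ , m) → record
    { out~ = λ w l v → o w v (view m w l)
    ; joins~ = λ w w' l l' → k w w' (view m w l) (view m w' l') }))
    where
    id↔ : ∀ {X : Set} → X ↔ X
    id↔ = (λ x → x) , (λ x → x)
    o : ∀ w v → View w → out stW (F w) v ↔ out stW w v
    o w v (free _ _ refl fl) rewrite fl = id↔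
    o w v (elsewhere d t p B refl b n fl) rewrite fl = id↔
    o w v (self e p refl fl) rewrite fl = id↔
    o w v (opp e p refl fl) rewrite fl = id↔
    not-inj : ∀ {a b} → not a ≡ not b → a ≡ b
    not-inj {a} {b} q = trans (sym (not-involutive a)) (trans (cong not q) (not-involutive b))
    k : ∀ w w' → View w → View w' → joins stW (F w) (F w') ↔ joins stW w w'
    k _ _ (free _ _ refl fl) _ rewrite fl = (λ ()) , (λ ())
    k w (concl n , p) v (free _ _ refl fl) rewrite fl = (λ j → ⊥-elim (no-join (F w) j)) , (λ j → ⊥-elim (no-join w j))
      where
      no-join : ∀ w → joins stW w (concl n , p) → ⊥
      no-join (concl _ , _) ()
      no-join (cutside _ _ , _) ()
    k _ _ (elsewhere _ _ _ _ refl _ _ fl) (elsewhere _ _ _ _ refl _ _ fl') rewrite fl | fl' = id↔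
    k _ _ (elsewhere d _ _ _ refl b n fl) (self e _ refl fl') rewrite fl | fl' =
      (λ (q , _) → ⊥-elim (child-neq b (sym q))) , (λ (q , _) → ⊥-elim (n (sym q)))
    k _ _ (elsewhere d _ _ _ refl b n fl) (opp e _ refl fl') rewrite fl | fl' =
      (λ (q , _) → ⊥-elim (child-neq b (sym q))) , (λ (q , _) → ⊥-elim (n (sym q)))
    k _ _ (self e _ refl fl') (elsewhere d _ _ _ refl b n fl) rewrite fl | fl' =
      (λ (q , _) → ⊥-elim (child-neq b q)) , (λ (q , _) → ⊥-elim (n q))
    k _ _ (opp e _ refl fl') (elsewhere d _ _ _ refl b n fl) rewrite fl | fl' =
      (λ (q , _) → ⊥-elim (child-neq b q)) , (λ (q , _) → ⊥-elim (n q))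
    k _ _ (self e _ refl fl) (self e' _ refl fl') rewrite fl | fl' =
      (λ { (_ , () , _) }) , (λ (_ , q , _) → ⊥-elim (not-≢ s q))
    k _ _ (opp e _ refl fl) (opp e' _ refl fl') rewrite fl | fl' =
      (λ { (_ , () , _) }) , (λ (_ , q , _) → ⊥-elim (not-≢ (not s) q))
    k _ _ (self e p refl fl) (opp e' p' refl fl') rewrite fl | fl' =
      (λ { (refl , _ , refl) → refl , refl , refl }) ,
      (λ (_ , _ , q) → cong (_∷ c) (sym (not-inj (∷-injectiveˡ q))) , refl , ∷-injectiveʳ q)
    k _ _ (opp e p refl fl) (self e' p' refl fl') rewrite fl | fl' =
      (λ { (refl , _ , refl) → refl , sym (not-involutive s) , cong (_∷ flip p) (sym (not-involutive e)) }) ,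
      (λ (_ , _ , q) → cong (_∷ c) (sym (trans (∷-injectiveˡ q) (not-involutive e))) , refl , ∷-injectiveʳ q)

conn : Fm → ℕ
conn (var _) = 0
conn (nvar _) = 0
conn (A ⊗ B) = suc (conn A + conn B)
conn (A ⅋ B) = suc (conn A + conn B)
conn (A & B) = suc (conn A + conn B)
conn (A ⊕ B) = suc (conn A + conn B)

conn-dual : ∀ A → conn (dual A) ≡ conn A
conn-dual (var _) = refl
conn-dual (nvar _) = refl
conn-dual (A ⊗ B) = cong suc (trans (cong₂ _+_ (conn-dual B) (conn-dual A)) (+-comm (conn B) (conn A)))
conn-dual (A ⅋ B) = cong suc (trans (cong₂ _+_ (conn-dual B) (conn-dual A)) (+-comm (conn B) (conn A)))
conn-dual (A & B) = cong suc (trans (cong₂ _+_ (conn-dual B) (conn-dual A)) (+-comm (conn B) (conn A)))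
conn-dual (A ⊕ B) = cong suc (trans (cong₂ _+_ (conn-dual B) (conn-dual A)) (+-comm (conn B) (conn A)))

conn-side : ∀ s A → conn (sideFm s A) ≡ conn A
conn-side false A = refl
conn-side true A = conn-dual A

total : Cuts → ℕ
total [] = 0
total ((_ , A) ∷ Σ') = conn A + total Σ'

total-filter : ∀ p Σ' → total (filterᵇ p Σ') ≤ total Σ'
total-filter p [] = z≤n
total-filter p (x ∷ Σ') with p x
... | true = +-monoʳ-≤ (conn (proj₂ x)) (total-filter p Σ')
... | false = ≤-trans (total-filter p Σ') (m≤n+m _ (conn (proj₂ x)))

total-drop : ∀ {c A} Σ' → (c , A) ∈ Σ' → conn A + total (dropCut c Σ') ≤ total Σ'
total-drop {c} {A} ((c , A) ∷ Σ') (here refl) rewrite eqCN-refl c = +-monoʳ-≤ (conn A) (total-filter _ Σ')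
total-drop {c} {A} ((d , B) ∷ Σ') (there i) with eqCN c d
... | true = ≤-trans (total-drop Σ' i) (m≤n+m _ (conn B))
... | false = ≤-trans (≤-reflexive (trans (sym (+-assoc (conn A) (conn B) _)) (trans (cong (_+ total (dropCut c Σ')) (+-comm (conn A) (conn B))) (+-assoc (conn B) (conn A) _))))
                (+-monoʳ-≤ (conn B) (total-drop Σ' i))

total-split : ∀ {c A A₁ A₂ s} Σ' → (c , A) ∈ Σ' → conn (sideFm s A) ≡ suc (conn A₁ + conn A₂) →
              total (splitCuts c A₁ A₂ Σ') < total Σ'
total-split {c} {A} {A₁} {A₂} {s} Σ' i e = ≤-trans (≤-reflexive (cong suc (sym (+-assoc (conn A₁) (conn A₂) _))))
  (≤-trans (≤-reflexive (cong (_+ total (dropCut c Σ')) (sym (trans (sym (conn-side s A)) e)))) (total-drop Σ' i))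

root-inner : ∀ {X Y : Fm} → X ≡ Y → (∀ (r : Res Y) → ¬ rleaf r []) → ∀ (r : Res X) → ¬ rleaf r []
root-inner refl h = h

nil-side : ∀ {s A X Y} → sideFm s A ≡ X → sideFm (not s) A ≡ Y → (∀ (r : Res X) → ¬ rleaf r []) → (∀ (r : Res Y) → ¬ rleaf r []) →
           ∀ t (r : Res (sideFm t A)) → ¬ rleaf r []
nil-side {false} e e' h h' false = root-inner e h
nil-side {false} e e' h h' true = root-inner e' h'
nil-side {true} e e' h h' true = root-inner e h
nil-side {true} e e' h h' false = root-inner e' h'

Reduct : List Fm → Cuts → Net → Cuts → Net → Set
Reduct Γ Σ' θ Σ₁ θ₁ = NStep (cs Σ' Γ , θ) (cs Σ₁ Γ , θ₁) × Inv Σ₁ θ₁ × (stN θ₁ ≈ stN θ) × total Σ₁ < total Σ'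

mult-step : ∀ {Γ Σ' θ c A A₁ A₂} s → Inv Σ' θ → (c , A) ∈ Σ' → sideFm s A ≡ A₁ ⊗ A₂ → sideFm (not s) A ≡ dual A₂ ⅋ dual A₁ →
            ∃[ Σ₁ ] ∃[ θ₁ ] Reduct Γ Σ' θ Σ₁ θ₁
mult-step {Γ} {Σ'} {θ} {c} {A} {A₁} {A₂} s inv i e e' = _ , _ , mult s i e , M.inv'' , M.split-sem ,
  total-split {A₁ = A₁} {A₂} {s} Σ' i (cong conn e)
  where
  self : ∀ d p → sub (sideFm s A) (d ∷ p) ≡ sub (two A₁ A₂ d) p
  self false p rewrite e = refl
  self true p rewrite e = refl
  opp : ∀ d p → sub (sideFm (not s) A) (not d ∷ p) ≡ sub (dual (two A₁ A₂ d)) p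
  opp false p rewrite e' = refl
  opp true p rewrite e' = refl
  halves : ∀ {λ₀} → λ₀ ∈ θ → (∀ t → SideShape λ₀ c t (sideFm t A)) → ∀ d → _ ⊎ _
  halves {λ₀} m sh d with subst (SideShape λ₀ c s) e (sh s) | subst (SideShape λ₀ c (not s)) e' (sh (not s))
  halves m sh false | r⊗ x y , k | r⅋ x' y' , k' = inj₂ ((x , λ p → k (false ∷ p)) , (y' , λ p → k' (true ∷ p)))
  halves m sh true | r⊗ x y , k | r⅋ x' y' , k' = inj₂ ((y , λ p → k (true ∷ p)) , (x' , λ p → k' (false ∷ p)))
  nil⊗ : ∀ (r : Res (A₁ ⊗ A₂)) → ¬ rleaf r []
  nil⊗ (r⊗ _ _) ()
  nil⅋ : ∀ (r : Res (dual A₂ ⅋ dual A₁)) → ¬ rleaf r []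
  nil⅋ (r⅋ _ _) ()
  module M = Split inv i s (two A₁ A₂) self opp (nil-side {s} e e' nil⊗ nil⅋) halves

under⁺ : ∀ c s d p → under (cutside c s) d (cutside c s , d ∷ p) ≡ true
under⁺ c s d p rewrite eqCN-refl c | eqB-refl s | eqB-refl d = refl

under⁻ : ∀ c s d v → under (cutside c s) d v ≡ true → ∃[ p ] (v ≡ (cutside c s , d ∷ p))
under⁻ c s d (cutside c' s' , d' ∷ p) e with eqCN c c' in q | s | s' | d | d' | e
... | true | true | true | true | true | _ = p , cong (λ c → cutside c true , true ∷ p) (sym (eqCN-true c c' q))
... | true | true | true | false | false | _ = p , cong (λ c → cutside c true , false ∷ p) (sym (eqCN-true c c' q))
... | true | false | false | true | true | _ = p , cong (λ c → cutside c false , true ∷ p) (sym (eqCN-true c c' q))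
... | true | false | false | false | false | _ = p , cong (λ c → cutside c false , false ∷ p) (sym (eqCN-true c c' q))

∨-cases : ∀ a b c d → (a ∧ b) ∨ (c ∧ d) ≡ true → (a ≡ true × b ≡ true) ⊎ (c ≡ true × d ≡ true)
∨-cases true true _ _ _ = inj₁ (refl , refl)
∨-cases true false true true _ = inj₂ (refl , refl)
∨-cases false _ true true _ = inj₂ (refl , refl)

meets : ∀ c s λ₀ d → any (under (cutside c s) d) (leaves λ₀) ≡ true → any (under (cutside c (not s)) d) (leaves λ₀) ≡ true →
  ∃[ p ] ∃[ q ] ((cutside c s , d ∷ p) ∈ leaves λ₀ × (cutside c (not s) , d ∷ q) ∈ leaves λ₀)
meets c s λ₀ d a b with any⁻ _ (leaves λ₀) a | any⁻ _ (leaves λ₀) b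
... | v , i , q | w , j , q' with under⁻ c s d v q | under⁻ c (not s) d w q'
...   | p , refl | p' , refl = p , p' , i , j

mismatch⁻ : ∀ c s λ₀ → mismatch c s λ₀ ≡ true →
  ∃[ d ] ∃[ p ] ∃[ q ] ((cutside c s , d ∷ p) ∈ leaves λ₀ × (cutside c (not s) , d ∷ q) ∈ leaves λ₀)
mismatch⁻ c s λ₀ e with ∨-cases (any (under (cutside c s) false) (leaves λ₀)) (any (under (cutside c (not s)) false) (leaves λ₀))
                                 (any (under (cutside c s) true) (leaves λ₀)) (any (under (cutside c (not s)) true) (leaves λ₀)) e
... | inj₁ (a , b) = false , meets c s λ₀ false a b
... | inj₂ (a , b) = true , meets c s λ₀ true a b

mismatch⁺ : ∀ c s λ₀ d {p q} → (cutside c s , d ∷ p) ∈ leaves λ₀ → (cutside c (not s) , d ∷ q) ∈ leaves λ₀ → mismatch c s λ₀ ≡ true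
mismatch⁺ c s λ₀ false {p} {q} i j
  rewrite any⁺ (under (cutside c s) false) i (under⁺ c s false p) | any⁺ (under (cutside c (not s)) false) j (under⁺ c (not s) false q) = refl
mismatch⁺ c s λ₀ true {p} {q} i j
  rewrite any⁺ (under (cutside c s) true) i (under⁺ c s true p) | any⁺ (under (cutside c (not s)) true) j (under⁺ c (not s) true q) = ∨-true _
  where
  ∨-true : ∀ b → b ∨ true ≡ true
  ∨-true true = refl
  ∨-true false = refl

add-step : ∀ {Γ Σ' θ c A A₁ A₂} s → Inv Σ' θ → (c , A) ∈ Σ' → sideFm s A ≡ A₁ & A₂ → sideFm (not s) A ≡ dual A₂ ⊕ dual A₁ →
           ∃[ Σ₁ ] ∃[ θ₁ ] Reduct Γ Σ' θ Σ₁ θ₁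
add-step {Γ} {Σ'} {θ} {c} {A} {A₁} {A₂} s inv i e e' = _ , _ , add s i e , inv-prune M.inv'' , ≈-trans M.split-sem keep-sem ,
  ≤-trans (s≤s (total-filter (present? (map (mapl (remap c s)) θ₀)) (splitCuts c A₁ A₂ Σ'))) (total-split {A₁ = A₁} {A₂} {s} Σ' i (cong conn e))
  where
  θ₀ : Net
  θ₀ = filterᵇ (λ λ₀ → not (mismatch c s λ₀)) θ
  kept : ∀ {λ₀} → λ₀ ∈ θ₀ → λ₀ ∈ θ × not (mismatch c s λ₀) ≡ true
  kept m = ∈-filterᵇ⁻ (λ λ₀ → not (mismatch c s λ₀)) {xs = θ} m
  self : ∀ d p → sub (sideFm s A) (d ∷ p) ≡ sub (two A₁ A₂ d) p
  self false p rewrite e = refl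
  self true p rewrite e = refl
  opp : ∀ d p → sub (sideFm (not s) A) (not d ∷ p) ≡ sub (dual (two A₁ A₂ d)) p
  opp false p rewrite e' = refl
  opp true p rewrite e' = refl
  clash : ∀ {λ₀} → λ₀ ∈ θ₀ → ∀ d {p q} → (cutside c s , d ∷ p) ∈ leaves λ₀ → (cutside c (not s) , d ∷ q) ∈ leaves λ₀ → ⊥
  clash {λ₀} m d a b with trans (sym (cong not (mismatch⁺ c s λ₀ d a b))) (proj₂ (kept m))
  ... | ()
  halves : ∀ {λ₀} → λ₀ ∈ θ₀ → (∀ t → SideShape λ₀ c t (sideFm t A)) → ∀ d → _ ⊎ _
  halves {λ₀} m sh d with subst (SideShape λ₀ c s) e (sh s) | subst (SideShape λ₀ c (not s)) e' (sh (not s))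
  ... | r&₁ x , k | r⊕₁ y , k' = ⊥-elim (clash m false (proj₂ (k (false ∷ _)) (proj₂ (rleaf-nonempty x))) (proj₂ (k' (false ∷ _)) (proj₂ (rleaf-nonempty y))))
  ... | r&₂ x , k | r⊕₂ y , k' = ⊥-elim (clash m true (proj₂ (k (true ∷ _)) (proj₂ (rleaf-nonempty x))) (proj₂ (k' (true ∷ _)) (proj₂ (rleaf-nonempty y))))
  halves m sh false | r&₁ x , k | r⊕₂ y , k' = inj₂ ((x , λ p → k (false ∷ p)) , (y , λ p → k' (true ∷ p)))
  halves m sh true | r&₁ x , k | r⊕₂ y , k' = inj₁ ((λ p l → proj₁ (k (true ∷ p)) l) , (λ p l → proj₁ (k' (false ∷ p)) l))
  halves m sh false | r&₂ x , k | r⊕₁ y , k' = inj₁ ((λ p l → proj₁ (k (false ∷ p)) l) , (λ p l → proj₁ (k' (true ∷ p)) l))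
  halves m sh true | r&₂ x , k | r⊕₁ y , k' = inj₂ ((x , λ p → k (true ∷ p)) , (y , λ p → k' (false ∷ p)))
  nil& : ∀ (r : Res (A₁ & A₂)) → ¬ rleaf r []
  nil& (r&₁ _) ()
  nil& (r&₂ _) ()
  nil⊕ : ∀ (r : Res (dual A₂ ⊕ dual A₁)) → ¬ rleaf r []
  nil⊕ (r⊕₁ _) ()
  nil⊕ (r⊕₂ _) ()
  module M = Split (inv-⊆ (λ m → proj₁ (kept m)) inv) i s (two A₁ A₂) self opp (nil-side {s} e e' nil& nil⊕) halves
  one-branch : ∀ {F G} (r : Res (F ⊕ G)) d {p q} → rleaf r (d ∷ p) → rleaf r (not d ∷ q) → ⊥
  one-branch (r⊕₁ _) false _ ()
  one-branch (r⊕₁ _) true () _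
  one-branch (r⊕₂ _) false () _
  one-branch (r⊕₂ _) true _ ()
  routed-match : ∀ {λ₀} → λ₀ ∈ θ → Routed stW (toV λ₀) → not (mismatch c s λ₀) ≡ true
  routed-match {λ₀} m rt with mismatch c s λ₀ in q
  ... | false = refl
  ... | true with mismatch⁻ c s λ₀ q
  ...   | d , p , p' , a , b with rt _ a
  ...     | inj₂ ((cutside .c _ , _) , (refl , refl , refl) , a') with Inv.state inv m i
  ...       | inj₁ ab = ⊥-elim (ab s _ a)
  ...       | inj₂ sh with subst (SideShape λ₀ c (not s)) e' (sh (not s))
  ...         | r , k = ⊥-elim (one-branch r d (proj₁ (k _) b) (proj₁ (k _) a'))
  keep-sem : stN θ₀ ≈ stN θ
  keep-sem = (λ ((λ₀ , m) , rt) → ((λ₀ , proj₁ (kept m)) , rt) , ≃-refl) ,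
             (λ ((λ₀ , m) , rt) → ((λ₀ , ∈-filterᵇ⁺ _ m (routed-match m rt)) , rt) , ≃-refl)

Atomic : Fm → Set
Atomic A = ∃[ n ] (A ≡ var n ⊎ A ≡ nvar n)

compound-step : ∀ {Γ Σ' θ c} A → Inv Σ' θ → (c , A) ∈ Σ' → Atomic A ⊎ (∃[ Σ₁ ] ∃[ θ₁ ] Reduct Γ Σ' θ Σ₁ θ₁)
compound-step (var n) inv i = inj₁ (n , inj₁ refl)
compound-step (nvar n) inv i = inj₁ (n , inj₂ refl)
compound-step (A ⊗ B) inv i = inj₂ (mult-step false inv i refl refl)
compound-step (A ⅋ B) inv i = inj₂ (mult-step true inv i refl (sym (cong₂ _⅋_ (dual-dual A) (dual-dual B))))
compound-step (A & B) inv i = inj₂ (add-step false inv i refl refl)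
compound-step (A ⊕ B) inv i = inj₂ (add-step true inv i refl (sym (cong₂ _⊕_ (dual-dual A) (dual-dual B))))

AllAtomic : Cuts → Set
AllAtomic Σ' = ∀ {c A} → (c , A) ∈ Σ' → Atomic A

scan : ∀ {Γ Σ' θ} → Inv Σ' θ → ∀ Σ₀ → (∀ {q} → q ∈ Σ₀ → q ∈ Σ') →
       AllAtomic Σ₀ ⊎ (∃[ Σ₁ ] ∃[ θ₁ ] Reduct Γ Σ' θ Σ₁ θ₁)
scan inv [] h = inj₁ (λ ())
scan inv ((c , A) ∷ Σ₀) h with compound-step A inv (h (here refl)) | scan inv Σ₀ (λ i → h (there i))
... | inj₂ r | _ = inj₂ r
... | _ | inj₂ r = inj₂ r
... | inj₁ a | inj₁ b = inj₁ λ { (here refl) → a ; (there i) → b i }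

to-atoms : ∀ {Γ} n {Σ' θ} → total Σ' ≤ n → Inv Σ' θ →
  ∃[ Σ₁ ] ∃[ θ₁ ] (Star NStep (cs Σ' Γ , θ) (cs Σ₁ Γ , θ₁) × Inv Σ₁ θ₁ × (stN θ₁ ≈ stN θ) × AllAtomic Σ₁)
to-atoms {Γ} n {Σ'} {θ} le inv with scan {Γ} inv Σ' (λ i → i)
... | inj₁ a = Σ' , θ , ε , inv , ≈-refl , a
to-atoms zero le inv | inj₂ (_ , _ , _ , _ , _ , lt) with ≤-trans lt le
... | ()
to-atoms (suc n) le inv | inj₂ (Σ₁ , θ₁ , st , inv₁ , e , lt) with to-atoms n (s≤s⁻¹ (≤-trans lt le)) inv₁
... | Σ₂ , θ₂ , sts , inv₂ , e₂ , a = Σ₂ , θ₂ , st ◅ sts , inv₂ , ≈-trans e₂ e , a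

onC : CutName → Vertex → Bool
onC c v = onCut c (proj₁ v)

onC⁻ : ∀ c v → onC c v ≡ true → ∃[ s ] ∃[ p ] (v ≡ (cutside c s , p))
onC⁻ c (cutside d s , p) e = s , p , cong (λ c → cutside c s , p) (sym (eqCN-true c d e))

both-off : ∀ {a b} → not (a ∨ b) ≡ true → a ≡ false × b ≡ false
both-off {false} {false} _ = refl , refl
both-off {false} {true} ()
both-off {true} ()

∈-merge⁻ : ∀ c λ₀ {b} → b ∈ mergeAt c λ₀ → (b ∈ λ₀ × onC c (pos b) ≡ false × onC c (neg b) ≡ false) ⊎
  ∃[ a ] ∃[ a' ] (a ∈ λ₀ × a' ∈ λ₀ × onC c (pos a) ≡ true × onC c (neg a') ≡ true × b ≡ lk (pos a') (neg a))
∈-merge⁻ c λ₀ {b} i with ∈-++⁻ (filterᵇ (λ a → not (onC c (pos a) ∨ onC c (neg a))) λ₀) i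
... | inj₁ j = let (k , e) = ∈-filterᵇ⁻ (λ a → not (onC c (pos a) ∨ onC c (neg a))) {xs = λ₀} j in inj₁ (k , both-off e)
... | inj₂ j with find (∈-concatMap⁻ _ {xs = λ₀} j)
...   | a , a∈ , k with onC c (pos a) in e
...     | true with find (∈-concatMap⁻ _ {xs = λ₀} k)
...       | a' , a'∈ , k' with onC c (neg a') in e'
∈-merge⁻ c λ₀ {b} i | inj₂ j | a , a∈ , k | true | a' , a'∈ , here refl | true = inj₂ (a , a' , a∈ , a'∈ , e , e' , refl)

∈-merge⁺₁ : ∀ c λ₀ {b} → b ∈ λ₀ → onC c (pos b) ≡ false → onC c (neg b) ≡ false → b ∈ mergeAt c λ₀
∈-merge⁺₁ c λ₀ i e e' = ∈-++⁺ˡ (∈-filterᵇ⁺ _ i (cong₂ (λ a b → not (a ∨ b)) e e'))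

∈-merge⁺₂ : ∀ c λ₀ {a a'} → a ∈ λ₀ → a' ∈ λ₀ → onC c (pos a) ≡ true → onC c (neg a') ≡ true →
            lk (pos a') (neg a) ∈ mergeAt c λ₀
∈-merge⁺₂ c λ₀ {a} {a'} i j e e' = ∈-++⁺ʳ (filterᵇ _ λ₀) (∈-concatMap⁺ _ (lose i outer))
  where
  inner : lk (pos a') (neg a) ∈ (if onC c (neg a') then lk (pos a') (neg a) ∷ [] else [])
  inner rewrite e' = here refl
  outer : lk (pos a') (neg a) ∈ (if onC c (pos a) then concatMap (λ b → if onC c (neg b) then lk (pos b) (neg a) ∷ [] else []) λ₀ else [])
  outer rewrite e = ∈-concatMap⁺ _ (lose j inner)

side-atomic : ∀ s {A} → Atomic A → Atomic (sideFm s A)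
side-atomic false a = a
side-atomic true (n , inj₁ refl) = n , inj₂ refl
side-atomic true (n , inj₂ refl) = n , inj₁ refl

atomic-path : ∀ {A p B} → Atomic A → sub A p ≡ just B → p ≡ []
atomic-path {p = []} _ _ = refl
atomic-path {p = _ ∷ _} (n , inj₁ refl) ()
atomic-path {p = _ ∷ _} (n , inj₂ refl) ()

one-neg : ∀ {A} → Atomic A → ∀ t → Neg (sideFm t A) [] → Neg (sideFm (not t) A) [] → ⊥
one-neg (_ , inj₁ refl) false (_ , ()) _
one-neg (_ , inj₁ refl) true _ (_ , ())
one-neg (_ , inj₂ refl) false _ (_ , ())
one-neg (_ , inj₂ refl) true (_ , ()) _

one-pos : ∀ {A} → Atomic A → ∀ t → Pos (sideFm t A) [] → Pos (sideFm (not t) A) [] → ⊥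
one-pos (_ , inj₁ refl) false _ (_ , ())
one-pos (_ , inj₁ refl) true (_ , ()) _
one-pos (_ , inj₂ refl) false (_ , ()) _
one-pos (_ , inj₂ refl) true _ (_ , ())

atomic-leaf : ∀ {A} → Atomic A → (r : Res A) → rleaf r []
atomic-leaf (_ , inj₁ refl) at⁺ = tt
atomic-leaf (_ , inj₂ refl) at⁻ = tt

atomic-only : ∀ {A} → Atomic A → (r : Res A) → ∀ {p} → rleaf r p → p ≡ []
atomic-only a r {p} l with rleaf-atom r p l
... | inj₁ (_ , e) = atomic-path {p = p} a e
... | inj₂ (_ , e) = atomic-path {p = p} a e

module Merge {Σ' : Cuts} {θ : Net} (inv : Inv Σ' θ) {c : CutName} {A : Fm} (cA : (c , A) ∈ Σ') (atm : Atomic A)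
  {λ₀ : Linking} (m : λ₀ ∈ θ) (noloop : ¬ Loop (wire stW (toV λ₀))) where
  open Inv inv

  pos-on : ∀ {u v} → lk u v ∈ λ₀ → onC c u ≡ true → ∃[ s ] (u ≡ (cutside c s , []) × Pos (sideFm s A) [])
  pos-on {u} i e with onC⁻ c u e
  ... | s , p , refl with polar⁺ m i cA
  ...   | k , q with atomic-path {p = p} (side-atomic s {A} atm) q
  ...     | refl = s , refl , k , q

  neg-on : ∀ {u v} → lk u v ∈ λ₀ → onC c v ≡ true → ∃[ s ] (v ≡ (cutside c s , []) × Neg (sideFm s A) [])
  neg-on {v = v} i e with onC⁻ c v e
  ... | s , p , refl with polar⁻ m i cA
  ...   | k , q with atomic-path {p = p} (side-atomic s {A} atm) q
  ...     | refl = s , refl , k , q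

  opposite : ∀ s t → Pos (sideFm s A) [] → Neg (sideFm t A) [] → s ≡ not t
  opposite false true _ _ = refl
  opposite true false _ _ = refl
  opposite false false (_ , e) (_ , e') with trans (sym e) e'
  ... | ()
  opposite true true (_ , e) (_ , e') with trans (sym e) e'
  ... | ()

  bridge : ∀ {u v u' v'} → lk u v ∈ λ₀ → lk u' v' ∈ λ₀ → onC c v ≡ true → onC c u' ≡ true → joins stW v u'
  bridge i j e e' with neg-on i e | pos-on j e'
  ... | t , refl , n | s , refl , p = refl , opposite s t p n , refl

  no-self : ∀ {u v} → lk u v ∈ λ₀ → onC c u ≡ true → onC c v ≡ true → ⊥
  no-self i e e' = noloop (inj₂ (_ , _ , hop i , bridge i i e' e))

  merged = mergeAt c λ₀

  ends-off : ∀ {b} → b ∈ merged → onC c (pos b) ≡ false × onC c (neg b) ≡ false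
  ends-off i with ∈-merge⁻ c λ₀ i
  ... | inj₁ (_ , e , e') = e , e'
  ... | inj₂ (a , a' , i₁ , i₂ , e , e' , refl) = off-pos , off-neg
    where
    off-pos : onC c (pos a') ≡ false
    off-pos with onC c (pos a') in q
    ... | false = refl
    ... | true = ⊥-elim (no-self i₂ q e')
    off-neg : onC c (neg a) ≡ false
    off-neg with onC c (neg a) in q
    ... | false = refl
    ... | true = ⊥-elim (no-self i₁ e q)

  expand : ∀ {u v} → Run stW (toV merged) u v → Run stW (toV λ₀) u v
  expand (hop r) with ∈-merge⁻ c λ₀ r
  ... | inj₁ (i , _) = hop i
  ... | inj₂ (a , a' , i , i' , e , e' , refl) = step i' (bridge i' i e' e) (hop i)
  expand (step r k p) with ∈-merge⁻ c λ₀ r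
  ... | inj₁ (i , _) = step i k (expand p)
  ... | inj₂ (a , a' , i , i' , e , e' , refl) = step i' (bridge i' i e' e) (step i k (expand p))

  joins-on : ∀ v v' → joins stW v v' → onC c v ≡ onC c v'
  joins-on (cutside _ _ , _) (cutside _ _ , _) (refl , _) = refl

  contract : ∀ {u v} → Run stW (toV λ₀) u v → onC c u ≡ false → onC c v ≡ false → Run stW (toV merged) u v
  contract (hop r) e e' = hop (∈-merge⁺₁ c λ₀ r e e')
  contract (step {v = v} {v' = v'} r k p) e e' with onC c v in q
  ... | false = step (∈-merge⁺₁ c λ₀ r e q) k (contract p (trans (sym (joins-on v v' k)) q) e')
  contract (step {v = v} {v' = v'} r k (hop r')) e e' | true =
    hop (∈-merge⁺₂ c λ₀ r' r (trans (sym (joins-on v v' k)) q) q)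
  contract (step {v = v} {v' = v'} r k (step {v = x} {v' = x'} r' k' p)) e e' | true with onC c x in qx
  ... | true = ⊥-elim (no-self r' (trans (sym (joins-on v v' k)) q) qx)
  ... | false = step (∈-merge⁺₂ c λ₀ r' r (trans (sym (joins-on v v' k)) q) q) k'
                  (contract p (trans (sym (joins-on x x' k')) qx) e')

  partner : ∀ {v s} → v ≡ (cutside c s , []) → v ∈ leaves λ₀ → (cutside c (not s) , []) ∈ leaves λ₀
  partner {s = s} refl l with state m cA
  ... | inj₁ ab = ⊥-elim (ab s [] l)
  ... | inj₂ sh with sh (not s)
  ...   | r , k = proj₂ (k []) (atomic-leaf (side-atomic (not s) atm) r)

  on-self : ∀ s → onC c (cutside c s , []) ≡ true
  on-self s = eqCN-refl c

  leaf→ : ∀ {v} → v ∈ leaves merged → v ∈ leaves λ₀ × onC c v ≡ false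
  leaf→ l with leaves⁻ {λ₀ = merged} l
  ... | b , i , here refl with ∈-merge⁻ c λ₀ i
  ...   | inj₁ (j , e , _) = leaves-pos j , e
  ...   | inj₂ (a , a' , j , j' , e , e' , refl) = leaves-pos j' , proj₁ (ends-off i)
  leaf→ l | b , i , there (here refl) with ∈-merge⁻ c λ₀ i
  ...   | inj₁ (j , _ , e) = leaves-neg j , e
  ...   | inj₂ (a , a' , j , j' , e , e' , refl) = leaves-neg j , proj₂ (ends-off i)

  leaf← : ∀ {v} → v ∈ leaves λ₀ → onC c v ≡ false → v ∈ leaves merged
  leaf← l e with leaves⁻ {λ₀ = λ₀} l
  ... | lk u w , i , here refl with onC c w in q
  ...   | false = leaves-pos (∈-merge⁺₁ c λ₀ i e q)
  ...   | true with neg-on i q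
  ...     | t , refl , n with leaves⁻ {λ₀ = λ₀} (partner {s = t} refl (leaves-neg i))
  ...       | b , j , here r = leaves-pos (∈-merge⁺₂ c λ₀ j i (trans (cong (onC c) (sym r)) (on-self (not t))) q)
  ...       | lk x y , j , there (here refl) with neg-on j (on-self (not t))
  ...         | .(not t) , refl , n' = ⊥-elim (one-neg atm t n n')
  leaf← l e | lk w u , i , there (here refl) with onC c w in q
  ...   | false = leaves-neg (∈-merge⁺₁ c λ₀ i q e)
  ...   | true with pos-on i q
  ...     | t , refl , n with leaves⁻ {λ₀ = λ₀} (partner {s = t} refl (leaves-pos i))
  ...       | b , j , there (here r) = leaves-neg (∈-merge⁺₂ c λ₀ i j q (trans (cong (onC c) (sym r)) (on-self (not t))))
  ...       | lk x y , j , here refl with pos-on j (on-self (not t))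
  ...         | .(not t) , refl , n' = ⊥-elim (one-pos atm t n n')

  out-off : ∀ w v → out stW w v → onC c w ≡ false
  out-off (concl _ , _) _ _ = refl

  merge-≃ : wire stW (toV merged) ≃ wire stW (toV λ₀)
  merge-≃ = record
    { leaf~ = λ v → (λ (w , o , l) → w , o , proj₁ (leaf→ l)) , (λ (w , o , l) → w , o , leaf← l (out-off w v o))
    ; rel~ = λ v v' → (λ (w , w' , o , o' , p) → w , w' , o , o' , expand p) ,
                      (λ (w , w' , o , o' , p) → w , w' , o , o' , contract p (out-off w v o) (out-off w' v' o'))
    ; loop~ = (λ { (inj₂ (u , v , p , k)) → inj₂ (u , v , expand p , k) }) , (λ l → ⊥-elim (noloop l)) }

NoLoops : Net → Set
NoLoops θ = ∀ {λ₀} → λ₀ ∈ θ → ¬ Loop (wire stW (toV λ₀))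

routed-atomic : ∀ {Σ' θ} → Inv Σ' θ → AllAtomic Σ' → ∀ {λ₀} → λ₀ ∈ θ → Routed stW (toV λ₀)
routed-atomic inv at m (concl n , p) l = inj₁ (_ , refl)
routed-atomic {θ = θ} inv at {λ₀} m (cutside c s , p) l with Inv.named inv m l
... | A , cA with Inv.state inv m cA
...   | inj₁ ab = ⊥-elim (ab s p l)
...   | inj₂ sh with atomic-only (side-atomic s (at cA)) (proj₁ (sh s)) (proj₁ (proj₂ (sh s) p) l)
...     | refl with sh (not s)
...       | r , k = inj₂ ((cutside c (not s) , []) , (refl , refl , refl) , proj₂ (k []) (atomic-leaf (side-atomic (not s) (at cA)) r))

module _ {Σ' : Cuts} {θ : Net} (inv : Inv Σ' θ) (at : AllAtomic Σ') (nl : NoLoops θ) {c : CutName} {A : Fm} (cA : (c , A) ∈ Σ') where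
  private
    module M {λ₀} (m : λ₀ ∈ θ) = Merge inv cA (at cA) m (nl m)
    open Inv inv

    off-name : ∀ {d t p} → c ≢ d → onC c (cutside d t , p) ≡ false
    off-name n = eqCN-false n

    off⇒≢ : ∀ {d t p} → onC c (cutside d t , p) ≡ false → c ≢ d
    off⇒≢ e refl with trans (sym e) (eqCN-refl c)
    ... | ()

  merge-inv : Inv (dropCut c Σ') (map (mergeAt c) θ)
  merge-inv = record
    { indep = λ xs a b → indep xs (proj₁ (∈-dropCut⁻ {c} a)) (proj₁ (∈-dropCut⁻ {c} b))
    ; named = nm ; state = st ; polar⁺ = p⁺ ; polar⁻ = p⁻ }
    where
    nm : ∀ {λ₀ d t p} → λ₀ ∈ map (mergeAt c) θ → (cutside d t , p) ∈ leaves λ₀ → ∃[ B ] ((d , B) ∈ dropCut c Σ')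
    nm {d = d} {t} {p} m' l with ∈-map⁻ _ m'
    ... | λ₀ , m , refl with M.leaf→ m l
    ...   | l' , e = let (B , b) = named m l' in B , ∈-dropCut⁺ b (off⇒≢ {d} {t} {p} e)
    st : ∀ {λ₀ d B} → λ₀ ∈ map (mergeAt c) θ → (d , B) ∈ dropCut c Σ' → Absent λ₀ d ⊎ (∀ t → SideShape λ₀ d t (sideFm t B))
    st {d = d} m' b with ∈-map⁻ _ m' | ∈-dropCut⁻ {c} b
    ... | λ₀ , m , refl | b' , n with state m b'
    ...   | inj₁ ab = inj₁ λ t p l → ab t p (proj₁ (M.leaf→ m l))
    ...   | inj₂ sh = inj₂ λ t → let (r , k) = sh t in r , λ p →
              (λ l → proj₁ (k p) (proj₁ (M.leaf→ m l))) , (λ l → M.leaf← m (proj₂ (k p) l) (off-name {d} {t} {p} n))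
    p⁺ : ∀ {λ₀ d t p v B} → λ₀ ∈ map (mergeAt c) θ → lk (cutside d t , p) v ∈ λ₀ → (d , B) ∈ dropCut c Σ' → Pos (sideFm t B) p
    p⁺ m' i b with ∈-map⁻ _ m' | ∈-dropCut⁻ {c} b
    ... | λ₀ , m , refl | b' , n with ∈-merge⁻ c λ₀ i
    ...   | inj₁ (j , _) = polar⁺ m j b'
    ...   | inj₂ (a , lk _ _ , _ , j' , _ , _ , refl) = polar⁺ m j' b'
    p⁻ : ∀ {λ₀ d t p v B} → λ₀ ∈ map (mergeAt c) θ → lk v (cutside d t , p) ∈ λ₀ → (d , B) ∈ dropCut c Σ' → Neg (sideFm t B) p
    p⁻ m' i b with ∈-map⁻ _ m' | ∈-dropCut⁻ {c} b
    ... | λ₀ , m , refl | b' , n with ∈-merge⁻ c λ₀ i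
    ...   | inj₁ (j , _) = polar⁻ m j b'
    ...   | inj₂ (lk _ _ , a' , j , _ , _ , _ , refl) = polar⁻ m j b'

  merge-atomic : AllAtomic (dropCut c Σ')
  merge-atomic b = at (proj₁ (∈-dropCut⁻ {c} b))

  merge-sem : stN (map (mergeAt c) θ) ≈ stN θ
  merge-sem =
    (λ ((λ' , m') , _) → let (λ₀ , m , q) = ∈-map⁻ _ m' in
       ((λ₀ , m) , routed-atomic inv at m) , subst (λ μ → wire stW (toV μ) ≃ wire stW (toV λ₀)) (sym q) (M.merge-≃ m)) ,
    (λ ((λ₀ , m) , _) → ((_ , ∈-map⁺ _ m) , routed-atomic merge-inv merge-atomic (∈-map⁺ _ m)) , M.merge-≃ m)

  merge-noloops : NoLoops (map (mergeAt c) θ)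
  merge-noloops m' l with ∈-map⁻ _ m'
  ... | λ₀ , m , refl = nl m (proj₁ (Sim.loop~ (M.merge-≃ m)) l)

dissolve : ∀ {Γ} n {Σ' θ} → length Σ' ≤ n → Inv Σ' θ → AllAtomic Σ' → NoLoops θ →
  ∃[ θ₁ ] (Star NStep (cs Σ' Γ , θ) (cs [] Γ , θ₁) × Inv [] θ₁ × (stN θ₁ ≈ stN θ))
dissolve n {[]} {θ} le inv at nl = θ , ε , inv , ≈-refl
dissolve {Γ} (suc n) {(c , A) ∷ Σ'} {θ} (s≤s le) inv at nl with
  dissolve {Γ} n {dropCut c ((c , A) ∷ Σ')} {map (mergeAt c) θ} shorter (merge-inv inv at nl (here refl)) (merge-atomic inv at nl (here refl)) (merge-noloops inv at nl (here refl))
  where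
  shorter : length (dropCut c ((c , A) ∷ Σ')) ≤ n
  shorter rewrite eqCN-refl c = ≤-trans (length-filter _ Σ') le
... | θ₁ , sts , inv₁ , e = θ₁ , atomic (here refl) (at (here refl)) ◅ sts , inv₁ , ≈-trans e (merge-sem inv at nl (here refl))

normalise : ∀ {Γ Σ' θ} → Inv Σ' θ → (∀ i → ¬ Loop (SNet.at (stN θ) i)) →
  ∃[ θ₁ ] (Star NStep (cs Σ' Γ , θ) (cs [] Γ , θ₁) × Inv [] θ₁ × (stN θ₁ ≈ stN θ))
normalise {Γ} {Σ'} {θ} inv nl with to-atoms {Γ} (total Σ') ≤-refl inv
... | Σ₁ , θ₁ , sts , inv₁ , e₁ , at with dissolve {Γ} (length Σ₁) ≤-refl inv₁ at
        (λ {λ₀} m l → let (i , s) = _≈_.forth e₁ ((λ₀ , m) , routed-atomic inv₁ at m) in nl i (proj₁ (Sim.loop~ s) l))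
...   | θ₂ , sts' , inv₂ , e₂ = θ₂ , sts ◅◅ sts' , inv₂ , ≈-trans e₂ e₁

inv[]-visible : ∀ {θ} → Inv [] θ → Visible θ
inv[]-visible inv m {concl n , p} l = n , refl
inv[]-visible inv m {cutside c s , p} l with Inv.named inv m l
... | _ , ()

visible-sem : ∀ {θ} → Visible θ → stN θ ≈ toNet θ
visible-sem {θ} v = (λ ((λ₀ , m) , _) → (λ₀ , m) , eqv m) , (λ (λ₀ , m) → ((λ₀ , m) , routed m) , eqv m)
  where
  routed : ∀ {λ₀} → λ₀ ∈ θ → Routed stW (toV λ₀)
  routed m (r , p) l with v m l
  ... | n , refl = inj₁ (_ , refl)
  run : ∀ {λ₀ u w} → λ₀ ∈ θ → Run stW (toV λ₀) u w → lk u w ∈ λ₀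
  run m (hop r) = r
  run m (step {v = x} r k p) with x | v m (leaves-neg r) | k
  ... | .(concl n) , _ | n , refl | ()
  no-cycle : ∀ {λ₀ u w} → λ₀ ∈ θ → Run stW (toV λ₀) u w → joins stW w u → ⊥
  no-cycle {w = w} m p k with w | v m (run-tgt p) | k
  ... | .(concl n) , _ | n , refl | ()
  out-vx : ∀ w u → out stW w u → w ≡ vx u
  out-vx (concl n , p) _ refl = refl
  eqv : ∀ {λ₀} → λ₀ ∈ θ → wire stW (toV λ₀) ≃ toSlice λ₀
  eqv {λ₀} m = record
    { leaf~ = λ u → (λ (w , o , l) → subst (_∈ leaves λ₀) (out-vx w u o) l) , (λ l → vx u , refl , l)
    ; rel~ = λ u u' → (λ (w , w' , o , o' , p) → subst (_∈ λ₀) (cong₂ lk (out-vx w u o) (out-vx w' u' o')) (run m p)) ,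
                      (λ i → vx u , vx u' , refl , refl , hop i)
    ; loop~ = (λ { (inj₁ ()) ; (inj₂ (_ , _ , p , k)) → no-cycle m p k }) , (λ ()) }

-- Composition

module _ (F G : Vertex → Vertex) {θ ψ : Net} (vθ : Visible θ) (vψ : Visible ψ) where
  private
    H : Occ ⊎ Occ → Vertex
    H = copair (λ v → F (vx v)) (λ v → G (vx v))

    joined : ∀ {λ₀ μ} → λ₀ ∈ θ → μ ∈ ψ → toV (mapl F λ₀ ++ mapl G μ) ≃ wire (relabel H) (toSlice λ₀ ⊎ₛ toSlice μ)
    joined {λ₀} {μ} i j = relabel-≃
      (λ { {inj₁ _} l → leaves-++ˡ (mapl F λ₀) (mapl G μ) (leaves-mapl⁺ F λ₀ l)
         ; {inj₂ _} l → leaves-++ʳ (mapl F λ₀) (mapl G μ) (leaves-mapl⁺ G μ l) })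
      lf
      (λ { {inj₁ _} {inj₁ _} r → ∈-++⁺ˡ (∈-map⁺ (mapLink F) r) ; {inj₂ _} {inj₂ _} r → ∈-++⁺ʳ (mapl F λ₀) (∈-map⁺ (mapLink G) r)
         ; {inj₁ _} {inj₂ _} () ; {inj₂ _} {inj₁ _} () })
      (λ {v} {v'} r → rl v v' r) ((λ ()) , (λ { (inj₁ ()) ; (inj₂ ()) }))
      where
      lf : ∀ {v} → v ∈ leaves (mapl F λ₀ ++ mapl G μ) → ∃[ w ] (v ≡ H w × Leaf (toSlice λ₀ ⊎ₛ toSlice μ) w)
      lf l with leaves-++ (mapl F λ₀) l
      ... | inj₁ l' with leaves-mapl⁻ F {λ₀} l'
      ...   | (_ , p) , k , q with vθ i k
      ...     | n , refl = inj₁ (n , p) , q , k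
      lf l | inj₂ l' with leaves-mapl⁻ G {μ} l'
      ...   | (_ , p) , k , q with vψ j k
      ...     | n , refl = inj₂ (n , p) , q , k
      rl : ∀ v v' → lk v v' ∈ mapl F λ₀ ++ mapl G μ → ∃[ w ] ∃[ w' ] (v ≡ H w × v' ≡ H w' × Rel (toSlice λ₀ ⊎ₛ toSlice μ) w w')
      rl v v' r with ∈-++⁻ (mapl F λ₀) r
      ... | inj₁ r' with ∈-map⁻ (mapLink F) r'
      ...   | lk (_ , p) (_ , p') , k , refl with vθ i (leaves-pos k) | vθ i (leaves-neg k)
      ...     | n , refl | n' , refl = inj₁ (n , p) , inj₁ (n' , p') , refl , refl , k
      rl v v' r | inj₂ r' with ∈-map⁻ (mapLink G) r'
      ...   | lk (_ , p) (_ , p') , k , refl with vψ j (leaves-pos k) | vψ j (leaves-neg k)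
      ...     | n , refl | n' , refl = inj₂ (n , p) , inj₂ (n' , p') , refl , refl , k

  netV-join : netV (joinL F G θ ψ) ≈ relN H (toNet θ ⊎ₙ toNet ψ)
  netV-join =
    (λ (λ' , m) → let (λ₀ , μ , i , j , q) = ∈-joinL⁻ F G θ ψ m in
       (((λ₀ , i) , (μ , j)) , relabel-routed (toSlice λ₀ ⊎ₛ toSlice μ) H) ,
       subst (λ ν → toV ν ≃ wire (relabel H) (toSlice λ₀ ⊎ₛ toSlice μ)) (sym q) (joined i j)) ,
    (λ (((λ₀ , i) , (μ , j)) , _) → (_ , ∈-joinL⁺ F G i j) , joined i j)

leftRoot rightRoot : Root → Root
leftRoot (concl 0) = concl 0
leftRoot (concl 1) = cutside [] false
leftRoot (concl (suc (suc n))) = concl (suc n)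
leftRoot r = r
rightRoot (concl 0) = cutside [] true
rightRoot (concl (suc n)) = concl (suc n)
rightRoot r = r

composed : Net → Net → Net
composed = joinL (onRoot leftRoot) (onRoot rightRoot)

compose-pair : ∀ {F B F' C} θ ψ →
  compose (F ∷ B ∷ []) (F' ∷ C ∷ []) 1 0 B θ ψ ≡ (cs (([] , B) ∷ []) (F ∷ C ∷ []) , composed θ ψ)
compose-pair {F} {B} {F'} {C} θ ψ = cong (cs (([] , B) ∷ []) (F ∷ C ∷ []) ,_)
  (concatMap-cong (λ λ₀ → map-cong (λ μ → cong₂ _++_
    (map-cong (mapLink-cong λ { (concl 0 , p) → refl ; (concl 1 , p) → refl ; (concl (suc (suc n)) , p) → refl ; (cutside c s , p) → refl }) λ₀)
    (map-cong (mapLink-cong λ { (concl 0 , p) → refl ; (concl (suc n) , p) → refl ; (cutside c s , p) → refl }) μ)) ψ) θ)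

module Composition {A B : Fm} (D : CF (pair-ctx (dual A) B)) (E : CF (pair-ctx (dual B) A)) where
  private
    θ = netL D
    ψ = netL E
    Fl = onRoot leftRoot
    Fr = onRoot rightRoot

  cf-visible : ∀ {Γ} (D : CF Γ) → Visible (netL D)
  cf-visible D i l with GoodNet.scoped (good D) i l
  ... | n , _ , e , _ = n , e

  composed-sem : stN (composed θ ψ) ≈ cut₀ 1 0 (toNet θ) (toNet ψ)
  composed-sem = ≈-trans (wireN-cong stW (netV-join Fl Fr (cf-visible D) (cf-visible E)))
    (≈-trans (pre stW (copair (λ v → Fl (vx v)) (λ v → Fr (vx v)))) (agreeN λ ((λ₀ , i) , (μ , j)) → record
      { out~ = λ w l v → o i j w l v ; joins~ = λ w w' _ _ → k w w' }))
    where
    D' = cutW (λ n → n) (λ n → n) 1 0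
    H : Occ ⊎ Occ → Vertex
    H = copair (λ v → Fl (vx v)) (λ v → Fr (vx v))
    o : ∀ {λ₀ μ} → λ₀ ∈ θ → μ ∈ ψ → ∀ w → Leaf (toSlice λ₀ ⊎ₛ toSlice μ) w → ∀ v → out stW (H w) v ↔ out D' w v
    o i j (inj₁ (0 , p)) l v = (λ e → (λ ()) , e) , proj₂
    o i j (inj₁ (1 , p)) l v = (λ ()) , (λ (n , _) → n refl)
    o i j (inj₁ (suc (suc n) , p)) l v with GoodNet.scoped (good D) i l
    ... | _ , _ , refl , there (there ())
    o i j (inj₂ (0 , p)) l v = (λ ()) , (λ (n , _) → n refl)
    o i j (inj₂ (suc n , p)) l v = (λ e → (λ ()) , e) , proj₂
    k : ∀ w w' → joins stW (H w) (H w') ↔ joins D' w w'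
    k (inj₁ (0 , _)) (inj₁ _) = (λ ()) , (λ ())
    k (inj₁ (1 , _)) (inj₁ (0 , _)) = (λ ()) , (λ ())
    k (inj₁ (1 , _)) (inj₁ (1 , _)) = (λ { (_ , () , _) }) , (λ ())
    k (inj₁ (1 , _)) (inj₁ (suc (suc _) , _)) = (λ ()) , (λ ())
    k (inj₁ (suc (suc _) , _)) (inj₁ _) = (λ ()) , (λ ())
    k (inj₁ (0 , _)) (inj₂ _) = (λ ()) , (λ { (() , _) })
    k (inj₁ (1 , _)) (inj₂ (0 , _)) = (λ (_ , _ , e) → refl , refl , e) , (λ (_ , _ , e) → refl , refl , e)
    k (inj₁ (1 , _)) (inj₂ (suc _ , _)) = (λ ()) , (λ { (_ , () , _) })
    k (inj₁ (suc (suc _) , _)) (inj₂ _) = (λ ()) , (λ { (() , _) })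
    k (inj₂ (0 , _)) (inj₁ (0 , _)) = (λ ()) , (λ { (() , _) })
    k (inj₂ (0 , _)) (inj₁ (1 , _)) = (λ (_ , _ , e) → refl , refl , flip-swap e) , (λ (_ , _ , e) → refl , refl , flip-swap e)
    k (inj₂ (0 , _)) (inj₁ (suc (suc _) , _)) = (λ ()) , (λ { (() , _) })
    k (inj₂ (suc _ , _)) (inj₁ _) = (λ ()) , (λ { (_ , () , _) })
    k (inj₂ (0 , _)) (inj₂ (0 , _)) = (λ { (_ , () , _) }) , (λ ())
    k (inj₂ (0 , _)) (inj₂ (suc _ , _)) = (λ ()) , (λ ())
    k (inj₂ (suc _ , _)) (inj₂ _) = (λ ()) , (λ ())

  left-cut : ∀ {n p c s q} → (cutside c s , q) ≡ Fl (vx (n , p)) → n ≡ 1 × c ≡ [] × s ≡ false × q ≡ p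
  left-cut {1} refl = refl , refl , refl , refl

  right-cut : ∀ {n p c s q} → (cutside c s , q) ≡ Fr (vx (n , p)) → n ≡ 0 × c ≡ [] × s ≡ true × q ≡ p
  right-cut {0} refl = refl , refl , refl , refl

  CutLeaf : Linking → Linking → Bool → List Bool → Set
  CutLeaf λ₀ μ false p = (concl 1 , p) ∈ leaves λ₀
  CutLeaf λ₀ μ true p = (concl 0 , p) ∈ leaves μ

  cutleaf⁻ : ∀ {λ₀ μ c s p} → λ₀ ∈ θ → μ ∈ ψ → (cutside c s , p) ∈ leaves (mapl Fl λ₀ ++ mapl Fr μ) → c ≡ [] × CutLeaf λ₀ μ s p
  cutleaf⁻ {λ₀} {μ} i j l with leaves-++ (mapl Fl λ₀) l
  ... | inj₁ l' with leaves-mapl⁻ Fl {λ₀} l'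
  ...   | (_ , p) , m , q with cf-visible D i m
  ...     | n , refl with left-cut q
  ...       | refl , refl , refl , refl = refl , m
  cutleaf⁻ {λ₀} {μ} i j l | inj₂ l' with leaves-mapl⁻ Fr {μ} l'
  ...   | (_ , p) , m , q with cf-visible E j m
  ...     | n , refl with right-cut q
  ...       | refl , refl , refl , refl = refl , m

  cutleaf⁺ : ∀ {λ₀ μ} s {p} → CutLeaf λ₀ μ s p → (cutside [] s , p) ∈ leaves (mapl Fl λ₀ ++ mapl Fr μ)
  cutleaf⁺ {λ₀} {μ} false m = leaves-++ˡ (mapl Fl λ₀) (mapl Fr μ) (leaves-mapl⁺ Fl λ₀ m)
  cutleaf⁺ {λ₀} {μ} true m = leaves-++ʳ (mapl Fl λ₀) (mapl Fr μ) (leaves-mapl⁺ Fr μ m)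

  left-atom : ∀ {p a} → Atom (pair-ctx (dual A) B) (1 , p) a → sub B p ≡ just a
  left-atom (_ , there (here refl) , e) = e

  right-atom : ∀ {p a} → Atom (pair-ctx (dual B) A) (0 , p) a → sub (dual B) p ≡ just a
  right-atom (_ , here refl , e) = e
  right-atom (_ , there (here ()) , _)

  cut-link : ∀ {λ₀ μ u v} → λ₀ ∈ θ → μ ∈ ψ → lk u v ∈ mapl Fl λ₀ ++ mapl Fr μ →
    (∀ {c s p} → u ≡ (cutside c s , p) → Pos (sideFm s B) p) × (∀ {c s p} → v ≡ (cutside c s , p) → Neg (sideFm s B) p)
  cut-link {λ₀} {μ} i j r with ∈-++⁻ (mapl Fl λ₀) r
  ... | inj₁ r' with ∈-map⁻ (mapLink Fl) r'
  ...   | a , m , refl with netL-wf D i m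
  ...     | (n , p) , (n' , p') , k , refl , x , y =
    (λ e → let (_ , e') = pos-case e in k , e') , (λ e → let (_ , e') = neg-case e in k , e')
    where
    pos-case : ∀ {c s q} → Fl (vx (n , p)) ≡ (cutside c s , q) → s ≡ false × sub (sideFm s B) q ≡ just (var k)
    pos-case e with left-cut (sym e)
    ... | refl , refl , refl , refl = refl , left-atom {p} x
    neg-case : ∀ {c s q} → Fl (vx (n' , p')) ≡ (cutside c s , q) → s ≡ false × sub (sideFm s B) q ≡ just (nvar k)
    neg-case e with left-cut (sym e)
    ... | refl , refl , refl , refl = refl , left-atom {p'} y
  cut-link {λ₀} {μ} i j r | inj₂ r' with ∈-map⁻ (mapLink Fr) r'
  ...   | a , m , refl with netL-wf E j m
  ...     | (n , p) , (n' , p') , k , refl , x , y =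
    (λ e → let (_ , e') = pos-case e in k , e') , (λ e → let (_ , e') = neg-case e in k , e')
    where
    pos-case : ∀ {c s q} → Fr (vx (n , p)) ≡ (cutside c s , q) → s ≡ true × sub (sideFm s B) q ≡ just (var k)
    pos-case e with right-cut (sym e)
    ... | refl , refl , refl , refl = refl , right-atom {p} x
    neg-case : ∀ {c s q} → Fr (vx (n' , p')) ≡ (cutside c s , q) → s ≡ true × sub (sideFm s B) q ≡ just (nvar k)
    neg-case e with right-cut (sym e)
    ... | refl , refl , refl , refl = refl , right-atom {p'} y

  composed-inv : Inv (([] , B) ∷ []) (composed θ ψ)
  composed-inv = record
    { indep = λ { _ (here refl) (here refl) _ → refl }
    ; named = nm ; state = st
    ; polar⁺ = p⁺ ; polar⁻ = p⁻ }
    where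
    nm : ∀ {λ' c s p} → λ' ∈ composed θ ψ → (cutside c s , p) ∈ leaves λ' → ∃[ F ] ((c , F) ∈ ([] , B) ∷ [])
    nm m l with ∈-joinL⁻ Fl Fr θ ψ m
    ... | λ₀ , μ , i , j , refl with cutleaf⁻ {λ₀} {μ} i j l
    ...   | refl , _ = B , here refl
    st : ∀ {λ' c F} → λ' ∈ composed θ ψ → (c , F) ∈ ([] , B) ∷ [] → Absent λ' c ⊎ (∀ s → SideShape λ' c s (sideFm s F))
    st m (here refl) with ∈-joinL⁻ Fl Fr θ ψ m
    ... | λ₀ , μ , i , j , refl = inj₂ shape
      where
      shape : ∀ s → SideShape (mapl Fl λ₀ ++ mapl Fr μ) [] s (sideFm s B)
      shape false = let (r , k) = WT.shape (netL-wt D (λ₀ , i)) (there (here refl)) in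
        r , λ p → (λ l → proj₁ (k p) (proj₂ (cutleaf⁻ {λ₀} {μ} i j l))) , (λ l → cutleaf⁺ {λ₀} {μ} false (proj₂ (k p) l))
      shape true = let (r , k) = WT.shape (netL-wt E (μ , j)) (here refl) in
        r , λ p → (λ l → proj₁ (k p) (proj₂ (cutleaf⁻ {λ₀} {μ} i j l))) , (λ l → cutleaf⁺ {λ₀} {μ} true (proj₂ (k p) l))
    p⁺ : ∀ {λ' c s p v F} → λ' ∈ composed θ ψ → lk (cutside c s , p) v ∈ λ' → (c , F) ∈ ([] , B) ∷ [] → Pos (sideFm s F) p
    p⁺ m r (here refl) with ∈-joinL⁻ Fl Fr θ ψ m
    ... | λ₀ , μ , i , j , refl = proj₁ (cut-link {λ₀} {μ} i j r) refl
    p⁻ : ∀ {λ' c s p v F} → λ' ∈ composed θ ψ → lk v (cutside c s , p) ∈ λ' → (c , F) ∈ ([] , B) ∷ [] → Neg (sideFm s F) p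
    p⁻ m r (here refl) with ∈-joinL⁻ Fl Fr θ ψ m
    ... | λ₀ , μ , i , j , refl = proj₂ (cut-link {λ₀} {μ} i j r) refl

  composed-reduces : cut₀ 1 0 (sem D) (sem E) ≈ axNet 0 1 A →
    ReducesToId (compose (dual A ∷ B ∷ []) (dual B ∷ A ∷ []) 1 0 B θ ψ) A
  composed-reduces c = subst (λ N → ReducesToId N A) (sym (compose-pair {F' = dual B} θ ψ)) (reduces (normalise composed-inv acyclic))
    where
    axiom : stN (composed θ ψ) ≈ axNet 0 1 A
    axiom = ≈-trans composed-sem (≈-trans (cutN-cong (netL-sem D) (netL-sem E)) c)
    acyclic : ∀ i → ¬ Loop (at (stN (composed θ ψ)) i)
    acyclic i l = proj₁ (Sim.loop~ (proj₂ (_≈_.forth axiom i))) l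
    reduces : ∃[ θ₁ ] (Star NStep (cs (([] , B) ∷ []) (dual A ∷ A ∷ []) , composed θ ψ) (cs [] (dual A ∷ A ∷ []) , θ₁) ×
                       Inv [] θ₁ × (stN θ₁ ≈ stN (composed θ ψ))) →
              ReducesToId (cs (([] , B) ∷ []) (dual A ∷ A ∷ []) , composed θ ψ) A
    reduces (θ₁ , steps , inv , e) = θ₁ , steps , ≈⇒SameNet visible (idNet-visible A) same
      where
      visible : Visible θ₁
      visible = inv[]-visible inv
      same : toNet θ₁ ≈ toNet (idNet A)
      same = ≈-trans (≈-sym (visible-sem visible)) (≈-trans e (≈-trans axiom (≈-sym (idNet-sem A))))

theorem7p9 : ∀ (A B : Fm) → A ≅ B →
    ∃[ θ ] ∃[ ψ ]
      (IsProofNet (cs [] (dual A ∷ B ∷ [])) θ ×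
       IsProofNet (cs [] (dual B ∷ A ∷ [])) ψ ×
       ReducesToId (compose (dual A ∷ B ∷ []) (dual B ∷ A ∷ []) 1 0 B θ ψ) A ×
       ReducesToId (compose (dual B ∷ A ∷ []) (dual A ∷ B ∷ []) 1 0 A ψ θ) B)
theorem7p9 A B (_ , _ , dπ , dπ' , c , c') with adequate dπ | adequate dπ'
... | D , e | E , e' = netL D , netL E , netL-proofnet D , netL-proofnet E ,
  Composition.composed-reduces D E (≈-trans (cutN-cong e e') (conv-sound c)) ,
  Composition.composed-reduces E D (≈-trans (cutN-cong e' e) (conv-sound c'))
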